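{- Let $0\le m\le n$, let $\lambda=(\lambda_1,\dotsc,\lambda_m)\in(\mathbb{Z}_{\ge 0})^m$ with $\lambda_1\ge\dotsm\ge\lambda_m$, and let $\gamma=(\gamma_1,\dotsc,\gamma_{n-m})\in(\mathbb{Z}_{\ge 0})^{n-m}$. Then, under the Kazhdan–Lusztig involution $*$ on $\mathbb{Q}(q,t)[x_1,\dotsc,x_n]^{S_m}$, $$P_{\lambda|\gamma}^*=t^{\mathrm{inv}(\lambda|\gamma)}P_{\lambda|\gamma},\qquad (\mathrm{A})$$ where $\mathrm{inv}(\lambda|\gamma)=\mathrm{inv}(\gamma)+|\{(i,j)\in[m]\times[n-m]:\lambda_i>\gamma_j\}|$. Furthermore, identity (A) is equivalent to the identity $$P_{\lambda|\gamma}(x_1,\dotsc,x_m,qx_n,\dotsc,qx_{m+1};q^{ -1},t^{ -1})=q^{\gamma_1+\dotsm+\gamma_{n-m}}\,t^{\mathrm{inv}(\gamma)-\ell(\omega_0^{[m+1,n]})}\,T_{\omega_0^{[m+1,n]}}P_{\lambda|\gamma}(x_1,\dotsc,x_n;q,t),\qquad(\mathrm{B})$$ where $\omega_0^{[m+1,n]}$ is the longest element of the symmetric group $S_{[m+1,n]}$ of $\{m+1,\dotsc,n\}$ (viewed inside $S_n$) and $\ell$ denotes Coxeter length.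
   Context: Notation: $[a,b]=\{a,\dotsc,b\}$, $[b]=[1,b]$. $S_n$ acts on $\mathbb{Q}(q,t^{1/2})[x_1,\dotsc,x_n]$ by algebra automorphisms with $\pi(x_i)=x_{\pi(i)}$; $S_m\subset S_n$ fixes $m+1,\dotsc,n$. For a composition $\gamma$, $\mathrm{inv}(\gamma)=|\{i<j:\gamma_i>\gamma_j\}|$. Demazure–Lusztig operators: for $1\le i\le n-1$, with $\sigma_i=(i,i+1)$, $T_if=t\,\sigma_i(f)+(t-1)x_{i+1}\frac{\sigma_i(f)-f}{x_i-x_{i+1}}$; for $\pi\in S_n$ with reduced word $\pi=\sigma_{i_1}\cdots\sigma_{i_\ell}$, $T_\pi=T_{i_1}\cdots T_{i_\ell}$ (independent of the reduced word). Nonsymmetric Macdonald polynomials $E_\mu$ (Haglund–Haiman–Loehr conventions), for $\mu\in(\mathbb{Z}_{\ge0})^n$: the column diagram is $\mathrm{dg}'(\mu)=\{(i,j):1\le i\le n,\ 1\le j\le\mu_i\}$ ($i$ = column, $j$ = row), the augmented diagram is $\hat{\mathrm{dg}}(\mu)=\mathrm{dg}'(\mu)\cup\{(i,0):1\le i\le n\}$. For $u=(i,j)\in\mathrm{dg}'(\mu)$: $d(u)=(i,j-1)$, $l(u)=\mu_i-j$, and $a(u)$ is the number of boxes $(i',j)\in\mathrm{dg}'(\mu)$ with $i'<i$, $\mu_{i'}\le\mu_i$, plus the number of boxes $(i',j-1)\in\hat{\mathrm{dg}}(\mu)$ with $i'>i$, $\mu_{i'}<\mu_i$. For $\pi\in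 S_n$, an augmented filling with basement $\pi$ is a map $\hat\sigma:\hat{\mathrm{dg}}(\mu)\to[n]$ with $\hat\sigma(i,0)=\pi(i)$. Two distinct boxes attack each other if they lie in the same row, or have the form $(i,j),(i',j-1)$ with $i'>i$. $\mathrm{NAF}^\pi_\mu$ is the set of such fillings taking distinct values on every attacking pair. A box $u\in\mathrm{dg}'(\mu)$ is a descent if $\hat\sigma(u)>\hat\sigma(d(u))$; $\mathrm{maj}(\hat\sigma)=\sum_{u\text{ descent}}(l(u)+1)$. The reading order lists boxes row by row from the top row down, right to left within each row. An inversion is a pair of attacking boxes $u,v$ with $u$ before $v$ in reading order and $\hat\sigma(u)>\hat\sigma(v)$. Set $\mathrm{inv}(\hat\sigma)=|\mathrm{Inv}(\hat\sigma)|-|\{i<j:\mu_i\le\mu_j,\ \pi(i)<\pi(j)\}|-\sum_{u\text{ descent}}a(u)$ and $\mathrm{coinv}(\hat\sigma)=\sum_{u\in\mathrm{dg}'(\mu)}a(u)-\mathrm{inv}(\hat\sigma)$. Then $E_\mu(x;q,t)=\sum_{\hat\sigma\in\mathrm{NAF}^{\mathrm{id}}_\mu}x^{\hat\sigma}q^{\mathrm{maj}(\hat\sigma)}t^{\mathrm{coinv}(\hat\sigma)}\prod_{u\in\mathrm{dg}'(\mu),\ \hat\sigma(u)\ne\hat\sigma(d(u))}\frac{1-t}{1-q^{l(u)+1}t^{a(u)+1}}$, where $x^{\hat\sigma}=\prod_{u\in\mathrm{dg}'(\mu)}x_{\hat\sigma(u)}$. Partially symmetric Macdonald polynomials: $P_{\lambda|\gamma}=\sum_{\pi\in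 S_m^\lambda}T_\pi E_\mu$ where $\mu=(\lambda,\gamma)\in(\mathbb{Z}_{\ge0})^n$ is the concatenation and $S_m^\lambda$ is the set of minimal length coset representatives of $S_m/(S_m)_\lambda$, $(S_m)_\lambda$ the stabilizer of $\lambda$. Kazhdan–Lusztig involution: on $\mathcal{M}=\mathbb{Q}(q,t^{1/2})[x_1,\dotsc,x_n]$, $f^*=t^{\ell(\omega_0)}T_{\omega_0}^{ -1}\,\omega_0\big(f(q^{ -1},t^{ -1})\big)$, where $\omega_0$ is the longest element of $S_n$ and $f(q^{ -1},t^{ -1})$ is the image of $f$ under the $\mathbb{Q}$-algebra automorphism $q\mapsto q^{ -1}$, $t^{1/2}\mapsto t^{ -1/2}$, $x_i\mapsto x_i$. This $\mathbb{Q}$-linear involution preserves $\mathbb{Q}(q,t)[x_1,\dotsc,x_n]^{S_m}$ and restricts to it. -}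

module Defs where

open import Data.Bool using (Bool; true; false; _∧_; _∨_; not; if_then_else_)
open import Data.Nat as N using (ℕ; zero; suc; _∸_; _<ᵇ_; _≤ᵇ_; _≡ᵇ_)
open import Data.Integer as Z using (ℤ; +_)
open import Data.Rational as Q using (ℚ; 0ℚ; 1ℚ)
open import Data.List as L using (List; []; _∷_; _++_; map; foldr; concatMap; length; upTo; zip; reverse; take; drop)
open import Data.Nat.ListAction using (sum)
import Data.List.Properties as LP
open import Data.Maybe using (Maybe; just; nothing)
import Data.Maybe as M
open import Data.Vec as V using (Vec)
open import Data.Fin as F using (Fin)
open import Data.Product using (_×_; _,_; proj₁; proj₂)
open import Relation.Nullary.Decidable using (⌊_⌋)
open import Relation.Binary.PropositionalEquality using (_≡_)

countB : {A : Set} → (A → Bool) → List A → ℕ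
countB p [] = 0
countB p (x ∷ xs) = if p x then suc (countB p xs) else countB p xs

allB : {A : Set} → (A → Bool) → List A → Bool
allB p [] = true
allB p (x ∷ xs) = p x ∧ allB p xs

filterB : {A : Set} → (A → Bool) → List A → List A
filterB p [] = []
filterB p (x ∷ xs) = if p x then x ∷ filterB p xs else filterB p xs

lookupL : List ℕ → ℕ → ℕ
lookupL [] k = 0
lookupL (x ∷ xs) zero = x
lookupL (x ∷ xs) (suc k) = lookupL xs k

setL : List ℕ → ℕ → ℕ → List ℕ
setL [] k v = []
setL (x ∷ xs) zero v = v ∷ xs
setL (x ∷ xs) (suc k) v = x ∷ setL xs k v

swapL : ℕ → List ℕ → List ℕ
swapL k α = setL (setL α k (lookupL α (suc k))) (suc k) (lookupL α k)

incL : List ℕ → ℕ → List ℕ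
incL α k = setL α k (suc (lookupL α k))

eqListB : List ℕ → List ℕ → Bool
eqListB α β = ⌊ LP.≡-dec N._≟_ α β ⌋

-- Coefficient field ℚ(q, s), s = t^{1/2}.
-- Laurent polynomials in q and s over ℚ: list of terms (c , i , j) = c q^i s^j.

Laurent : Set
Laurent = List (ℚ × ℤ × ℤ)

coeffL : Laurent → ℤ → ℤ → ℚ
coeffL [] a b = 0ℚ
coeffL ((c , i , j) ∷ p) a b =
  if ⌊ i Z.≟ a ⌋ ∧ ⌊ j Z.≟ b ⌋ then c Q.+ coeffL p a b else coeffL p a b

_≈L_ : Laurent → Laurent → Set
p ≈L r = ∀ a b → coeffL p a b ≡ coeffL r a b

mulL : Laurent → Laurent → Laurent
mulL p r = concatMap (λ { (c , i , j) → map (λ { (d , k , l) → (c Q.* d , i Z.+ k , j Z.+ l) }) r }) p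

negL : Laurent → Laurent
negL = map (λ { (c , i , j) → (Q.- c , i , j) })

barL : Laurent → Laurent
barL = map (λ { (c , i , j) → (c , Z.- i , Z.- j) })

monoL : ℤ → ℤ → Laurent
monoL i j = (1ℚ , i , j) ∷ []

-- Elements of ℚ(q, t^{1/2}) as fractions num/den (all denominators built below are nonzero)
record Frac : Set where
  constructor _/_
  field
    num : Laurent
    den : Laurent
open Frac public

_≈F_ : Frac → Frac → Set
x ≈F y = mulL (num x) (den y) ≈L mulL (num y) (den x)

addF : Frac → Frac → Frac
addF x y = (mulL (num x) (den y) ++ mulL (num y) (den x)) / mulL (den x) (den y)

mulF : Frac → Frac → Frac
mulF x y = mulL (num x) (num y) / mulL (den x) (den y)

negF : Frac → Frac
negF x = negL (num x) / den x

barF : Frac → Frac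
barF x = barL (num x) / barL (den x)

fromL : Laurent → Frac
fromL p = p / monoL (+ 0) (+ 0)

0F : Frac
0F = fromL []

qF : ℤ → Frac
qF i = fromL (monoL i (+ 0))

tF : ℤ → Frac
tF k = fromL (monoL (+ 0) (k Z.+ k))

tMinus1 : Frac
tMinus1 = fromL ((1ℚ , + 0 , + 2) ∷ (Q.- 1ℚ , + 0 , + 0) ∷ [])

tInvMinus1 : Frac
tInvMinus1 = fromL ((1ℚ , + 0 , Z.- (+ 2)) ∷ (Q.- 1ℚ , + 0 , + 0) ∷ [])

-- Polynomials in x₁,…,xₙ over ℚ(q,t^{1/2}): lists of terms (coefficient , exponent vector),
-- exponent vectors of length n (position k ↔ variable x_{k+1}).

Mono : Set
Mono = List ℕ

Poly : Set
Poly = List (Frac × Mono)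

coeffP : Poly → Mono → Frac
coeffP [] α = 0F
coeffP ((c , β) ∷ f) α = if eqListB β α then addF c (coeffP f α) else coeffP f α

_≈P_ : Poly → Poly → Set
f ≈P g = ∀ α → coeffP f α ≈F coeffP g α

zeroP : Poly
zeroP = []

addP : Poly → Poly → Poly
addP f g = f ++ g

scaleP : Frac → Poly → Poly
scaleP c = map (λ { (d , β) → (mulF c d , β) })

mapMono : (Mono → Mono) → Poly → Poly
mapMono h = map (λ { (d , β) → (d , h β) })

barP : Poly → Poly
barP = map (λ { (d , β) → (barF d , β) })

-- Demazure–Lusztig operators (0-based index k ↔ σ_{k+1} = (k+1, k+2))

sigmaP : ℕ → Poly → Poly
sigmaP k = mapMono (swapL k)

-- (σ_{k+1}(x^α) - x^α)/(x_{k+1} - x_{k+2}) written out as a signed sum of monomials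
ddMono : ℕ → Mono → List (Bool × Mono)
ddMono k α =
  if a <ᵇ b
  then map (λ j → (true , mk (a N.+ j) (b ∸ 1 ∸ j))) (upTo (b ∸ a))
  else map (λ j → (false , mk (b N.+ j) (a ∸ 1 ∸ j))) (upTo (a ∸ b))
  where
  a = lookupL α k
  b = lookupL α (suc k)
  mk : ℕ → ℕ → Mono
  mk e₁ e₂ = setL (setL α k e₁) (suc k) e₂

ddP : ℕ → Poly → Poly
ddP k = concatMap (λ { (c , β) → map (λ { (s , γ) → ((if s then c else negF c) , γ) }) (ddMono k β) })

mulXP : ℕ → Poly → Poly
mulXP j = mapMono (λ β → incL β j)

TP : ℕ → Poly → Poly
TP k f = addP (scaleP (tF (+ 1)) (sigmaP k f)) (scaleP tMinus1 (mulXP (suc k) (ddP k f)))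

-- T_{k+1}⁻¹ = t⁻¹ T_{k+1} + (t⁻¹ - 1)   (from the quadratic relation (T-t)(T+1)=0)
TinvP : ℕ → Poly → Poly
TinvP k f = addP (scaleP (tF (Z.- (+ 1))) (TP k f)) (scaleP tInvMinus1 f)

Tword : List ℕ → Poly → Poly
Tword [] f = f
Tword (k ∷ w) f = TP k (Tword w f)

TwordInv : List ℕ → Poly → Poly
TwordInv [] f = f
TwordInv (k ∷ w) f = TwordInv w (TinvP k f)

-- Permutations in one-line notation (0-based values), reduced words, lengths

insertAll : ℕ → List ℕ → List (List ℕ)
insertAll x [] = (x ∷ []) ∷ []
insertAll x (y ∷ ys) = (x ∷ y ∷ ys) ∷ map (y ∷_) (insertAll x ys)

permsOf : List ℕ → List (List ℕ)
permsOf [] = [] ∷ []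
permsOf (x ∷ xs) = concatMap (insertAll x) (permsOf xs)

perms : ℕ → List (List ℕ)
perms m = permsOf (upTo m)

-- number of inversions of a word (= inv of a composition; = Coxeter length of a permutation)
invW : List ℕ → ℕ
invW [] = 0
invW (x ∷ xs) = countB (λ y → y <ᵇ x) xs N.+ invW xs

firstDescent : List ℕ → Maybe ℕ
firstDescent (x ∷ y ∷ xs) = if y <ᵇ x then just 0 else M.map suc (firstDescent (y ∷ xs))
firstDescent _ = nothing

-- reduced word: if π(k+1) > π(k+2) then π = (π σ_{k+1}) σ_{k+1}
redWord : ℕ → List ℕ → List ℕ
redWord zero w = []
redWord (suc fuel) w with firstDescent w
... | nothing = []
... | just k = redWord fuel (swapL k w) ++ (k ∷ [])

permWord : List ℕ → List ℕ
permWord w = redWord (length w N.* length w) w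

compose : List ℕ → List ℕ → List ℕ
compose π σ = map (lookupL π) σ

w0 : ℕ → List ℕ
w0 n = reverse (upTo n)

w0mn : ℕ → ℕ → List ℕ
w0mn m n = upTo m ++ reverse (map (m N.+_) (upTo (n ∸ m)))

star : ℕ → Poly → Poly
star n f = scaleP (tF (+ invW (w0 n))) (TwordInv (permWord (w0 n)) (mapMono reverse (barP f)))

-- Nonsymmetric Macdonald polynomial E_μ via non-attacking fillings (HHL), basement id

Box : Set
Box = ℕ × ℕ   -- (column i , row j), 1-based columns

Filling : Set
Filling = List (Box × ℕ)

eqBox : Box → Box → Bool
eqBox (i , j) (i' , j') = (i ≡ᵇ i') ∧ (j ≡ᵇ j')

val : Filling → Box → ℕ
val fl (i , zero) = i
val [] (i , suc j) = 0
val ((u , v) ∷ fl) (i , suc j) = if eqBox u (i , suc j) then v else val fl (i , suc j)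

module Mac (μ : List ℕ) where
  n : ℕ
  n = length μ

  cols : List ℕ
  cols = map suc (upTo n)

  μAt : ℕ → ℕ
  μAt i = lookupL μ (i ∸ 1)

  boxes : List Box
  boxes = concatMap (λ i → map (λ j → (i , j)) (map suc (upTo (μAt i)))) cols

  basement : List Box
  basement = map (λ i → (i , 0)) cols

  aug : List Box
  aug = boxes ++ basement

  pairs : List (Box × Box)
  pairs = concatMap (λ u → map (u ,_) aug) aug

  formAtt : Box → Box → Bool
  formAtt (i , j) (i' , j') = (suc j' ≡ᵇ j) ∧ (i <ᵇ i')

  attacks : Box → Box → Bool
  attacks u v = not (eqBox u v) ∧ ((proj₂ u ≡ᵇ proj₂ v) ∨ formAtt u v ∨ formAtt v u)

  readBefore : Box → Box → Bool
  readBefore (i , j) (i' , j') = (j' <ᵇ j) ∨ ((j ≡ᵇ j') ∧ (i' <ᵇ i))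

  nonAttacking : Filling → Bool
  nonAttacking fl = allB (λ { (u , v) → not (attacks u v) ∨ not (val fl u ≡ᵇ val fl v) }) pairs

  allLists : ℕ → List (List ℕ)
  allLists zero = [] ∷ []
  allLists (suc k) = concatMap (λ v → map (v ∷_) (allLists k)) cols

  NAF : List Filling
  NAF = filterB nonAttacking (map (zip boxes) (allLists (length boxes)))

  down : Box → Box
  down (i , j) = (i , j ∸ 1)

  leg : Box → ℕ
  leg (i , j) = μAt i ∸ j

  arm : Box → ℕ
  arm (i , j) =
    countB (λ i' → (i' <ᵇ i) ∧ (j ≤ᵇ μAt i') ∧ (μAt i' ≤ᵇ μAt i)) cols N.+
    countB (λ i' → (i <ᵇ i') ∧ ((j ∸ 1) ≤ᵇ μAt i') ∧ (μAt i' <ᵇ μAt i)) cols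

  descent : Filling → Box → Bool
  descent fl u = val fl (down u) <ᵇ val fl u

  maj : Filling → ℕ
  maj fl = sum (map (λ u → if descent fl u then suc (leg u) else 0) boxes)

  invCount : Filling → ℕ
  invCount fl = countB (λ { (u , v) → attacks u v ∧ readBefore u v ∧ (val fl v <ᵇ val fl u) }) pairs

  -- |{i<j : μ_i ≤ μ_j, π(i) < π(j)}| with π = id
  basementCount : ℕ
  basementCount = countB (λ { (i , j) → (i <ᵇ j) ∧ (μAt i ≤ᵇ μAt j) ∧ (i <ᵇ j) })
                         (concatMap (λ i → map (i ,_) cols) cols)

  invF : Filling → ℤ
  invF fl = + invCount fl Z.- + basementCount
            Z.- + sum (map (λ u → if descent fl u then arm u else 0) boxes)

  coinvF : Filling → ℤ
  coinvF fl = + sum (map arm boxes) Z.- invF fl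

  factor : Box → Frac
  factor u = ((1ℚ , + 0 , + 0) ∷ (Q.- 1ℚ , + 0 , + 2) ∷ [])
           / ((1ℚ , + 0 , + 0) ∷ (Q.- 1ℚ , + suc (leg u) , + (2 N.* suc (arm u))) ∷ [])

  prodF : List Frac → Frac
  prodF = foldr mulF (fromL (monoL (+ 0) (+ 0)))

  weightCoeff : Filling → Frac
  weightCoeff fl = mulF (qF (+ maj fl)) (mulF (tF (coinvF fl))
    (prodF (map factor (filterB (λ u → not (val fl u ≡ᵇ val fl (down u))) boxes))))

  xExp : Filling → Mono
  xExp fl = map (λ k → countB (λ u → val fl u ≡ᵇ k) boxes) cols

  E : Poly
  E = map (λ fl → (weightCoeff fl , xExp fl)) NAF

Emac : List ℕ → Poly
Emac μ = Mac.E μ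

stabB : List ℕ → List ℕ → Bool
stabB lam σ = eqListB (map (lookupL lam) σ) lam

isMinRep : List ℕ → List ℕ → Bool
isMinRep lam π = allB (λ σ → not (stabB lam σ) ∨ (invW π ≤ᵇ invW (compose π σ))) (perms (length lam))

cosetReps : List ℕ → List (List ℕ)
cosetReps lam = filterB (isMinRep lam) (perms (length lam))

Ppartial : List ℕ → List ℕ → Poly
Ppartial lam gam =
  foldr addP zeroP
    (map (λ π → Tword (permWord (π ++ map (length lam N.+_) (upTo (length gam)))) (Emac (lam ++ gam)))
         (cosetReps lam))

invLG : List ℕ → List ℕ → ℕ
invLG lam gam = invW gam N.+ sum (map (λ l → countB (λ g → g <ᵇ l) gam) lam)

IdentityA : List ℕ → List ℕ → Set
IdentityA lam gam =
  star (length lam N.+ length gam) (Ppartial lam gam)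
    ≈P scaleP (tF (+ invLG lam gam)) (Ppartial lam gam)

substB : ℕ → Poly → Poly
substB m = map (λ { (c , β) → (mulF (barF c) (qF (+ sum (drop m β))) , take m β ++ reverse (drop m β)) })

IdentityB : List ℕ → List ℕ → Set
IdentityB lam gam =
  substB m P
    ≈P scaleP (mulF (qF (+ sum gam)) (tF (+ invW gam Z.- + invW w)))
              (Tword (permWord w) P)
  where
  m = length lam
  P = Ppartial lam gam
  w = w0mn m (m N.+ length gam)

WeaklyDecreasing : {m : ℕ} → Vec ℕ m → Set
WeaklyDecreasing {m} lam = ∀ (i j : Fin m) → i F.≤ j → V.lookup lam j N.≤ V.lookup lam i

{-# OPTIONS --safe #-}

-- The polynomial t^{inv μ} E_μ is a sum G(L) over fillings grown row by row from the
-- basement, L being the list of columns with their top labels and remaining heights.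
-- By induction on the growth:
--   T_k G(L) = t G(s_k L) if k precedes k+1 in L or is absent from L;
--   adjacent columns of equal height may be exchanged;
--   inverting q and t, reversing the variables within two blocks and replacing x_i by
--   q x_i in the second block multiplies G(L) by a monomial in q and t and reverses
--   the labels of L in the same way.
-- Up to a power of t, P_{λ|γ} is the sum of t^{ℓ(π)} G over the minimal coset
-- representatives π, which label the columns of λ.  Reversal permutes the terms of this
-- sum and T_k P = t P for k < m, so T_{w₀} brings the reversed labels back and both
-- dualities follow.

module Submission where

-- The operators T_w are only applied along the particular words that `permWord` produces, so
-- neither the braid relations nor independence of the reduced word is required: on `G` each letter
-- acts by a mere relabelling, provided that the labels it exchanges still stand in their original
-- order. For w₀ this condition fails on the columns of λ, whose labels a coset representative has
-- already permuted. The letters concerned are, however, the ones applied first, and they meet a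
-- polynomial on which they act as t. The two dualities are one computation with a parameter.
-- Reversing the labels in two blocks is order-reversing up to a cyclic rotation, and the labels
-- that wrap around account for all powers of q; a single block of size n gives (A), blocks of sizes
-- m and n - m give (B). The factor t^(inv μ) absorbs the contribution of the basement. After that
-- the weight of a filling is a product over boxes, in which the factor of a box depends only on the
-- boxes it attacks and on the box beneath it.

open import Defs
open import Level using (0ℓ)
open import Algebra.Bundles using (CommutativeRing; RawRing)
import Algebra.Solver.Ring
import Algebra.Solver.Ring.AlmostCommutativeRing as ACR
open import Data.Bool using (Bool; true; false; if_then_else_; _∨_; _∧_; not)
open import Data.Empty using (⊥; ⊥-elim)
open import Data.Fin using (Fin; zero; suc)
open import Data.Integer as Z using (ℤ; +_)
import Data.Integer.Properties as ZP
open import Data.Integer.Tactic.RingSolver using () renaming (solve-∀ to solve-∀ℤ)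
open import Data.List using (List; []; _∷_; _++_; map; length; concatMap; upTo; applyUpTo; zip; reverse; foldr; applyDownFrom; replicate; take; drop)
open import Data.List.Membership.Propositional using (_∈_)
open import Data.List.Membership.Propositional.Properties using (∈-∃++; ∈-upTo⁺; ∈-upTo⁻; ∈-map⁻; ∈-map⁺; ∈-concatMap⁺; ∈-concatMap⁻; ∈-++⁺ʳ; ∈-++⁺ˡ; ∈-++⁻)
import Data.List.Properties as LP
open import Data.List.Relation.Binary.Permutation.Propositional as ↭ using (_↭_; ↭-refl; ↭-sym; ↭-trans; ↭-prep; ↭-swap; ↭-reflexive)
open import Data.List.Relation.Binary.Permutation.Propositional.Properties using (shift; ∈-resp-↭; All-resp-↭; ++⁺ˡ; ++⁺ʳ; drop-∷; ↭-length; map⁺; ++⁺; ↭-reverse; ++-comm)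
open import Data.List.Relation.Unary.All as All using (All; []; _∷_)
import Data.List.Relation.Unary.All.Properties as AllP
open import Data.List.Relation.Unary.AllPairs as AllPairs using ([]; _∷_; AllPairs)
import Data.List.Relation.Unary.AllPairs.Properties as AllPairsP
open import Data.List.Relation.Unary.Any as Any using (here; there; Any)
open import Data.List.Relation.Unary.Linked using (Linked; []; [-]; _∷_)
open import Data.List.Relation.Unary.Linked.Properties using (Linked⇒AllPairs; applyUpTo⁺₂)
open import Data.List.Relation.Unary.Unique.Propositional using (Unique)
import Data.List.Relation.Unary.Unique.Propositional.Properties as UniqueP
open import Data.Maybe using (Maybe; just; nothing)
open import Data.Nat as N using (ℕ; zero; suc; _<ᵇ_; _≤ᵇ_; _≡ᵇ_; _∸_; _≤_)
open import Data.Nat.ListAction using (sum)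
open import Data.Nat.ListAction.Properties using (sum-++)
import Data.Nat.Properties as NP
open import Data.Nat.Tactic.RingSolver using () renaming (solve-∀ to solve-∀ℕ)
open import Data.Product using (_×_; _,_; proj₁; proj₂; ∃)
open import Data.Rational as Q using (ℚ; 0ℚ; 1ℚ)
import Data.Rational.Properties as QP
open import Data.Sum using (_⊎_; inj₁; inj₂)
open import Data.Vec as Vec using (Vec; lookup; toList) renaming ([] to []ⱽ; _∷_ to _∷ⱽ_)
open import Function using (_∘_)
open import Relation.Binary.Bundles using (Setoid)
open import Relation.Binary.Definitions using (tri<; tri≈; tri>)
open import Relation.Binary.PropositionalEquality as ≡ using (_≡_)
open import Relation.Nullary using (yes; no; ¬_)
open import Relation.Nullary.Decidable using (recompute; ⌊_⌋)

-- The ring solver with coefficients in ℤ, an integer being written as a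
-- formal difference (a , b) of naturals.
module IntegerSolver (R : CommutativeRing 0ℓ 0ℓ) where
  open CommutativeRing R
  open import Algebra.Properties.Ring ring
  open import Algebra.Properties.AbelianGroup +-abelianGroup using (⁻¹-∙-comm)
  open import Algebra.Properties.Semiring.Mult semiring using (×-homo-+; ×1-homo-*) renaming (_×_ to _·_)
  open import Algebra.Properties.CommutativeSemigroup +-commutativeSemigroup using (interchange)
  open import Relation.Binary.Reasoning.Setoid setoid

  -- Results of coefficient arithmetic must come out literally as (0 , 0) and (1 , 0) for the
  -- special clauses of `⟦_⟧ᵈ` to apply; without cancellation 1 - 1 would be stored as (1 , 1).
  reduce : ℕ × ℕ → ℕ × ℕ
  reduce (suc a , suc b) = reduce (a , b)
  reduce x = x

  _+ᵈ_ _*ᵈ_ : ℕ × ℕ → ℕ × ℕ → ℕ × ℕ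
  (a , b) +ᵈ (c , d) = (a N.+ c , b N.+ d)
  (a , b) *ᵈ (c , d) = (a N.* c N.+ b N.* d , a N.* d N.+ b N.* c)

  Diff : RawRing 0ℓ 0ℓ
  Diff = record
    { Carrier = ℕ × ℕ
    ; _≈_ = _≡_
    ; _+_ = λ x y → reduce (x +ᵈ y)
    ; _*_ = λ x y → reduce (x *ᵈ y)
    ; -_ = λ { (a , b) → (b , a) }
    ; 0# = (0 , 0)
    ; 1# = (1 , 0)
    }

  embed : ℕ × ℕ → Carrier
  embed (a , b) = (a · 1#) + - (b · 1#)

  +-homoᵈ : ∀ x y → embed (x +ᵈ y) ≈ embed x + embed y
  +-homoᵈ (a , b) (c , d) = begin
    (a N.+ c) · 1# + - ((b N.+ d) · 1#)
      ≈⟨ +-cong (×-homo-+ 1# a c) (-‿cong (×-homo-+ 1# b d)) ⟩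
    (a · 1# + c · 1#) + - (b · 1# + d · 1#)
      ≈⟨ +-cong refl (sym (⁻¹-∙-comm _ _)) ⟩
    (a · 1# + c · 1#) + (- (b · 1#) + - (d · 1#))
      ≈⟨ interchange _ _ _ _ ⟩
    (a · 1# + - (b · 1#)) + (c · 1# + - (d · 1#)) ∎

  mul-differences : ∀ A B C D → (A * C + B * D) + - (A * D + B * C) ≈ (A + - B) * (C + - D)
  mul-differences A B C D = sym (begin
    (A + - B) * (C + - D)
      ≈⟨ distribʳ _ _ _ ⟩
    A * (C + - D) + - B * (C + - D)
      ≈⟨ +-cong (distribˡ _ _ _) (distribˡ _ _ _) ⟩
    (A * C + A * - D) + (- B * C + - B * - D)
      ≈⟨ +-cong refl (+-comm _ _) ⟩
    (A * C + A * - D) + (- B * - D + - B * C)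
      ≈⟨ interchange _ _ _ _ ⟩
    (A * C + - B * - D) + (A * - D + - B * C)
      ≈⟨ +-cong (+-cong refl (trans (sym (-‿distribˡ-* _ _)) (trans (-‿cong (sym (-‿distribʳ-* _ _))) (-‿involutive _))))
                (+-cong (sym (-‿distribʳ-* _ _)) (sym (-‿distribˡ-* _ _))) ⟩
    (A * C + B * D) + (- (A * D) + - (B * C))
      ≈⟨ +-cong refl (⁻¹-∙-comm _ _) ⟩
    (A * C + B * D) + - (A * D + B * C) ∎)

  *-homoᵈ : ∀ x y → embed (x *ᵈ y) ≈ embed x * embed y
  *-homoᵈ (a , b) (c , d) = begin
    (a N.* c N.+ b N.* d) · 1# + - ((a N.* d N.+ b N.* c) · 1#)
      ≈⟨ +-cong (sum-homo a c b d) (-‿cong (sum-homo a d b c)) ⟩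
    ((a · 1#) * (c · 1#) + (b · 1#) * (d · 1#)) + - ((a · 1#) * (d · 1#) + (b · 1#) * (c · 1#))
      ≈⟨ mul-differences _ _ _ _ ⟩
    embed (a , b) * embed (c , d) ∎
    where
    sum-homo : ∀ a c b d → (a N.* c N.+ b N.* d) · 1# ≈ (a · 1#) * (c · 1#) + (b · 1#) * (d · 1#)
    sum-homo a c b d = trans (×-homo-+ 1# (a N.* c) (b N.* d)) (+-cong (×1-homo-* a c) (×1-homo-* b d))

  -‿homoᵈ : ∀ x → embed (RawRing.-_ Diff x) ≈ - embed x
  -‿homoᵈ (a , b) = sym (begin
    - (a · 1# + - (b · 1#)) ≈⟨ sym (⁻¹-∙-comm _ _) ⟩
    - (a · 1#) + - - (b · 1#) ≈⟨ +-cong refl (-‿involutive _) ⟩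
    - (a · 1#) + b · 1# ≈⟨ +-comm _ _ ⟩
    b · 1# + - (a · 1#) ∎)

  embed-equal : ∀ x y → proj₁ x N.+ proj₂ y ≡ proj₁ y N.+ proj₂ x → embed x ≈ embed y
  embed-equal (a , b) (c , d) e = begin
    a · 1# + - (b · 1#) ≈⟨ +-cong (sym (+-identityʳ _)) refl ⟩
    (a · 1# + 0#) + - (b · 1#) ≈⟨ +-cong (+-cong refl (sym (-‿inverseʳ (d · 1#)))) refl ⟩
    (a · 1# + (d · 1# + - (d · 1#))) + - (b · 1#) ≈⟨ +-cong (sym (+-assoc _ _ _)) refl ⟩
    ((a · 1# + d · 1#) + - (d · 1#)) + - (b · 1#)
      ≈⟨ +-cong (+-cong (trans (sym (×-homo-+ 1# a d)) (trans (reflexive (≡.cong (_· 1#) e)) (×-homo-+ 1# c b))) refl) refl ⟩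
    ((c · 1# + b · 1#) + - (d · 1#)) + - (b · 1#) ≈⟨ +-assoc _ _ _ ⟩
    (c · 1# + b · 1#) + (- (d · 1#) + - (b · 1#)) ≈⟨ interchange _ _ _ _ ⟩
    (c · 1# + - (d · 1#)) + (b · 1# + - (b · 1#)) ≈⟨ +-cong refl (-‿inverseʳ _) ⟩
    (c · 1# + - (d · 1#)) + 0# ≈⟨ +-identityʳ _ ⟩
    c · 1# + - (d · 1#) ∎

  embed-reduce : ∀ x → embed (reduce x) ≈ embed x
  embed-reduce (zero , b) = refl
  embed-reduce (suc a , zero) = refl
  embed-reduce (suc a , suc b) = trans (embed-reduce (a , b)) (embed-equal (a , b) (suc a , suc b) (NP.+-suc a b))

  -- 0 and 1 are interpreted on the nose, so that the solver's normal forms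
  -- match goals that mention 0# and 1#.
  ⟦_⟧ᵈ : ℕ × ℕ → Carrier
  ⟦ 0 , 0 ⟧ᵈ = 0#
  ⟦ 1 , 0 ⟧ᵈ = 1#
  ⟦ x ⟧ᵈ = embed x

  ⟦⟧≈embed : ∀ x → ⟦ x ⟧ᵈ ≈ embed x
  ⟦⟧≈embed (0 , 0) = sym (-‿inverseʳ 0#)
  ⟦⟧≈embed (1 , 0) = sym (trans (+-cong (+-identityʳ 1#) -0#≈0#) (+-identityʳ 1#))
  ⟦⟧≈embed (0 , suc b) = refl
  ⟦⟧≈embed (1 , suc b) = refl
  ⟦⟧≈embed (suc (suc a) , b) = refl

  almostRing : ACR.AlmostCommutativeRing 0ℓ 0ℓ
  almostRing = ACR.fromCommutativeRing R

  morphism : Diff ACR.-Raw-AlmostCommutative⟶ almostRing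
  morphism = record
    { ⟦_⟧ = ⟦_⟧ᵈ
    ; +-homo = λ x y → trans (⟦⟧≈embed (reduce (x +ᵈ y))) (trans (trans (embed-reduce (x +ᵈ y)) (+-homoᵈ x y)) (sym (+-cong (⟦⟧≈embed x) (⟦⟧≈embed y))))
    ; *-homo = λ x y → trans (⟦⟧≈embed (reduce (x *ᵈ y))) (trans (trans (embed-reduce (x *ᵈ y)) (*-homoᵈ x y)) (sym (*-cong (⟦⟧≈embed x) (⟦⟧≈embed y))))
    ; -‿homo = λ x → trans (⟦⟧≈embed (RawRing.-_ Diff x)) (trans (-‿homoᵈ x) (sym (-‿cong (⟦⟧≈embed x))))
    ; 0-homo = refl
    ; 1-homo = refl
    }

  equal? : ∀ x y → Maybe (⟦ x ⟧ᵈ ≈ ⟦ y ⟧ᵈ)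
  equal? x@(a , b) y@(c , d) with a N.+ d N.≟ c N.+ b
  ... | no _ = nothing
  ... | yes e = just (trans (⟦⟧≈embed x) (trans (embed-equal x y e) (sym (⟦⟧≈embed y))))

  open Algebra.Solver.Ring Diff almostRing morphism equal? public
    using (solve; con; _:=_; _:+_; _:*_; _:-_; :-_)

  :1 : ∀ {n} → Algebra.Solver.Ring.Polynomial Diff almostRing morphism equal? n
  :1 = con (1 , 0)
  :0 : ∀ {n} → Algebra.Solver.Ring.Polynomial Diff almostRing morphism equal? n
  :0 = con (0 , 0)

-- Formal linear combinations over a basis with decidable equality

record DecidableBasis : Set₁ where
  field
    Basis : Set
    _==_ : Basis → Basis → Bool
    sound : ∀ b b' → (b == b') ≡ true → b ≡ b'
    complete : ∀ b → (b == b) ≡ true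

module FormalSum (R : CommutativeRing 0ℓ 0ℓ) (DB : DecidableBasis) where
  open CommutativeRing R
  open DecidableBasis DB
  open import Algebra.Properties.Ring ring
  open import Relation.Binary.Reasoning.Setoid setoid
  open IntegerSolver R using (solve; _:=_; _:+_; _:*_; _:-_; :-_; con; :1; :0)

  Sum : Set
  Sum = List (Carrier × Basis)

  coef : Sum → Basis → Carrier
  coef [] α = 0#
  coef ((c , β) ∷ f) α = if β == α then c + coef f α else coef f α

  infix 4 _≋_
  _≋_ : Sum → Sum → Set
  f ≋ g = ∀ α → coef f α ≈ coef g α

  lin : (Basis → Carrier) → Sum → Carrier
  lin h [] = 0#
  lin h ((c , β) ∷ f) = c * h β + lin h f

  δ : Basis → Basis → Carrier
  δ α β = if β == α then 1# else 0#

  coef≈lin : ∀ f α → coef f α ≈ lin (δ α) f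
  coef≈lin [] α = refl
  coef≈lin ((c , β) ∷ f) α with β == α
  ... | true = +-cong (sym (*-identityʳ c)) (coef≈lin f α)
  ... | false = trans (coef≈lin f α) (sym (trans (+-cong (zeroʳ c) refl) (+-identityˡ _)))

  lin-++ : ∀ h f g → lin h (f ++ g) ≈ lin h f + lin h g
  lin-++ h [] g = sym (+-identityˡ _)
  lin-++ h ((c , β) ∷ f) g = trans (+-cong refl (lin-++ h f g)) (sym (+-assoc _ _ _))

  lin-cong : ∀ {h h'} f → (∀ β → h β ≈ h' β) → lin h f ≈ lin h' f
  lin-cong [] e = refl
  lin-cong ((c , β) ∷ f) e = +-cong (*-cong refl (e β)) (lin-cong f e)

  scale : Carrier → Sum → Sum
  scale c = map (λ { (d , β) → (c * d , β) })

  lin-scale : ∀ h c f → lin h (scale c f) ≈ c * lin h f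
  lin-scale h c [] = sym (zeroʳ c)
  lin-scale h c ((d , β) ∷ f) = trans (+-cong (*-assoc c d _) (lin-scale h c f)) (sym (distribˡ c _ _))

  lin-+ : ∀ h h' f → lin (λ β → h β + h' β) f ≈ lin h f + lin h' f
  lin-+ h h' [] = sym (+-identityˡ 0#)
  lin-+ h h' ((c , β) ∷ f) = trans (+-cong refl (lin-+ h h' f))
    (solve 5 (λ c x y u v → c :* (x :+ y) :+ (u :+ v) := (c :* x :+ u) :+ (c :* y :+ v)) refl c (h β) (h' β) _ _)

  lin-* : ∀ d h f → lin (λ β → d * h β) f ≈ d * lin h f
  lin-* d h [] = sym (zeroʳ d)
  lin-* d h ((c , β) ∷ f) = trans (+-cong refl (lin-* d h f))
    (solve 4 (λ c d x u → c :* (d :* x) :+ d :* u := d :* (c :* x :+ u)) refl c d (h β) _)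

  lin-zero : ∀ f → lin (λ _ → 0#) f ≈ 0#
  lin-zero [] = refl
  lin-zero ((c , β) ∷ f) = trans (+-cong (zeroʳ c) (lin-zero f)) (+-identityˡ 0#)

  lin-swap : ∀ (H : Basis → Basis → Carrier) f g →
    lin (λ β → lin (H β) g) f ≈ lin (λ γ → lin (λ β → H β γ) f) g
  lin-swap H [] g = sym (lin-zero g)
  lin-swap H ((c , β) ∷ f) g = trans
    (+-cong (sym (lin-* c (H β) g)) (lin-swap H f g))
    (sym (lin-+ (λ γ → c * H β γ) (λ γ → lin (λ β' → H β' γ) f) g))

  without : Basis → Sum → Sum
  without β [] = []
  without β ((c , α) ∷ f) = if α == β then without β f else (c , α) ∷ without β f

  lin-without : ∀ h β f → lin h f ≈ coef f β * h β + lin h (without β f)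
  lin-without h β [] = sym (trans (+-cong (zeroˡ _) refl) (+-identityˡ 0#))
  lin-without h β ((c , α) ∷ f) with α == β in e
  ... | true rewrite sound α β e = trans (+-cong refl (lin-without h β f))
    (solve 4 (λ c x k r → c :* x :+ (k :* x :+ r) := (c :+ k) :* x :+ r) refl c (h β) (coef f β) _)
  ... | false = trans (+-cong refl (lin-without h β f))
    (solve 5 (λ c x k y r → c :* x :+ (k :* y :+ r) := k :* y :+ (c :* x :+ r)) refl c (h α) (coef f β) (h β) _)

  ==-false : ∀ {α β γ} → (α == β) ≡ true → (α == γ) ≡ false → (β == γ) ≡ false
  ==-false {α} {β} e e' rewrite sound α β e = e'

  coef-without : ∀ β f α → coef (without β f) α ≈ (if β == α then 0# else coef f α)
  coef-without β [] α with β == α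
  ... | true = refl
  ... | false = refl
  coef-without β ((c , γ) ∷ f) α with γ == β in e
  ... | true = trans (coef-without β f α) aux
    where
    aux : (if β == α then 0# else coef f α) ≈ (if β == α then 0# else (if γ == α then c + coef f α else coef f α))
    aux rewrite sound γ β e with β == α
    ... | true = refl
    ... | false = refl
  ... | false with γ == α in e'
  ...   | false = coef-without β f α
  ...   | true rewrite sound γ α e' with β == α in e''
  ...     | true with () ← ≡.trans (≡.sym e) (≡.subst (λ b → (α == b) ≡ true) (≡.sym (sound β α e'')) (complete α))
  ...     | false = +-cong refl (trans (coef-without β f α) (reflexive (≡.cong (λ b → if b then 0# else coef f α) e'')))

  length-without : ∀ β f → length (without β f) N.≤ length f
  length-without β [] = N.z≤n
  length-without β ((c , α) ∷ f) with α == β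
  ... | true = NP.m≤n⇒m≤1+n (length-without β f)
  ... | false = N.s≤s (length-without β f)

  -- Gathering all terms at the basis element of the head removes at least the head, and the
  -- gathered coefficient is zero by hypothesis. What is left has zero coefficients again but need
  -- not be the tail of f, so the induction runs over a bound for the length.
  lin-vanishes : ∀ N f → length f N.≤ N → (∀ α → coef f α ≈ 0#) → ∀ h → lin h f ≈ 0#
  lin-vanishes N [] _ z h = refl
  lin-vanishes (suc N) f@((c , β) ∷ f') (N.s≤s len) z h = begin
    lin h f ≈⟨ lin-without h β f ⟩
    coef f β * h β + lin h (without β f)
      ≈⟨ +-cong (trans (*-cong (z β) refl) (zeroˡ _)) (lin-vanishes N (without β f) len' z' h) ⟩
    0# + 0# ≈⟨ +-identityˡ 0# ⟩
    0# ∎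
    where
    len' : length (without β f) N.≤ N
    len' rewrite complete β = NP.≤-trans (length-without β f') len
    z' : ∀ α → coef (without β f) α ≈ 0#
    z' α = trans (coef-without β f α) aux
      where
      aux : (if β == α then 0# else coef f α) ≈ 0#
      aux with β == α in e
      ... | true = refl
      ... | false = trans (reflexive (≡.cong (λ b → if b then c + coef f' α else coef f' α) (≡.sym e))) (z α)

  coef-++ : ∀ f g α → coef (f ++ g) α ≈ coef f α + coef g α
  coef-++ f g α = trans (coef≈lin (f ++ g) α) (trans (lin-++ (δ α) f g) (sym (+-cong (coef≈lin f α) (coef≈lin g α))))

  coef-scale : ∀ c f α → coef (scale c f) α ≈ c * coef f α
  coef-scale c f α = trans (coef≈lin (scale c f) α) (trans (lin-scale (δ α) c f) (*-cong refl (sym (coef≈lin f α))))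

  -- Every coefficient of f - g is zero, so `lin-vanishes` applies to it. Functionals are thus well
  -- defined on sums modulo `≋`, whatever the order and repetition of terms.
  lin-resp : ∀ h f g → f ≋ g → lin h f ≈ lin h g
  lin-resp h f g e = begin
    lin h f ≈⟨ solve 2 (λ x y → x := (x :+ (:- :1) :* y) :+ y) refl _ (lin h g) ⟩
    (lin h f + (- 1#) * lin h g) + lin h g
      ≈⟨ +-cong (sym (trans (lin-++ h f (scale (- 1#) g)) (+-cong refl (lin-scale h (- 1#) g)))) refl ⟩
    lin h (f ++ scale (- 1#) g) + lin h g
      ≈⟨ +-cong (lin-vanishes _ (f ++ scale (- 1#) g) NP.≤-refl zero-coef h) refl ⟩
    0# + lin h g ≈⟨ +-identityˡ _ ⟩
    lin h g ∎
    where
    zero-coef : ∀ α → coef (f ++ scale (- 1#) g) α ≈ 0#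
    zero-coef α = begin
      coef (f ++ scale (- 1#) g) α ≈⟨ coef-++ f _ α ⟩
      coef f α + coef (scale (- 1#) g) α ≈⟨ +-cong (e α) (coef-scale (- 1#) g α) ⟩
      coef g α + (- 1#) * coef g α ≈⟨ solve 1 (λ x → x :+ (:- :1) :* x := :0) refl _ ⟩
      0# ∎

  -- With `lin-resp` this says that a sum is known by the values of all functionals on it. Operator
  -- identities are verified below by moving the operators over to the functional.
  lin-ext : ∀ f g → (∀ h → lin h f ≈ lin h g) → f ≋ g
  lin-ext f g e α = trans (coef≈lin f α) (trans (e (δ α)) (sym (coef≈lin g α)))

-- Columns, labels and linear combinations

-- The interface between the combinatorial argument and the polynomial ring. `tz` and `qz` are the
-- integral powers of t and q, `ρ h a` is the inverse of 1 - q^(h+1) t^(a+1), `X` multiplies by a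
-- variable and `T` is the Demazure-Lusztig operator, both indexed from 0. Division enters only
-- through these powers, `ρ` and `half`.
record Setting : Set₁ where
  infixl 6 _⊞_
  infixr 7 _·_
  field
    scalars : CommutativeRing 0ℓ 0ℓ
  open CommutativeRing scalars public
  field
    tz qz : ℤ → Carrier
    tz-+ : ∀ i j → tz (i Z.+ j) ≈ tz i * tz j
    tz-0 : tz (+ 0) ≈ 1#
    qz-+ : ∀ i j → qz (i Z.+ j) ≈ qz i * qz j
    qz-0 : qz (+ 0) ≈ 1#
    ρ ζ : ℕ → ℕ → Carrier
    ρ-inverse : ∀ h a → ρ h a * (1# - qz (+ suc h) * tz (+ suc a)) ≈ 1#
    ζ-numerator : ∀ h a → ζ h a ≈ (1# - tz (+ 1)) * ρ h a
    half : Carrier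
    half+half : half + half ≈ 1#
    n : ℕ
    M : Set
    Index : Set
    coef : M → Index → Carrier
    _⊞_ : M → M → M
    𝟘 : M
    _·_ : Carrier → M → M
    coef-⊞ : ∀ f g α → coef (f ⊞ g) α ≈ coef f α + coef g α
    coef-𝟘 : ∀ α → coef 𝟘 α ≈ 0#
    coef-· : ∀ c f α → coef (c · f) α ≈ c * coef f α

  infix 4 _≐_
  _≐_ : M → M → Set
  f ≐ g = ∀ α → coef f α ≈ coef g α

  field
    X T : ℕ → M → M
    X-cong : ∀ k f g → f ≐ g → X k f ≐ X k g
    X-⊞ : ∀ k f g → X k (f ⊞ g) ≐ X k f ⊞ X k g
    X-· : ∀ k c f → X k (c · f) ≐ c · X k f
    X-comm : ∀ j k f → X j (X k f) ≐ X k (X j f)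
    T-cong : ∀ k f g → f ≐ g → T k f ≐ T k g
    T-⊞ : ∀ k f g → T k (f ⊞ g) ≐ T k f ⊞ T k g
    T-· : ∀ k c f → T k (c · f) ≐ c · T k f
    T-quadratic : ∀ k → suc k N.< n → ∀ f → T k (T k f) ≐ (tz (+ 1) - 1#) · T k f ⊞ tz (+ 1) · f
    T-X : ∀ k → suc k N.< n → ∀ f → T k (X k f) ≐ X (suc k) (T k f ⊞ (1# - tz (+ 1)) · f)
    T-X-other : ∀ k j → suc k N.< n → ¬ j ≡ k → ¬ j ≡ suc k → ∀ f → T k (X j f) ≐ X j (T k f)
    𝟙 : M
    T-𝟙 : ∀ k → suc k N.< n → T k 𝟙 ≐ tz (+ 1) · 𝟙

-- Comparisons of labels, states and adjacent transpositions

<ᵇ-true : ∀ {m n} → m N.< n → (m <ᵇ n) ≡ true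
<ᵇ-true {m} {n} p with m <ᵇ n | NP.<⇒<ᵇ p
... | true | _ = ≡.refl

<ᵇ-false : ∀ {m n} → n N.≤ m → (m <ᵇ n) ≡ false
<ᵇ-false {m} {n} p with m <ᵇ n in e
... | false = ≡.refl
... | true = ⊥-elim (NP.<⇒≱ (NP.<ᵇ⇒< m n (≡.subst Data.Bool.T (≡.sym e) _)) p)

≤ᵇ-true : ∀ {m n} → m N.≤ n → (m ≤ᵇ n) ≡ true
≤ᵇ-true {m} {n} p with m ≤ᵇ n | NP.≤⇒≤ᵇ p
... | true | _ = ≡.refl

≤ᵇ-false : ∀ {m n} → n N.< m → (m ≤ᵇ n) ≡ false
≤ᵇ-false {m} {n} p with m ≤ᵇ n in e
... | false = ≡.refl
... | true = ⊥-elim (NP.<⇒≱ p (NP.≤ᵇ⇒≤ m n (≡.subst Data.Bool.T (≡.sym e) _)))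

≡ᵇ-refl : ∀ m → (m ≡ᵇ m) ≡ true
≡ᵇ-refl zero = ≡.refl
≡ᵇ-refl (suc m) = ≡ᵇ-refl m

≡ᵇ-sound : ∀ m n → (m ≡ᵇ n) ≡ true → m ≡ n
≡ᵇ-sound m n e = NP.≡ᵇ⇒≡ m n (≡.subst Data.Bool.T (≡.sym e) _)

≡ᵇ-false : ∀ {m n} → ¬ m ≡ n → (m ≡ᵇ n) ≡ false
≡ᵇ-false {m} {n} p with m ≡ᵇ n in e
... | false = ≡.refl
... | true = ⊥-elim (p (≡ᵇ-sound m n e))

≡ᵇ-distinct : ∀ {m n} → (m ≡ᵇ n) ≡ false → ¬ m ≡ n
≡ᵇ-distinct {m} e ≡.refl with () ← ≡.trans (≡.sym e) (≡ᵇ-refl m)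

-- A state is a list of columns (label , height).
State : Set
State = List (ℕ × ℕ)

mem : ℕ → State → Bool
mem u [] = false
mem u ((l , h) ∷ L) = (l ≡ᵇ u) ∨ mem u L

arms : ℕ → State → ℕ
arms h = countB (λ x → proj₂ x ≤ᵇ h)

below : ℕ → State → ℕ
below u = countB (λ x → proj₁ x <ᵇ u)

relabel : (ℕ → ℕ) → State → State
relabel g = map (λ x → (g (proj₁ x) , proj₂ x))

data Uniq : State → Set where
  [] : Uniq []
  _∷_ : ∀ {l h L} → mem l L ≡ false → Uniq L → Uniq ((l , h) ∷ L)

-- The exact number of steps of `G`: one for each box still to be placed, and one to discard each
-- exhausted column.
meas : State → ℕ
meas [] = 0
meas ((l , h) ∷ L) = suc h N.+ meas L

countB-++ : ∀ {A : Set} (p : A → Bool) xs ys → countB p (xs ++ ys) ≡ countB p xs N.+ countB p ys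
countB-++ p [] ys = ≡.refl
countB-++ p (x ∷ xs) ys with p x
... | true = ≡.cong suc (countB-++ p xs ys)
... | false = countB-++ p xs ys

mem-++ : ∀ u L L' → mem u (L ++ L') ≡ mem u L ∨ mem u L'
mem-++ u [] L' = ≡.refl
mem-++ u ((l , h) ∷ L) L' with l ≡ᵇ u
... | true = ≡.refl
... | false = mem-++ u L L'

∨-false : ∀ {a b} → a ∨ b ≡ false → (a ≡ false) × (b ≡ false)
∨-false {false} {false} _ = ≡.refl , ≡.refl

∨-false⁺ : ∀ {a b} → a ≡ false → b ≡ false → a ∨ b ≡ false
∨-false⁺ ≡.refl ≡.refl = ≡.refl

mem-snoc-false : ∀ {v} L u h → mem v L ≡ false → ¬ u ≡ v → mem v (L ++ (u , h) ∷ []) ≡ false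
mem-snoc-false {v} L u h p q = ≡.trans (mem-++ v L _) (∨-false⁺ p (∨-false⁺ (≡ᵇ-false q) ≡.refl))

uniq-snoc : ∀ {L} u h → Uniq L → mem u L ≡ false → Uniq (L ++ (u , h) ∷ [])
uniq-snoc u h [] p = ≡.refl ∷ []
uniq-snoc u h (_∷_ {l} {g} {L} q U) p with ∨-false p
... | l≢u , u∉L = mem-snoc-false L u h q (λ e → ≡ᵇ-distinct l≢u (≡.sym e)) ∷ uniq-snoc u h U u∉L

data Transposed (k : ℕ) : ℕ → ℕ → Set where
  lower : Transposed k k (suc k)
  upper : Transposed k (suc k) k
  other : ∀ {u} → ¬ u ≡ k → ¬ u ≡ suc k → Transposed k u u

suc-≡ᵇ : ∀ k → (suc k ≡ᵇ k) ≡ false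
suc-≡ᵇ zero = ≡.refl
suc-≡ᵇ (suc k) = suc-≡ᵇ k

abstract
  transpose : ℕ → ℕ → ℕ
  transpose k u = if u ≡ᵇ k then suc k else if u ≡ᵇ suc k then k else u

  transposed : ∀ k u → Transposed k u (transpose k u)
  transposed k u with u ≡ᵇ k in e
  ... | true rewrite ≡ᵇ-sound u k e = lower
  ... | false with u ≡ᵇ suc k in e'
  ...   | true rewrite ≡ᵇ-sound u (suc k) e' = upper
  ...   | false = other (≡ᵇ-distinct e) (≡ᵇ-distinct e')

  transpose-lower : ∀ k → transpose k k ≡ suc k
  transpose-lower k rewrite ≡ᵇ-refl k = ≡.refl

  transpose-upper : ∀ k → transpose k (suc k) ≡ k
  transpose-upper k rewrite suc-≡ᵇ k | ≡ᵇ-refl k = ≡.refl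

  transpose-other : ∀ k {u} → ¬ u ≡ k → ¬ u ≡ suc k → transpose k u ≡ u
  transpose-other k p q rewrite ≡ᵇ-false p | ≡ᵇ-false q = ≡.refl

transpose-involutive : ∀ k u → transpose k (transpose k u) ≡ u
transpose-involutive k u with transpose k u | transposed k u
... | _ | lower = transpose-upper k
... | _ | upper = transpose-lower k
... | _ | other p q = transpose-other k p q

transpose-<ᵇ-left : ∀ k l {u} → ¬ u ≡ k → ¬ u ≡ suc k → (transpose k l <ᵇ u) ≡ (l <ᵇ u)
transpose-<ᵇ-left k l {u} p q with transpose k l | transposed k l
... | _ | other _ _ = ≡.refl
... | _ | lower with NP.<-cmp k u
...   | tri< k<u _ _ = ≡.trans (<ᵇ-true (NP.≤∧≢⇒< k<u (λ e → q (≡.sym e)))) (≡.sym (<ᵇ-true k<u))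
...   | tri≈ _ e _ = ⊥-elim (p (≡.sym e))
...   | tri> _ _ u<k = ≡.trans (<ᵇ-false (NP.m≤n⇒m≤1+n (NP.<⇒≤ u<k))) (≡.sym (<ᵇ-false (NP.<⇒≤ u<k)))
transpose-<ᵇ-left k l {u} p q | _ | upper with NP.<-cmp k u
...   | tri< k<u _ _ = ≡.trans (<ᵇ-true k<u) (≡.sym (<ᵇ-true (NP.≤∧≢⇒< k<u (λ e → q (≡.sym e)))))
...   | tri≈ _ e _ = ⊥-elim (p (≡.sym e))
...   | tri> _ _ u<k = ≡.trans (<ᵇ-false (NP.<⇒≤ u<k)) (≡.sym (<ᵇ-false (NP.m≤n⇒m≤1+n (NP.<⇒≤ u<k))))

transpose-<ᵇ-right : ∀ k l {u} → ¬ u ≡ k → ¬ u ≡ suc k → (u <ᵇ transpose k l) ≡ (u <ᵇ l)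
transpose-<ᵇ-right k l {u} p q with transpose k l | transposed k l
... | _ | other _ _ = ≡.refl
... | _ | lower with NP.<-cmp u k
...   | tri< u<k _ _ = ≡.trans (<ᵇ-true (NP.m≤n⇒m≤1+n u<k)) (≡.sym (<ᵇ-true u<k))
...   | tri≈ _ e _ = ⊥-elim (p e)
...   | tri> _ _ k<u = ≡.trans (<ᵇ-false k<u) (≡.sym (<ᵇ-false (NP.<⇒≤ k<u)))
transpose-<ᵇ-right k l {u} p q | _ | upper with NP.<-cmp u k
...   | tri< u<k _ _ = ≡.trans (<ᵇ-true u<k) (≡.sym (<ᵇ-true (NP.m≤n⇒m≤1+n u<k)))
...   | tri≈ _ e _ = ⊥-elim (p e)
...   | tri> _ _ k<u = ≡.trans (<ᵇ-false (NP.<⇒≤ k<u)) (≡.sym (<ᵇ-false k<u))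

transpose-≡ᵇ : ∀ k l u → (transpose k l ≡ᵇ transpose k u) ≡ (l ≡ᵇ u)
transpose-≡ᵇ k l u with l ≡ᵇ u in e
... | true rewrite ≡ᵇ-sound l u e = ≡ᵇ-refl (transpose k u)
... | false = ≡ᵇ-false λ e' → ≡ᵇ-distinct e (≡.trans (≡.sym (transpose-involutive k l))
                (≡.trans (≡.cong (transpose k) e') (transpose-involutive k u)))

transpose-≡ᵇ-other : ∀ k l {u} → ¬ u ≡ k → ¬ u ≡ suc k → (transpose k l ≡ᵇ u) ≡ (l ≡ᵇ u)
transpose-≡ᵇ-other k l {u} p q = ≡.trans (≡.cong (transpose k l ≡ᵇ_) (≡.sym (transpose-other k p q))) (transpose-≡ᵇ k l u)

mem-relabel : ∀ k u L → mem (transpose k u) (relabel (transpose k) L) ≡ mem u L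
mem-relabel k u [] = ≡.refl
mem-relabel k u ((l , h) ∷ L) = ≡.cong₂ _∨_ (transpose-≡ᵇ k l u) (mem-relabel k u L)

mem-relabel-other : ∀ k L {u} → ¬ u ≡ k → ¬ u ≡ suc k → mem u (relabel (transpose k) L) ≡ mem u L
mem-relabel-other k L {u} p q = ≡.trans (≡.cong (λ v → mem v (relabel (transpose k) L)) (≡.sym (transpose-other k p q))) (mem-relabel k u L)

mem-relabel-lower : ∀ k L → mem k (relabel (transpose k) L) ≡ mem (suc k) L
mem-relabel-lower k L = ≡.trans (≡.cong (λ v → mem v (relabel (transpose k) L)) (≡.sym (transpose-upper k))) (mem-relabel k (suc k) L)

mem-relabel-upper : ∀ k L → mem (suc k) (relabel (transpose k) L) ≡ mem k L
mem-relabel-upper k L = ≡.trans (≡.cong (λ v → mem v (relabel (transpose k) L)) (≡.sym (transpose-lower k))) (mem-relabel k k L)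

uniq-relabel : ∀ k {L} → Uniq L → Uniq (relabel (transpose k) L)
uniq-relabel k [] = []
uniq-relabel k (_∷_ {l} {h} {L} p U) = ≡.trans (mem-relabel k l L) p ∷ uniq-relabel k U

arms-relabel : ∀ g h L → arms h (relabel g L) ≡ arms h L
arms-relabel g h [] = ≡.refl
arms-relabel g h ((l , x) ∷ L) rewrite arms-relabel g h L = ≡.refl

below-relabel-other : ∀ k L {u} → ¬ u ≡ k → ¬ u ≡ suc k → below u (relabel (transpose k) L) ≡ below u L
below-relabel-other k [] p q = ≡.refl
below-relabel-other k ((l , h) ∷ L) p q
  rewrite transpose-<ᵇ-left k l p q | below-relabel-other k L p q = ≡.refl

relabel-++ : ∀ g L L' → relabel g (L ++ L') ≡ relabel g L ++ relabel g L'
relabel-++ g [] L' = ≡.refl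
relabel-++ g (x ∷ L) L' = ≡.cong (_ ∷_) (relabel-++ g L L')

relabel-involutive : ∀ k L → relabel (transpose k) (relabel (transpose k) L) ≡ L
relabel-involutive k [] = ≡.refl
relabel-involutive k ((l , h) ∷ L) = ≡.cong₂ _∷_ (≡.cong (_, h) (transpose-involutive k l)) (relabel-involutive k L)

relabel-absent : ∀ k L → mem k L ≡ false → mem (suc k) L ≡ false → relabel (transpose k) L ≡ L
relabel-absent k [] p q = ≡.refl
relabel-absent k ((l , h) ∷ L) p q with ∨-false p | ∨-false q
... | l≢k , k∉L | l≢sk , sk∉L = ≡.cong₂ _∷_ (≡.cong (_, h) (transpose-other k (≡ᵇ-distinct l≢k) (≡ᵇ-distinct l≢sk)))
                                  (relabel-absent k L k∉L sk∉L)

<ᵇ-suc : ∀ l k → ¬ l ≡ k → (l <ᵇ suc k) ≡ (l <ᵇ k)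
<ᵇ-suc l k p with NP.<-cmp l k
... | tri< l<k _ _ = ≡.trans (<ᵇ-true (NP.m≤n⇒m≤1+n l<k)) (≡.sym (<ᵇ-true l<k))
... | tri≈ _ e _ = ⊥-elim (p e)
... | tri> _ _ k<l = ≡.trans (<ᵇ-false k<l) (≡.sym (<ᵇ-false (NP.<⇒≤ k<l)))

suc-<ᵇ : ∀ k l → ¬ l ≡ suc k → (k <ᵇ l) ≡ (suc k <ᵇ l)
suc-<ᵇ k l p with NP.<-cmp (suc k) l
... | tri< sk<l _ _ = ≡.trans (<ᵇ-true (NP.≤-trans (NP.n≤1+n _) sk<l)) (≡.sym (<ᵇ-true sk<l))
... | tri≈ _ e _ = ⊥-elim (p (≡.sym e))
... | tri> _ _ l<sk = ≡.trans (<ᵇ-false (NP.≤-pred l<sk)) (≡.sym (<ᵇ-false (NP.<⇒≤ l<sk)))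

below-suc : ∀ k L → mem k L ≡ false → below (suc k) L ≡ below k L
below-suc k [] p = ≡.refl
below-suc k ((l , h) ∷ L) p with ∨-false p
... | l≢k , k∉L rewrite <ᵇ-suc l k (≡ᵇ-distinct l≢k) | below-suc k L k∉L = ≡.refl

-- The labels k+1 and k count each other exactly once: k+1 ∈ L is renamed to k,
-- which lies below k+1.
below-relabel-upper : ∀ k {L} → Uniq L → mem k L ≡ false → mem (suc k) L ≡ true →
  below (suc k) (relabel (transpose k) L) ≡ suc (below k L)
below-relabel-upper k (_∷_ {l} {h} {L} p U) k∉ sk∈ with transpose k l | transposed k l
... | _ | lower with () ← ≡.trans (≡.sym (proj₁ (∨-false {k ≡ᵇ k} k∉))) (≡ᵇ-refl k)
... | _ | upper rewrite <ᵇ-true (NP.n<1+n k) | <ᵇ-false (NP.n≤1+n k)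
    | relabel-absent k L (proj₂ (∨-false {suc k ≡ᵇ k} k∉)) p | below-suc k L (proj₂ (∨-false {suc k ≡ᵇ k} k∉)) = ≡.refl
... | _ | other l≢k l≢sk rewrite ≡ᵇ-false l≢sk | ≡ᵇ-false l≢k | <ᵇ-suc l k l≢k with l <ᵇ k
...   | true = ≡.cong suc (below-relabel-upper k U k∉ sk∈)
...   | false = below-relabel-upper k U k∉ sk∈

-- "k occurs before k+1", a label absent from the state counting as preceding
-- all present ones.
data Ordered (k : ℕ) : State → Set where
  absent : ∀ {L} → mem k L ≡ false → Ordered k L
  before : ∀ {L} A h B → L ≡ A ++ (k , h) ∷ B →
    mem k A ≡ false → mem (suc k) A ≡ false → mem k B ≡ false → mem (suc k) B ≡ true → Ordered k L

split-mem : ∀ k {L} → Uniq L → mem k L ≡ true →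
  ∃ λ A → ∃ λ h → ∃ λ B → (L ≡ A ++ (k , h) ∷ B) × (mem k A ≡ false) × (mem k B ≡ false)
split-mem k (_∷_ {l} {h} {L} p U) q with l ≡ᵇ k in e
... | true rewrite ≡ᵇ-sound l k e = [] , h , L , ≡.refl , ≡.refl , p
... | false with split-mem k U q
...   | A , g , B , ≡.refl , r , s = (l , h) ∷ A , g , B , ≡.refl , ∨-false⁺ e r , s

∨-true-right : ∀ a {b} → b ≡ true → a ∨ b ≡ true
∨-true-right true _ = ≡.refl
∨-true-right false e = e

ordered-snoc : ∀ k {L} h → Uniq L → mem k L ≡ true → mem (suc k) L ≡ false → Ordered k (L ++ (suc k , h) ∷ [])
ordered-snoc k {L} h U p q with split-mem k U p
... | A , g , B , ≡.refl , r , s with ∨-false (≡.trans (≡.sym (mem-++ (suc k) A ((k , g) ∷ B))) q)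
...   | r' , q' rewrite LP.++-assoc A ((k , g) ∷ B) ((suc k , h) ∷ []) =
  before A g (B ++ (suc k , h) ∷ []) ≡.refl r r' (mem-snoc-false B (suc k) h s (λ e → NP.1+n≢n e))
    (≡.trans (mem-++ (suc k) B _) (∨-true-right (mem (suc k) B) (≡.cong (_∨ false) (≡ᵇ-refl k))))

-- Equality and linear algebra in the module of polynomials

module Core (S : Setting) where
  open Setting S hiding (refl; sym; trans; zero)
  private module K = Setting S
  open IntegerSolver scalars
  import Relation.Binary.Reasoning.Setoid as SetoidReasoning
  module K-Reasoning = SetoidReasoning K.setoid

  infix 4 _≋_
  -- A record around `≐`, so that the two polynomials can be recovered from the type of an equation;
  -- the pointwise statement unfolds and does not determine them.
  record _≋_ (f g : M) : Set where
    constructor ext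
    field at : f ≐ g
  open _≋_ public

  ≋-refl : ∀ {f} → f ≋ f
  ≋-refl = ext λ α → K.refl

  ≋-sym : ∀ {f g} → f ≋ g → g ≋ f
  ≋-sym e = ext λ α → K.sym (at e α)

  ≋-trans : ∀ {f g h} → f ≋ g → g ≋ h → f ≋ h
  ≋-trans e e' = ext λ α → K.trans (at e α) (at e' α)

  ≋-setoid : Setoid 0ℓ 0ℓ
  ≋-setoid = record { Carrier = M ; _≈_ = _≋_ ; isEquivalence = record { refl = ≋-refl ; sym = ≋-sym ; trans = ≋-trans } }

  module ≋-Reasoning = SetoidReasoning ≋-setoid

  ≋-reflexive : ∀ {f g} → f ≡ g → f ≋ g
  ≋-reflexive ≡.refl = ≋-refl

  ⊞-cong : ∀ {f f' g g'} → f ≋ f' → g ≋ g' → f ⊞ g ≋ f' ⊞ g'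
  ⊞-cong {f} {f'} {g} {g'} e e' = ext λ α →
    K.trans (coef-⊞ f g α) (K.trans (+-cong (at e α) (at e' α)) (K.sym (coef-⊞ f' g' α)))

  ·-cong : ∀ {c d f g} → c ≈ d → f ≋ g → c · f ≋ d · g
  ·-cong {c} {d} {f} {g} e e' = ext λ α →
    K.trans (coef-· c f α) (K.trans (*-cong e (at e' α)) (K.sym (coef-· d g α)))

  infixl 6 _:⊞_
  infixr 7 _:·_
  data Combination (m : ℕ) : Set where
    var : Fin m → Combination m
    :𝟘 : Combination m
    _:⊞_ : Combination m → Combination m → Combination m
    _:·_ : Carrier → Combination m → Combination m

  module _ {m : ℕ} where
    ⟦_⟧ : Combination m → Vec M m → M
    ⟦ var i ⟧ ρ = lookup ρ i
    ⟦ :𝟘 ⟧ ρ = 𝟘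
    ⟦ a :⊞ b ⟧ ρ = ⟦ a ⟧ ρ ⊞ ⟦ b ⟧ ρ
    ⟦ c :· a ⟧ ρ = c · ⟦ a ⟧ ρ

    ⟦_⟧ᶜ : Combination m → (Fin m → Carrier) → Carrier
    ⟦ var i ⟧ᶜ v = v i
    ⟦ :𝟘 ⟧ᶜ v = 0#
    ⟦ a :⊞ b ⟧ᶜ v = ⟦ a ⟧ᶜ v + ⟦ b ⟧ᶜ v
    ⟦ c :· a ⟧ᶜ v = c * ⟦ a ⟧ᶜ v

    coef-combination : ∀ a ρ α → coef (⟦ a ⟧ ρ) α ≈ ⟦ a ⟧ᶜ (λ i → coef (lookup ρ i) α)
    coef-combination (var i) ρ α = K.refl
    coef-combination :𝟘 ρ α = coef-𝟘 α
    coef-combination (a :⊞ b) ρ α = K.trans (coef-⊞ _ _ α) (+-cong (coef-combination a ρ α) (coef-combination b ρ α))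
    coef-combination (c :· a) ρ α = K.trans (coef-· c _ α) (*-cong K.refl (coef-combination a ρ α))

    -- Linear combinations are compared coefficientwise, which leaves an identity between scalars
    -- for arbitrary values v; the ring axioms or the solver settle it.
    combine : ∀ a b ρ → (∀ v → ⟦ a ⟧ᶜ v ≈ ⟦ b ⟧ᶜ v) → ⟦ a ⟧ ρ ≋ ⟦ b ⟧ ρ
    combine a b ρ e = ext λ α → K.trans (coef-combination a ρ α) (K.trans (e _) (K.sym (coef-combination b ρ α)))

  x₀ : ∀ {m} → Combination (suc m)
  x₀ = var zero
  x₁ : ∀ {m} → Combination (suc (suc m))
  x₁ = var (suc zero)
  x₂ : ∀ {m} → Combination (suc (suc (suc m)))
  x₂ = var (suc (suc zero))
  x₃ : ∀ {m} → Combination (suc (suc (suc (suc m))))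
  x₃ = var (suc (suc (suc zero)))

  record Linear (F : M → M) : Set where
    field
      cong : ∀ {f g} → f ≋ g → F f ≋ F g
      add : ∀ f g → F (f ⊞ g) ≋ F f ⊞ F g
      scale : ∀ c f → F (c · f) ≋ c · F f

    zero-map : F 𝟘 ≋ 𝟘
    zero-map = ≋-trans (cong (combine :𝟘 (0# :· :𝟘) []ⱽ (λ v → K.sym (zeroˡ _))))
      (≋-trans (scale 0# 𝟘) (combine (0# :· x₀) :𝟘 (F 𝟘 ∷ⱽ []ⱽ) (λ v → zeroˡ _)))

  T-linear : ∀ k → Linear (T k)
  T-linear k = record { cong = λ e → ext (T-cong k _ _ (at e)) ; add = λ f g → ext (T-⊞ k f g) ; scale = λ c f → ext (T-· k c f) }

  X-linear : ∀ k → Linear (X k)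
  X-linear k = record { cong = λ e → ext (X-cong k _ _ (at e)) ; add = λ f g → ext (X-⊞ k f g) ; scale = λ c f → ext (X-· k c f) }

  module T k = Linear (T-linear k)
  module X k = Linear (X-linear k)

  t t⁻¹ : Carrier
  t = tz (+ 1)
  t⁻¹ = tz (Z.- (+ 1))

  t⁻¹*t : t⁻¹ * t ≈ 1#
  t⁻¹*t = K.trans (K.sym (tz-+ (Z.- (+ 1)) (+ 1))) tz-0

  ΣM : ∀ {A : Set} → (A → M) → List A → M
  ΣM φ [] = 𝟘
  ΣM φ (x ∷ xs) = φ x ⊞ ΣM φ xs

  ΣM-cong : ∀ {A : Set} {φ ψ : A → M} xs → (∀ x → φ x ≋ ψ x) → ΣM φ xs ≋ ΣM ψ xs
  ΣM-cong [] e = ≋-refl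
  ΣM-cong (x ∷ xs) e = ⊞-cong (e x) (ΣM-cong xs e)

  ΣM-↭ : ∀ {A : Set} (φ : A → M) {xs ys} → xs ↭ ys → ΣM φ xs ≋ ΣM φ ys
  ΣM-↭ φ ↭.refl = ≋-refl
  ΣM-↭ φ (↭.prep x p) = ⊞-cong ≋-refl (ΣM-↭ φ p)
  ΣM-↭ φ (↭.swap {xs} {ys} x y p) = ≋-trans (⊞-cong ≋-refl (⊞-cong ≋-refl (ΣM-↭ φ p)))
    (combine (x₀ :⊞ (x₁ :⊞ x₂)) (x₁ :⊞ (x₀ :⊞ x₂)) (φ x ∷ⱽ φ y ∷ⱽ ΣM φ ys ∷ⱽ []ⱽ)
      (λ v → solve 3 (λ a b c → a :+ (b :+ c) := b :+ (a :+ c)) K.refl _ _ _))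
  ΣM-↭ φ (↭.trans p q) = ≋-trans (ΣM-↭ φ p) (ΣM-↭ φ q)

  linear-Σ : ∀ {F} → Linear F → ∀ {A : Set} (φ : A → M) xs → F (ΣM φ xs) ≋ ΣM (λ x → F (φ x)) xs
  linear-Σ L φ [] = Linear.zero-map L
  linear-Σ L φ (x ∷ xs) = ≋-trans (Linear.add L _ _) (⊞-cong ≋-refl (linear-Σ L φ xs))

  ΣM-⊞ : ∀ {A : Set} (φ ψ : A → M) xs → ΣM (λ x → φ x ⊞ ψ x) xs ≋ ΣM φ xs ⊞ ΣM ψ xs
  ΣM-⊞ φ ψ [] = combine :𝟘 (:𝟘 :⊞ :𝟘) []ⱽ (λ v → K.sym (+-identityˡ _))
  ΣM-⊞ φ ψ (x ∷ xs) = ≋-trans (⊞-cong ≋-refl (ΣM-⊞ φ ψ xs))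
    (combine ((x₀ :⊞ x₁) :⊞ (x₂ :⊞ x₃)) ((x₀ :⊞ x₂) :⊞ (x₁ :⊞ x₃))
      (φ x ∷ⱽ ψ x ∷ⱽ ΣM φ xs ∷ⱽ ΣM ψ xs ∷ⱽ []ⱽ)
      (λ v → solve 4 (λ a b c d → (a :+ b) :+ (c :+ d) := (a :+ c) :+ (b :+ d)) K.refl _ _ _ _))

  ·-linear : ∀ c → Linear (c ·_)
  ·-linear c = record
    { cong = ·-cong K.refl
    ; add = λ f g → combine (c :· (x₀ :⊞ x₁)) (c :· x₀ :⊞ c :· x₁) (f ∷ⱽ g ∷ⱽ []ⱽ) (λ v → distribˡ _ _ _)
    ; scale = λ d f → combine (c :· d :· x₀) (d :· c :· x₀) (f ∷ⱽ []ⱽ)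
        (λ v → solve 3 (λ c d x → c :* (d :* x) := d :* (c :* x)) K.refl c d _) }

  ΣM-zero : ∀ {A : Set} (xs : List A) → ΣM (λ _ → 𝟘) xs ≋ 𝟘
  ΣM-zero [] = ≋-refl
  ΣM-zero (x ∷ xs) = ≋-trans (⊞-cong ≋-refl (ΣM-zero xs)) (combine (:𝟘 :⊞ :𝟘) :𝟘 []ⱽ (λ v → +-identityˡ _))

  ΣM-swap : ∀ {A B : Set} (φ : A → B → M) xs ys → ΣM (λ x → ΣM (φ x) ys) xs ≋ ΣM (λ y → ΣM (λ x → φ x y) xs) ys
  ΣM-swap φ [] ys = ≋-sym (ΣM-zero ys)
  ΣM-swap φ (x ∷ xs) ys = ≋-trans (⊞-cong ≋-refl (ΣM-swap φ xs ys))
    (≋-sym (ΣM-⊞ (φ x) (λ y → ΣM (λ x → φ x y) xs) ys))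

  -- Several sums are compared after pairing each term with its image under an involution. This
  -- counts everything twice, but spares the separation of fixed points from orbits of length two.
  halve : ∀ {f g} → f ⊞ f ≋ g ⊞ g → f ≋ g
  halve {f} {g} e = ext λ α → begin
    coef f α ≈⟨ K.sym (*-identityˡ _) ⟩
    1# * coef f α ≈⟨ *-cong (K.sym half+half) K.refl ⟩
    (half + half) * coef f α ≈⟨ solve 2 (λ h x → (h :+ h) :* x := h :* (x :+ x)) K.refl half _ ⟩
    half * (coef f α + coef f α) ≈⟨ *-cong K.refl (K.trans (K.sym (coef-⊞ f f α)) (K.trans (at e α) (coef-⊞ g g α))) ⟩
    half * (coef g α + coef g α) ≈⟨ solve 2 (λ h x → h :* (x :+ x) := (h :+ h) :* x) K.refl half _ ⟩
    (half + half) * coef g α ≈⟨ *-cong half+half K.refl ⟩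
    1# * coef g α ≈⟨ *-identityˡ _ ⟩
    coef g α ∎
    where open K-Reasoning

  -- T² = (t − 1) T + t turns T f = t g into a formula for T g.
  T-reverse : ∀ k → suc k N.< n → ∀ {f g} → T k f ≋ t · g → T k g ≋ (t - 1#) · g ⊞ f
  T-reverse k k<n {f} {g} e = ext λ α → begin
    coef (T k g) α ≈⟨ K.sym (*-identityˡ _) ⟩
    1# * coef (T k g) α ≈⟨ *-cong (K.sym t⁻¹*t) K.refl ⟩
    (t⁻¹ * t) * coef (T k g) α ≈⟨ *-assoc _ _ _ ⟩
    t⁻¹ * (t * coef (T k g) α) ≈⟨ *-cong K.refl (lhs α) ⟩
    t⁻¹ * ((t - 1#) * (t * coef g α) + t * coef f α)
      ≈⟨ solve 4 (λ u t x y → u :* ((t :- :1) :* (t :* x) :+ t :* y) := (u :* t) :* ((t :- :1) :* x :+ y)) K.refl t⁻¹ t _ _ ⟩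
    (t⁻¹ * t) * ((t - 1#) * coef g α + coef f α) ≈⟨ *-cong t⁻¹*t K.refl ⟩
    1# * ((t - 1#) * coef g α + coef f α) ≈⟨ *-identityˡ _ ⟩
    (t - 1#) * coef g α + coef f α
      ≈⟨ K.sym (coef-combination ((t - 1#) :· x₀ :⊞ x₁) (g ∷ⱽ f ∷ⱽ []ⱽ) α) ⟩
    coef ((t - 1#) · g ⊞ f) α ∎
    where
    open K-Reasoning
    step : t · T k g ≋ (t - 1#) · (t · g) ⊞ t · f
    step = ≋-trans (≋-sym (T.scale k t g)) (≋-trans (T.cong k (≋-sym e)) (≋-trans (ext (T-quadratic k k<n f))
      (⊞-cong (·-cong K.refl e) ≋-refl)))
    lhs : ∀ α → t * coef (T k g) α ≈ (t - 1#) * (t * coef g α) + t * coef f α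
    lhs α = K.trans (K.sym (coef-· t (T k g) α)) (K.trans (at step α)
      (coef-combination ((t - 1#) :· t :· x₀ :⊞ t :· x₁) (g ∷ⱽ f ∷ⱽ []ⱽ) α))

-- The exchange relation

extract : ∀ {A : Set} {x : A} {xs} → x ∈ xs → ∃ λ ys → xs ↭ x ∷ ys
extract {x = x} p with ∈-∃++ p
... | ys , zs , ≡.refl = ys ++ zs , shift x ys zs

unique-↭ : ∀ {A : Set} {xs ys : List A} → xs ↭ ys → Unique xs → Unique ys
unique-↭ ↭.refl U = U
unique-↭ (↭.prep x p) (a ∷ U) = All-resp-↭ p a ∷ unique-↭ p U
unique-↭ (↭.swap x y p) ((x≢y ∷ a) ∷ b ∷ U) = ((λ e → x≢y (≡.sym e)) ∷ All-resp-↭ p b) ∷ All-resp-↭ p a ∷ unique-↭ p U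
unique-↭ (↭.trans p q) U = unique-↭ q (unique-↭ p U)

adjacent-labels : ∀ k n → suc k N.< n → ∃ λ rest → (upTo n ↭ k ∷ suc k ∷ rest) × All (λ u → (¬ u ≡ k) × (¬ u ≡ suc k)) rest
adjacent-labels k n k<n with extract {xs = upTo n} (∈-upTo⁺ (NP.<-trans (NP.n<1+n k) k<n))
... | ys , p with ∈-resp-↭ p (∈-upTo⁺ k<n)
...   | here e = ⊥-elim (NP.1+n≢n e)
...   | there sk∈ys with extract sk∈ys
...     | zs , q with unique-↭ (↭-trans p (↭-prep k q)) (UniqueP.upTo⁺ n)
...       | (_ ∷ a) ∷ b ∷ _ = zs , ↭-trans p (↭-prep k q) , All.zipWith (λ (c , d) → (λ e → c (≡.sym e)) , (λ e → d (≡.sym e))) (a , b)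

≡ᵇ-comm : ∀ a b → (a ≡ᵇ b) ≡ (b ≡ᵇ a)
≡ᵇ-comm zero zero = ≡.refl
≡ᵇ-comm zero (suc b) = ≡.refl
≡ᵇ-comm (suc a) zero = ≡.refl
≡ᵇ-comm (suc a) (suc b) = ≡ᵇ-comm a b

bool-cases : ∀ b → (b ≡ true) ⊎ (b ≡ false)
bool-cases true = inj₁ ≡.refl
bool-cases false = inj₂ ≡.refl

true≢false : ∀ {b} → b ≡ true → b ≡ false → ⊥
true≢false ≡.refl ()

module Exchange (S : Setting) where
  open Setting S hiding (refl; sym; trans; zero)
  private module K = Setting S
  open IntegerSolver scalars
  open Core S

  -- What a descent adds to the weight of a box: q^(leg+1) from `maj` and t^arm from the descent
  -- term of `coinvF`.
  κ : ℕ → ℕ → Carrier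
  κ h a = qz (+ suc h) * tz (+ a)

  ratio : ℕ → ℕ → ℕ → ℕ → Carrier
  ratio h a u l = if u ≡ᵇ l then 1# else if u <ᵇ l then ζ h a else ζ h a * κ h a

  -- For the box placed on the head column, `L` lists by label and remaining height exactly the
  -- boxes which it attacks and which follow it in reading order. So `arms` is its arm, and `below`
  -- the number of inversions in which it comes first.
  weight : ℕ → ℕ → State → ℕ → Carrier
  weight l h L u = tz (+ arms h L Z.- + below u L) * ratio h (arms h L) u l

  -- Fillings are read row by row from the bottom, left to right.  The head of
  -- the state is the next column to grow; once grown it moves to the end.  The
  -- first argument bounds the number of remaining steps.
  G : ℕ → State → M
  grow : ℕ → ℕ → ℕ → State → ℕ → M
  G zero L = 𝟙
  G (suc N) [] = 𝟙
  G (suc N) ((l , zero) ∷ L) = G N L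
  G (suc N) ((l , suc h) ∷ L) = ΣM (grow N l h L) (upTo n)
  grow N l h L u = if mem u L then 𝟘 else weight l h L u · X u (G N (L ++ (u , h) ∷ []))

  grow-blocked : ∀ N l h L u → mem u L ≡ true → grow N l h L u ≡ 𝟘
  grow-blocked N l h L u e rewrite e = ≡.refl

  grow-free : ∀ N l h L u → mem u L ≡ false → grow N l h L u ≡ weight l h L u · X u (G N (L ++ (u , h) ∷ []))
  grow-free N l h L u e rewrite e = ≡.refl

  ratio-equal : ∀ h a u → ratio h a u u ≡ 1#
  ratio-equal h a u rewrite ≡ᵇ-refl u = ≡.refl

  ratio-less : ∀ h a {u l} → u N.< l → ratio h a u l ≡ ζ h a
  ratio-less h a p rewrite ≡ᵇ-false (NP.<⇒≢ p) | <ᵇ-true p = ≡.refl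

  ratio-greater : ∀ h a {u l} → l N.< u → ratio h a u l ≡ ζ h a * κ h a
  ratio-greater h a {u} {l} p rewrite ≡ᵇ-false {u} {l} (λ e → NP.<⇒≢ p (≡.sym e)) | <ᵇ-false (NP.<⇒≤ p) = ≡.refl

  ΣM-congᴬ : ∀ {A : Set} {P : A → Set} {φ ψ : A → M} {xs} → All P xs → (∀ x → P x → φ x ≋ ψ x) → ΣM φ xs ≋ ΣM ψ xs
  ΣM-congᴬ [] e = ≋-refl
  ΣM-congᴬ (p ∷ ps) e = ⊞-cong (e _ p) (ΣM-congᴬ ps e)

  -- T_k commutes with x_u for u other than k and k + 1, so these summands can be treated one by
  -- one. The summands for k and k + 1 are mixed by T_k and have to be taken together.
  ΣM-pair : ∀ k → suc k N.< n → (φ ψ : ℕ → M) →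
    (∀ u → ¬ u ≡ k → ¬ u ≡ suc k → T k (φ u) ≋ t · ψ u) →
    T k (φ k ⊞ φ (suc k)) ≋ t · (ψ k ⊞ ψ (suc k)) →
    T k (ΣM φ (upTo n)) ≋ t · ΣM ψ (upTo n)
  ΣM-pair k k<n φ ψ others pair with adjacent-labels k n k<n
  ... | rest , p , distinct = begin
    T k (ΣM φ (upTo n)) ≈⟨ T.cong k (ΣM-↭ φ p) ⟩
    T k (φ k ⊞ (φ (suc k) ⊞ ΣM φ rest)) ≈⟨ T.cong k (⊞-assoc _ _ _) ⟩
    T k ((φ k ⊞ φ (suc k)) ⊞ ΣM φ rest) ≈⟨ T.add k _ _ ⟩
    T k (φ k ⊞ φ (suc k)) ⊞ T k (ΣM φ rest) ≈⟨ ⊞-cong pair (linear-Σ (T-linear k) φ rest) ⟩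
    t · (ψ k ⊞ ψ (suc k)) ⊞ ΣM (λ u → T k (φ u)) rest
      ≈⟨ ⊞-cong ≋-refl (ΣM-congᴬ distinct (λ u (p , q) → others u p q)) ⟩
    t · (ψ k ⊞ ψ (suc k)) ⊞ ΣM (λ u → t · ψ u) rest
      ≈⟨ ⊞-cong ≋-refl (≋-sym (linear-Σ (·-linear t) ψ rest)) ⟩
    t · (ψ k ⊞ ψ (suc k)) ⊞ t · ΣM ψ rest ≈⟨ ≋-sym (Linear.add (·-linear t) _ _) ⟩
    t · ((ψ k ⊞ ψ (suc k)) ⊞ ΣM ψ rest) ≈⟨ ·-cong K.refl (≋-sym (⊞-assoc _ _ _)) ⟩
    t · (ψ k ⊞ (ψ (suc k) ⊞ ΣM ψ rest)) ≈⟨ ·-cong K.refl (≋-sym (ΣM-↭ ψ p)) ⟩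
    t · ΣM ψ (upTo n) ∎
    where
    open ≋-Reasoning
    ⊞-assoc : ∀ a b c → a ⊞ (b ⊞ c) ≋ (a ⊞ b) ⊞ c
    ⊞-assoc a b c = combine (x₀ :⊞ (x₁ :⊞ x₂)) ((x₀ :⊞ x₁) :⊞ x₂) (a ∷ⱽ b ∷ⱽ c ∷ⱽ []ⱽ) (λ v → K.sym (+-assoc _ _ _))

  -- In T x_k f = x_(k+1) (T f + (1 - t) f) the correction cancels the term (t - 1) f that
  -- `T-reverse` produces.
  T-X-exchange : ∀ k → suc k N.< n → ∀ {f g} → T k g ≋ t · f → T k (X k f) ≋ X (suc k) g
  T-X-exchange k k<n {f} {g} e = ≋-trans (ext (T-X k k<n f)) (X.cong (suc k)
    (≋-trans (⊞-cong (T-reverse k k<n e) ≋-refl)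
      (combine (((t - 1#) :· x₀ :⊞ x₁) :⊞ (1# - t) :· x₀) x₁ (f ∷ⱽ g ∷ⱽ []ⱽ)
        (λ v → solve 3 (λ t f g → ((t :- :1) :* f :+ g) :+ (:1 :- t) :* f := g) K.refl t _ _))))

  κ-suc : ∀ h a → qz (+ suc h) * tz (+ suc a) ≈ t * κ h a
  κ-suc h a = K.trans (*-cong K.refl (tz-+ (+ 1) (+ a)))
    (solve 3 (λ q t a → q :* (t :* a) := t :* (q :* a)) K.refl (qz (+ suc h)) t (tz (+ a)))

  ζ-equation : ∀ h a → ζ h a * (1# - qz (+ suc h) * tz (+ suc a)) ≈ 1# - t
  ζ-equation h a = K.trans (*-cong (ζ-numerator h a) K.refl)
    (K.trans (*-assoc _ _ _) (K.trans (*-cong K.refl (ρ-inverse h a)) (*-identityʳ _)))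

  -- Clearing the denominator 1 - t κ of ζ. It expresses the ratio ζ for u < l through the ratio ζ κ
  -- for u > l, as (1 - t) + t ζ κ.
  ζ-relation : ∀ h a → ζ h a + (t - 1#) ≈ t * (ζ h a * κ h a)
  ζ-relation h a = begin
    ζ h a + (t - 1#)
      ≈⟨ solve 2 (λ z t → z :+ (t :- :1) := z :- (:1 :- t)) K.refl (ζ h a) t ⟩
    ζ h a - (1# - t) ≈⟨ +-cong K.refl (-‿cong (K.sym (ζ-equation h a))) ⟩
    ζ h a - ζ h a * (1# - qz (+ suc h) * tz (+ suc a))
      ≈⟨ +-cong K.refl (-‿cong (*-cong K.refl (+-cong K.refl (-‿cong (κ-suc h a))))) ⟩
    ζ h a - ζ h a * (1# - t * κ h a)
      ≈⟨ solve 3 (λ z t k → z :- z :* (:1 :- t :* k) := t :* (z :* k)) K.refl (ζ h a) t (κ h a) ⟩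
    t * (ζ h a * κ h a) ∎
    where open K-Reasoning

  weight-relabel-other : ∀ k l h L {u} → ¬ u ≡ k → ¬ u ≡ suc k →
    weight (transpose k l) h (relabel (transpose k) L) u ≡ weight l h L u
  weight-relabel-other k l h L {u} p q
    rewrite arms-relabel (transpose k) h L | below-relabel-other k L p q
          | transpose-<ᵇ-right k l p q | ≡ᵇ-comm u (transpose k l) | transpose-≡ᵇ-other k l p q | ≡ᵇ-comm u l = ≡.refl

  ratio-suc : ∀ h a k l → ¬ l ≡ k → ¬ l ≡ suc k → ratio h a k l ≡ ratio h a (suc k) l
  ratio-suc h a k l p q rewrite ≡ᵇ-false {k} {l} (λ e → p (≡.sym e)) | ≡ᵇ-false {suc k} {l} (λ e → q (≡.sym e)) | suc-<ᵇ k l q = ≡.refl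

  ordered-tail : ∀ {k l h L} → Ordered k ((l , h) ∷ L) → Ordered k L
  ordered-tail {k} {l} (absent p) = absent (proj₂ (∨-false {l ≡ᵇ k} p))
  ordered-tail (before [] h B ≡.refl p q r s) = absent r
  ordered-tail {k} {l} (before (_ ∷ A) h B ≡.refl p q r s) = before A h B ≡.refl (proj₂ (∨-false {l ≡ᵇ k} p)) (proj₂ (∨-false {l ≡ᵇ suc k} q)) r s

  ordered-snoc-other : ∀ {k L} u h → ¬ u ≡ k → ¬ u ≡ suc k → Ordered k L → Ordered k (L ++ (u , h) ∷ [])
  ordered-snoc-other {k} {L} u h p q (absent r) = absent (mem-snoc-false L u h r p)
  ordered-snoc-other {k} u h p q (before A g B ≡.refl a b c d) rewrite LP.++-assoc A ((k , g) ∷ B) ((u , h) ∷ []) =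
    before A g (B ++ (u , h) ∷ []) ≡.refl a b (mem-snoc-false B u h c p)
      (≡.trans (mem-++ (suc k) B _) (≡.cong (_∨ mem (suc k) ((u , h) ∷ [])) d))

  T-𝟙-step : ∀ k → suc k N.< n → T k 𝟙 ≋ t · 𝟙
  T-𝟙-step k k<n = ext (T-𝟙 k k<n)

  T-𝟘-step : ∀ k → T k (𝟘 ⊞ 𝟘) ≋ t · (𝟘 ⊞ 𝟘)
  T-𝟘-step k = ≋-trans (T.cong k 𝟘⊞𝟘) (≋-trans (T.zero-map k)
    (combine :𝟘 (t :· (:𝟘 :⊞ :𝟘)) []ⱽ (λ v → solve 1 (λ t → :0 := t :* (:0 :+ :0)) K.refl t)))
    where
    𝟘⊞𝟘 : 𝟘 ⊞ 𝟘 ≋ 𝟘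
    𝟘⊞𝟘 = combine (:𝟘 :⊞ :𝟘) :𝟘 []ⱽ (λ v → +-identityˡ _)

  -- Induction on the growth, by what is left of k and k + 1 for the new box. If both are taken,
  -- their summands vanish on either side. If only k + 1 is taken, the choice of k on the left
  -- corresponds to the choice of k + 1 on the right. If both are available, T_k is known on the two
  -- choices from the induction hypothesis and coefficients are compared; this is immediate unless l
  -- = k + 1, which needs `ζ-relation`.
  T-G : ∀ k → suc k N.< n → ∀ N L → Uniq L → Ordered k L → T k (G N L) ≋ t · G N (relabel (transpose k) L)
  T-G k k<n zero L U o = T-𝟙-step k k<n
  T-G k k<n (suc N) [] U o = T-𝟙-step k k<n
  T-G k k<n (suc N) ((l , zero) ∷ L) (_ ∷ U) o = T-G k k<n N L U (ordered-tail o)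
  T-G k k<n (suc N) ((l , suc h) ∷ L) (l∉L ∷ U) o =
    ΣM-pair k k<n φ ψ others (pair o)
    where
    s : ℕ → ℕ
    s = transpose k
    sL : State
    sL = relabel s L
    φ ψ : ℕ → M
    φ = grow N l h L
    ψ = grow N (s l) h sL
    T-step : ∀ u → mem u L ≡ false → ¬ u ≡ k → ¬ u ≡ suc k →
      T k (G N (L ++ (u , h) ∷ [])) ≋ t · G N (sL ++ (u , h) ∷ [])
    T-step u u∉ p q = ≋-trans (T-G k k<n N (L ++ (u , h) ∷ []) (uniq-snoc u h U u∉) (ordered-snoc-other u h p q (ordered-tail o)))
      (≋-reflexive (≡.cong (λ z → t · G N z) (≡.trans (relabel-++ s L _) (≡.cong (λ v → sL ++ (v , h) ∷ []) (transpose-other k p q)))))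
    others : ∀ u → ¬ u ≡ k → ¬ u ≡ suc k → T k (φ u) ≋ t · ψ u
    others u p q with bool-cases (mem u L)
    ... | inj₁ e rewrite grow-blocked N l h L u e | grow-blocked N (s l) h sL u (≡.trans (mem-relabel-other k L p q) e) =
      ≋-trans (T.zero-map k) (≋-sym (Linear.zero-map (·-linear t)))
    ... | inj₂ e rewrite grow-free N l h L u e | grow-free N (s l) h sL u (≡.trans (mem-relabel-other k L p q) e)
                      | weight-relabel-other k l h L p q =
      begin
        T k (w · X u (G N (L ++ (u , h) ∷ []))) ≈⟨ T.scale k _ _ ⟩
        w · T k (X u (G N (L ++ (u , h) ∷ []))) ≈⟨ ·-cong K.refl (ext (T-X-other k u k<n p q _)) ⟩
        w · X u (T k (G N (L ++ (u , h) ∷ []))) ≈⟨ ·-cong K.refl (X.cong u (T-step u e p q)) ⟩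
        w · X u (t · G N (sL ++ (u , h) ∷ [])) ≈⟨ ·-cong K.refl (X.scale u _ _) ⟩
        w · (t · X u (G N (sL ++ (u , h) ∷ []))) ≈⟨ Linear.scale (·-linear w) t _ ⟩
        t · (w · X u (G N (sL ++ (u , h) ∷ []))) ∎
      where
      open ≋-Reasoning
      w = weight l h L u
    -- neither k nor k+1 in L: f and g are the states in which k, resp. k+1, is chosen
    both-free : mem k L ≡ false → mem (suc k) L ≡ false →
      T k (G N (L ++ (suc k , h) ∷ [])) ≋ t · G N (L ++ (k , h) ∷ [])
    both-free p q = ≋-trans (T-G k k<n N (L ++ (suc k , h) ∷ []) (uniq-snoc (suc k) h U q) (absent (mem-snoc-false L (suc k) h p NP.1+n≢n)))
      (≋-reflexive (≡.cong (λ z → t · G N z) (≡.trans (relabel-++ s L _)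
        (≡.cong₂ (λ A v → A ++ (v , h) ∷ []) (relabel-absent k L p q) (transpose-upper k)))))
    -- With Y and Z the polynomials for the choices k and k + 1, the induction hypothesis yields T Y
    -- = Z and hence T Z = (t - 1) Z + t Y. The two equations assumed are the comparison of the
    -- coefficients of Y and of Z.
    free-pair : mem k L ≡ false → mem (suc k) L ≡ false →
      weight l h L (suc k) ≈ weight (s l) h sL k →
      weight l h L k + weight l h L (suc k) * (t - 1#) ≈ t * weight (s l) h sL (suc k) →
      T k (φ k ⊞ φ (suc k)) ≋ t · (ψ k ⊞ ψ (suc k))
    free-pair p q e e'
      rewrite grow-free N l h L k p | grow-free N l h L (suc k) q
            | grow-free N (s l) h sL k (≡.trans (mem-relabel-lower k L) q)
            | grow-free N (s l) h sL (suc k) (≡.trans (mem-relabel-upper k L) p)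
            | relabel-absent k L p q =
      begin
        T k (A · Y ⊞ B · Z) ≈⟨ ≋-trans (T.add k _ _) (⊞-cong (T.scale k _ _) (T.scale k _ _)) ⟩
        A · T k Y ⊞ B · T k Z ≈⟨ ⊞-cong (·-cong K.refl TY) (·-cong K.refl TZ) ⟩
        A · Z ⊞ B · ((t - 1#) · Z ⊞ t · Y)
          ≈⟨ combine (A :· x₁ :⊞ B :· ((t - 1#) :· x₁ :⊞ t :· x₀)) (t :· (B :· x₀) :⊞ (A + B * (t - 1#)) :· x₁) (Y ∷ⱽ Z ∷ⱽ []ⱽ)
               (λ v → solve 5 (λ A B t y z → A :* z :+ B :* ((t :- :1) :* z :+ t :* y) := t :* (B :* y) :+ (A :+ B :* (t :- :1)) :* z) K.refl A B t _ _) ⟩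
        t · (B · Y) ⊞ (A + B * (t - 1#)) · Z
          ≈⟨ ⊞-cong (·-cong K.refl (·-cong e ≋-refl)) (·-cong e' ≋-refl) ⟩
        t · (A' · Y) ⊞ (t * B') · Z
          ≈⟨ combine (t :· (A' :· x₀) :⊞ (t * B') :· x₁) (t :· (A' :· x₀ :⊞ B' :· x₁)) (Y ∷ⱽ Z ∷ⱽ []ⱽ)
               (λ v → solve 5 (λ A B t y z → t :* (A :* y) :+ (t :* B) :* z := t :* (A :* y :+ B :* z)) K.refl A' B' t _ _) ⟩
        t · (A' · Y ⊞ B' · Z) ∎
      where
      open ≋-Reasoning
      A B A' B' : Carrier
      A = weight l h L k
      B = weight l h L (suc k)
      A' = weight (s l) h L k
      B' = weight (s l) h L (suc k)
      Y Z : M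
      Y = X k (G N (L ++ (k , h) ∷ []))
      Z = X (suc k) (G N (L ++ (suc k , h) ∷ []))
      TY : T k Y ≋ Z
      TY = T-X-exchange k k<n (both-free p q)
      TZ : T k Z ≋ (t - 1#) · Z ⊞ t · Y
      TZ = ≋-trans (T.cong k (≋-sym TY)) (≋-trans (ext (T-quadratic k k<n Y)) (⊞-cong (·-cong K.refl TY) ≋-refl))
    mixed-pair : mem k L ≡ false → mem (suc k) L ≡ true → ratio h (arms h L) k l ≡ ratio h (arms h L) (suc k) (s l) →
      T k (φ k ⊞ φ (suc k)) ≋ t · (ψ k ⊞ ψ (suc k))
    mixed-pair p q r
      rewrite grow-free N l h L k p | grow-blocked N l h L (suc k) q
            | grow-blocked N (s l) h sL k (≡.trans (mem-relabel-lower k L) q)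
            | grow-free N (s l) h sL (suc k) (≡.trans (mem-relabel-upper k L) p) =
      begin
        T k (A · Y ⊞ 𝟘) ≈⟨ T.cong k (combine (A :· x₀ :⊞ :𝟘) (A :· x₀) (Y ∷ⱽ []ⱽ) (λ v → +-identityʳ _)) ⟩
        T k (A · Y) ≈⟨ T.scale k _ _ ⟩
        A · T k Y ≈⟨ ·-cong A≈ (T-X-exchange k k<n step) ⟩
        (t * B') · Z ≈⟨ combine ((t * B') :· x₀) (t :· (:𝟘 :⊞ B' :· x₀)) (Z ∷ⱽ []ⱽ)
                          (λ v → solve 3 (λ t b z → (t :* b) :* z := t :* (:0 :+ b :* z)) K.refl t B' _) ⟩
        t · (𝟘 ⊞ B' · Z) ∎
      where
      open ≋-Reasoning
      A B' : Carrier
      A = weight l h L k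
      B' = weight (s l) h sL (suc k)
      Y Z : M
      Y = X k (G N (L ++ (k , h) ∷ []))
      Z = X (suc k) (G N (sL ++ (suc k , h) ∷ []))
      -- When k is appended to `L`, it stands after k + 1, and the induction hypothesis does not
      -- apply. It is applied to the relabelled state, where k stands before k + 1, and
      -- `T-X-exchange` reads the result backwards.
      step : T k (G N (sL ++ (suc k , h) ∷ [])) ≋ t · G N (L ++ (k , h) ∷ [])
      step = ≋-trans (T-G k k<n N (sL ++ (suc k , h) ∷ [])
          (uniq-snoc (suc k) h (uniq-relabel k U) (≡.trans (mem-relabel-upper k L) p))
          (ordered-snoc k h (uniq-relabel k U) (≡.trans (mem-relabel-lower k L) q) (≡.trans (mem-relabel-upper k L) p)))
        (≋-reflexive (≡.cong (λ z → t · G N z) (≡.trans (relabel-++ s sL _)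
          (≡.cong₂ (λ A v → A ++ (v , h) ∷ []) (relabel-involutive k L) (transpose-upper k)))))
      -- In the relabelled state the label k lies below the new k + 1, whereas in `L` the label k +
      -- 1 does not lie below the new k. This one inversion is the factor t.
      A≈ : A ≈ t * B'
      A≈ rewrite arms-relabel s h L | below-relabel-upper k U p q | r =
        K.trans (*-cong (K.trans (K.reflexive (≡.cong tz (shuffle (+ arms h L) (+ below k L)))) (tz-+ (+ 1) _)) K.refl) (*-assoc _ _ _)
        where
        shuffle : ∀ a b → a Z.- b ≡ + 1 Z.+ (a Z.- (+ 1 Z.+ b))
        shuffle = solve-∀ℤ
    generic-pair : mem k L ≡ false → mem (suc k) L ≡ false → ¬ l ≡ k → ¬ l ≡ suc k → T k (φ k ⊞ φ (suc k)) ≋ t · (ψ k ⊞ ψ (suc k))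
    generic-pair k∉L e l≢k l≢sk = free-pair k∉L e e₁ e₂
      where
      e₁ : weight l h L (suc k) ≈ weight (s l) h sL k
      e₁ rewrite transpose-other k l≢k l≢sk | relabel-absent k L k∉L e | below-suc k L k∉L
               | ratio-suc h (arms h L) k l l≢k l≢sk = K.refl
      e₂ : weight l h L k + weight l h L (suc k) * (t - 1#) ≈ t * weight (s l) h sL (suc k)
      e₂ rewrite transpose-other k l≢k l≢sk | relabel-absent k L k∉L e | below-suc k L k∉L
               | ratio-suc h (arms h L) k l l≢k l≢sk =
        solve 2 (λ w t → w :+ w :* (t :- :1) := t :* w) K.refl _ t
    pair : Ordered k ((l , suc h) ∷ L) → T k (φ k ⊞ φ (suc k)) ≋ t · (ψ k ⊞ ψ (suc k))
    pair (before (_ ∷ A) g B ≡.refl p q r q') = blocked (≡.trans (mem-++ k A _) (∨-true-right (mem k A) (≡.cong (_∨ mem k B) (≡ᵇ-refl k))))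
        (≡.trans (mem-++ (suc k) A _) (∨-true-right (mem (suc k) A) (∨-true-right (k ≡ᵇ suc k) q')))
      where
      blocked : mem k L ≡ true → mem (suc k) L ≡ true → T k (φ k ⊞ φ (suc k)) ≋ t · (ψ k ⊞ ψ (suc k))
      blocked a b rewrite grow-blocked N l h L k a | grow-blocked N l h L (suc k) b
            | grow-blocked N (s l) h sL k (≡.trans (mem-relabel-lower k L) b)
            | grow-blocked N (s l) h sL (suc k) (≡.trans (mem-relabel-upper k L) a) = T-𝟘-step k
    pair (before [] g B ≡.refl p q r q') = mixed-pair r q' (≡.trans (ratio-equal h (arms h L) k)
      (≡.sym (≡.trans (≡.cong (ratio h (arms h L) (suc k)) (transpose-lower k)) (ratio-equal h (arms h L) (suc k)))))
    pair (absent p) with ∨-false {l ≡ᵇ k} p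
    ... | l≢k , k∉L with bool-cases (mem (suc k) L) | NP.<-cmp l (suc k)
    ...   | inj₁ e | tri≈ _ ≡.refl _ = ⊥-elim (true≢false e l∉L)
    ...   | inj₁ e | tri< _ l≢sk _ = mixed-pair k∉L e (≡.trans (ratio-suc h (arms h L) k l (≡ᵇ-distinct l≢k) l≢sk)
              (≡.cong (ratio h (arms h L) (suc k)) (≡.sym (transpose-other k (≡ᵇ-distinct l≢k) l≢sk))))
    ...   | inj₁ e | tri> _ l≢sk _ = mixed-pair k∉L e (≡.trans (ratio-suc h (arms h L) k l (≡ᵇ-distinct l≢k) l≢sk)
              (≡.cong (ratio h (arms h L) (suc k)) (≡.sym (transpose-other k (≡ᵇ-distinct l≢k) l≢sk))))
    ...   | inj₂ e | tri≈ _ ≡.refl _ = free-pair k∉L e e₁ e₂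
      where
      e₁ : weight (suc k) h L (suc k) ≈ weight (s (suc k)) h sL k
      e₁ rewrite transpose-upper k | relabel-absent k L k∉L e | ratio-equal h (arms h L) (suc k)
               | below-suc k L k∉L = K.refl
      e₂ : weight (suc k) h L k + weight (suc k) h L (suc k) * (t - 1#) ≈ t * weight (s (suc k)) h sL (suc k)
      e₂ rewrite transpose-upper k | relabel-absent k L k∉L e | ratio-equal h (arms h L) (suc k) | ratio-less h (arms h L) (NP.n<1+n k)
               | ratio-greater h (arms h L) (NP.n<1+n k) | below-suc k L k∉L =
        K.trans (solve 3 (λ τ z t → τ :* z :+ (τ :* :1) :* (t :- :1) := τ :* (z :+ (t :- :1))) K.refl τ (ζ h (arms h L)) t)
        (K.trans (*-cong K.refl (ζ-relation h (arms h L)))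
        (solve 3 (λ τ z t → τ :* (t :* z) := t :* (τ :* z)) K.refl τ (ζ h (arms h L) * κ h (arms h L)) t))
        where
        τ : Carrier
        τ = tz (+ arms h L Z.- + below k L)
    ...   | inj₂ e | tri< _ l≢sk _ = generic-pair k∉L e (≡ᵇ-distinct l≢k) l≢sk
    ...   | inj₂ e | tri> _ l≢sk _ = generic-pair k∉L e (≡ᵇ-distinct l≢k) l≢sk

-- Exchanging adjacent columns of equal height

data Sign : Set where
  negative null positive : Sign

data Comparison (m n : ℕ) : Sign → Set where
  less : m N.< n → Comparison m n negative
  equal : m ≡ n → Comparison m n null
  greater : n N.< m → Comparison m n positive

compare : ∀ m n → ∃ (Comparison m n)
compare m n with NP.<-cmp m n
... | tri< p _ _ = negative , less p
... | tri≈ _ p _ = null , equal p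
... | tri> _ _ p = positive , greater p

countB-↭ : ∀ {A : Set} (p : A → Bool) {xs ys} → xs ↭ ys → countB p xs ≡ countB p ys
countB-↭ p ↭.refl = ≡.refl
countB-↭ p (↭.prep x q) rewrite countB-↭ p q = ≡.refl
countB-↭ p (↭.swap x y q) rewrite countB-↭ p q with p x | p y
... | true | true = ≡.refl
... | true | false = ≡.refl
... | false | true = ≡.refl
... | false | false = ≡.refl
countB-↭ p (↭.trans q r) = ≡.trans (countB-↭ p q) (countB-↭ p r)

mem-↭ : ∀ u {L L'} → L ↭ L' → mem u L ≡ mem u L'
mem-↭ u ↭.refl = ≡.refl
mem-↭ u (↭.prep (l , h) q) = ≡.cong ((l ≡ᵇ u) ∨_) (mem-↭ u q)
mem-↭ u (↭.swap (l , h) (l' , h') q) rewrite mem-↭ u q with l ≡ᵇ u | l' ≡ᵇ u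
... | true | true = ≡.refl
... | true | false = ≡.refl
... | false | true = ≡.refl
... | false | false = ≡.refl
mem-↭ u (↭.trans q r) = ≡.trans (mem-↭ u q) (mem-↭ u r)

meas-snoc : ∀ L u h → meas (L ++ (u , h) ∷ []) ≡ suc h N.+ meas L
meas-snoc [] u h = ≡.refl
meas-snoc ((l , g) ∷ L) u h = ≡.trans (≡.cong (suc g N.+_) (meas-snoc L u h)) (shuffle (suc g) (suc h) (meas L))
  where
  shuffle : ∀ a b c → a N.+ (b N.+ c) ≡ b N.+ (a N.+ c)
  shuffle = solve-∀ℕ

meas-step : ∀ {N} l h L u → meas ((l , suc h) ∷ L) N.≤ suc N → meas (L ++ (u , h) ∷ []) N.≤ N
meas-step l h L u p = ≡.subst (N._≤ _) (≡.sym (meas-snoc L u h)) (NP.≤-pred p)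

arms-same : ∀ h u → arms h ((u , h) ∷ []) ≡ 1
arms-same h u rewrite ≤ᵇ-true (NP.≤-refl {h}) = ≡.refl

arms-taller : ∀ h l L → arms h ((l , suc h) ∷ L) ≡ arms h L
arms-taller h l L rewrite ≤ᵇ-false (NP.n<1+n h) = ≡.refl

module Columns (S : Setting) where
  open Setting S hiding (refl; sym; trans; zero)
  private module K = Setting S
  open IntegerSolver scalars
  open Core S
  open Exchange S

  grow-cong : ∀ N l h {L L'} u → mem u L ≡ mem u L' → arms h L ≡ arms h L' → below u L ≡ below u L' →
    (mem u L ≡ false → G N (L ++ (u , h) ∷ []) ≋ G N (L' ++ (u , h) ∷ [])) → grow N l h L u ≋ grow N l h L' u
  grow-cong N l h {L} {L'} u p q r e with bool-cases (mem u L)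
  ... | inj₁ m = ≋-trans (≋-reflexive (grow-blocked N l h L u m)) (≋-sym (≋-reflexive (grow-blocked N l h L' u (≡.trans (≡.sym p) m))))
  ... | inj₂ m = ≋-trans (≋-reflexive (grow-free N l h L u m))
    (≋-trans (·-cong (K.reflexive (≡.cong₂ (λ a b → tz (+ a Z.- + b) * ratio h a u l) q r)) (X.cong u (e m)))
    (≋-sym (≋-reflexive (grow-free N l h L' u (≡.trans (≡.sym p) m)))))

  -- R is symmetric, so only W u v + W v u matters. Adding the double sum to its transpose exhibits
  -- this combination.
  ΣM-symmetrize : ∀ {A : Set} (W W' : A → A → Carrier) (R : A → A → M) →
    (∀ u v → W u v + W v u ≈ W' u v + W' v u) → (∀ u v → R u v ≋ R v u) → ∀ xs →
    ΣM (λ u → ΣM (λ v → W u v · R u v) xs) xs ≋ ΣM (λ u → ΣM (λ v → W' u v · R u v) xs) xs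
  ΣM-symmetrize {A} W W' R e r xs = halve (≋-trans (doubled W) (≋-trans
      (ΣM-cong xs (λ u → ΣM-cong xs (λ v → ·-cong (e u v) ≋-refl))) (≋-sym (doubled W'))))
    where
    doubled : ∀ (V : A → A → Carrier) → ΣM (λ u → ΣM (λ v → V u v · R u v) xs) xs ⊞ ΣM (λ u → ΣM (λ v → V u v · R u v) xs) xs
      ≋ ΣM (λ u → ΣM (λ v → (V u v + V v u) · R u v) xs) xs
    doubled V = ≋-trans (⊞-cong ≋-refl (ΣM-swap (λ u v → V u v · R u v) xs xs))
      (≋-trans (≋-sym (ΣM-⊞ _ _ xs)) (ΣM-cong xs λ u → ≋-trans (≋-sym (ΣM-⊞ _ _ xs)) (ΣM-cong xs λ v →
        ≋-trans (⊞-cong ≋-refl (·-cong K.refl (r v u)))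
          (combine (V u v :· x₀ :⊞ V v u :· x₀) ((V u v + V v u) :· x₀) (R u v ∷ⱽ []ⱽ) (λ z → K.sym (distribʳ _ _ _))))))

  -- With y = ζ κ the ratios of two equally high adjacent columns, of arms a and
  -- a + 1, are polynomials in t and two quantities y₀, y₁ with y₁ = t y₀ (1 − y₁).
  module TwoColumns (h a : ℕ) where
    y₀ y₁ : Carrier
    y₀ = ζ h a * κ h a
    y₁ = ζ h (suc a) * κ h (suc a)

    y-relation : y₁ - t * y₀ + t * (y₀ * y₁) ≈ 0#
    y-relation = begin
      y₁ - t * y₀ + t * (y₀ * y₁)
        ≈⟨ +-cong (+-cong y₁≈ (-‿cong (*-cong K.refl y₀≈))) (*-cong K.refl (*-cong y₀≈ y₁≈)) ⟩
      ((1# - t) * r₁) * (t * k) - t * (((1# - t) * r₀) * k) + t * ((((1# - t) * r₀) * k) * (((1# - t) * r₁) * (t * k)))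
        ≈⟨ solve 4 (λ t k r s → ((:1 :- t) :* s) :* (t :* k) :- t :* (((:1 :- t) :* r) :* k) :+ t :* ((((:1 :- t) :* r) :* k) :* (((:1 :- t) :* s) :* (t :* k)))
             := ((:1 :- t) :* (t :* k)) :* (s :- r :+ ((:1 :- t) :* (t :* k)) :* (r :* s))) K.refl t k r₀ r₁ ⟩
      ((1# - t) * (t * k)) * (r₁ - r₀ + ((1# - t) * (t * k)) * (r₀ * r₁))
        -- Each of r₀ and r₁ is multiplied by 1, written as the other one times its denominator.
        -- Then every term contains r₀ r₁ and the bracket vanishes identically.
        ≈⟨ *-cong K.refl (+-cong (+-cong r₁≈ (-‿cong r₀≈)) K.refl) ⟩
      ((1# - t) * (t * k)) * (r₁ * (r₀ * (1# - t * k)) - r₀ * (r₁ * (1# - t * (t * k))) + ((1# - t) * (t * k)) * (r₀ * r₁))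
        ≈⟨ solve 4 (λ t k r s → ((:1 :- t) :* (t :* k)) :* (s :* (r :* (:1 :- t :* k)) :- r :* (s :* (:1 :- t :* (t :* k))) :+ ((:1 :- t) :* (t :* k)) :* (r :* s)) := :0) K.refl t k r₀ r₁ ⟩
      0# ∎
      where
      open K-Reasoning
      k r₀ r₁ : Carrier
      k = κ h a
      r₀ = ρ h a
      r₁ = ρ h (suc a)
      y₀≈ : y₀ ≈ ((1# - t) * r₀) * k
      y₀≈ = *-cong (ζ-numerator h a) K.refl
      y₁≈ : y₁ ≈ ((1# - t) * r₁) * (t * k)
      y₁≈ = *-cong (ζ-numerator h (suc a)) (κ-suc h a)
      r₁≈ : r₁ ≈ r₁ * (r₀ * (1# - t * k))
      r₁≈ = K.sym (K.trans (*-cong K.refl (K.trans (*-cong K.refl (+-cong K.refl (-‿cong (K.sym (κ-suc h a))))) (ρ-inverse h a))) (*-identityʳ _))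
      r₀≈ : r₀ ≈ r₀ * (r₁ * (1# - t * (t * k)))
      r₀≈ = K.sym (K.trans (*-cong K.refl (K.trans (*-cong K.refl (+-cong K.refl (-‿cong (K.sym
        (K.trans (κ-suc h (suc a)) (*-cong K.refl (κ-suc h a))))))) (ρ-inverse h (suc a)))) (*-identityʳ _))

    -- `shiftˢ` is the effect of the waiting column on the weight of the growing one, up to a common
    -- power of t: an equal label is blocked, a larger one gains an inversion. `f₀` and `f₁` are the
    -- ratios for the arms a and a + 1, where ζ for a smaller label is rewritten as (1 - t) + t y.
    shiftˢ f₀ f₁ : Sign → Carrier
    shiftˢ negative = t
    shiftˢ null = 0#
    shiftˢ positive = 1#
    f₀ negative = (1# - t) + t * y₀
    f₀ null = 1#
    f₀ positive = y₀
    f₁ negative = (1# - t) + t * y₁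
    f₁ null = 1#
    f₁ positive = y₁

    ratio-sign : ∀ b y → y ≈ ζ h b * κ h b → ∀ {u l o} → Comparison u l o → (f : Sign → Carrier) →
      f negative ≈ (1# - t) + t * y → f null ≈ 1# → f positive ≈ y → ratio h b u l ≈ f o
    ratio-sign b y e (less p) f e₁ e₂ e₃ = K.trans (K.reflexive (ratio-less h b p)) (K.trans (K.trans
      (solve 2 (λ z t → z := (:1 :- t) :+ (z :+ (t :- :1))) K.refl (ζ h b) t)
      (+-cong K.refl (K.trans (ζ-relation h b) (*-cong K.refl (K.sym e))))) (K.sym e₁))
    ratio-sign b y e {u} (equal ≡.refl) f e₁ e₂ e₃ = K.trans (K.reflexive (ratio-equal h b u)) (K.sym e₂)
    ratio-sign b y e (greater p) f e₁ e₂ e₃ = K.trans (K.reflexive (ratio-greater h b p)) (K.trans (K.sym e) (K.sym e₃))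

    -- The cofactor m certifies that the two sides agree modulo `y-relation`. Each case of
    -- `identity` thereby becomes a polynomial identity in t, y₀ and y₁.
    modulo : ∀ m {x y} → x ≈ y + m * (y₁ - t * y₀ + t * (y₀ * y₁)) → x ≈ y
    modulo m e = K.trans e (K.trans (+-cong K.refl (K.trans (*-cong K.refl y-relation) (zeroʳ m))) (+-identityʳ _))

    -- signs of u − α, u − β, v − α, v − β for u < v and α < β
    data Possible : Sign → Sign → Sign → Sign → Set where
      case0 : Possible positive null positive positive
      case1 : Possible positive negative positive positive
      case2 : Possible positive negative positive null
      case3 : Possible positive negative positive negative
      case4 : Possible null negative positive positive
      case5 : Possible null negative positive null
      case6 : Possible null negative positive negative
      case7 : Possible negative negative positive null
      case8 : Possible negative negative positive negative
      case9 : Possible negative negative null negative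
      case10 : Possible positive positive positive positive
      case11 : Possible negative negative positive positive
      case12 : Possible negative negative negative negative

    -- The two sides are the symmetrised weights of two adjacent columns labelled α and β, in either
    -- order. If u compares in the same way with α and β, and so does v (the last three cases),
    -- exchanging α and β changes nothing. In the other cases the difference is a multiple of
    -- `y-relation`, in `case5` the zero multiple.
    identity : ∀ o₁ o₂ o₃ o₄ → Possible o₁ o₂ o₃ o₄ →
      shiftˢ o₂ * (f₀ o₁ * f₁ o₄) + t * (shiftˢ o₄ * (f₀ o₃ * f₁ o₂))
        ≈ shiftˢ o₁ * (f₀ o₂ * f₁ o₃) + t * (shiftˢ o₃ * (f₀ o₄ * f₁ o₁))
    identity positive null positive positive case0 = modulo (- 1#) (solve 3 (λ t a b →
      :0 :* (a :* b) :+ t :* (:1 :* (a :* :1))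
        := (:1 :* (:1 :* b) :+ t :* (:1 :* (a :* b))) :+ (:- :1) :* (b :- t :* a :+ t :* (a :* b))) K.refl t y₀ y₁)
    identity positive negative positive positive case1 = modulo (t - 1#) (solve 3 (λ t a b →
      t :* (a :* b) :+ t :* (:1 :* (a :* ((:1 :- t) :+ t :* b)))
        := (:1 :* (((:1 :- t) :+ t :* a) :* b) :+ t :* (:1 :* (a :* b))) :+ (t :- :1) :* (b :- t :* a :+ t :* (a :* b))) K.refl t y₀ y₁)
    identity positive negative positive null case2 = modulo (- 1#) (solve 3 (λ t a b →
      t :* (a :* :1) :+ t :* (:0 :* (a :* ((:1 :- t) :+ t :* b)))
        := (:1 :* (((:1 :- t) :+ t :* a) :* b) :+ t :* (:1 :* (:1 :* b))) :+ (:- :1) :* (b :- t :* a :+ t :* (a :* b))) K.refl t y₀ y₁)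
    identity positive negative positive negative case3 = modulo (t * t - 1#) (solve 3 (λ t a b →
      t :* (a :* ((:1 :- t) :+ t :* b)) :+ t :* (t :* (a :* ((:1 :- t) :+ t :* b)))
        := (:1 :* (((:1 :- t) :+ t :* a) :* b) :+ t :* (:1 :* (((:1 :- t) :+ t :* a) :* b))) :+ (t :* t :- :1) :* (b :- t :* a :+ t :* (a :* b))) K.refl t y₀ y₁)
    identity null negative positive positive case4 = modulo (t) (solve 3 (λ t a b →
      t :* (:1 :* b) :+ t :* (:1 :* (a :* ((:1 :- t) :+ t :* b)))
        := (:0 :* (((:1 :- t) :+ t :* a) :* b) :+ t :* (:1 :* (a :* :1))) :+ (t) :* (b :- t :* a :+ t :* (a :* b))) K.refl t y₀ y₁)
    identity null negative positive null case5 = modulo (0#) (solve 3 (λ t a b →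
      t :* (:1 :* :1) :+ t :* (:0 :* (a :* ((:1 :- t) :+ t :* b)))
        := (:0 :* (((:1 :- t) :+ t :* a) :* b) :+ t :* (:1 :* (:1 :* :1))) :+ (:0) :* (b :- t :* a :+ t :* (a :* b))) K.refl t y₀ y₁)
    identity null negative positive negative case6 = modulo (t * t) (solve 3 (λ t a b →
      t :* (:1 :* ((:1 :- t) :+ t :* b)) :+ t :* (t :* (a :* ((:1 :- t) :+ t :* b)))
        := (:0 :* (((:1 :- t) :+ t :* a) :* b) :+ t :* (:1 :* (((:1 :- t) :+ t :* a) :* :1))) :+ (t :* t) :* (b :- t :* a :+ t :* (a :* b))) K.refl t y₀ y₁)
    identity negative negative positive null case7 = modulo (- t) (solve 3 (λ t a b →
      t :* (((:1 :- t) :+ t :* a) :* :1) :+ t :* (:0 :* (a :* ((:1 :- t) :+ t :* b)))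
        := (t :* (((:1 :- t) :+ t :* a) :* b) :+ t :* (:1 :* (:1 :* ((:1 :- t) :+ t :* b)))) :+ (:- t) :* (b :- t :* a :+ t :* (a :* b))) K.refl t y₀ y₁)
    identity negative negative positive negative case8 = modulo (t * t - t) (solve 3 (λ t a b →
      t :* (((:1 :- t) :+ t :* a) :* ((:1 :- t) :+ t :* b)) :+ t :* (t :* (a :* ((:1 :- t) :+ t :* b)))
        := (t :* (((:1 :- t) :+ t :* a) :* b) :+ t :* (:1 :* (((:1 :- t) :+ t :* a) :* ((:1 :- t) :+ t :* b)))) :+ (t :* t :- t) :* (b :- t :* a :+ t :* (a :* b))) K.refl t y₀ y₁)
    identity negative negative null negative case9 = modulo (t * t) (solve 3 (λ t a b →
      t :* (((:1 :- t) :+ t :* a) :* ((:1 :- t) :+ t :* b)) :+ t :* (t :* (:1 :* ((:1 :- t) :+ t :* b)))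
        := (t :* (((:1 :- t) :+ t :* a) :* :1) :+ t :* (:0 :* (((:1 :- t) :+ t :* a) :* ((:1 :- t) :+ t :* b)))) :+ (t :* t) :* (b :- t :* a :+ t :* (a :* b))) K.refl t y₀ y₁)
    identity positive positive positive positive case10 = K.refl
    identity negative negative positive positive case11 = K.refl
    identity negative negative negative negative case12 = K.refl

    record Configuration (u v α β : ℕ) : Set where
      constructor conf
      field
        {o₁ o₂ o₃ o₄} : Sign
        possible : Possible o₁ o₂ o₃ o₄
        cmp-uα : Comparison u α o₁
        cmp-uβ : Comparison u β o₂
        cmp-vα : Comparison v α o₃
        cmp-vβ : Comparison v β o₄

    configuration : ∀ {u v α β} → u N.< v → α N.< β → Configuration u v α β
    configuration {u} {v} {α} {β} u<v α<β with compare u α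
    ... | _ , less u<α with compare v α
    ...   | _ , less v<α = conf case12 (less u<α) (less (NP.<-trans u<α α<β)) (less v<α) (less (NP.<-trans v<α α<β))
    ...   | _ , equal ≡.refl = conf case9 (less u<α) (less (NP.<-trans u<α α<β)) (equal ≡.refl) (less α<β)
    ...   | _ , greater α<v with compare v β
    ...     | _ , less v<β = conf case8 (less u<α) (less (NP.<-trans u<α α<β)) (greater α<v) (less v<β)
    ...     | _ , equal e = conf case7 (less u<α) (less (NP.<-trans u<α α<β)) (greater α<v) (equal e)
    ...     | _ , greater β<v = conf case11 (less u<α) (less (NP.<-trans u<α α<β)) (greater α<v) (greater β<v)
    configuration {u} {v} {α} {β} u<v α<β | _ , equal ≡.refl with compare v β
    ...   | _ , less v<β = conf case6 (equal ≡.refl) (less α<β) (greater u<v) (less v<β)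
    ...   | _ , equal e = conf case5 (equal ≡.refl) (less α<β) (greater u<v) (equal e)
    ...   | _ , greater β<v = conf case4 (equal ≡.refl) (less α<β) (greater u<v) (greater β<v)
    configuration {u} {v} {α} {β} u<v α<β | _ , greater α<u with compare u β
    ...   | _ , equal ≡.refl = conf case0 (greater α<u) (equal ≡.refl) (greater (NP.<-trans α<u u<v)) (greater u<v)
    ...   | _ , greater β<u = conf case10 (greater α<u) (greater β<u) (greater (NP.<-trans α<u u<v)) (greater (NP.<-trans β<u u<v))
    ...   | _ , less u<β with compare v β
    ...     | _ , less v<β = conf case3 (greater α<u) (less u<β) (greater (NP.<-trans α<u u<v)) (less v<β)
    ...     | _ , equal e = conf case2 (greater α<u) (less u<β) (greater (NP.<-trans α<u u<v)) (equal e)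
    ...     | _ , greater β<v = conf case1 (greater α<u) (less u<β) (greater (NP.<-trans α<u u<v)) (greater β<v)

  module EqualColumns (h : ℕ) (L : State) where
    a : ℕ
    a = arms h L
    open TwoColumns h a

    -- `first` is the weight of u on the column labelled α while the column labelled β waits,
    -- `second` that of v on the latter afterwards. Blocked choices carry the scalar 0, so that both
    -- orders of the columns give sums over all pairs of labels.
    first second : ℕ → ℕ → ℕ → Carrier
    first α β u = if mem u ((β , suc h) ∷ L) then 0# else weight α h ((β , suc h) ∷ L) u
    second β u v = if mem v (L ++ (u , h) ∷ []) then 0# else weight β h (L ++ (u , h) ∷ []) v

    W : ℕ → ℕ → ℕ → ℕ → Carrier
    W α β u v = first α β u * second β u v

    orderˢ : Sign → Carrier
    orderˢ negative = 1#
    orderˢ null = 0#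
    orderˢ positive = t

    -- One factor t⁻¹ is split off so that, for u smaller than, equal to or larger than β, the
    -- remaining factor is t, 0 or 1 as in `shiftˢ`.
    base : ℕ → Carrier
    base u = tz (+ a Z.- + below u L) * t⁻¹

    first-sign : ∀ {α β u o o'} → mem u L ≡ false → Comparison u β o → Comparison u α o' →
      first α β u ≈ base u * (shiftˢ o * f₀ o')
    first-sign {α} {β} {u} m (less p) c
      rewrite ≡ᵇ-false {β} {u} (λ e → NP.<⇒≢ p (≡.sym e)) | m | arms-taller h β L | <ᵇ-false (NP.<⇒≤ p) =
      K.trans (*-cong K.refl (ratio-sign a y₀ K.refl c f₀ K.refl K.refl K.refl)) (K.trans
        (K.sym (K.trans (*-cong t⁻¹*t K.refl) (*-identityˡ _)))
        (solve 4 (λ p t x f → (p :* t) :* (x :* f) := (x :* p) :* (t :* f)) K.refl t⁻¹ t (tz (+ a Z.- + below u L)) _))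
    first-sign {α} {β} {u} m (equal ≡.refl) c rewrite ≡ᵇ-refl u =
      K.sym (K.trans (*-cong K.refl (zeroˡ _)) (zeroʳ _))
    first-sign {α} {β} {u} m (greater p) c
      rewrite ≡ᵇ-false {β} {u} (NP.<⇒≢ p) | m | arms-taller h β L | <ᵇ-true p =
      *-cong (K.trans (K.reflexive (≡.cong tz (shuffle (+ a) (+ below u L)))) (tz-+ _ _))
        (K.trans (ratio-sign a y₀ K.refl c f₀ K.refl K.refl K.refl) (K.sym (*-identityˡ _)))
      where
      shuffle : ∀ a b → a Z.- (+ 1 Z.+ b) ≡ (a Z.- b) Z.+ Z.- + 1
      shuffle = solve-∀ℤ

    arms-snoc : ∀ u → arms h (L ++ (u , h) ∷ []) ≡ suc a
    arms-snoc u = ≡.trans (countB-++ _ L _) (≡.trans (≡.cong (a N.+_) (arms-same h u)) (NP.+-comm a 1))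

    second-sign : ∀ {β u v o o'} → mem v L ≡ false → Comparison u v o → Comparison v β o' →
      second β u v ≈ (t * base v) * (orderˢ o * f₁ o')
    second-sign {β} {u} {v} m (less p) c
      rewrite mem-++ v L ((u , h) ∷ []) | m | ≡ᵇ-false {u} {v} (NP.<⇒≢ p) | arms-snoc u
            | countB-++ (λ x → proj₁ x <ᵇ v) L ((u , h) ∷ []) | <ᵇ-true p =
      *-cong (K.trans (K.reflexive (≡.cong tz (≡.trans (≡.cong (λ z → + suc a Z.- + z) (NP.+-comm (below v L) 1)) (shuffle (+ a) (+ below v L)))))
          (K.trans (K.sym (K.trans (*-cong t⁻¹*t K.refl) (*-identityˡ _))) (solve 3 (λ p t x → (p :* t) :* x := t :* (x :* p)) K.refl t⁻¹ t _)))
        (K.trans (ratio-sign (suc a) y₁ K.refl c f₁ K.refl K.refl K.refl) (K.sym (*-identityˡ _)))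
      where
      shuffle : ∀ a b → (+ 1 Z.+ a) Z.- (+ 1 Z.+ b) ≡ a Z.- b
      shuffle = solve-∀ℤ
    second-sign {β} {u} {v} m (equal ≡.refl) c
      rewrite mem-++ v L ((u , h) ∷ []) | m | ≡ᵇ-refl u = K.sym (K.trans (*-cong K.refl (zeroˡ _)) (zeroʳ _))
    second-sign {β} {u} {v} m (greater p) c
      rewrite mem-++ v L ((u , h) ∷ []) | m | ≡ᵇ-false {u} {v} (λ e → NP.<⇒≢ p (≡.sym e)) | arms-snoc u
            | countB-++ (λ x → proj₁ x <ᵇ v) L ((u , h) ∷ []) | <ᵇ-false (NP.<⇒≤ p) | NP.+-identityʳ (below v L) =
      K.trans (*-cong (K.trans (K.reflexive (≡.cong tz (shuffle (+ a) (+ below v L)))) (tz-+ (+ 1) _))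
          (ratio-sign (suc a) y₁ K.refl c f₁ K.refl K.refl K.refl))
        (K.trans (K.sym (K.trans (*-cong t⁻¹*t K.refl) (*-identityˡ _)))
          (solve 4 (λ p t x f → (p :* t) :* ((t :* x) :* f) := (t :* (x :* p)) :* (t :* f)) K.refl t⁻¹ t _ _))
      where
      shuffle : ∀ a b → (+ 1 Z.+ a) Z.- b ≡ + 1 Z.+ (a Z.- b)
      shuffle = solve-∀ℤ

    W-sum : ∀ {α β u v o₁ o₂ o₃ o₄} → mem u L ≡ false → mem v L ≡ false → u N.< v →
      Comparison u α o₁ → Comparison u β o₂ → Comparison v α o₃ → Comparison v β o₄ →
      W α β u v + W α β v u ≈ (t * (base u * base v)) * (shiftˢ o₂ * (f₀ o₁ * f₁ o₄) + t * (shiftˢ o₄ * (f₀ o₃ * f₁ o₂)))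
    W-sum {u = u} {v = v} {o₁ = o₁} {o₂} {o₃} {o₄} m m' p uα uβ vα vβ = K.trans
      (+-cong (*-cong (first-sign m uβ uα) (second-sign m' (less p) vβ))
              (*-cong (first-sign m' vβ vα) (second-sign m (greater p) uβ)))
      (solve 9 (λ t x y s₂ f₁ g₄ s₄ f₃ g₂ → (x :* (s₂ :* f₁)) :* ((t :* y) :* (:1 :* g₄)) :+ (y :* (s₄ :* f₃)) :* ((t :* x) :* (t :* g₂))
          := (t :* (x :* y)) :* (s₂ :* (f₁ :* g₄) :+ t :* (s₄ :* (f₃ :* g₂)))) K.refl
        t (base u) (base v) (shiftˢ o₂) (f₀ o₁) (f₁ o₄) (shiftˢ o₄) (f₀ o₃) (f₁ o₂))

    W-free : ∀ {α β u v} → mem u L ≡ false → mem v L ≡ false → u N.< v → α N.< β →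
      W α β u v + W α β v u ≈ W β α u v + W β α v u
    W-free m m' p q with configuration p q
    ... | conf {o₁} {o₂} {o₃} {o₄} r uα uβ vα vβ = K.trans (W-sum m m' p uα uβ vα vβ)
      (K.trans (*-cong K.refl (identity o₁ o₂ o₃ o₄ r)) (K.sym (W-sum m m' p uβ uα vβ vα)))

    first-blocked : ∀ α β u → mem u L ≡ true → first α β u ≡ 0#
    first-blocked α β u m rewrite m with β ≡ᵇ u
    ... | true = ≡.refl
    ... | false = ≡.refl

    second-blocked : ∀ β u v → mem v L ≡ true → second β u v ≡ 0#
    second-blocked β u v m rewrite mem-++ v L ((u , h) ∷ []) | m = ≡.refl

    W-blocked : ∀ α β u v → (mem u L ≡ true) ⊎ (mem v L ≡ true) → W α β u v ≈ 0#
    W-blocked α β u v (inj₁ m) = K.trans (*-cong (K.reflexive (first-blocked α β u m)) K.refl) (zeroˡ _)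
    W-blocked α β u v (inj₂ m) = K.trans (*-cong K.refl (K.reflexive (second-blocked β u v m))) (zeroʳ _)

    W-diagonal : ∀ α β u → W α β u u ≈ 0#
    W-diagonal α β u = K.trans (*-cong K.refl (K.reflexive zero-second)) (zeroʳ _)
      where
      zero-second : second β u u ≡ 0#
      zero-second rewrite mem-++ u L ((u , h) ∷ []) | ≡ᵇ-refl u with mem u L
      ... | true = ≡.refl
      ... | false = ≡.refl

    W-symmetric : ∀ α β u v → W α β u v + W α β v u ≈ W β α u v + W β α v u
    W-symmetric α β u v with bool-cases (mem u L) | bool-cases (mem v L)
    ... | inj₁ m | _ = K.trans (+-cong (W-blocked α β u v (inj₁ m)) (W-blocked α β v u (inj₂ m)))
                         (K.sym (+-cong (W-blocked β α u v (inj₁ m)) (W-blocked β α v u (inj₂ m))))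
    ... | inj₂ _ | inj₁ m = K.trans (+-cong (W-blocked α β u v (inj₂ m)) (W-blocked α β v u (inj₁ m)))
                         (K.sym (+-cong (W-blocked β α u v (inj₂ m)) (W-blocked β α v u (inj₁ m))))
    ... | inj₂ m | inj₂ m' with compare u v | compare α β
    ...   | _ , equal ≡.refl | _ = K.trans (+-cong (W-diagonal α β u) (W-diagonal α β u)) (K.sym (+-cong (W-diagonal β α u) (W-diagonal β α u)))
    ...   | _ , less _ | _ , equal ≡.refl = K.refl
    ...   | _ , greater _ | _ , equal ≡.refl = K.refl
    ...   | _ , less p | _ , less q = W-free m m' p q
    ...   | _ , less p | _ , greater q = K.sym (W-free m m' p q)
    ...   | _ , greater p | _ , less q = K.trans (+-comm _ _) (K.trans (W-free m' m p q) (+-comm _ _))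
    ...   | _ , greater p | _ , greater q = K.trans (+-comm _ _) (K.trans (K.sym (W-free m' m p q)) (+-comm _ _))

    R : ℕ → ℕ → ℕ → M
    R N u v = X u (X v (G N ((L ++ (u , h) ∷ []) ++ (v , h) ∷ [])))

    two-steps : ∀ N α β → G (suc (suc N)) ((α , suc h) ∷ (β , suc h) ∷ L) ≋
      ΣM (λ u → ΣM (λ v → W α β u v · R N u v) (upTo n)) (upTo n)
    two-steps N α β = ΣM-cong (upTo n) λ u → ≋-trans (outer u) (≋-trans (·-cong K.refl
        (≋-trans (linear-Σ (X-linear u) _ (upTo n)) (ΣM-cong (upTo n) λ v → ≋-trans (X.cong u (inner u v)) (X.scale u _ _))))
        (≋-trans (linear-Σ (·-linear _) _ (upTo n)) (ΣM-cong (upTo n) λ v →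
          combine (first α β u :· second β u v :· x₀) (W α β u v :· x₀) (R N u v ∷ⱽ []ⱽ) (λ z → K.sym (*-assoc _ _ _)))))
      where
      inner : ∀ u v → grow N β h (L ++ (u , h) ∷ []) v ≋ second β u v · X v (G N ((L ++ (u , h) ∷ []) ++ (v , h) ∷ []))
      inner u v with mem v (L ++ (u , h) ∷ [])
      ... | true = combine :𝟘 (0# :· x₀) (_ ∷ⱽ []ⱽ) (λ z → K.sym (zeroˡ _))
      ... | false = ≋-refl
      outer : ∀ u → grow (suc N) α h ((β , suc h) ∷ L) u ≋ first α β u · X u (ΣM (grow N β h (L ++ (u , h) ∷ [])) (upTo n))
      outer u with mem u ((β , suc h) ∷ L)
      ... | true = combine :𝟘 (0# :· x₀) (_ ∷ⱽ []ⱽ) (λ z → K.sym (zeroˡ _))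
      ... | false = ≋-refl

  -- Another column at the head grows alike on both sides. Once the two columns are at the head and
  -- not exhausted, both are grown: their weights are compared by `W-symmetric`, and what remains is
  -- symmetric in the new labels u and v by induction, because the two columns are again adjacent
  -- and equally high, now at the end.
  G-swap : ∀ N L₁ α β h L₂ → meas (L₁ ++ (α , h) ∷ (β , h) ∷ L₂) N.≤ N →
    G N (L₁ ++ (α , h) ∷ (β , h) ∷ L₂) ≋ G N (L₁ ++ (β , h) ∷ (α , h) ∷ L₂)
  G-swap (suc N) ((l , zero) ∷ L₁) α β h L₂ p = G-swap N L₁ α β h L₂ (NP.≤-pred p)
  G-swap (suc N) ((l , suc g) ∷ L₁) α β h L₂ p = ΣM-cong (upTo n) λ u →
    grow-cong N l g u (mem-↭ u swapped) (countB-↭ _ swapped) (countB-↭ _ swapped) λ _ → ≋-trans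
      (≋-reflexive (≡.cong (G N) (LP.++-assoc L₁ ((α , h) ∷ (β , h) ∷ L₂) ((u , g) ∷ []))))
      (≋-trans (G-swap N L₁ α β h (L₂ ++ (u , g) ∷ [])
        (≡.subst (λ z → meas z N.≤ N) (LP.++-assoc L₁ ((α , h) ∷ (β , h) ∷ L₂) ((u , g) ∷ [])) (meas-step l g (L₁ ++ (α , h) ∷ (β , h) ∷ L₂) u p)))
      (≋-reflexive (≡.cong (G N) (≡.sym (LP.++-assoc L₁ ((β , h) ∷ (α , h) ∷ L₂) ((u , g) ∷ []))))))
    where
    swapped : L₁ ++ (α , h) ∷ (β , h) ∷ L₂ ↭ L₁ ++ (β , h) ∷ (α , h) ∷ L₂
    swapped = ++⁺ˡ L₁ (↭-swap _ _ ↭-refl)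
  G-swap (suc (suc N)) [] α β zero L₂ p = ≋-refl
  G-swap (suc zero) [] α β (suc h) L₂ (N.s≤s ())
  G-swap (suc zero) [] α β zero L₂ (N.s≤s ())
  G-swap (suc (suc N)) [] α β (suc h) L₂ p = ≋-trans (two-steps N α β) (≋-trans
    (ΣM-symmetrize (W α β) (W β α) (R N) (W-symmetric α β) R-symmetric (upTo n))
    (≋-sym (two-steps N β α)))
    where
    open EqualColumns h L₂
    R-symmetric : ∀ u v → R N u v ≋ R N v u
    R-symmetric u v = ≋-trans (ext (X-comm u v _)) (X.cong v (X.cong u (≋-trans
        (≋-reflexive (≡.cong (G N) (LP.++-assoc L₂ _ _))) (≋-trans
        (G-swap N L₂ u v h [] (≡.subst (λ z → meas z N.≤ N) (LP.++-assoc L₂ ((u , h) ∷ []) ((v , h) ∷ []))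
          (meas-step β h (L₂ ++ (u , h) ∷ []) v (meas-two u))))
        (≋-reflexive (≡.cong (G N) (≡.sym (LP.++-assoc L₂ _ _))))))))
      where
      meas-two : ∀ u → meas ((β , suc h) ∷ L₂ ++ (u , h) ∷ []) N.≤ suc N
      meas-two u = meas-step α h ((β , suc h) ∷ L₂) u p

-- Order-reversing relabellings

ℤ-cancelˡ : ∀ x y z → x Z.+ y ≡ x Z.+ z → y ≡ z
ℤ-cancelˡ x y z e = ≡.trans (shuffle x y) (≡.trans (≡.cong (λ w → Z.- x Z.+ w) e) (≡.sym (shuffle x z)))
  where
  shuffle : ∀ x y → y ≡ Z.- x Z.+ (x Z.+ y)
  shuffle = solve-∀ℤ

⟨_⟩ : Bool → ℤ
⟨ true ⟩ = + 1
⟨ false ⟩ = + 0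

-- An order-reversing relabelling up to a cyclic rotation: b tells which
-- labels wrap around.
record Reversal (n : ℕ) : Set where
  field
    φ : ℕ → ℕ
    b : ℕ → ℤ
    φ-permutes : map φ (upTo n) ↭ upTo n
    reverses : ∀ {u l} → u N.< n → l N.< n → ¬ l ≡ u → ⟨ l <ᵇ u ⟩ Z.+ ⟨ φ l <ᵇ φ u ⟩ ≡ + 1 Z.+ (b u Z.- b l)

-- `ψ` is semilinear over the inversion `bar` of q and t, and turns x_u into q^(b u) x_(φ u). In
-- `bar-ζ` numerator and denominator are cleared of negative powers, and the factor κ of a descent
-- remains.
record Conjugation (S : Setting) (V : Reversal (Setting.n S)) : Set where
  open Setting S
  open Reversal V
  field
    bar : Carrier → Carrier
    bar-cong : ∀ x y → x ≈ y → bar x ≈ bar y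
    bar-* : ∀ x y → bar (x * y) ≈ bar x * bar y
    bar-1 : bar 1# ≈ 1#
    bar-tz : ∀ i → bar (tz i) ≈ tz (Z.- i)
    bar-qz : ∀ i → bar (qz i) ≈ qz (Z.- i)
    bar-ζ : ∀ h a → bar (ζ h a) ≈ (qz (+ suc h) * tz (+ a)) * ζ h a
    ψ : M → M
    ψ-cong : ∀ f g → f ≐ g → ψ f ≐ ψ g
    ψ-𝟘 : ψ 𝟘 ≐ 𝟘
    ψ-⊞ : ∀ f g → ψ (f ⊞ g) ≐ ψ f ⊞ ψ g
    ψ-· : ∀ c f → ψ (c · f) ≐ bar c · ψ f
    ψ-X : ∀ u → u N.< n → ∀ f → ψ (X u f) ≐ qz (b u) · X (φ u) (ψ f)
    ψ-𝟙 : ψ 𝟙 ≐ 𝟙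

Bounded : ℕ → State → Set
Bounded n = All (λ x → proj₁ x N.< n)

module Discrepancy {n : ℕ} (V : Reversal n) where
  open Reversal V

  -- The exponent of q in the factor of `ψ-G`. When the head (l , suc h) becomes (u , h), it drops
  -- by (h + 1) b l and gains h b u; the new variable supplies b u, and the inverted ratio supplies
  -- (h + 1) (b l - b u).
  wrapped : State → ℤ
  wrapped [] = + 0
  wrapped ((l , h) ∷ L) = b l Z.* + h Z.+ wrapped L

  -- A pair of columns contributes when the later one is shorter. The contribution 1 + b k - b l
  -- then says how often, before and after the reversal, the label of the taller one is the smaller.
  -- `higherTo` collects the same contributions from the side of the later column.
  lowerTo higherTo : ℕ → ℕ → State → ℤ
  lowerTo l h [] = + 0
  lowerTo l h ((k , g) ∷ L) = (if g <ᵇ h then + 1 Z.+ (b k Z.- b l) else + 0) Z.+ lowerTo l h L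
  higherTo u h [] = + 0
  higherTo u h ((k , g) ∷ L) = (if h <ᵇ g then + 1 Z.+ (b u Z.- b k) else + 0) Z.+ higherTo u h L

  discrepancy : State → ℤ
  discrepancy [] = + 0
  discrepancy ((l , h) ∷ L) = lowerTo l h L Z.+ discrepancy L

  φ-injective : ∀ {u l} → u N.< n → l N.< n → ¬ l ≡ u → ¬ φ l ≡ φ u
  φ-injective {u} {l} u<n l<n l≢u e = one≢two {b u} {b l} (≡.trans total (≡.cong₂ Z._+_ (reverses u<n l<n l≢u) (reverses l<n u<n (λ e → l≢u (≡.sym e)))))
    where
    irrefl : ∀ {k m} → k ≡ m → (k <ᵇ m) ≡ false
    irrefl {k} ≡.refl = <ᵇ-false (NP.≤-refl {k})
    total : + 1 ≡ (⟨ l <ᵇ u ⟩ Z.+ ⟨ φ l <ᵇ φ u ⟩) Z.+ (⟨ u <ᵇ l ⟩ Z.+ ⟨ φ u <ᵇ φ l ⟩)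
    total rewrite irrefl e | irrefl (≡.sym e) with NP.<-cmp l u
    ... | tri< p _ _ rewrite <ᵇ-true p | <ᵇ-false (NP.<⇒≤ p) = ≡.refl
    ... | tri≈ _ p _ = ⊥-elim (l≢u p)
    ... | tri> _ _ p rewrite <ᵇ-true p | <ᵇ-false (NP.<⇒≤ p) = ≡.refl
    one≢two : ∀ {x y} → ¬ + 1 ≡ (+ 1 Z.+ (x Z.- y)) Z.+ (+ 1 Z.+ (y Z.- x))
    one≢two {x} {y} e with ≡.trans e (cancel x y)
      where
      cancel : ∀ x y → (+ 1 Z.+ (x Z.- y)) Z.+ (+ 1 Z.+ (y Z.- x)) ≡ + 2
      cancel = solve-∀ℤ
    ... | ()

  mem-φ : ∀ {u L} → u N.< n → Bounded n L → mem (φ u) (relabel φ L) ≡ mem u L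
  mem-φ p [] = ≡.refl
  mem-φ {u} {(l , h) ∷ L} p (q ∷ B) = ≡.cong₂ _∨_ same (mem-φ p B)
    where
    same : (φ l ≡ᵇ φ u) ≡ (l ≡ᵇ u)
    same with NP.<-cmp l u
    ... | tri≈ _ ≡.refl _ = ≡.trans (≡ᵇ-refl (φ l)) (≡.sym (≡ᵇ-refl l))
    ... | tri< _ e _ = ≡.trans (≡ᵇ-false (φ-injective p q e)) (≡.sym (≡ᵇ-false e))
    ... | tri> _ e _ = ≡.trans (≡ᵇ-false (φ-injective p q e)) (≡.sym (≡ᵇ-false e))

  wrapped-snoc : ∀ L u h → wrapped (L ++ (u , h) ∷ []) ≡ b u Z.* + h Z.+ wrapped L
  wrapped-snoc [] u h = ≡.refl
  wrapped-snoc ((l , g) ∷ L) u h = ≡.trans (≡.cong (λ z → b l Z.* + g Z.+ z) (wrapped-snoc L u h)) (shuffle (b l Z.* + g) (b u Z.* + h) (wrapped L))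
    where
    shuffle : ∀ x y z → x Z.+ (y Z.+ z) ≡ y Z.+ (x Z.+ z)
    shuffle = solve-∀ℤ

  lowerTo-snoc : ∀ l h L u g → lowerTo l h (L ++ (u , g) ∷ []) ≡ lowerTo l h L Z.+ (if g <ᵇ h then + 1 Z.+ (b u Z.- b l) else + 0)
  lowerTo-snoc l h [] u g = ZP.+-comm (if g <ᵇ h then + 1 Z.+ (b u Z.- b l) else + 0) (+ 0)
  lowerTo-snoc l h ((k , f) ∷ L) u g = ≡.trans (≡.cong (λ z → (if f <ᵇ h then + 1 Z.+ (b k Z.- b l) else + 0) Z.+ z) (lowerTo-snoc l h L u g)) (≡.sym (ZP.+-assoc (if f <ᵇ h then + 1 Z.+ (b k Z.- b l) else + 0) (lowerTo l h L) _))

  discrepancy-snoc : ∀ L u h → discrepancy (L ++ (u , h) ∷ []) ≡ discrepancy L Z.+ higherTo u h L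
  discrepancy-snoc [] u h = ≡.refl
  discrepancy-snoc ((l , g) ∷ L) u h = ≡.trans (≡.cong₂ Z._+_ (lowerTo-snoc l g L u h) (discrepancy-snoc L u h))
    (shuffle (lowerTo l g L) (if h <ᵇ g then + 1 Z.+ (b u Z.- b l) else + 0) (discrepancy L) (higherTo u h L))
    where
    shuffle : ∀ x y z w → (x Z.+ y) Z.+ (z Z.+ w) ≡ (x Z.+ z) Z.+ (y Z.+ w)
    shuffle = solve-∀ℤ

  -- `reverses` summed over the columns of `L`. Columns of height at most h are those counted by
  -- `arms` and `lowerTo l (suc h)`, the others those of `higherTo u h`. The right side is arranged
  -- to match the change of `discrepancy` when the head (l , suc h) turns into (u , h) at the end.
  below-reversed : ∀ {u} h l L → u N.< n → Bounded n L → mem u L ≡ false →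
    + below u L Z.+ + below (φ u) (relabel φ L) ≡
      (+ 2 Z.* + arms h L Z.- + arms h L Z.* (b l Z.- b u)) Z.+ (higherTo u h L Z.- lowerTo l (suc h) L)
  below-reversed {u} h l [] p B m = base (b l) (b u)
    where
    base : ∀ x y → + 0 ≡ (+ 2 Z.* + 0 Z.- + 0 Z.* (x Z.- y)) Z.+ (+ 0 Z.- + 0)
    base = solve-∀ℤ
  below-reversed {u} h l ((k , g) ∷ L) p (q ∷ B) m with ∨-false {k ≡ᵇ u} m
  ... | k≢u , u∉L = ≡.trans (≡.cong₂ Z._+_ (count (k <ᵇ u) (below u L)) (count (φ k <ᵇ φ u) (below (φ u) (relabel φ L))))
      (≡.trans (shuffle₁ ⟨ k <ᵇ u ⟩ ⟨ φ k <ᵇ φ u ⟩ (+ below u L) (+ below (φ u) (relabel φ L)))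
      (≡.trans (≡.cong₂ Z._+_ (reverses p q (≡ᵇ-distinct k≢u)) (below-reversed h l L p B u∉L)) aux))
    where
    count : ∀ c x → + (if c then suc x else x) ≡ ⟨ c ⟩ Z.+ + x
    count true x = ≡.refl
    count false x = ≡.refl
    shuffle₁ : ∀ a b c d → (a Z.+ c) Z.+ (b Z.+ d) ≡ (a Z.+ b) Z.+ (c Z.+ d)
    shuffle₁ = solve-∀ℤ
    aux : (+ 1 Z.+ (b u Z.- b k)) Z.+ ((+ 2 Z.* + arms h L Z.- + arms h L Z.* (b l Z.- b u)) Z.+ (higherTo u h L Z.- lowerTo l (suc h) L))
      ≡ (+ 2 Z.* + arms h ((k , g) ∷ L) Z.- + arms h ((k , g) ∷ L) Z.* (b l Z.- b u)) Z.+ (higherTo u h ((k , g) ∷ L) Z.- lowerTo l (suc h) ((k , g) ∷ L))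
    aux with g NP.≤? h
    ... | yes g≤h rewrite ≤ᵇ-true g≤h | <ᵇ-true (N.s≤s g≤h) | <ᵇ-false g≤h =
      shuffle (+ arms h L) (b u) (b k) (b l) (higherTo u h L) (lowerTo l (suc h) L)
      where
      shuffle : ∀ a u k l x y → (+ 1 Z.+ (u Z.- k)) Z.+ ((+ 2 Z.* a Z.- a Z.* (l Z.- u)) Z.+ (x Z.- y))
        ≡ (+ 2 Z.* (+ 1 Z.+ a) Z.- (+ 1 Z.+ a) Z.* (l Z.- u)) Z.+ ((+ 0 Z.+ x) Z.- ((+ 1 Z.+ (k Z.- l)) Z.+ y))
      shuffle = solve-∀ℤ
    ... | no g≰h rewrite ≤ᵇ-false (NP.≰⇒> g≰h) | <ᵇ-false {g} {suc h} (NP.≰⇒> g≰h) | <ᵇ-true (NP.≰⇒> g≰h) =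
      shuffle (+ arms h L) (b u) (b k) (b l) (higherTo u h L) (lowerTo l (suc h) L)
      where
      shuffle : ∀ a u k l x y → (+ 1 Z.+ (u Z.- k)) Z.+ ((+ 2 Z.* a Z.- a Z.* (l Z.- u)) Z.+ (x Z.- y))
        ≡ (+ 2 Z.* a Z.- a Z.* (l Z.- u)) Z.+ (((+ 1 Z.+ (u Z.- k)) Z.+ x) Z.- (+ 0 Z.+ y))
      shuffle = solve-∀ℤ

-- Conjugation of `G` by an order-reversing relabelling

module Flip (S : Setting) (V : Reversal (Setting.n S)) (C : Conjugation S V) where
  open Setting S hiding (refl; sym; trans; zero)
  private module K = Setting S
  open IntegerSolver scalars
  open Core S
  open Exchange S
  open Columns S
  open Reversal V
  open Conjugation C
  open Discrepancy V

  ψ-cong′ : ∀ {f g} → f ≋ g → ψ f ≋ ψ g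
  ψ-cong′ e = ext (ψ-cong _ _ (at e))

  ψ-Σ : ∀ {A : Set} (f : A → M) xs → ψ (ΣM f xs) ≋ ΣM (λ x → ψ (f x)) xs
  ψ-Σ f [] = ext ψ-𝟘
  ψ-Σ f (x ∷ xs) = ≋-trans (ext (ψ-⊞ _ _)) (⊞-cong ≋-refl (ψ-Σ f xs))

  ΣM-map : ∀ {A B : Set} (f : B → M) (g : A → B) xs → ΣM f (map g xs) ≡ ΣM (λ x → f (g x)) xs
  ΣM-map f g [] = ≡.refl
  ΣM-map f g (x ∷ xs) = ≡.cong (f (g x) ⊞_) (ΣM-map f g xs)

  bar-κ : ∀ h a → bar (κ h a) ≈ qz (Z.- (+ suc h)) * tz (Z.- (+ a))
  bar-κ h a = K.trans (bar-* _ _) (*-cong (bar-qz _) (bar-tz _))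

  bar-κ*κ : ∀ h a → (qz (Z.- (+ suc h)) * tz (Z.- (+ a))) * κ h a ≈ 1#
  bar-κ*κ h a = K.trans (solve 4 (λ p q r s → (p :* q) :* (r :* s) := (p :* r) :* (q :* s)) K.refl _ _ _ _)
    (K.trans (*-cong (K.trans (K.sym (qz-+ _ _)) (K.trans (K.reflexive (≡.cong qz (ZP.+-inverseˡ (+ suc h)))) qz-0))
                     (K.trans (K.sym (tz-+ _ _)) (K.trans (K.reflexive (≡.cong tz (ZP.+-inverseˡ (+ a)))) tz-0)))
    (*-identityˡ 1#))

  -- `bar` exchanges ζ and ζ κ, that is, the ratios of a pair of labels and of the reversed pair. If
  -- φ keeps the order of the pair, a power κ or κ⁻¹ is left over, and by `reverses` its exponent is
  -- b l - b u in every case.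
  bar-ratio : ∀ h a u l → u N.< n → l N.< n →
    bar (ratio h a u l) ≈ (qz (+ suc h Z.* (b l Z.- b u)) * tz (+ a Z.* (b l Z.- b u))) * ratio h a (φ u) (φ l)
  bar-ratio h a u l u<n l<n with NP.<-cmp u l
  ... | tri≈ _ ≡.refl _ rewrite ratio-equal h a u | ratio-equal h a (φ u) | ZP.+-inverseʳ (b u)
        | ZP.*-zeroʳ (+ suc h) | ZP.*-zeroʳ (+ a) = K.trans bar-1 (K.sym (K.trans (*-identityʳ _) (K.trans (*-cong qz-0 tz-0) (*-identityˡ _))))
  ... | tri< p u≢l _ rewrite ratio-less h a p with bool-cases (φ u <ᵇ φ l) | reverses l<n u<n u≢l
  ...   | inj₁ e | r rewrite ratio-less h a (NP.<ᵇ⇒< (φ u) (φ l) (≡.subst Data.Bool.T (≡.sym e) _)) | <ᵇ-true p | e =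
    K.trans (bar-ζ h a) (*-cong (K.reflexive (≡.cong₂ (λ x y → qz x * tz y) (times (+ suc h) (diff r)) (times (+ a) (diff r)))) K.refl)
    where
    diff : ∀ {d} → + 1 Z.+ + 1 ≡ + 1 Z.+ d → d ≡ + 1
    diff {d} e = ℤ-cancelˡ (+ 1) d (+ 1) (≡.sym e)
    times : ∀ x {d} → d ≡ + 1 → x ≡ x Z.* d
    times x ≡.refl = ≡.sym (ZP.*-identityʳ x)
  ...   | inj₂ e | r rewrite ratio-greater h a (NP.≤∧≢⇒< (NP.≮⇒≥ (λ q → true≢false (<ᵇ-true q) e)) (λ e' → φ-injective u<n l<n (λ e'' → u≢l (≡.sym e'')) e')) | <ᵇ-true p | e =
    K.trans (bar-ζ h a) (K.trans (*-comm _ _) (K.trans (K.sym (*-identityˡ _)) (*-cong (K.sym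
      (K.trans (K.reflexive (≡.cong₂ (λ x y → qz x * tz y) (times (+ suc h) (diff r)) (times (+ a) (diff r)))) (K.trans (*-cong qz-0 tz-0) (*-identityˡ _)))) K.refl)))
    where
    diff : ∀ {d} → + 1 ≡ + 1 Z.+ d → d ≡ + 0
    diff {d} e = ℤ-cancelˡ (+ 1) d (+ 0) (≡.sym e)
    times : ∀ x {d} → d ≡ + 0 → x Z.* d ≡ + 0
    times x ≡.refl = ZP.*-zeroʳ x
  bar-ratio h a u l u<n l<n | tri> _ u≢l p rewrite ratio-greater h a p with bool-cases (φ u <ᵇ φ l) | reverses l<n u<n u≢l
  ...   | inj₁ e | r rewrite ratio-less h a (NP.<ᵇ⇒< (φ u) (φ l) (≡.subst Data.Bool.T (≡.sym e) _)) | <ᵇ-false (NP.<⇒≤ p) | e =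
    K.trans barζκ (K.trans (K.sym (*-identityˡ _)) (*-cong (K.sym
      (K.trans (K.reflexive (≡.cong₂ (λ x y → qz x * tz y) (times (+ suc h) (diff r)) (times (+ a) (diff r)))) (K.trans (*-cong qz-0 tz-0) (*-identityˡ _)))) K.refl))
    where
    diff : ∀ {d} → + 0 Z.+ + 1 ≡ + 1 Z.+ d → d ≡ + 0
    diff {d} e = ℤ-cancelˡ (+ 1) d (+ 0) (≡.sym e)
    times : ∀ x {d} → d ≡ + 0 → x Z.* d ≡ + 0
    times x ≡.refl = ZP.*-zeroʳ x
    barζκ : bar (ζ h a * κ h a) ≈ ζ h a
    barζκ = K.trans (bar-* _ _) (K.trans (*-cong (bar-ζ h a) (bar-κ h a))
      (K.trans (solve 3 (λ k z c → (k :* z) :* c := (c :* k) :* z) K.refl (κ h a) (ζ h a) _)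
      (K.trans (*-cong (bar-κ*κ h a) K.refl) (*-identityˡ _))))
  ...   | inj₂ e | r rewrite ratio-greater h a (NP.≤∧≢⇒< (NP.≮⇒≥ (λ q → true≢false (<ᵇ-true q) e)) (λ e' → φ-injective u<n l<n (λ e'' → u≢l (≡.sym e'')) e')) | <ᵇ-false (NP.<⇒≤ p) | e =
    K.trans (bar-* _ _) (K.trans (*-cong (bar-ζ h a) (bar-κ h a)) (K.trans
      (solve 3 (λ k z c → (k :* z) :* c := c :* (z :* k)) K.refl (κ h a) (ζ h a) _)
      (*-cong (K.reflexive (≡.cong₂ (λ x y → qz x * tz y) (times (+ suc h) (diff r)) (times (+ a) (diff r)))) K.refl)))
    where
    diff : ∀ {d} → + 0 ≡ + 1 Z.+ d → d ≡ Z.- + 1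
    diff {d} e = ℤ-cancelˡ (+ 1) d (Z.- + 1) (≡.sym e)
    times : ∀ x {d} → d ≡ Z.- + 1 → Z.- x ≡ x Z.* d
    times x ≡.refl = ≡.trans (≡.sym (ZP.-1*i≡-i x)) (ZP.*-comm (Z.- + 1) x)

  factorᶠ : State → Carrier
  factorᶠ L = qz (wrapped L) * tz (Z.- discrepancy L)

  -- One growth step of `ψ-G`. The powers of q cancel directly; those of t are compared through
  -- `below-reversed`.
  weight-flip : ∀ l h L u → u N.< n → l N.< n → Bounded n L → mem u L ≡ false →
    bar (weight l h L u) * (qz (b u) * factorᶠ (L ++ (u , h) ∷ []))
      ≈ factorᶠ ((l , suc h) ∷ L) * weight (φ l) h (relabel φ L) (φ u)
  weight-flip l h L u u<n l<n B m
    rewrite arms-relabel φ h L | wrapped-snoc L u h | discrepancy-snoc L u h = begin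
    bar (tz (α Z.- c) * ratio h (arms h L) u l) * (qz (b u) * (qz w₁ * tz (Z.- d₁)))
      ≈⟨ *-cong (K.trans (bar-* _ _) (*-cong (bar-tz _) (bar-ratio h (arms h L) u l u<n l<n))) K.refl ⟩
    (tz (Z.- (α Z.- c)) * ((qz e₁ * tz e₂) * r)) * (qz (b u) * (qz w₁ * tz (Z.- d₁)))
      ≈⟨ solve 7 (λ p x y r z w d → (p :* ((x :* y) :* r)) :* (z :* (w :* d)) := ((x :* (z :* w)) :* (p :* (y :* d))) :* r) K.refl
           (tz (Z.- (α Z.- c))) (qz e₁) (tz e₂) r (qz (b u)) (qz w₁) (tz (Z.- d₁)) ⟩
    ((qz e₁ * (qz (b u) * qz w₁)) * (tz (Z.- (α Z.- c)) * (tz e₂ * tz (Z.- d₁)))) * r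
      ≈⟨ *-cong (*-cong (K.trans (*-cong K.refl (K.sym (qz-+ _ _))) (K.sym (qz-+ _ _))) (K.trans (*-cong K.refl (K.sym (tz-+ _ _))) (K.sym (tz-+ _ _)))) K.refl ⟩
    (qz (e₁ Z.+ (b u Z.+ w₁)) * tz (Z.- (α Z.- c) Z.+ (e₂ Z.+ Z.- d₁))) * r
      ≈⟨ *-cong (*-cong (K.reflexive (≡.cong qz q-exponent)) (K.trans (K.reflexive (≡.cong tz t-exponent)) (tz-+ _ _))) K.refl ⟩
    (qz w₂ * (tz (Z.- d₂) * tz (α Z.- c'))) * r
      ≈⟨ solve 4 (λ x y z r → (x :* (y :* z)) :* r := (x :* y) :* (z :* r)) K.refl (qz w₂) (tz (Z.- d₂)) (tz (α Z.- c')) r ⟩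
    (qz w₂ * tz (Z.- d₂)) * (tz (α Z.- c') * r) ∎
    where
    open K-Reasoning
    r : Carrier
    r = ratio h (arms h L) (φ u) (φ l)
    α c c' e₁ e₂ w₁ w₂ d₁ d₂ : ℤ
    α = + arms h L
    c = + below u L
    c' = + below (φ u) (relabel φ L)
    e₁ = + suc h Z.* (b l Z.- b u)
    e₂ = α Z.* (b l Z.- b u)
    w₁ = b u Z.* + h Z.+ wrapped L
    w₂ = b l Z.* + suc h Z.+ wrapped L
    d₁ = discrepancy L Z.+ higherTo u h L
    d₂ = lowerTo l (suc h) L Z.+ discrepancy L
    q-exponent : e₁ Z.+ (b u Z.+ w₁) ≡ w₂
    q-exponent = shuffle (+ h) (b l) (b u) (wrapped L)
      where
      shuffle : ∀ h l u w → (+ 1 Z.+ h) Z.* (l Z.- u) Z.+ (u Z.+ (u Z.* h Z.+ w)) ≡ l Z.* (+ 1 Z.+ h) Z.+ w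
      shuffle = solve-∀ℤ
    t-exponent : Z.- (α Z.- c) Z.+ (e₂ Z.+ Z.- d₁) ≡ Z.- d₂ Z.+ (α Z.- c')
    t-exponent = ≡.trans (isolate (Z.- (α Z.- c) Z.+ (e₂ Z.+ Z.- d₁)) c') (≡.trans
      (≡.cong (λ z → z Z.- c') (≡.trans (collect α c c' e₂ d₁) (≡.trans (≡.cong (λ z → z Z.+ (e₂ Z.- α Z.- d₁)) (below-reversed h l L u<n B m))
        (simplify α (b l Z.- b u) (higherTo u h L) (lowerTo l (suc h) L) (discrepancy L))))) (regroup α c' d₂))
      where
      isolate : ∀ x c → x ≡ (x Z.+ c) Z.- c
      isolate = solve-∀ℤ
      collect : ∀ a c c' e d → (Z.- (a Z.- c) Z.+ (e Z.+ Z.- d)) Z.+ c' ≡ (c Z.+ c') Z.+ (e Z.- a Z.- d)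
      collect = solve-∀ℤ
      simplify : ∀ a x hi lo d → ((+ 2 Z.* a Z.- a Z.* x) Z.+ (hi Z.- lo)) Z.+ (a Z.* x Z.- a Z.- (d Z.+ hi)) ≡ a Z.- (lo Z.+ d)
      simplify = solve-∀ℤ
      regroup : ∀ a c d → (a Z.- d) Z.- c ≡ Z.- d Z.+ (a Z.- c)
      regroup = solve-∀ℤ

  -- φ permutes the labels and respects which of them are taken, so the summand of u is matched with
  -- that of φ u. By `weight-flip` the scalar between them is determined by the state before the
  -- step, hence the same for all u.
  ψ-G : ∀ N L → meas L N.≤ N → Bounded n L → ψ (G N L) ≋ factorᶠ L · G N (relabel φ L)
  ψ-G zero [] p B = trivial
    where
    trivial : ψ 𝟙 ≋ (qz (+ 0) * tz (Z.- + 0)) · 𝟙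
    trivial = ≋-trans (ext ψ-𝟙) (ext λ α → K.sym (K.trans (coef-· _ _ α) (K.trans (*-cong (K.trans (*-cong qz-0 tz-0) (*-identityˡ _)) K.refl) (*-identityˡ _))))
  ψ-G (suc N) [] p B = ψ-G zero [] N.z≤n []
  ψ-G (suc N) ((l , zero) ∷ L) p (l<n ∷ B) = ≋-trans (ψ-G N L (NP.≤-pred p) B)
    (·-cong (K.reflexive (≡.cong₂ (λ x y → qz x * tz (Z.- y)) wrapped-zero discrepancy-zero)) ≋-refl)
    where
    wrapped-zero : wrapped L ≡ b l Z.* + 0 Z.+ wrapped L
    wrapped-zero = ≡.sym (≡.trans (≡.cong (λ z → z Z.+ wrapped L) (ZP.*-zeroʳ (b l))) (ZP.+-identityˡ _))
    lowerTo-zero : ∀ L → lowerTo l 0 L ≡ + 0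
    lowerTo-zero [] = ≡.refl
    lowerTo-zero (x ∷ L) = ≡.trans (ZP.+-identityˡ _) (lowerTo-zero L)
    discrepancy-zero : discrepancy L ≡ lowerTo l 0 L Z.+ discrepancy L
    discrepancy-zero = ≡.sym (≡.trans (≡.cong (λ z → z Z.+ discrepancy L) (lowerTo-zero L)) (ZP.+-identityˡ _))
  ψ-G (suc N) ((l , suc h) ∷ L) p (l<n ∷ B) = begin
    ψ (ΣM (grow N l h L) (upTo n)) ≈⟨ ψ-Σ _ (upTo n) ⟩
    ΣM (λ u → ψ (grow N l h L u)) (upTo n) ≈⟨ ΣM-congᴬ (All.tabulate ∈-upTo⁻) step ⟩
    ΣM (λ u → F · grow N (φ l) h (relabel φ L) (φ u)) (upTo n) ≈⟨ ≋-sym (linear-Σ (·-linear F) _ (upTo n)) ⟩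
    F · ΣM (λ u → grow N (φ l) h (relabel φ L) (φ u)) (upTo n)
      ≈⟨ ·-cong K.refl (≋-trans (≋-sym (≋-reflexive (ΣM-map _ φ (upTo n)))) (ΣM-↭ _ φ-permutes)) ⟩
    F · ΣM (grow N (φ l) h (relabel φ L)) (upTo n) ∎
    where
    open ≋-Reasoning
    F : Carrier
    F = factorᶠ ((l , suc h) ∷ L)
    step : ∀ u → u N.< n → ψ (grow N l h L u) ≋ F · grow N (φ l) h (relabel φ L) (φ u)
    step u u<n with bool-cases (mem u L)
    ... | inj₁ m = ≋-trans (ψ-cong′ (≋-reflexive (grow-blocked N l h L u m))) (≋-trans (ext ψ-𝟘) (≋-trans
        (≋-sym (Linear.zero-map (·-linear F))) (·-cong K.refl (≋-sym (≋-reflexive (grow-blocked N (φ l) h (relabel φ L) (φ u) (≡.trans (mem-φ u<n B) m)))))))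
    ... | inj₂ m = begin
      ψ (grow N l h L u) ≈⟨ ψ-cong′ (≋-reflexive (grow-free N l h L u m)) ⟩
      ψ (weight l h L u · X u (G N L')) ≈⟨ ext (ψ-· _ _) ⟩
      bar (weight l h L u) · ψ (X u (G N L')) ≈⟨ ·-cong K.refl (≋-trans (ext (ψ-X u u<n _)) (·-cong K.refl (X.cong (φ u)
          (≋-trans (ψ-G N L' (meas-step l h L u p) (AllP.++⁺ B (u<n ∷ []))) (≋-reflexive (≡.cong (λ z → factorᶠ L' · G N z) (relabel-++ φ L _))))))) ⟩
      bar (weight l h L u) · (qz (b u) · X (φ u) (factorᶠ L' · Gφ)) ≈⟨ ·-cong K.refl (·-cong K.refl (X.scale (φ u) _ _)) ⟩
      bar (weight l h L u) · (qz (b u) · (factorᶠ L' · X (φ u) Gφ))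
        ≈⟨ combine (bar (weight l h L u) :· (qz (b u) :· (factorᶠ L' :· x₀))) ((bar (weight l h L u) * (qz (b u) * factorᶠ L')) :· x₀) (X (φ u) Gφ ∷ⱽ []ⱽ)
             (λ v → solve 4 (λ a b c x → a :* (b :* (c :* x)) := (a :* (b :* c)) :* x) K.refl _ _ _ _) ⟩
      (bar (weight l h L u) * (qz (b u) * factorᶠ L')) · X (φ u) Gφ ≈⟨ ·-cong (weight-flip l h L u u<n l<n B m) ≋-refl ⟩
      (F * weight (φ l) h (relabel φ L) (φ u)) · X (φ u) Gφ
        ≈⟨ combine ((F * weight (φ l) h (relabel φ L) (φ u)) :· x₀) (F :· (weight (φ l) h (relabel φ L) (φ u) :· x₀)) (X (φ u) Gφ ∷ⱽ []ⱽ) (λ v → *-assoc _ _ _) ⟩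
      F · (weight (φ l) h (relabel φ L) (φ u) · X (φ u) Gφ)
        ≈⟨ ·-cong K.refl (≋-sym (≋-reflexive (grow-free N (φ l) h (relabel φ L) (φ u) (≡.trans (mem-φ u<n B) m)))) ⟩
      F · grow N (φ l) h (relabel φ L) (φ u) ∎
      where
      L' : State
      L' = L ++ (u , h) ∷ []
      Gφ : M
      Gφ = G N (relabel φ L ++ (φ u , h) ∷ [])

-- Words and permutations

swapL-++ : ∀ A x y B → swapL (length A) (A ++ x ∷ y ∷ B) ≡ A ++ y ∷ x ∷ B
swapL-++ [] x y B = ≡.refl
swapL-++ (a ∷ A) x y B = ≡.cong (a ∷_) (swapL-++ A x y B)

lookupL-++ˡ : ∀ A B {p} → p N.< length A → lookupL (A ++ B) p ≡ lookupL A p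
lookupL-++ˡ (a ∷ A) B {zero} _ = ≡.refl
lookupL-++ˡ (a ∷ A) B {suc p} (N.s≤s q) = lookupL-++ˡ A B q

lookupL-++ʳ : ∀ A B p → lookupL (A ++ B) (length A N.+ p) ≡ lookupL B p
lookupL-++ʳ [] B p = ≡.refl
lookupL-++ʳ (a ∷ A) B p = lookupL-++ʳ A B p

lookupL-map : ∀ f w {p} → p N.< length w → lookupL (map f w) p ≡ f (lookupL w p)
lookupL-map f (x ∷ w) {zero} _ = ≡.refl
lookupL-map f (x ∷ w) {suc p} (N.s≤s q) = lookupL-map f w q

lookupL-∈ : ∀ w {p} → p N.< length w → lookupL w p ∈ w
lookupL-∈ (x ∷ w) {zero} _ = here ≡.refl
lookupL-∈ (x ∷ w) {suc p} (N.s≤s q) = there (lookupL-∈ w q)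

lookupL-applyUpTo : ∀ f n {p} → p N.< n → lookupL (applyUpTo f n) p ≡ f p
lookupL-applyUpTo f (suc n) {zero} _ = ≡.refl
lookupL-applyUpTo f (suc n) {suc p} (N.s≤s q) = lookupL-applyUpTo (f ∘ suc) n q

lookupL-upTo : ∀ n {p} → p N.< n → lookupL (upTo n) p ≡ p
lookupL-upTo n = lookupL-applyUpTo (λ x → x) n

map-lookupL-upTo : ∀ w → map (lookupL w) (upTo (length w)) ≡ w
map-lookupL-upTo w = ≡.trans (LP.map-applyUpTo (λ x → x) (lookupL w) (length w)) (tabulated w)
  where
  tabulated : ∀ w → applyUpTo (lookupL w) (length w) ≡ w
  tabulated [] = ≡.refl
  tabulated (x ∷ w) = ≡.cong (x ∷_) (tabulated w)

upTo-+ : ∀ m p → upTo (m N.+ p) ≡ upTo m ++ map (m N.+_) (upTo p)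
upTo-+ m p = ≡.trans (applied (λ x → x) m p) (≡.cong (upTo m ++_) (≡.sym (LP.map-upTo (m N.+_) p)))
  where
  applied : ∀ (f : ℕ → ℕ) m p → applyUpTo f (m N.+ p) ≡ applyUpTo f m ++ applyUpTo (λ i → f (m N.+ i)) p
  applied f zero p = ≡.refl
  applied f (suc m) p = ≡.cong (f 0 ∷_) (applied (f ∘ suc) m p)

∧-split : ∀ {a b} → a ∧ b ≡ true → (a ≡ true) × (b ≡ true)
∧-split {true} {true} _ = ≡.refl , ≡.refl

lookupL-transpose : ∀ A x y B p → lookupL (A ++ y ∷ x ∷ B) (transpose (length A) p) ≡ lookupL (A ++ x ∷ y ∷ B) p
lookupL-transpose A x y B p with transpose (length A) p | transposed (length A) p
... | _ | lower = ≡.trans (≡.cong (lookupL (A ++ y ∷ x ∷ B)) (≡.sym (NP.+-comm (length A) 1)))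
      (≡.trans (lookupL-++ʳ A (y ∷ x ∷ B) 1) (≡.sym (≡.trans (≡.cong (lookupL (A ++ x ∷ y ∷ B)) (≡.sym (NP.+-identityʳ (length A)))) (lookupL-++ʳ A (x ∷ y ∷ B) 0))))
... | _ | upper = ≡.sym (≡.trans (≡.cong (lookupL (A ++ x ∷ y ∷ B)) (≡.sym (NP.+-comm (length A) 1)))
      (≡.trans (lookupL-++ʳ A (x ∷ y ∷ B) 1) (≡.sym (≡.trans (≡.cong (lookupL (A ++ y ∷ x ∷ B)) (≡.sym (NP.+-identityʳ (length A)))) (lookupL-++ʳ A (y ∷ x ∷ B) 0)))))
... | _ | other a b = away A p a b
  where
  away : ∀ A p → ¬ p ≡ length A → ¬ p ≡ suc (length A) → lookupL (A ++ y ∷ x ∷ B) p ≡ lookupL (A ++ x ∷ y ∷ B) p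
  away [] zero a b = ⊥-elim (a ≡.refl)
  away [] (suc zero) a b = ⊥-elim (b ≡.refl)
  away [] (suc (suc p)) a b = ≡.refl
  away (_ ∷ A) zero a b = ≡.refl
  away (_ ∷ A) (suc p) a b = away A p (λ e → a (≡.cong suc e)) (λ e → b (≡.cong suc e))

record Descent (w : List ℕ) (k : ℕ) : Set where
  constructor descent-at
  field
    {prefix} : List ℕ
    {high low} : ℕ
    {suffix} : List ℕ
    shape : w ≡ prefix ++ high ∷ low ∷ suffix
    position : length prefix ≡ k
    drops : low N.< high

firstDescent-just : ∀ w {k} → firstDescent w ≡ just k → Descent w k
firstDescent-just (x ∷ y ∷ w) e with y <ᵇ x in lt
firstDescent-just (x ∷ y ∷ w) ≡.refl | true = descent-at {prefix = []} ≡.refl ≡.refl (NP.<ᵇ⇒< y x (≡.subst Data.Bool.T (≡.sym lt) _))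
... | false with firstDescent (y ∷ w) in e'
firstDescent-just (x ∷ y ∷ w) ≡.refl | false | just k with firstDescent-just (y ∷ w) e'
...   | descent-at {A} s p d = descent-at {prefix = x ∷ A} (≡.cong (x ∷_) s) (≡.cong suc p) d

firstDescent-nothing : ∀ w → firstDescent w ≡ nothing → Linked N._≤_ w
firstDescent-nothing [] e = []
firstDescent-nothing (x ∷ w) e = from x w e
  where
  from : ∀ x w → firstDescent (x ∷ w) ≡ nothing → Linked N._≤_ (x ∷ w)
  from x [] e = [-]
  from x (y ∷ w) e with y <ᵇ x in lt
  ... | false with firstDescent (y ∷ w) in e'
  ...   | nothing = NP.≮⇒≥ (λ q → true≢false (<ᵇ-true q) lt) ∷ from y w e'

firstDescent-++ : ∀ xs ys {k} → firstDescent xs ≡ just k → firstDescent (xs ++ ys) ≡ just k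
firstDescent-++ (x ∷ xs) ys e = from x xs e
  where
  from : ∀ x xs {k} → firstDescent (x ∷ xs) ≡ just k → firstDescent (x ∷ xs ++ ys) ≡ just k
  from x (y ∷ xs) e with y <ᵇ x
  ... | true = e
  ... | false with firstDescent (y ∷ xs) in e'
  ...   | just k rewrite from y xs e' = e

descent-bound : ∀ {w k} → Descent w k → suc k N.< length w
descent-bound {w} (descent-at {A} {x} {y} {B} ≡.refl ≡.refl _) rewrite LP.length-++ A {x ∷ y ∷ B} | NP.+-suc (length A) (suc (length B)) | NP.+-suc (length A) (length B) =
  N.s≤s (N.s≤s (NP.m≤m+n (length A) (length B)))

invW-swap : ∀ A {x y} B → y N.< x → invW (A ++ x ∷ y ∷ B) ≡ suc (invW (A ++ y ∷ x ∷ B))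
invW-swap [] {x} {y} B p rewrite <ᵇ-true p | <ᵇ-false (NP.<⇒≤ p) = ≡.cong suc (shuffle (countB (_<ᵇ x) B) (countB (_<ᵇ y) B) (invW B))
  where
  shuffle : ∀ a b c → a N.+ (b N.+ c) ≡ b N.+ (a N.+ c)
  shuffle = solve-∀ℕ
invW-swap (a ∷ A) {x} {y} B p rewrite invW-swap A B p
  | countB-↭ (_<ᵇ a) (++⁺ˡ A (↭-swap x y (↭-refl {x = B}))) = NP.+-suc _ _

countB-none : ∀ {A : Set} (p : A → Bool) xs → All (λ x → p x ≡ false) xs → countB p xs ≡ 0
countB-none p [] [] = ≡.refl
countB-none p (x ∷ xs) (e ∷ es) rewrite e = countB-none p xs es

countB-cong : ∀ {A : Set} (p q : A → Bool) {xs} → All (λ x → p x ≡ q x) xs → countB p xs ≡ countB q xs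
countB-cong p q [] = ≡.refl
countB-cong p q {x ∷ xs} (e ∷ es) rewrite e | countB-cong p q es = ≡.refl

countB-map : ∀ {A B : Set} (p : B → Bool) (f : A → B) xs → countB p (map f xs) ≡ countB (λ x → p (f x)) xs
countB-map p f [] = ≡.refl
countB-map p f (x ∷ xs) rewrite countB-map p f xs = ≡.refl

invW-sorted : ∀ w → AllPairs N._≤_ w → invW w ≡ 0
invW-sorted [] [] = ≡.refl
invW-sorted (x ∷ w) (a ∷ s) rewrite countB-none (_<ᵇ x) w (All.map (λ p → <ᵇ-false p) a) = invW-sorted w s

sorted-unique : ∀ {A : Set} {R : A → A → Set} → (∀ {x y} → R x y → R y x → x ≡ y) →
  ∀ {xs ys} → AllPairs R xs → AllPairs R ys → xs ↭ ys → xs ≡ ys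
sorted-unique anti {[]} {[]} _ _ p = ≡.refl
sorted-unique anti {[]} {y ∷ ys} _ _ p with () ← ↭-length p
sorted-unique anti {x ∷ xs} {[]} _ _ p with () ← ↭-length p
sorted-unique anti {x ∷ xs} {y ∷ ys} (a ∷ s) (b ∷ s') p with heads
  where
  heads : x ≡ y
  heads with ∈-resp-↭ p (here ≡.refl) | ∈-resp-↭ (↭-sym p) (here ≡.refl)
  ... | here e | _ = e
  ... | there _ | here e = ≡.sym e
  ... | there q | there r = anti (All.lookup a r) (All.lookup b q)
... | ≡.refl = ≡.cong (x ∷_) (sorted-unique anti s s' (drop-∷ p))

≤-pairs : ∀ {w} → Linked N._≤_ w → AllPairs N._≤_ w
≤-pairs = Linked⇒AllPairs NP.≤-trans

upTo-sorted : ∀ n → AllPairs N._≤_ (upTo n)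
upTo-sorted n = ≤-pairs (applyUpTo⁺₂ (λ x → x) n (λ i → NP.n≤1+n i))

sorted-word : ∀ {n w} → Linked N._≤_ w → w ↭ upTo n → w ≡ upTo n
sorted-word {n} s p = sorted-unique NP.≤-antisym (≤-pairs s) (upTo-sorted n) p

-- `Ordered` concerns consecutive labels and admits absent ones. `Before` requires both labels to be
-- present and is stable under every relabelling.
data Before (p q : ℕ) : State → Set where
  here : ∀ {h L} → mem q L ≡ true → Before p q ((p , h) ∷ L)
  there : ∀ {x L} → Before p q L → Before p q (x ∷ L)

mem-relabel-true : ∀ g q L → mem q L ≡ true → mem (g q) (relabel g L) ≡ true
mem-relabel-true g q ((l , h) ∷ L) m with l ≡ᵇ q in e
... | true rewrite ≡ᵇ-sound l q e | ≡ᵇ-refl (g q) = ≡.refl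
... | false = ∨-true-right (g l ≡ᵇ g q) (mem-relabel-true g q L m)

before-relabel : ∀ g {p q L} → Before p q L → Before (g p) (g q) (relabel g L)
before-relabel g {p} {q} (here {h} {L} m) = here (mem-relabel-true g q L m)
before-relabel g (there b) = there (before-relabel g b)

before-++ˡ : ∀ {p q} L L' → Before p q L → Before p q (L ++ L')
before-++ˡ {p} {q} ((_ , h) ∷ L) L' (here m) = here (≡.trans (mem-++ q L L') (≡.cong (_∨ mem q L') m))
before-++ˡ (x ∷ L) L' (there b) = there (before-++ˡ L L' b)

before-++ʳ : ∀ {p q} L L' → Before p q L' → Before p q (L ++ L')
before-++ʳ [] L' b = b
before-++ʳ (x ∷ L) L' b = there (before-++ʳ L L' b)

before-++ : ∀ {p q} L L' → mem p L ≡ true → mem q L' ≡ true → Before p q (L ++ L')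
before-++ {p} {q} ((l , h) ∷ L) L' m m' with l ≡ᵇ p in e
... | true rewrite ≡ᵇ-sound l p e = here (≡.trans (mem-++ q L L') (∨-true-right (mem q L) m'))
... | false = there (before-++ L L' m m')

before-mem : ∀ {p q L} → Before p q L → (mem p L ≡ true) × (mem q L ≡ true)
before-mem {p} {q} (here {h} {L} m) rewrite ≡ᵇ-refl p = ≡.refl , ∨-true-right (p ≡ᵇ q) m
before-mem {p} {q} (there {l , h} b) = ∨-true-right (l ≡ᵇ p) (proj₁ (before-mem b)) , ∨-true-right (l ≡ᵇ q) (proj₂ (before-mem b))

mem⇒≢ : ∀ {l q L} → mem l L ≡ false → mem q L ≡ true → ¬ l ≡ q
mem⇒≢ a b ≡.refl = true≢false b a

before⇒ordered : ∀ k {L} → Uniq L → Before k (suc k) L → Ordered k L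
before⇒ordered k (_∷_ {h = h} {L = L} a U) (here m) = before [] h L ≡.refl ≡.refl ≡.refl a m
before⇒ordered k (_∷_ {l} {h} {L} a U) (there b) with before⇒ordered k U b | before-mem b
... | absent p | q , _ = ⊥-elim (true≢false q p)
... | before A g B ≡.refl p q r s | m , m' = before ((l , h) ∷ A) g B ≡.refl
  (∨-false⁺ (≡ᵇ-false (mem⇒≢ {L = L} a m)) p) (∨-false⁺ (≡ᵇ-false (mem⇒≢ {L = L} a m')) q) r s

transpose-mono : ∀ k {p q} → p N.< q → ¬ (p ≡ k × q ≡ suc k) → transpose k p N.< transpose k q
transpose-mono k {p} {q} p<q ne with transpose k p | transposed k p | transpose k q | transposed k q
... | _ | lower | _ | lower = ⊥-elim (NP.<-irrefl ≡.refl p<q)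
... | _ | lower | _ | upper = ⊥-elim (ne (≡.refl , ≡.refl))
... | _ | lower | _ | other _ b = NP.≤∧≢⇒< p<q (λ e → b (≡.sym e))
... | _ | upper | _ | lower = ⊥-elim (NP.<-asym p<q (NP.n<1+n k))
... | _ | upper | _ | upper = ⊥-elim (NP.<-irrefl ≡.refl p<q)
... | _ | upper | _ | other _ _ = NP.<-trans (NP.n<1+n k) p<q
... | _ | other _ _ | _ | lower = NP.m≤n⇒m≤1+n p<q
... | _ | other a _ | _ | upper = NP.≤∧≢⇒< (NP.≤-pred p<q) a
... | _ | other _ _ | _ | other _ _ = p<q

transpose-bounded : ∀ k {n p} → suc k N.< n → p N.< n → transpose k p N.< n
transpose-bounded k {n} {p} k<n p<n with transpose k p | transposed k p
... | _ | lower = k<n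
... | _ | upper = NP.<-trans (NP.n<1+n k) k<n
... | _ | other _ _ = p<n

∈-insertAll : ∀ x A B → A ++ x ∷ B ∈ insertAll x (A ++ B)
∈-insertAll x [] [] = here ≡.refl
∈-insertAll x [] (b ∷ B) = here ≡.refl
∈-insertAll x (a ∷ A) B = there (∈-map⁺ (a ∷_) (∈-insertAll x A B))

insertAll-↭ : ∀ x ys {w} → w ∈ insertAll x ys → w ↭ x ∷ ys
insertAll-↭ x [] (here ≡.refl) = ↭-refl
insertAll-↭ x (y ∷ ys) (here ≡.refl) = ↭-refl
insertAll-↭ x (y ∷ ys) (there p) with ∈-map⁻ (y ∷_) p
... | w , q , ≡.refl = ↭-trans (↭-prep y (insertAll-↭ x ys q)) (↭-swap y x ↭-refl)

permsOf-↭ : ∀ xs {w} → w ∈ permsOf xs → w ↭ xs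
permsOf-↭ [] (here ≡.refl) = ↭-refl
permsOf-↭ (x ∷ xs) p = any (∈-concatMap⁻ (insertAll x) {xs = permsOf xs} p) (λ q → permsOf-↭ xs q)
  where
  any : ∀ {w yss} → Any ((w ∈_) ∘ insertAll x) yss → (∀ {ys} → ys ∈ yss → ys ↭ xs) → w ↭ x ∷ xs
  any (here q) f = ↭-trans (insertAll-↭ x _ q) (↭-prep x (f (here ≡.refl)))
  any (there q) f = any q (λ r → f (there r))

↭-permsOf : ∀ xs {w} → w ↭ xs → w ∈ permsOf xs
↭-permsOf [] {[]} p = here ≡.refl
↭-permsOf [] {x ∷ w} p with () ← ↭-length p
↭-permsOf (x ∷ xs) {w} p with ∈-∃++ (∈-resp-↭ (↭-sym p) (here ≡.refl))
... | A , B , ≡.refl = ∈-concatMap⁺ (insertAll x) (any (↭-permsOf xs (drop-∷ (↭-trans (↭-sym (shift x A B)) p))))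
  where
  any : ∀ {yss} → A ++ B ∈ yss → Any ((A ++ x ∷ B ∈_) ∘ insertAll x) yss
  any (here ≡.refl) = here (∈-insertAll x A B)
  any (there q) = there (any q)

-- Left inverse of inserting a fresh x. It recovers the shorter permutation, so the lists
-- `insertAll x ys` for different ys are disjoint.
delete : ℕ → List ℕ → List ℕ
delete x [] = []
delete x (y ∷ ys) = if x ≡ᵇ y then ys else y ∷ delete x ys

delete-insertAll : ∀ x ys {w} → All (λ y → ¬ x ≡ y) ys → w ∈ insertAll x ys → delete x w ≡ ys
delete-insertAll x [] a (here ≡.refl) rewrite ≡ᵇ-refl x = ≡.refl
delete-insertAll x (y ∷ ys) a (here ≡.refl) rewrite ≡ᵇ-refl x = ≡.refl
delete-insertAll x (y ∷ ys) (x≢y ∷ a) (there p) with ∈-map⁻ (y ∷_) p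
... | w , q , ≡.refl rewrite ≡ᵇ-false x≢y = ≡.cong (y ∷_) (delete-insertAll x ys a q)

unique-insertAll : ∀ x ys → All (λ y → ¬ x ≡ y) ys → Unique (insertAll x ys)
unique-insertAll x [] a = [] ∷ []
unique-insertAll x (y ∷ ys) (x≢y ∷ a) =
  All.tabulate (λ p e → first (∈-map⁻ (y ∷_) p) e) ∷ UniqueP.map⁺ (λ { ≡.refl → ≡.refl }) (unique-insertAll x ys a)
  where
  first : ∀ {w} → (∃ λ z → z ∈ insertAll x ys × w ≡ y ∷ z) → ¬ x ∷ y ∷ ys ≡ w
  first (z , _ , ≡.refl) ≡.refl = x≢y ≡.refl

unique-permsOf : ∀ xs → Unique xs → Unique (permsOf xs)
unique-permsOf [] _ = [] ∷ []
unique-permsOf (x ∷ xs) (a ∷ U) = UniqueP.concat⁺ (AllP.map⁺ (All.tabulate (λ p → unique-insertAll x _ (fresh p))))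
  (disjoint (permsOf xs) (λ p → p) (unique-permsOf xs U))
  where
  fresh : ∀ {ys} → ys ∈ permsOf xs → All (λ y → ¬ x ≡ y) ys
  fresh p = All-resp-↭ (↭-sym (permsOf-↭ xs p)) a
  disjoint : ∀ yss → (∀ {ys} → ys ∈ yss → ys ∈ permsOf xs) → Unique yss → AllPairs (λ u v → ∀ {w} → ¬ (w ∈ u × w ∈ v)) (map (insertAll x) yss)
  disjoint [] f [] = []
  disjoint (ys ∷ yss) f (b ∷ V) = AllP.map⁺ (All.tabulate (λ {zs} q {w} (r , s) → All.lookup b q
      (≡.trans (≡.sym (delete-insertAll x ys (fresh (f (here ≡.refl))) r)) (delete-insertAll x zs (fresh (f (there q))) s))))
    ∷ disjoint yss (λ q → f (there q)) V

unique-⊆-↭ : ∀ {A : Set} (xs ys : List A) → Unique xs → Unique ys → (∀ {z} → z ∈ xs → z ∈ ys) → (∀ {z} → z ∈ ys → z ∈ xs) → xs ↭ ys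
unique-⊆-↭ [] [] _ _ f g = ↭-refl
unique-⊆-↭ [] (y ∷ ys) _ _ f g with () ← g (here ≡.refl)
unique-⊆-↭ (x ∷ xs) ys (a ∷ U) V f g with extract (f (here ≡.refl))
... | zs , p with unique-↭ p V
...   | b ∷ W = ↭-trans (↭-prep x (unique-⊆-↭ xs zs U W f' g')) (↭-sym p)
  where
  f' : ∀ {z} → z ∈ xs → z ∈ zs
  f' q with ∈-resp-↭ p (f (there q))
  ... | here ≡.refl = ⊥-elim (All.lookup a q ≡.refl)
  ... | there r = r
  g' : ∀ {z} → z ∈ zs → z ∈ xs
  g' q with g (∈-resp-↭ (↭-sym p) (there q))
  ... | here ≡.refl = ⊥-elim (All.lookup b q ≡.refl)
  ... | there r = r

-- The reindexings of sums below come from involutions: adjacent transpositions, reversals of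
-- blocks, and the maps which these induce on coset representatives.
involution-↭ : ∀ {A : Set} (s : A → A) xs → Unique xs → (∀ {x} → x ∈ xs → s x ∈ xs) → (∀ {x} → x ∈ xs → s (s x) ≡ x) → map s xs ↭ xs
involution-↭ {A} s xs U closed inv = unique-⊆-↭ (map s xs) xs (unique-map xs (λ p → inv p) U) U
  (λ p → let (x , q , e) = ∈-map⁻ s p in ≡.subst (_∈ xs) (≡.sym e) (closed q))
  (λ {z} p → ≡.subst (_∈ map s xs) (inv p) (∈-map⁺ s (closed p)))
  where
  unique-map : ∀ ys → (∀ {x} → x ∈ ys → s (s x) ≡ x) → Unique ys → Unique (map s ys)
  unique-map [] i [] = []
  unique-map (y ∷ ys) i (a ∷ V) = AllP.map⁺ (All.tabulate λ {z} p e → All.lookup a p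
      (≡.trans (≡.sym (i (here ≡.refl))) (≡.trans (≡.cong s e) (i (there p)))))
    ∷ unique-map ys (λ p → i (there p)) V

-- Minimal coset representatives

-- Each pair is tested in both directions, which makes the count a function of the multiset of
-- entries.
pairCount : {A : Set} → (A → A → Bool) → List A → ℕ
pairCount r [] = 0
pairCount r (x ∷ xs) = countB (r x) xs N.+ countB (λ y → r y x) xs N.+ pairCount r xs

bit : Bool → ℕ
bit b = if b then 1 else 0

countB-∷ : ∀ {A : Set} (p : A → Bool) x xs → countB p (x ∷ xs) ≡ bit (p x) N.+ countB p xs
countB-∷ p x xs with p x
... | true = ≡.refl
... | false = ≡.refl

pairCount-↭ : ∀ {A : Set} (r : A → A → Bool) {xs ys} → xs ↭ ys → pairCount r xs ≡ pairCount r ys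
pairCount-↭ r ↭.refl = ≡.refl
pairCount-↭ r (↭.prep x p) rewrite countB-↭ (r x) p | countB-↭ (λ y → r y x) p | pairCount-↭ r p = ≡.refl
pairCount-↭ r (↭.swap {xs} {ys} x y p)
  rewrite countB-∷ (r x) y xs | countB-∷ (λ z → r z x) y xs | countB-∷ (r y) x ys | countB-∷ (λ z → r z y) x ys
        | countB-↭ (r x) p | countB-↭ (λ z → r z x) p | countB-↭ (r y) p | countB-↭ (λ z → r z y) p | pairCount-↭ r p =
  shuffle (bit (r x y)) (countB (r x) ys) (bit (r y x)) (countB (λ z → r z x) ys) (countB (r y) ys) (countB (λ z → r z y) ys) (pairCount r ys)
  where
  shuffle : ∀ a b c d e f g → (a N.+ b) N.+ (c N.+ d) N.+ (e N.+ f N.+ g) ≡ (c N.+ e) N.+ (a N.+ f) N.+ (b N.+ d N.+ g)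
  shuffle = solve-∀ℕ
pairCount-↭ r (↭.trans p q) = ≡.trans (pairCount-↭ r p) (pairCount-↭ r q)

drops : ℕ × ℕ → ℕ × ℕ → Bool
drops x y = proj₂ y <ᵇ proj₂ x

crosses : ℕ × ℕ → ℕ × ℕ → Bool
crosses x y = (proj₂ y <ᵇ proj₂ x) ∧ (proj₁ y <ᵇ proj₁ x)

-- On a minimal representative this is the Coxeter length, but it does not depend on the order in
-- which the columns are listed. Lengths can therefore be read off from the set of labelled columns.
crossing : State → ℕ
crossing = pairCount crosses

-- The column order that characterises minimal representatives: taller columns first, increasing
-- labels among columns of equal height.
Lex : ℕ × ℕ → ℕ × ℕ → Set
Lex x y = (proj₂ y N.< proj₂ x) ⊎ (proj₂ x ≡ proj₂ y × proj₁ x N.≤ proj₁ y)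

Taller : ℕ × ℕ → ℕ × ℕ → Set
Taller x y = proj₂ y N.≤ proj₂ x

lex⇒taller : ∀ {x y} → Lex x y → Taller x y
lex⇒taller (inj₁ p) = NP.<⇒≤ p
lex⇒taller (inj₂ (p , _)) = NP.≤-reflexive (≡.sym p)

lex-antisym : ∀ {x y} → Lex x y → Lex y x → x ≡ y
lex-antisym (inj₁ p) (inj₁ q) = ⊥-elim (NP.<-asym p q)
lex-antisym (inj₁ p) (inj₂ (q , _)) = ⊥-elim (NP.<⇒≢ p q)
lex-antisym (inj₂ (p , _)) (inj₁ q) = ⊥-elim (NP.<⇒≢ q p)
lex-antisym (inj₂ (p , q)) (inj₂ (_ , r)) = ≡.cong₂ _,_ (NP.≤-antisym q r) p

lex-trans : ∀ {x y z} → Lex x y → Lex y z → Lex x z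
lex-trans (inj₁ p) (inj₁ q) = inj₁ (NP.<-trans q p)
lex-trans (inj₁ p) (inj₂ (q , _)) = inj₁ (≡.subst (N._< _) q p)
lex-trans (inj₂ (p , _)) (inj₁ q) = inj₁ (≡.subst (_ N.<_) (≡.sym p) q)
lex-trans (inj₂ (p , q)) (inj₂ (r , s)) = inj₂ (≡.trans p r , NP.≤-trans q s)

lex-total : ∀ x y → Lex x y ⊎ Lex y x
lex-total x y with NP.<-cmp (proj₂ x) (proj₂ y)
... | tri< p _ _ = inj₂ (inj₁ p)
... | tri> _ _ p = inj₁ (inj₁ p)
... | tri≈ _ p _ with NP.≤-total (proj₁ x) (proj₁ y)
...   | inj₁ q = inj₁ (inj₂ (p , q))
...   | inj₂ q = inj₂ (inj₂ (≡.sym p , q))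

ins : ℕ × ℕ → State → State
ins x [] = x ∷ []
ins x (y ∷ L) with lex-total x y
... | inj₁ _ = x ∷ y ∷ L
... | inj₂ _ = y ∷ ins x L

isort : State → State
isort [] = []
isort (x ∷ L) = ins x (isort L)

ins-↭ : ∀ x L → ins x L ↭ x ∷ L
ins-↭ x [] = ↭-refl
ins-↭ x (y ∷ L) with lex-total x y
... | inj₁ _ = ↭-refl
... | inj₂ _ = ↭-trans (↭-prep y (ins-↭ x L)) (↭-swap y x ↭-refl)

isort-↭ : ∀ L → isort L ↭ L
isort-↭ [] = ↭-refl
isort-↭ (x ∷ L) = ↭-trans (ins-↭ x (isort L)) (↭-prep x (isort-↭ L))

ins-sorted : ∀ x L → AllPairs Lex L → AllPairs Lex (ins x L)
ins-sorted x [] [] = [] ∷ []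
ins-sorted x (y ∷ L) (a ∷ s) with lex-total x y
... | inj₁ p = (p ∷ All.map (lex-trans p) a) ∷ a ∷ s
... | inj₂ p = All-resp-↭ (↭-sym (ins-↭ x L)) (p ∷ a) ∷ ins-sorted x L s

isort-sorted : ∀ L → AllPairs Lex (isort L)
isort-sorted [] = []
isort-sorted (x ∷ L) = ins-sorted x (isort L) (isort-sorted L)

map-proj₁-zip : ∀ (π lam : List ℕ) → length π ≡ length lam → map proj₁ (zip π lam) ≡ π
map-proj₁-zip [] [] e = ≡.refl
map-proj₁-zip (x ∷ π) (h ∷ lam) e = ≡.cong (x ∷_) (map-proj₁-zip π lam (NP.suc-injective e))

map-proj₂-zip : ∀ (π lam : List ℕ) → length π ≡ length lam → map proj₂ (zip π lam) ≡ lam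
map-proj₂-zip [] [] e = ≡.refl
map-proj₂-zip (x ∷ π) (h ∷ lam) e = ≡.cong (h ∷_) (map-proj₂-zip π lam (NP.suc-injective e))

zip-projections : ∀ (Z : State) → zip (map proj₁ Z) (map proj₂ Z) ≡ Z
zip-projections [] = ≡.refl
zip-projections (x ∷ Z) = ≡.cong (x ∷_) (zip-projections Z)

zip-relabel : ∀ f (π lam : List ℕ) → zip (map f π) lam ≡ relabel f (zip π lam)
zip-relabel f [] lam = ≡.refl
zip-relabel f (x ∷ π) [] = ≡.refl
zip-relabel f (x ∷ π) (h ∷ lam) = ≡.cong ((f x , h) ∷_) (zip-relabel f π lam)

zip-++ : ∀ (π lam ρ mu : List ℕ) → length π ≡ length lam → zip (π ++ ρ) (lam ++ mu) ≡ zip π lam ++ zip ρ mu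
zip-++ [] [] ρ mu e = ≡.refl
zip-++ (x ∷ π) (h ∷ lam) ρ mu e = ≡.cong ((x , h) ∷_) (zip-++ π lam ρ mu (NP.suc-injective e))

zip-map-map : ∀ {A : Set} (f g : A → ℕ) xs → zip (map f xs) (map g xs) ≡ map (λ x → (f x , g x)) xs
zip-map-map f g [] = ≡.refl
zip-map-map f g (x ∷ xs) = ≡.cong (_ ∷_) (zip-map-map f g xs)

all-zip : ∀ {P : ℕ → Set} {π : List ℕ} (lam : List ℕ) → All P π → All (λ x → P (proj₁ x)) (zip π lam)
all-zip lam [] = []
all-zip [] (p ∷ ps) = []
all-zip (h ∷ lam) (p ∷ ps) = p ∷ all-zip lam ps

mem-zip : ∀ u (π lam : List ℕ) → length π ≡ length lam → u ∈ π → mem u (zip π lam) ≡ true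
mem-zip u (x ∷ π) (h ∷ lam) e (here ≡.refl) rewrite ≡ᵇ-refl x = ≡.refl
mem-zip u (x ∷ π) (h ∷ lam) e (there p) = ∨-true-right (x ≡ᵇ u) (mem-zip u π lam (NP.suc-injective e) p)

mem-absent : ∀ u L → All (λ x → ¬ u ≡ proj₁ x) L → mem u L ≡ false
mem-absent u [] [] = ≡.refl
mem-absent u ((l , h) ∷ L) (p ∷ ps) = ∨-false⁺ (≡ᵇ-false (λ e → p (≡.sym e))) (mem-absent u L ps)

uniq-zip : ∀ {π : List ℕ} (lam : List ℕ) → Unique π → Uniq (zip π lam)
uniq-zip lam [] = []
uniq-zip [] (a ∷ U) = []
uniq-zip (h ∷ lam) (a ∷ U) = mem-absent _ _ (all-zip lam a) ∷ uniq-zip lam U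

decreasing-zip : ∀ (π : List ℕ) {lam : List ℕ} → AllPairs N._≥_ lam → AllPairs Taller (zip π lam)
decreasing-zip [] d = []
decreasing-zip (x ∷ π) [] = []
decreasing-zip (x ∷ π) (_∷_ {h} {lam} a d) = heights π a ∷ decreasing-zip π d
  where
  heights : ∀ (π : List ℕ) {lam : List ℕ} → All (N._≤ h) lam → All (Taller (x , h)) (zip π lam)
  heights [] a = []
  heights (y ∷ π) [] = []
  heights (y ∷ π) (p ∷ a) = p ∷ heights π a

taller⇒decreasing : ∀ {Z} → AllPairs Taller Z → AllPairs N._≥_ (map proj₂ Z)
taller⇒decreasing [] = []
taller⇒decreasing (a ∷ s) = AllP.map⁺ a ∷ taller⇒decreasing s

countB-mono : ∀ {A : Set} (p q : A → Bool) {xs} → All (λ x → p x ≡ true → q x ≡ true) xs → countB p xs N.≤ countB q xs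
countB-mono p q [] = N.z≤n
countB-mono p q {x ∷ xs} (e ∷ es) with p x | q x
... | true | true = N.s≤s (countB-mono p q es)
... | true | false with () ← e ≡.refl
... | false | true = NP.m≤n⇒m≤1+n (countB-mono p q es)
... | false | false = countB-mono p q es

countB-proj₁ : ∀ (p : ℕ → Bool) (π lam : List ℕ) → length π ≡ length lam → countB (λ x → p (proj₁ x)) (zip π lam) ≡ countB p π
countB-proj₁ p π lam e = ≡.trans (≡.sym (countB-map p proj₁ (zip π lam))) (≡.cong (countB p) (map-proj₁-zip π lam e))

countB-proj₂ : ∀ (p : ℕ → Bool) (π lam : List ℕ) → length π ≡ length lam → countB (λ x → p (proj₂ x)) (zip π lam) ≡ countB p lam
countB-proj₂ p π lam e = ≡.trans (≡.sym (countB-map p proj₂ (zip π lam))) (≡.cong (countB p) (map-proj₂-zip π lam e))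

no-ascent : ∀ (x : ℕ × ℕ) Z → All (Taller x) Z → countB (λ y → crosses y x) Z ≡ 0
no-ascent x Z a = countB-none (λ y → crosses y x) Z (All.map (λ {y} p → ≡.cong (_∧ (proj₁ x <ᵇ proj₁ y)) (<ᵇ-false p)) a)

crossing≤invW : ∀ ρ {lam} → length ρ ≡ length lam → AllPairs N._≥_ lam → crossing (zip ρ lam) N.≤ invW ρ
crossing≤invW [] {[]} e d = N.z≤n
crossing≤invW (l ∷ ρ) {h ∷ lam} e d@(_ ∷ d') with decreasing-zip (l ∷ ρ) d
... | a ∷ _ rewrite no-ascent (l , h) (zip ρ lam) a | NP.+-identityʳ (countB (crosses (l , h)) (zip ρ lam)) =
  NP.+-mono-≤ (NP.≤-trans (countB-mono (crosses (l , h)) (λ x → proj₁ x <ᵇ l) (All.universal (λ x m → proj₂ (∧-split {proj₂ x <ᵇ h} m)) (zip ρ lam)))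
      (NP.≤-reflexive (countB-proj₁ (_<ᵇ l) ρ lam (NP.suc-injective e))))
    (crossing≤invW ρ (NP.suc-injective e) d')

-- In the order `Lex` an inversion of labels can occur only between columns of different height.
crossing≡invW : ∀ ρ {lam} → length ρ ≡ length lam → AllPairs Lex (zip ρ lam) → crossing (zip ρ lam) ≡ invW ρ
crossing≡invW [] {[]} e s = ≡.refl
crossing≡invW (l ∷ ρ) {h ∷ lam} e (a ∷ s)
  rewrite no-ascent (l , h) (zip ρ lam) (All.map lex⇒taller a) | NP.+-identityʳ (countB (crosses (l , h)) (zip ρ lam)) =
  ≡.cong₂ N._+_ (≡.trans (countB-cong (crosses (l , h)) (λ x → proj₁ x <ᵇ l) (All.map same a)) (countB-proj₁ (_<ᵇ l) ρ lam (NP.suc-injective e)))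
    (crossing≡invW ρ (NP.suc-injective e) s)
  where
  same : ∀ {x} → Lex (l , h) x → crosses (l , h) x ≡ (proj₁ x <ᵇ l)
  same (inj₁ p) rewrite <ᵇ-true p = ≡.refl
  same {x} (inj₂ (_ , p)) rewrite <ᵇ-false p with proj₂ x <ᵇ h
  ... | true = ≡.refl
  ... | false = ≡.refl

drops≡invW : ∀ (π : List ℕ) {lam} → length π ≡ length lam → AllPairs N._≥_ lam → pairCount drops (zip π lam) ≡ invW lam
drops≡invW [] {[]} e d = ≡.refl
drops≡invW (l ∷ π) {h ∷ lam} e d@(_ ∷ d') with decreasing-zip (l ∷ π) d
... | a ∷ _ rewrite countB-none (λ y → drops y (l , h)) (zip π lam) (All.map <ᵇ-false a)
                  | NP.+-identityʳ (countB (drops (l , h)) (zip π lam)) =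
  ≡.cong₂ N._+_ (countB-proj₂ (_<ᵇ h) π lam (NP.suc-injective e)) (drops≡invW π (NP.suc-injective e) d')

eqListB-sound : ∀ α β → eqListB α β ≡ true → α ≡ β
eqListB-sound α β e with LP.≡-dec N._≟_ α β
... | yes p = p

eqListB-refl : ∀ α → eqListB α α ≡ true
eqListB-refl α with LP.≡-dec N._≟_ α α
... | yes _ = ≡.refl
... | no n = ⊥-elim (n ≡.refl)

allB-∈ : ∀ {A : Set} (p : A → Bool) {xs} → allB p xs ≡ true → ∀ {x} → x ∈ xs → p x ≡ true
allB-∈ p {x ∷ xs} e (here ≡.refl) = proj₁ (∧-split e)
allB-∈ p {x ∷ xs} e (there q) = allB-∈ p (proj₂ (∧-split {p x} e)) q

∈-allB : ∀ {A : Set} (p : A → Bool) xs → (∀ {x} → x ∈ xs → p x ≡ true) → allB p xs ≡ true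
∈-allB p [] e = ≡.refl
∈-allB p (x ∷ xs) e rewrite e (here ≡.refl) = ∈-allB p xs (λ q → e (there q))

filterB-∈ : ∀ {A : Set} (p : A → Bool) xs {x} → x ∈ filterB p xs → (x ∈ xs) × (p x ≡ true)
filterB-∈ p (y ∷ xs) q with p y in e
filterB-∈ p (y ∷ xs) (here ≡.refl) | true = here ≡.refl , e
filterB-∈ p (y ∷ xs) (there q) | true = there (proj₁ (filterB-∈ p xs q)) , proj₂ (filterB-∈ p xs q)
filterB-∈ p (y ∷ xs) q | false = there (proj₁ (filterB-∈ p xs q)) , proj₂ (filterB-∈ p xs q)

∈-filterB : ∀ {A : Set} (p : A → Bool) xs {x} → x ∈ xs → p x ≡ true → x ∈ filterB p xs
∈-filterB p (y ∷ xs) (here ≡.refl) e rewrite e = here ≡.refl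
∈-filterB p (y ∷ xs) (there q) e with p y
... | true = there (∈-filterB p xs q e)
... | false = ∈-filterB p xs q e

unique-filterB : ∀ {A : Set} (p : A → Bool) xs → Unique xs → Unique (filterB p xs)
unique-filterB p [] [] = []
unique-filterB p (x ∷ xs) (a ∷ U) with p x
... | true = All.tabulate (λ q → All.lookup a (proj₁ (filterB-∈ p xs q))) ∷ unique-filterB p xs U
... | false = unique-filterB p xs U

adjacent⇒linked : ∀ {A : Set} {R : A → A → Set} L → (∀ P x y Q → L ≡ P ++ x ∷ y ∷ Q → R x y) → Linked R L
adjacent⇒linked [] f = []
adjacent⇒linked (x ∷ L) f = from x L f
  where
  from : ∀ x L → (∀ P y z Q → x ∷ L ≡ P ++ y ∷ z ∷ Q → _) → Linked _ (x ∷ L)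
  from x [] f = [-]
  from x (y ∷ L) f = f [] x y L ≡.refl ∷ from y L (λ P a b Q e → f (x ∷ P) a b Q (≡.cong (x ∷_) e))

adjacent : ∀ {A : Set} {R : A → A → Set} P x y Q → AllPairs R (P ++ x ∷ y ∷ Q) → R x y
adjacent [] x y Q ((p ∷ _) ∷ _) = p
adjacent (z ∷ P) x y Q (_ ∷ s) = adjacent P x y Q s

transpose-upTo : ∀ k n → suc k N.< n → map (transpose k) (upTo n) ↭ upTo n
transpose-upTo k n k<n = involution-↭ (transpose k) (upTo n) (UniqueP.upTo⁺ n)
  (λ p → ∈-upTo⁺ (transpose-bounded k k<n (∈-upTo⁻ p))) (λ _ → transpose-involutive k _)

map-lookup-transpose : ∀ A x y B → map (lookupL (A ++ x ∷ y ∷ B)) (map (transpose (length A)) (upTo (length (A ++ x ∷ y ∷ B)))) ≡ A ++ y ∷ x ∷ B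
map-lookup-transpose A x y B = ≡.trans (≡.sym (LP.map-∘ (upTo (length (A ++ x ∷ y ∷ B))))) (≡.trans
  (LP.map-cong (lookupL-transpose A y x B) (upTo (length (A ++ x ∷ y ∷ B))))
  (≡.trans (≡.cong (λ n → map (lookupL (A ++ y ∷ x ∷ B)) (upTo n)) same-length) (map-lookupL-upTo (A ++ y ∷ x ∷ B))))
  where
  same-length : length (A ++ x ∷ y ∷ B) ≡ length (A ++ y ∷ x ∷ B)
  same-length = ≡.trans (LP.length-++ A) (≡.sym (LP.length-++ A))

module Cosets (lam : List ℕ) (decreasing : AllPairs N._≥_ lam) where
  m : ℕ
  m = length lam

  reps : List (List ℕ)
  reps = cosetReps lam

  perm-length : ∀ {π} → π ↭ upTo m → length π ≡ m
  perm-length p = ≡.trans (↭-length p) (LP.length-upTo m)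

  rep-perm : ∀ {π} → π ∈ reps → π ↭ upTo m
  rep-perm p = permsOf-↭ (upTo m) (proj₁ (filterB-∈ (isMinRep lam) (perms m) p))

  reps-unique : Unique reps
  reps-unique = unique-filterB (isMinRep lam) (perms m) (unique-permsOf (upTo m) (UniqueP.upTo⁺ m))

  -- π is compared with π s_k, where s_k exchanges two neighbouring columns of equal height and so
  -- stabilises λ. A descent of π there would make π s_k shorter, by `invW-swap`.
  rep-lex : ∀ {π} → π ∈ reps → AllPairs Lex (zip π lam)
  rep-lex {π} p = Linked⇒AllPairs lex-trans (adjacent⇒linked (zip π lam) step)
    where
    len : length π ≡ length lam
    len = perm-length (rep-perm p)
    minimal : isMinRep lam π ≡ true
    minimal = proj₂ (filterB-∈ (isMinRep lam) (perms m) p)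
    step : ∀ P x y Q → zip π lam ≡ P ++ x ∷ y ∷ Q → Lex x y
    step P (l , h) (l' , h') Q e with NP.m≤n⇒m<n∨m≡n (adjacent P (l , h) (l' , h') Q (≡.subst (AllPairs Taller) e (decreasing-zip π decreasing)))
    ... | inj₁ h'<h = inj₁ h'<h
    ... | inj₂ ≡.refl = inj₂ (≡.refl , NP.≮⇒≥ no-drop)
      where
      π-shape : π ≡ map proj₁ P ++ l ∷ l' ∷ map proj₁ Q
      π-shape = ≡.trans (≡.sym (map-proj₁-zip π lam len)) (≡.trans (≡.cong (map proj₁) e) (LP.map-++ proj₁ P _))
      lam-shape : lam ≡ map proj₂ P ++ h ∷ h ∷ map proj₂ Q
      lam-shape = ≡.trans (≡.sym (map-proj₂-zip π lam len)) (≡.trans (≡.cong (map proj₂) e) (LP.map-++ proj₂ P _))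
      k : ℕ
      k = length P
      k<m : suc k N.< m
      k<m rewrite lam-shape | LP.length-++ (map proj₂ P) {h ∷ h ∷ map proj₂ Q} | LP.length-map proj₂ P
        | NP.+-suc (length P) (suc (length (map proj₂ Q))) | NP.+-suc (length P) (length (map proj₂ Q)) = N.s≤s (N.s≤s (NP.m≤m+n _ _))
      σ : List ℕ
      σ = map (transpose k) (upTo m)
      lookup-σ : ∀ w A x y B → length w ≡ m → length A ≡ k → w ≡ A ++ x ∷ y ∷ B → map (lookupL w) σ ≡ A ++ y ∷ x ∷ B
      lookup-σ w A x y B e e' ≡.refl = ≡.trans (≡.cong₂ (λ j n → map (lookupL w) (map (transpose j) (upTo n))) (≡.sym e') (≡.sym e)) (map-lookup-transpose A x y B)
      stab : stabB lam σ ≡ true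
      stab = ≡.trans (≡.cong (λ z → eqListB z lam) (≡.trans (lookup-σ lam (map proj₂ P) h h (map proj₂ Q) ≡.refl (LP.length-map proj₂ P) lam-shape) (≡.sym lam-shape))) (eqListB-refl lam)
      no-drop : ¬ l' N.< l
      no-drop l'<l with allB-∈ (λ σ → not (stabB lam σ) ∨ (invW π ≤ᵇ invW (compose π σ))) minimal (↭-permsOf (upTo m) (transpose-upTo k m k<m))
      ... | b rewrite stab | lookup-σ π (map proj₁ P) l l' (map proj₁ Q) len (LP.length-map proj₁ P) π-shape =
        NP.<-irrefl ≡.refl (NP.≤-trans (NP.≤-reflexive (≡.trans (≡.sym (invW-swap (map proj₁ P) (map proj₁ Q) l'<l)) (≡.cong invW (≡.sym π-shape))))
          (NP.≤ᵇ⇒≤ _ _ (≡.subst Data.Bool.T (≡.sym b) _)))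

  -- For σ in the stabiliser, π σ labels the same set of columns as π, so both have the same
  -- `crossing`. This equals the length of π and is a lower bound for the length of π σ.
  lex-rep : ∀ {π} → π ↭ upTo m → AllPairs Lex (zip π lam) → π ∈ reps
  lex-rep {π} p s = ∈-filterB (isMinRep lam) (perms m) (↭-permsOf (upTo m) p) (∈-allB _ (perms m) minimal)
    where
    len : length π ≡ m
    len = perm-length p
    minimal : ∀ {σ} → σ ∈ perms m → not (stabB lam σ) ∨ (invW π ≤ᵇ invW (compose π σ)) ≡ true
    minimal {σ} q with stabB lam σ in e
    ... | false = ≡.refl
    ... | true = ≤ᵇ-true (NP.≤-trans (NP.≤-reflexive (≡.trans (≡.sym (crossing≡invW π len s)) (≡.sym (pairCount-↭ crosses same))))
        (crossing≤invW (compose π σ) (≡.trans (LP.length-map (lookupL π) σ) σ-length) decreasing))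
      where
      σ↭ : σ ↭ upTo m
      σ↭ = permsOf-↭ (upTo m) q
      σ-length : length σ ≡ m
      σ-length = perm-length σ↭
      zipped : ∀ σ → zip (map (lookupL π) σ) (map (lookupL lam) σ) ≡ map (λ i → (lookupL π i , lookupL lam i)) σ
      zipped σ = zip-map-map (lookupL π) (lookupL lam) σ
      same : zip (compose π σ) lam ↭ zip π lam
      same = ≡.subst₂ _↭_ (≡.trans (≡.sym (zipped σ)) (≡.cong (zip (compose π σ)) (eqListB-sound _ _ e)))
        (≡.trans (≡.sym (zipped (upTo m))) (≡.cong₂ zip (≡.trans (≡.cong (λ n → map (lookupL π) (upTo n)) (≡.sym len)) (map-lookupL-upTo π)) (map-lookupL-upTo lam)))
        (map⁺ (λ i → (lookupL π i , lookupL lam i)) σ↭)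

  -- relabelling a representative and re-sorting the labels of equally high columns
  act : (ℕ → ℕ) → List ℕ → List ℕ
  act f π = map proj₁ (isort (zip (map f π) lam))

  module _ {f : ℕ → ℕ} (f-permutes : map f (upTo m) ↭ upTo m) where
    image-perm : ∀ {π} → π ↭ upTo m → map f π ↭ upTo m
    image-perm p = ↭-trans (map⁺ f p) f-permutes

    -- Sorting keeps the multiset of heights, and a decreasing list is determined by its multiset.
    -- So the heights of the sorted columns form λ again.
    zip-act : ∀ {π} → π ↭ upTo m → zip (act f π) lam ≡ isort (zip (map f π) lam)
    zip-act {π} p = ≡.trans (≡.cong (zip (act f π)) (≡.sym heights)) (zip-projections (isort (zip (map f π) lam)))
      where
      Z : State
      Z = zip (map f π) lam
      heights : map proj₂ (isort Z) ≡ lam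
      heights = sorted-unique (λ a b → NP.≤-antisym b a)
        (taller⇒decreasing (AllPairs.map lex⇒taller (isort-sorted Z))) decreasing
        (≡.subst (map proj₂ (isort Z) ↭_) (map-proj₂-zip (map f π) lam (perm-length (image-perm p))) (map⁺ proj₂ (isort-↭ Z)))

    zip-act-↭ : ∀ {π} → π ↭ upTo m → zip (act f π) lam ↭ relabel f (zip π lam)
    zip-act-↭ {π} p = ≡.subst₂ _↭_ (≡.sym (zip-act p)) (zip-relabel f π lam) (isort-↭ (zip (map f π) lam))

    act-perm : ∀ {π} → π ↭ upTo m → act f π ↭ upTo m
    act-perm {π} p = ↭-trans (≡.subst (act f π ↭_) (map-proj₁-zip (map f π) lam (perm-length (image-perm p))) (map⁺ proj₁ (isort-↭ (zip (map f π) lam)))) (image-perm p)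

    act-rep : ∀ {π} → π ∈ reps → act f π ∈ reps
    act-rep {π} r = lex-rep (act-perm (rep-perm r)) (≡.subst (AllPairs Lex) (≡.sym (zip-act (rep-perm r))) (isort-sorted (zip (map f π) lam)))

    -- Both lists of columns are sorted by the antisymmetric relation `Lex`, so they are determined
    -- by their multiset.
    rep-unique-state : ∀ {π ρ} → π ∈ reps → ρ ∈ reps → zip π lam ↭ zip ρ lam → π ≡ ρ
    rep-unique-state {π} {ρ} r r' p = ≡.trans (≡.sym (map-proj₁-zip π lam (perm-length (rep-perm r))))
      (≡.trans (≡.cong (map proj₁) (sorted-unique lex-antisym (rep-lex r) (rep-lex r') p)) (map-proj₁-zip ρ lam (perm-length (rep-perm r'))))

    act-involutive : (∀ {p} → p N.< m → f (f p) ≡ p) → ∀ {π} → π ∈ reps → act f (act f π) ≡ π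
    act-involutive inv {π} r = rep-unique-state (act-rep (act-rep r)) r (↭-trans (zip-act-↭ (act-perm (rep-perm r)))
        (↭-trans (map⁺ _ (zip-act-↭ (rep-perm r))) (≡.subst (_↭ zip π lam) (≡.sym (twice (zip π lam) bounded)) ↭-refl)))
      where
      bounded : All (λ x → proj₁ x N.< m) (zip π lam)
      bounded = all-zip lam (All-resp-↭ (↭-sym (rep-perm r)) (All.tabulate ∈-upTo⁻))
      twice : ∀ L → All (λ x → proj₁ x N.< m) L → relabel f (relabel f L) ≡ L
      twice [] [] = ≡.refl
      twice ((l , h) ∷ L) (p ∷ ps) = ≡.cong₂ _∷_ (≡.cong (_, h) (inv p)) (twice L ps)

    reindex : (∀ {p} → p N.< m → f (f p) ≡ p) → map (act f) reps ↭ reps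
    reindex inv = involution-↭ (act f) reps reps-unique act-rep (act-involutive inv)

-- The action of reduced words

-- Exchanging k and k + 1 leaves their comparisons with all other labels unchanged. Only the pair of
-- these two columns matters: the taller one receives the larger label, which creates one crossing.
crossing-transpose : ∀ k {Z g g'} → Unique (map proj₁ Z) → (k , g) ∈ Z → (suc k , g') ∈ Z → g' N.< g →
  crossing (relabel (transpose k) Z) ≡ suc (crossing Z)
crossing-transpose k {Z} {g} {g'} U p q g'<g with extract p
... | Y₁ , e₁ with ∈-resp-↭ e₁ q
...   | here e = ⊥-elim (NP.1+n≢n (≡.cong proj₁ e))
...   | there q' with extract q'
...     | Y , e₂ with ↭-trans e₁ (↭-prep (k , g) e₂)
...       | e with unique-↭ (map⁺ proj₁ e) U
...         | (_ ∷ a) ∷ b ∷ _ =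
  ≡.trans (pairCount-↭ crosses (map⁺ _ e)) (≡.trans (≡.cong₂ (λ x y → crossing ((x , g) ∷ (y , g') ∷ relabel (transpose k) Y)) (transpose-lower k) (transpose-upper k))
    (≡.trans (≡.cong (λ W → crossing ((suc k , g) ∷ (k , g') ∷ W)) (fixed Y (AllP.map⁻ a) (AllP.map⁻ b)))
    (≡.trans compare-crossings (≡.cong suc (≡.sym (pairCount-↭ crosses e))))))
  where
  fixed : ∀ Y → All (λ x → ¬ k ≡ proj₁ x) Y → All (λ x → ¬ suc k ≡ proj₁ x) Y → relabel (transpose k) Y ≡ Y
  fixed Y a b = relabel-absent k Y (mem-absent k Y a) (mem-absent (suc k) Y b)
  up : ∀ h → countB (crosses (suc k , h)) Y ≡ countB (crosses (k , h)) Y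
  up h = countB-cong (crosses (suc k , h)) (crosses (k , h)) (All.map (λ {x} k≢ → ≡.cong ((proj₂ x <ᵇ h) ∧_) (<ᵇ-suc (proj₁ x) k (λ e → k≢ (≡.sym e)))) (AllP.map⁻ a))
  down : ∀ h → countB (λ y → crosses y (suc k , h)) Y ≡ countB (λ y → crosses y (k , h)) Y
  down h = countB-cong (λ y → crosses y (suc k , h)) (λ y → crosses y (k , h)) (All.map (λ {x} sk≢ → ≡.cong ((h <ᵇ proj₂ x) ∧_) (≡.sym (suc-<ᵇ k (proj₁ x) (λ e → sk≢ (≡.sym e))))) (AllP.map⁻ b))
  compare-crossings : crossing ((suc k , g) ∷ (k , g') ∷ Y) ≡ suc (crossing ((k , g) ∷ (suc k , g') ∷ Y))
  compare-crossings
    rewrite countB-∷ (crosses (suc k , g)) (k , g') Y | countB-∷ (λ y → crosses y (suc k , g)) (k , g') Y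
          | countB-∷ (crosses (k , g)) (suc k , g') Y | countB-∷ (λ y → crosses y (k , g)) (suc k , g') Y
          | <ᵇ-true g'<g | <ᵇ-false (NP.<⇒≤ g'<g) | <ᵇ-true (NP.n<1+n k) | <ᵇ-false (NP.n≤1+n k)
          | up g | down g | up g' | down g' = ≡.refl

countB-sum : ∀ {A : Set} (p q r : A → Bool) {xs} → All (λ x → bit (p x) N.+ bit (q x) ≡ bit (r x)) xs →
  countB p xs N.+ countB q xs ≡ countB r xs
countB-sum p q r [] = ≡.refl
countB-sum p q r {x ∷ xs} (e ∷ es) rewrite countB-∷ p x xs | countB-∷ q x xs | countB-∷ r x xs | ≡.sym e | ≡.sym (countB-sum p q r es) =
  shuffle (bit (p x)) (countB p xs) (bit (q x)) (countB q xs)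
  where
  shuffle : ∀ a b c d → (a N.+ b) N.+ (c N.+ d) ≡ (a N.+ c) N.+ (b N.+ d)
  shuffle = solve-∀ℕ

Reverses : ℕ → (ℕ → ℕ) → Set
Reverses m f = ∀ {l l'} → l N.< m → l' N.< m → ¬ l ≡ l' → bit (f l' <ᵇ f l) N.+ bit (l' <ᵇ l) ≡ 1

-- Two columns of different heights cross either before or after the reversal and never both times,
-- so each such pair is counted exactly once on the left.
crossing-reverse : ∀ {m f} → Reverses m f → ∀ {Z} → Unique (map proj₁ Z) → Bounded m Z →
  crossing (relabel f Z) N.+ crossing Z ≡ pairCount drops Z
crossing-reverse rev {[]} [] [] = ≡.refl
crossing-reverse {m} {f} rev {(l , h) ∷ Z} (a ∷ U) (p ∷ B)
  rewrite countB-map (crosses (f l , h)) (λ x → (f (proj₁ x) , proj₂ x)) Z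
        | countB-map (λ y → crosses y (f l , h)) (λ x → (f (proj₁ x) , proj₂ x)) Z =
  ≡.trans (shuffle (countB p₁ Z) (countB p₂ Z) (crossing (relabel f Z)) (countB q₁ Z) (countB q₂ Z) (crossing Z)) (≡.cong₂ N._+_ (≡.cong₂ N._+_
    (countB-sum p₁ q₁ (drops (l , h)) (All.zipWith (λ {x} (q , e) → split (proj₂ x <ᵇ h) (f (proj₁ x) <ᵇ f l) (proj₁ x <ᵇ l) (rev p q e)) (B , AllP.map⁻ a)))
    (countB-sum p₂ q₂ (λ y → drops y (l , h)) (All.zipWith (λ {x} (q , e) → split (h <ᵇ proj₂ x) (f l <ᵇ f (proj₁ x)) (l <ᵇ proj₁ x) (rev q p (λ e' → e (≡.sym e')))) (B , AllP.map⁻ a))))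
    (crossing-reverse {m} {f} rev U B))
  where
  shuffle : ∀ a b c d e f → (a N.+ b N.+ c) N.+ (d N.+ e N.+ f) ≡ ((a N.+ d) N.+ (b N.+ e)) N.+ (c N.+ f)
  shuffle = solve-∀ℕ
  p₁ p₂ q₁ q₂ : ℕ × ℕ → Bool
  p₁ x = crosses (f l , h) (f (proj₁ x) , proj₂ x)
  p₂ x = crosses (f (proj₁ x) , proj₂ x) (f l , h)
  q₁ = crosses (l , h)
  q₂ x = crosses x (l , h)
  split : ∀ c x y → bit x N.+ bit y ≡ 1 → bit (c ∧ x) N.+ bit (c ∧ y) ≡ bit c
  split true x y e = e
  split false x y e = ≡.refl

lex-before : ∀ {p q g g' Z} → AllPairs Lex Z → (p , g) ∈ Z → (q , g') ∈ Z → p N.< q → g' N.≤ g → Before p q Z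
lex-before _ (here ≡.refl) (here e) p<q _ = ⊥-elim (NP.<⇒≢ p<q (≡.sym (≡.cong proj₁ e)))
lex-before _ (here ≡.refl) (there b) p<q _ = here (∈-mem b)
  where
  ∈-mem : ∀ {q g L} → (q , g) ∈ L → mem q L ≡ true
  ∈-mem {q} (here ≡.refl) rewrite ≡ᵇ-refl q = ≡.refl
  ∈-mem {q} {L = (l , _) ∷ L} (there r) = ∨-true-right (l ≡ᵇ q) (∈-mem r)
lex-before (a ∷ _) (there b) (here ≡.refl) p<q le with All.lookup a b
... | inj₁ g<g' = ⊥-elim (NP.<⇒≱ g<g' le)
... | inj₂ (_ , q≤p) = ⊥-elim (NP.<⇒≱ p<q q≤p)
lex-before (_ ∷ s) (there b) (there c) p<q le = there (lex-before s b c p<q le)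

meas-↭ : ∀ {L L'} → L ↭ L' → meas L ≡ meas L'
meas-↭ ↭.refl = ≡.refl
meas-↭ (↭.prep (l , h) p) = ≡.cong (suc h N.+_) (meas-↭ p)
meas-↭ (↭.swap {xs} {ys} (l , h) (k , g) p) rewrite meas-↭ p = shuffle (suc h) (suc g) (meas ys)
  where
  shuffle : ∀ a b c → a N.+ (b N.+ c) ≡ b N.+ (a N.+ c)
  shuffle = solve-∀ℕ
meas-↭ (↭.trans p q) = ≡.trans (meas-↭ p) (meas-↭ q)

meas-heights : ∀ L L' → map proj₂ L ≡ map proj₂ L' → meas L ≡ meas L'
meas-heights [] [] e = ≡.refl
meas-heights ((l , h) ∷ L) ((l' , h') ∷ L') e = ≡.cong₂ (λ x y → suc x N.+ y) (LP.∷-injectiveˡ e) (meas-heights L L' (LP.∷-injectiveʳ e))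

taller-relabel : ∀ f {Z} → AllPairs Taller Z → AllPairs Taller (relabel f Z)
taller-relabel f s = AllPairsP.map⁺ s

module Words (S : Setting) where
  open Setting S hiding (refl; sym; trans; zero)
  private module K = Setting S
  open IntegerSolver scalars
  open Core S
  open Exchange S
  open Columns S

  Tw : List ℕ → M → M
  Tw [] f = f
  Tw (k ∷ w) f = T k (Tw w f)

  Tinv : ℕ → M → M
  Tinv k f = t⁻¹ · T k f ⊞ (t⁻¹ - 1#) · f

  TwInv : List ℕ → M → M
  TwInv [] f = f
  TwInv (k ∷ w) f = TwInv w (Tinv k f)

  Tw-linear : ∀ w → Linear (Tw w)
  Tw-linear [] = record { cong = λ e → e ; add = λ f g → ≋-refl ; scale = λ c f → ≋-refl }
  Tw-linear (k ∷ w) = record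
    { cong = λ e → T.cong k (L.cong e)
    ; add = λ f g → ≋-trans (T.cong k (L.add f g)) (T.add k _ _)
    ; scale = λ c f → ≋-trans (T.cong k (L.scale c f)) (T.scale k c _) }
    where module L = Linear (Tw-linear w)

  Tinv-linear : ∀ k → Linear (Tinv k)
  Tinv-linear k = record
    { cong = λ e → ⊞-cong (·-cong K.refl (T.cong k e)) (·-cong K.refl e)
    ; add = λ f g → ≋-trans (⊞-cong (·-cong K.refl (T.add k f g)) ≋-refl)
        (combine (t⁻¹ :· (x₀ :⊞ x₁) :⊞ (t⁻¹ - 1#) :· (x₂ :⊞ x₃)) ((t⁻¹ :· x₀ :⊞ (t⁻¹ - 1#) :· x₂) :⊞ (t⁻¹ :· x₁ :⊞ (t⁻¹ - 1#) :· x₃))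
          (T k f ∷ⱽ T k g ∷ⱽ f ∷ⱽ g ∷ⱽ []ⱽ)
          (λ v → solve 6 (λ p r a b c d → p :* (a :+ b) :+ r :* (c :+ d) := (p :* a :+ r :* c) :+ (p :* b :+ r :* d)) K.refl t⁻¹ (t⁻¹ - 1#) _ _ _ _))
    ; scale = λ c f → ≋-trans (⊞-cong (·-cong K.refl (T.scale k c f)) ≋-refl)
        (combine (t⁻¹ :· c :· x₀ :⊞ (t⁻¹ - 1#) :· c :· x₁) (c :· (t⁻¹ :· x₀ :⊞ (t⁻¹ - 1#) :· x₁)) (T k f ∷ⱽ f ∷ⱽ []ⱽ)
          (λ v → solve 5 (λ p r c a b → p :* (c :* a) :+ r :* (c :* b) := c :* (p :* a :+ r :* b)) K.refl t⁻¹ (t⁻¹ - 1#) c _ _)) }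

  TwInv-linear : ∀ w → Linear (TwInv w)
  TwInv-linear [] = Tw-linear []
  TwInv-linear (k ∷ w) = record
    { cong = λ e → L.cong (I.cong e)
    ; add = λ f g → ≋-trans (L.cong (I.add f g)) (L.add _ _)
    ; scale = λ c f → ≋-trans (L.cong (I.scale c f)) (L.scale c _) }
    where
    module L = Linear (TwInv-linear w)
    module I = Linear (Tinv-linear k)

  Tinv-T : ∀ k → suc k N.< n → ∀ f → Tinv k (T k f) ≋ f
  Tinv-T k k<n f = ≋-trans (⊞-cong (·-cong K.refl (ext (T-quadratic k k<n f))) ≋-refl) (ext λ α →
    K.trans (coef-combination (t⁻¹ :· ((t - 1#) :· x₀ :⊞ t :· x₁) :⊞ (t⁻¹ - 1#) :· x₀) (T k f ∷ⱽ f ∷ⱽ []ⱽ) α)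
    (K.trans (solve 4 (λ p t x y → p :* ((t :- :1) :* x :+ t :* y) :+ (p :- :1) :* x := (p :* t :- :1) :* x :+ (p :* t) :* y) K.refl t⁻¹ t _ _)
    (K.trans (+-cong (*-cong (+-cong t⁻¹*t K.refl) K.refl) (*-cong t⁻¹*t K.refl))
    (solve 2 (λ x y → (:1 :- :1) :* x :+ :1 :* y := y) K.refl _ _))))

  TwInv-Tw : ∀ w → All (λ k → suc k N.< n) w → ∀ f → TwInv w (Tw w f) ≋ f
  TwInv-Tw [] [] f = ≋-refl
  TwInv-Tw (k ∷ w) (p ∷ ps) f = ≋-trans (Linear.cong (TwInv-linear w) (Tinv-T k p (Tw w f))) (TwInv-Tw w ps f)

  Tw-snoc : ∀ w k f → Tw (w ++ k ∷ []) f ≡ Tw w (T k f)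
  Tw-snoc [] k f = ≡.refl
  Tw-snoc (j ∷ w) k f = ≡.cong (T j) (Tw-snoc w k f)

  redWord-letters : ∀ fuel w → length w ≡ n → All (λ k → suc k N.< n) (redWord fuel w)
  redWord-letters zero w e = []
  redWord-letters (suc fuel) w e with firstDescent w in d
  ... | nothing = []
  ... | just k with firstDescent-just w d
  ...   | D@(descent-at {A} {x} {y} {B} ≡.refl ≡.refl _) = AllP.++⁺
    (redWord-letters fuel (swapL (length A) (A ++ x ∷ y ∷ B)) (≡.trans (≡.cong length (swapL-++ A x y B)) (≡.trans (LP.length-++ A) (≡.trans (≡.sym (LP.length-++ A)) e))))
    (≡.subst (suc (length A) N.<_) e (descent-bound D) ∷ [])

  tz-suc : ∀ m → tz (+ suc m) ≈ t * tz (+ m)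
  tz-suc m = tz-+ (+ 1) (+ m)

  ·-· : ∀ c d f → c · (d · f) ≋ (c * d) · f
  ·-· c d f = combine (c :· d :· x₀) ((c * d) :· x₀) (f ∷ⱽ []ⱽ) (λ v → K.sym (*-assoc _ _ _))

  tz-· : ∀ i j f → tz i · (tz j · f) ≋ tz (i Z.+ j) · f
  tz-· i j f = ≋-trans (·-· (tz i) (tz j) f) (·-cong (K.sym (tz-+ i j)) ≋-refl)

  1·ₘ : ∀ f → 1# · f ≋ f
  1·ₘ f = combine (1# :· x₀) x₀ (f ∷ⱽ []ⱽ) (λ v → *-identityˡ _)

  tz0· : ∀ f → tz (+ 0) · f ≋ f
  tz0· f = ≋-trans (·-cong tz-0 ≋-refl) (1·ₘ f)

  relabel-lookup-upTo : ∀ L → Bounded n L → relabel (lookupL (upTo n)) L ≡ L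
  relabel-lookup-upTo [] [] = ≡.refl
  relabel-lookup-upTo ((l , h) ∷ L) (p ∷ B) = ≡.cong₂ _∷_ (≡.cong (_, h) (lookupL-upTo n p)) (relabel-lookup-upTo L B)

  relabel-∘ : ∀ f g {h} → (∀ x → f (g x) ≡ h x) → ∀ L → relabel f (relabel g L) ≡ relabel h L
  relabel-∘ f g e [] = ≡.refl
  relabel-∘ f g e ((l , x) ∷ L) = ≡.cong₂ _∷_ (≡.cong (_, x) (e l)) (relabel-∘ f g e L)

  bounded-transpose : ∀ k → suc k N.< n → ∀ {L} → Bounded n L → Bounded n (relabel (transpose k) L)
  bounded-transpose k k<n B = AllP.map⁺ (All.map (transpose-bounded k k<n) B)

  -- Every inversion of w is a pair of labels standing in its original order in `L`. This is what
  -- `T-G` demands of the letter applied first, and it passes to the remaining permutation and the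
  -- relabelled state.
  Additive : List ℕ → State → Set
  Additive w L = ∀ p q → p N.< q → q N.< n → lookupL w q N.< lookupL w p → Before p q L

  sorted-case : ∀ N w L → w ↭ upTo n → Bounded n L → Linked N._≤_ w → G N L ≋ tz (+ invW w) · G N (relabel (lookupL w) L)
  sorted-case N w L p B s with sorted-word s p
  ... | ≡.refl = ≋-sym (≋-trans (·-cong (K.reflexive (≡.cong (λ z → tz (+ z)) (invW-sorted (upTo n) (≤-pairs s)))) (≋-reflexive (≡.cong (G N) (relabel-lookup-upTo L B)))) (tz0· _))

  -- Each letter of a reduced word of w exchanges two labels that are still in
  -- their original order, so every step contributes the factor t.
  Tw-G : ∀ fuel N w L → w ↭ upTo n → invW w N.≤ fuel → Uniq L → Bounded n L → Additive w L →
    Tw (redWord fuel w) (G N L) ≋ tz (+ invW w) · G N (relabel (lookupL w) L)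
  Tw-G zero N w L p le U B add with firstDescent w in d
  ... | nothing = sorted-case N w L p B (firstDescent-nothing w d)
  ... | just k with firstDescent-just w d
  ...   | descent-at {A} {x} {y} {C} ≡.refl _ y<x with () ← NP.≤-trans (NP.≤-reflexive (≡.sym (invW-swap A C y<x))) le
  Tw-G (suc fuel) N w L p le U B add with firstDescent w in d
  ... | nothing = sorted-case N w L p B (firstDescent-nothing w d)
  ... | just k with firstDescent-just w d
  ...   | D@(descent-at {A} {x} {y} {C} ≡.refl ≡.refl y<x) rewrite swapL-++ A x y C = begin
    Tw (redWord fuel w' ++ length A ∷ []) (G N L) ≈⟨ ≋-reflexive (Tw-snoc (redWord fuel w') (length A) (G N L)) ⟩
    Tw (redWord fuel w') (T (length A) (G N L)) ≈⟨ Linear.cong (Tw-linear (redWord fuel w')) (T-G (length A) k<n N L U (before⇒ordered (length A) U initial)) ⟩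
    Tw (redWord fuel w') (t · G N L') ≈⟨ Linear.scale (Tw-linear (redWord fuel w')) t _ ⟩
    t · Tw (redWord fuel w') (G N L')
      ≈⟨ ·-cong K.refl (Tw-G fuel N w' L' p' (NP.≤-pred (NP.≤-trans (NP.≤-reflexive (≡.sym (invW-swap A C y<x))) le)) (uniq-relabel (length A) U) (bounded-transpose (length A) k<n B) add') ⟩
    t · (tz (+ invW w') · G N (relabel (lookupL w') L')) ≈⟨ ·-· _ _ _ ⟩
    (t * tz (+ invW w')) · G N (relabel (lookupL w') L')
      ≈⟨ ·-cong (K.trans (K.sym (tz-suc (invW w'))) (K.reflexive (≡.cong (λ z → tz (+ z)) (≡.sym (invW-swap A C y<x)))))
           (≋-reflexive (≡.cong (G N) (relabel-∘ (lookupL w') (transpose (length A)) (lookupL-transpose A x y C) L))) ⟩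
    tz (+ invW (A ++ x ∷ y ∷ C)) · G N (relabel (lookupL (A ++ x ∷ y ∷ C)) L) ∎
    where
    open ≋-Reasoning
    w' : List ℕ
    w' = A ++ y ∷ x ∷ C
    L' : State
    L' = relabel (transpose (length A)) L
    k<n : suc (length A) N.< n
    k<n = ≡.subst (suc (length A) N.<_) (≡.trans (↭-length p) (LP.length-upTo n)) (descent-bound D)
    p' : w' ↭ upTo n
    p' = ↭-trans (++⁺ˡ A (↭-swap y x ↭-refl)) p
    at-k : ∀ u v → lookupL (A ++ u ∷ v ∷ C) (length A) ≡ u
    at-k u v = ≡.trans (≡.cong (lookupL (A ++ u ∷ v ∷ C)) (≡.sym (NP.+-identityʳ (length A)))) (lookupL-++ʳ A (u ∷ v ∷ C) 0)
    at-k+1 : ∀ u v → lookupL (A ++ u ∷ v ∷ C) (suc (length A)) ≡ v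
    at-k+1 u v = ≡.trans (≡.cong (lookupL (A ++ u ∷ v ∷ C)) (≡.sym (NP.+-comm (length A) 1))) (lookupL-++ʳ A (u ∷ v ∷ C) 1)
    initial : Before (length A) (suc (length A)) L
    initial = add (length A) (suc (length A)) (NP.n<1+n _) k<n (≡.subst₂ N._<_ (≡.sym (at-k+1 x y)) (≡.sym (at-k x y)) y<x)
    add' : Additive w' L'
    add' i j i<j j<n drop = ≡.subst₂ (λ a b → Before a b L') (transpose-involutive (length A) i) (transpose-involutive (length A) j)
      (before-relabel (transpose (length A)) (add (transpose (length A) i) (transpose (length A) j)
        (transpose-mono (length A) i<j not-pair) (transpose-bounded (length A) k<n j<n)
        (≡.subst₂ N._<_ (≡.sym (lookupL-transpose A y x C j)) (≡.sym (lookupL-transpose A y x C i)) drop)))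
      where
      not-pair : ¬ (i ≡ length A × j ≡ suc (length A))
      not-pair (≡.refl , ≡.refl) = NP.<-asym y<x (≡.subst₂ N._<_ (at-k+1 y x) (at-k y x) drop)

  redWord-step : ∀ fuel w {k} → firstDescent w ≡ just k → redWord (suc fuel) w ≡ redWord fuel (swapL k w) ++ k ∷ []
  redWord-step fuel w d with firstDescent w
  redWord-step fuel w ≡.refl | just k = ≡.refl

  -- The canonical word sorts a prefix of w before touching the rest.
  record PrefixSorted (fuel : ℕ) (xs ys : List ℕ) (f : M) : Set where
    field
      xs' : List ℕ
      fuel' steps : ℕ
      permuted : xs' ↭ xs
      sorted : Linked N._≤_ xs'
      enough : invW (xs' ++ ys) N.≤ fuel'
      inversions : invW (xs ++ ys) ≡ steps N.+ invW (xs' ++ ys)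
      value : Tw (redWord fuel (xs ++ ys)) f ≋ tz (+ steps) · Tw (redWord fuel' (xs' ++ ys)) f

  -- `firstDescent` finds the leftmost descent, so while the prefix is unsorted the letter applied
  -- next lies inside it and acts on f as t. As f changes only by a scalar, the hypothesis can be
  -- used again.
  sort-prefix : ∀ fuel xs ys f → invW (xs ++ ys) N.≤ fuel → (∀ k → suc k N.< length xs → T k f ≋ t · f) → PrefixSorted fuel xs ys f
  sort-prefix zero xs ys f le sym with firstDescent xs in d
  ... | nothing = record { xs' = xs ; fuel' = 0 ; steps = 0 ; permuted = ↭-refl ; sorted = firstDescent-nothing xs d ; enough = le ; inversions = ≡.refl ; value = ≋-sym (tz0· _) }
  ... | just k with firstDescent-just xs d
  ...   | descent-at {A} {x} {y} {C} ≡.refl _ y<x rewrite LP.++-assoc A (x ∷ y ∷ C) ys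
          with () ← NP.≤-trans (NP.≤-reflexive (≡.sym (invW-swap A (C ++ ys) y<x))) le
  sort-prefix (suc fuel) xs ys f le sym with firstDescent xs in d
  ... | nothing = record { xs' = xs ; fuel' = suc fuel ; steps = 0 ; permuted = ↭-refl ; sorted = firstDescent-nothing xs d ; enough = le ; inversions = ≡.refl ; value = ≋-sym (tz0· _) }
  ... | just k with firstDescent-just xs d
  ...   | D@(descent-at {A} {x} {y} {C} ≡.refl ≡.refl y<x) = record
    { xs' = xs' ; fuel' = fuel' ; steps = suc steps
    ; permuted = ↭-trans permuted (++⁺ˡ A (↭-swap y x ↭-refl))
    ; sorted = sorted ; enough = enough
    ; inversions = ≡.trans (≡.cong invW (LP.++-assoc A (x ∷ y ∷ C) ys)) (≡.trans (invW-swap A (C ++ ys) y<x)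
        (≡.cong suc (≡.trans (≡.cong invW (≡.sym (LP.++-assoc A (y ∷ x ∷ C) ys))) inversions)))
    ; value = ≋-trans (≋-reflexive (≡.trans (≡.cong (λ z → Tw z f) (redWord-step fuel ((A ++ x ∷ y ∷ C) ++ ys) (firstDescent-++ (A ++ x ∷ y ∷ C) ys d))) (≡.trans (Tw-snoc (redWord fuel (swapL (length A) ((A ++ x ∷ y ∷ C) ++ ys))) (length A) f)
          (≡.cong (λ z → Tw (redWord fuel z) (T (length A) f)) swapped))))
        (≋-trans (Linear.cong (Tw-linear W) (sym (length A) (descent-bound D))) (≋-trans (Linear.scale (Tw-linear W) t f)
        (≋-trans (·-cong K.refl value) (≋-trans (·-· _ _ _) (·-cong (K.sym (tz-suc steps)) ≋-refl))))) }
    where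
    W : List ℕ
    W = redWord fuel ((A ++ y ∷ x ∷ C) ++ ys)
    swapped : swapL (length A) ((A ++ x ∷ y ∷ C) ++ ys) ≡ (A ++ y ∷ x ∷ C) ++ ys
    swapped = ≡.trans (≡.cong (swapL (length A)) (LP.++-assoc A (x ∷ y ∷ C) ys)) (≡.trans (swapL-++ A x y (C ++ ys)) (≡.sym (LP.++-assoc A (y ∷ x ∷ C) ys)))
    le' : invW ((A ++ y ∷ x ∷ C) ++ ys) N.≤ fuel
    le' = NP.≤-pred (NP.≤-trans (NP.≤-reflexive (≡.trans (≡.cong (λ z → suc (invW z)) (LP.++-assoc A (y ∷ x ∷ C) ys))
      (≡.trans (≡.sym (invW-swap A (C ++ ys) y<x)) (≡.cong invW (≡.sym (LP.++-assoc A (x ∷ y ∷ C) ys)))))) le)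
    same-length : length (A ++ y ∷ x ∷ C) ≡ length (A ++ x ∷ y ∷ C)
    same-length = ≡.trans (LP.length-++ A) (≡.sym (LP.length-++ A))
    open PrefixSorted (sort-prefix fuel (A ++ y ∷ x ∷ C) ys f le' (λ k b → sym k (≡.subst (suc k N.<_) same-length b)))

  bubble : ∀ N A B l h D → All (λ x → proj₂ x ≡ h) B → meas (A ++ B ++ (l , h) ∷ D) N.≤ N →
    G N (A ++ B ++ (l , h) ∷ D) ≋ G N (A ++ (l , h) ∷ B ++ D)
  bubble N A [] l h D [] le = ≋-refl
  bubble N A ((b , _) ∷ B) l h D (≡.refl ∷ es) le = begin
    G N (A ++ (b , h) ∷ B ++ (l , h) ∷ D) ≈⟨ ≋-reflexive (≡.cong (G N) (≡.sym (LP.++-assoc A _ _))) ⟩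
    G N ((A ++ (b , h) ∷ []) ++ B ++ (l , h) ∷ D) ≈⟨ bubble N (A ++ (b , h) ∷ []) B l h D es (≡.subst (λ z → meas z N.≤ N) (≡.sym (LP.++-assoc A _ _)) le) ⟩
    G N ((A ++ (b , h) ∷ []) ++ (l , h) ∷ B ++ D) ≈⟨ ≋-reflexive (≡.cong (G N) (LP.++-assoc A _ _)) ⟩
    G N (A ++ (b , h) ∷ (l , h) ∷ B ++ D) ≈⟨ G-swap N A b l h (B ++ D) (≡.subst (N._≤ N) (meas-↭ (++⁺ˡ A (↭-prep (b , h) (shift (l , h) B D)))) le) ⟩
    G N (A ++ (l , h) ∷ (b , h) ∷ B ++ D) ∎
    where open ≋-Reasoning

  -- Two decreasing arrangements of the same columns differ only within runs of equal height. The
  -- head of one is moved by `bubble` to the front of the other, past columns that all have its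
  -- height.
  G-decreasing : ∀ N A Z Z' R → AllPairs Taller Z → AllPairs Taller Z' → Z ↭ Z' → meas (A ++ Z ++ R) N.≤ N →
    G N (A ++ Z ++ R) ≋ G N (A ++ Z' ++ R)
  G-decreasing N A [] [] R s s' p le = ≋-refl
  G-decreasing N A [] (x ∷ Z') R s s' p le with () ← ↭-length p
  G-decreasing N A ((l , h) ∷ Z) Z' R (a ∷ s) s' p le with ∈-∃++ (∈-resp-↭ p (here ≡.refl))
  ... | B , C , ≡.refl = ≋-sym (begin
    G N (A ++ (B ++ (l , h) ∷ C) ++ R) ≈⟨ ≋-reflexive (≡.cong (λ z → G N (A ++ z)) (LP.++-assoc B _ R)) ⟩
    G N (A ++ B ++ (l , h) ∷ C ++ R)
      ≈⟨ bubble N A B l h (C ++ R) heights (≡.subst (N._≤ N) (meas-↭ (++⁺ˡ A (≡.subst ((l , h) ∷ Z ++ R ↭_) (LP.++-assoc B _ R) (++⁺ʳ R p)))) le) ⟩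
    G N (A ++ (l , h) ∷ B ++ C ++ R) ≈⟨ ≋-reflexive (≡.cong (λ z → G N (A ++ (l , h) ∷ z)) (≡.sym (LP.++-assoc B C R))) ⟩
    G N (A ++ (l , h) ∷ (B ++ C) ++ R) ≈⟨ ≋-reflexive (≡.cong (G N) (≡.sym (LP.++-assoc A _ _))) ⟩
    G N ((A ++ (l , h) ∷ []) ++ (B ++ C) ++ R)
      ≈⟨ ≋-sym (G-decreasing N (A ++ (l , h) ∷ []) Z (B ++ C) R s (omit B s') (drop-∷ (↭-trans p (shift (l , h) B C)))
           (≡.subst (λ z → meas z N.≤ N) (≡.sym (LP.++-assoc A _ _)) le)) ⟩
    G N ((A ++ (l , h) ∷ []) ++ Z ++ R) ≈⟨ ≋-reflexive (≡.cong (G N) (LP.++-assoc A _ _)) ⟩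
    G N (A ++ (l , h) ∷ Z ++ R) ∎)
    where
    open ≋-Reasoning
    omit : ∀ B {x C} → AllPairs Taller (B ++ x ∷ C) → AllPairs Taller (B ++ C)
    omit [] (_ ∷ s) = s
    omit (b ∷ B) (a ∷ s) = omit₁ B a ∷ omit B s
      where
      omit₁ : ∀ B {x C} → All (Taller b) (B ++ x ∷ C) → All (Taller b) (B ++ C)
      omit₁ [] (_ ∷ a) = a
      omit₁ (c ∷ B) (p ∷ a) = p ∷ omit₁ B a
    above : ∀ B {C} → AllPairs Taller (B ++ (l , h) ∷ C) → All (λ x → h N.≤ proj₂ x) B
    above [] _ = []
    above (b ∷ B) (a ∷ s) = All.lookup a (∈-++⁺ʳ B (here ≡.refl)) ∷ above B s
    under : All (λ x → proj₂ x N.≤ h) B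
    under = AllP.++⁻ˡ B (All-resp-↭ p (NP.≤-refl ∷ a))
    heights : All (λ x → proj₂ x ≡ h) B
    heights = All.zipWith (λ (p , q) → NP.≤-antisym p q) (under , above B s')

-- Reversal of the two blocks of labels below and from k on

data Block (k u : ℕ) : Set where
  left : u N.< k → (u <ᵇ k) ≡ true → Block k u
  right : k N.≤ u → (u <ᵇ k) ≡ false → Block k u

block : ∀ k u → Block k u
block k u with NP.<-≤-connex u k
... | inj₁ p = left p (<ᵇ-true p)
... | inj₂ p = right p (<ᵇ-false p)

∸-order : ∀ {c l u} → l N.< u → u N.< c → (c ∸ suc u) N.< (c ∸ suc l)
∸-order l<u u<c = NP.∸-monoʳ-< (N.s≤s l<u) u<c

∸-reflect : ∀ {c u} → u N.< c → c ∸ suc (c ∸ suc u) ≡ u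
∸-reflect {c} {u} p = ≡.trans (≡.cong (λ z → z ∸ suc (c ∸ suc u)) (≡.trans (≡.sym (NP.m∸n+n≡m p)) (NP.+-suc (c ∸ suc u) u)))
  (NP.m+n∸m≡n (c ∸ suc u) u)

reverses-∸ : ∀ c → Reverses c (λ u → c ∸ suc u)
reverses-∸ c {l} {l'} l<c l'<c l≢l' with NP.<-cmp l l'
... | tri< p _ _ rewrite <ᵇ-true (∸-order p l'<c) | <ᵇ-false (NP.<⇒≤ p) = ≡.refl
... | tri≈ _ e _ = ⊥-elim (l≢l' e)
... | tri> _ _ p rewrite <ᵇ-true p | <ᵇ-false (NP.<⇒≤ (∸-order p l<c)) = ≡.refl

module BlockReversal (n k : ℕ) (k≤n : k N.≤ n) where
  -- With it `flip` is u ↦ k - 1 - u on the first block and u ↦ n + k - 1 - u on the second; for k =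
  -- n there is a single block.
  total : ℕ → ℕ
  total u = if u <ᵇ k then k else n N.+ k

  flip : ℕ → ℕ
  flip u = total u ∸ suc u

  wrap : ℕ → ℤ
  wrap u = if u <ᵇ k then + 0 else + 1

  flip-left : ∀ {u} → u N.< k → flip u ≡ k ∸ suc u
  flip-left p rewrite <ᵇ-true p = ≡.refl

  flip-right : ∀ {u} → k N.≤ u → flip u ≡ (n N.+ k) ∸ suc u
  flip-right p rewrite <ᵇ-false p = ≡.refl

  flip-left-< : ∀ {u} → u N.< k → flip u N.< k
  flip-left-< {u} p rewrite flip-left p = NP.∸-monoʳ-< {k} {suc u} {0} (N.s≤s N.z≤n) p

  below-n+k : ∀ {u} → u N.< n → u N.< n N.+ k
  below-n+k p = NP.≤-trans p (NP.m≤m+n n k)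

  flip-right-≥ : ∀ {u} → k N.≤ u → u N.< n → k N.≤ flip u
  flip-right-≥ {u} p q rewrite flip-right p =
    NP.≤-trans (NP.≤-reflexive (≡.sym (NP.m+n∸m≡n n k))) (NP.∸-monoʳ-≤ (n N.+ k) q)

  flip-right-< : ∀ {u} → k N.≤ u → u N.< n → flip u N.< n
  flip-right-< {u} p q rewrite flip-right p = NP.+-cancelʳ-< (suc u) _ _
    (NP.≤-trans (NP.≤-reflexive (≡.cong suc (NP.m∸n+n≡m (below-n+k q)))) (NP.≤-trans (N.s≤s (NP.+-monoʳ-≤ n p)) (NP.≤-reflexive (≡.sym (NP.+-suc n u)))))

  flip-< : ∀ {u} → u N.< n → flip u N.< n
  flip-< {u} p with block k u
  ... | left q _ = NP.≤-trans (flip-left-< q) k≤n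
  ... | right q _ = flip-right-< q p

  flip-involutive : ∀ {u} → u N.< n → flip (flip u) ≡ u
  flip-involutive {u} p with block k u
  ... | left q _ = ≡.trans (flip-left (flip-left-< q)) (≡.trans (≡.cong (λ z → k ∸ suc z) (flip-left q)) (∸-reflect q))
  ... | right q _ = ≡.trans (flip-right (flip-right-≥ q p)) (≡.trans (≡.cong (λ z → (n N.+ k) ∸ suc z) (flip-right q)) (∸-reflect (below-n+k p)))

  -- Inside a block the order is reversed, so exactly one of the two comparisons holds. Between the
  -- blocks the order is kept: both hold or neither does, and `wrap u` and `wrap l` differ by one
  -- accordingly.
  flip-reverses : ∀ {u l} → u N.< n → l N.< n → ¬ l ≡ u → ⟨ l <ᵇ u ⟩ Z.+ ⟨ flip l <ᵇ flip u ⟩ ≡ + 1 Z.+ (wrap u Z.- wrap l)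
  flip-reverses {u} {l} u<n l<n l≢u with block k u | block k l
  ... | left p e | left q e' rewrite e | e' = same k p q
    where
    same : ∀ c → u N.< c → l N.< c → ⟨ l <ᵇ u ⟩ Z.+ ⟨ c ∸ suc l <ᵇ c ∸ suc u ⟩ ≡ + 1
    same c p q with NP.<-cmp l u
    ... | tri< r _ _ rewrite <ᵇ-true r | <ᵇ-false (NP.<⇒≤ (∸-order r p)) = ≡.refl
    ... | tri≈ _ r _ = ⊥-elim (l≢u r)
    ... | tri> _ _ r rewrite <ᵇ-true (∸-order r q) | <ᵇ-false (NP.<⇒≤ r) = ≡.refl
  ... | right p e | right q e' rewrite e | e' = same (n N.+ k) (below-n+k u<n) (below-n+k l<n)
    where
    same : ∀ c → u N.< c → l N.< c → ⟨ l <ᵇ u ⟩ Z.+ ⟨ c ∸ suc l <ᵇ c ∸ suc u ⟩ ≡ + 1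
    same c p q with NP.<-cmp l u
    ... | tri< r _ _ rewrite <ᵇ-true r | <ᵇ-false (NP.<⇒≤ (∸-order r p)) = ≡.refl
    ... | tri≈ _ r _ = ⊥-elim (l≢u r)
    ... | tri> _ _ r rewrite <ᵇ-true (∸-order r q) | <ᵇ-false (NP.<⇒≤ r) = ≡.refl
  ... | left p e | right q e' rewrite <ᵇ-false {l} {u} (NP.<⇒≤ (NP.<-≤-trans p q)) | <ᵇ-false {flip l} {flip u} (NP.<⇒≤ (NP.<-≤-trans (flip-left-< p) (flip-right-≥ q l<n))) | e | e' = ≡.refl
  ... | right p e | left q e' rewrite <ᵇ-true {l} {u} (NP.<-≤-trans q p) | <ᵇ-true {flip l} {flip u} (NP.<-≤-trans (flip-left-< q) (flip-right-≥ p u<n)) | e | e' = ≡.refl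

  reversal : Reversal n
  reversal = record
    { φ = flip
    ; b = wrap
    ; φ-permutes = involution-↭ flip (upTo n) (UniqueP.upTo⁺ n) (λ p → ∈-upTo⁺ (flip-< (∈-upTo⁻ p))) (λ p → flip-involutive (∈-upTo⁻ p))
    ; reverses = flip-reverses
    }

reverse-upTo : ∀ n → reverse (upTo n) ≡ map (λ u → n ∸ suc u) (upTo n)
reverse-upTo n = ≡.trans (LP.reverse-applyUpTo (λ x → x) n) (≡.trans (downward n) (≡.sym (LP.map-upTo (λ u → n ∸ suc u) n)))
  where
  downward : ∀ n → applyDownFrom (λ x → x) n ≡ applyUpTo (λ u → n ∸ suc u) n
  downward zero = ≡.refl
  downward (suc n) = ≡.cong (n ∷_) (downward n)

-- `permWord` takes the square of the length as its fuel; this shows that the fuel suffices for all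
-- letters.
invW-bound : ∀ w → invW w N.≤ length w N.* length w
invW-bound [] = N.z≤n
invW-bound (x ∷ w) = NP.≤-trans (NP.+-mono-≤ (count (_<ᵇ x) w) (invW-bound w))
  (NP.≤-trans (NP.≤-trans (NP.m≤n+m _ (suc (length w))) (NP.≤-reflexive (expand (length w)))) NP.≤-refl)
  where
  count : ∀ p w → countB {ℕ} p w N.≤ length w
  count p [] = N.z≤n
  count p (y ∷ w) with p y
  ... | true = N.s≤s (count p w)
  ... | false = NP.m≤n⇒m≤1+n (count p w)
  expand : ∀ a → suc a N.+ (a N.+ a N.* a) ≡ suc a N.* suc a
  expand = solve-∀ℕ

invW-++ : ∀ xs ys → invW (xs ++ ys) ≡ invW xs N.+ invW ys N.+ sum (map (λ x → countB (λ y → y <ᵇ x) ys) xs)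
invW-++ [] ys = ≡.sym (NP.+-identityʳ (invW ys))
invW-++ (x ∷ xs) ys rewrite countB-++ (_<ᵇ x) xs ys | invW-++ xs ys =
  shuffle (countB (_<ᵇ x) xs) (countB (_<ᵇ x) ys) (invW xs) (invW ys) (sum (map (λ x → countB (λ y → y <ᵇ x) ys) xs))
  where
  shuffle : ∀ a b c d e → (a N.+ b) N.+ (c N.+ d N.+ e) ≡ (a N.+ c) N.+ d N.+ (b N.+ e)
  shuffle = solve-∀ℕ

invW-below : ∀ {xs ys} → All (λ x → All (x N.≤_) ys) xs → invW ys ≡ 0 → invW (xs ++ ys) ≡ invW xs
invW-below {xs} {ys} a e = ≡.trans (invW-++ xs ys) (≡.trans (≡.cong₂ (λ u v → invW xs N.+ u N.+ v) e (none a)) (≡.trans (NP.+-identityʳ _) (NP.+-identityʳ _)))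
  where
  none : ∀ {xs} → All (λ x → All (x N.≤_) ys) xs → sum (map (λ x → countB (λ y → y <ᵇ x) ys) xs) ≡ 0
  none [] = ≡.refl
  none {x ∷ _} (p ∷ ps) rewrite none ps | countB-none (λ y → y <ᵇ x) ys (All.map <ᵇ-false p) = ≡.refl

before-zip : ∀ {us : List ℕ} (mu : List ℕ) → AllPairs N._<_ us → length us ≡ length mu → ∀ {p q} → p ∈ us → q ∈ us → p N.< q → Before p q (zip us mu)
before-zip {u ∷ us} (h ∷ mu) (a ∷ s) e (here ≡.refl) (here ≡.refl) p<q = ⊥-elim (NP.<-irrefl ≡.refl p<q)
before-zip {u ∷ us} (h ∷ mu) (a ∷ s) e (here ≡.refl) (there y) p<q = here (mem-zip _ us mu (NP.suc-injective e) y)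
before-zip {u ∷ us} (h ∷ mu) (a ∷ s) e (there x) (here ≡.refl) p<q = ⊥-elim (NP.<-asym p<q (All.lookup a x))
before-zip {u ∷ us} (h ∷ mu) (a ∷ s) e (there x) (there y) p<q = there (before-zip mu s (NP.suc-injective e) x y p<q)

upTo-increasing : ∀ n → AllPairs N._<_ (upTo n)
upTo-increasing n = Linked⇒AllPairs NP.<-trans (applyUpTo⁺₂ (λ x → x) n (λ i → NP.n<1+n i))

shifted-increasing : ∀ m p → AllPairs N._<_ (map (m N.+_) (upTo p))
shifted-increasing m p = AllPairsP.map⁺ (AllPairs.map (NP.+-monoʳ-< m) (upTo-increasing p))
  where import Data.List.Relation.Unary.AllPairs.Properties as AllPairsP

all-pairs-lookup : ∀ {w} → AllPairs N._≤_ w → ∀ {p q} → p N.< q → q N.< length w → lookupL w p N.≤ lookupL w q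
all-pairs-lookup (a ∷ s) {zero} {suc q} _ (N.s≤s r) = All.lookup a (lookupL-∈ _ r)
all-pairs-lookup (a ∷ s) {suc p} {suc q} (N.s≤s p<q) (N.s≤s r) = all-pairs-lookup s p<q r

relabel-cong : ∀ {f g L} → All (λ x → f (proj₁ x) ≡ g (proj₁ x)) L → relabel f L ≡ relabel g L
relabel-cong [] = ≡.refl
relabel-cong (e ∷ es) = ≡.cong₂ _∷_ (≡.cong (_, _) e) (relabel-cong es)

relabel-id : ∀ {f L} → All (λ x → f (proj₁ x) ≡ proj₁ x) L → relabel f L ≡ L
relabel-id [] = ≡.refl
relabel-id (e ∷ es) = ≡.cong₂ _∷_ (≡.cong (_, _) e) (relabel-id es)

proj₂-relabel : ∀ f L → map proj₂ (relabel f L) ≡ map proj₂ L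
proj₂-relabel f [] = ≡.refl
proj₂-relabel f (x ∷ L) = ≡.cong (_ ∷_) (proj₂-relabel f L)

-- Symmetrisation over the coset representatives

module Symmetrized (S : Setting) (lam gam : List ℕ) (decreasing : AllPairs N._≥_ lam)
  (sizes : Setting.n S ≡ length lam N.+ length gam) where
  open Setting S hiding (refl; sym; trans; zero)
  private module K = Setting S
  open IntegerSolver scalars
  open Core S
  open Exchange S
  open Columns S
  open Words S
  open Cosets lam decreasing

  mu ρ₀ : List ℕ
  mu = lam ++ gam
  ρ₀ = map (m N.+_) (upTo (length gam))

  L₀ : State
  L₀ = zip (upTo n) mu

  N₀ : ℕ
  N₀ = meas L₀

  R₀ : State
  R₀ = zip ρ₀ gam

  upTo-n : upTo n ≡ upTo m ++ ρ₀
  upTo-n = ≡.trans (≡.cong upTo sizes) (upTo-+ m (length gam))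

  m≤n : m N.≤ n
  m≤n = NP.≤-trans (NP.m≤m+n m (length gam)) (NP.≤-reflexive (≡.sym sizes))

  ρ₀-length : length ρ₀ ≡ length gam
  ρ₀-length = ≡.trans (LP.length-map (m N.+_) (upTo (length gam))) (LP.length-upTo (length gam))

  mu-length : n ≡ length mu
  mu-length = ≡.trans sizes (≡.sym (LP.length-++ lam))

  full-perm : ∀ {π} → π ↭ upTo m → π ++ ρ₀ ↭ upTo n
  full-perm p = ↭-trans (++⁺ʳ ρ₀ p) (↭-reflexive (≡.sym upTo-n))

  state : List ℕ → State
  state π = zip π lam ++ R₀

  state-zip : ∀ {π} → π ↭ upTo m → state π ≡ zip (π ++ ρ₀) mu
  state-zip {π} p = ≡.sym (zip-++ π lam ρ₀ gam (perm-length p))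

  state-uniq : ∀ {π} → π ↭ upTo m → Uniq (state π)
  state-uniq p = ≡.subst Uniq (≡.sym (state-zip p)) (uniq-zip mu (unique-↭ (↭-sym (full-perm p)) (UniqueP.upTo⁺ n)))

  state-bounded : ∀ {π} → π ↭ upTo m → Bounded n (state π)
  state-bounded p = ≡.subst (Bounded n) (≡.sym (state-zip p)) (all-zip mu (All-resp-↭ (↭-sym (full-perm p)) (All.tabulate ∈-upTo⁻)))

  zip-bounded : ∀ {π} → π ↭ upTo m → Bounded m (zip π lam)
  zip-bounded p = all-zip lam (All-resp-↭ (↭-sym p) (All.tabulate ∈-upTo⁻))

  ρ₀-≥ : All (m N.≤_) ρ₀
  ρ₀-≥ = AllP.map⁺ (All.universal (λ u → NP.m≤m+n m u) (upTo (length gam)))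

  ρ₀-< : All (N._< n) ρ₀
  ρ₀-< = AllP.map⁺ (All.tabulate (λ p → ≡.subst (_ N.<_) (≡.sym sizes) (NP.+-monoʳ-< m (∈-upTo⁻ p))))

  heights : ∀ {Z} → map proj₂ Z ≡ lam → ∀ {R} → map proj₂ R ≡ gam → meas (Z ++ R) N.≤ N₀
  heights {Z} e {R} e' = NP.≤-reflexive (meas-heights (Z ++ R) L₀ (≡.trans (LP.map-++ proj₂ Z R)
    (≡.trans (≡.cong₂ _++_ e e') (≡.sym (map-proj₂-zip (upTo n) mu (≡.trans (LP.length-upTo n) mu-length))))))

  zip-heights : ∀ {π} → π ↭ upTo m → map proj₂ (zip π lam) ≡ lam
  zip-heights {π} p = map-proj₂-zip π lam (perm-length p)

  R₀-heights : map proj₂ R₀ ≡ gam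
  R₀-heights = map-proj₂-zip ρ₀ gam ρ₀-length

  -- Σ_π t^{ℓ(π)} G over the minimal coset representatives, the labels being
  -- renamed by g on the first m columns.
  summand : (ℕ → ℕ) → State → List ℕ → M
  summand g R π = tz (+ crossing (zip π lam)) · G N₀ (relabel g (zip π lam) ++ R)

  Y : (ℕ → ℕ) → State → M
  Y g R = ΣM (summand g R) reps

  ΣM-∈ : ∀ {A : Set} {φ ψ : A → M} xs → (∀ {x} → x ∈ xs → φ x ≋ ψ x) → ΣM φ xs ≋ ΣM ψ xs
  ΣM-∈ xs f = ΣM-congᴬ (All.tabulate {P = _∈ xs} (λ p → p)) (λ x → f)

  word-length : ∀ {w} → w ↭ upTo n → length w ≡ n
  word-length p = ≡.trans (↭-length p) (LP.length-upTo n)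

  relabel-L₀ : ∀ {π} → π ↭ upTo m → relabel (lookupL (π ++ ρ₀)) L₀ ≡ state π
  relabel-L₀ {π} p = ≡.trans (≡.sym (zip-relabel (lookupL (π ++ ρ₀)) (upTo n) mu)) (≡.trans
    (≡.cong (λ z → zip z mu) (≡.trans (≡.cong (λ k → map (lookupL (π ++ ρ₀)) (upTo k)) (≡.sym (word-length (full-perm p)))) (map-lookupL-upTo (π ++ ρ₀))))
    (≡.sym (state-zip p)))

  identity-relabel : ∀ L → relabel (λ x → x) L ≡ L
  identity-relabel L = relabel-id (All.universal (λ _ → ≡.refl) L)

  -- In `L₀` the labels stand in increasing order, so every permutation is `Additive` there. The
  -- labels from m on add no inversions, which leaves the length of π as the exponent.
  Tw-rep : ∀ {π} → π ∈ reps → Tw (permWord (π ++ ρ₀)) (G N₀ L₀) ≋ summand (λ x → x) R₀ π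
  Tw-rep {π} r = ≋-trans (Tw-G _ N₀ (π ++ ρ₀) L₀ (full-perm p) (invW-bound (π ++ ρ₀)) (uniq-zip mu (UniqueP.upTo⁺ n))
      (all-zip mu (All.tabulate ∈-upTo⁻)) (λ i j i<j j<n _ → before-zip mu (upTo-increasing n) (≡.trans (LP.length-upTo n) mu-length) (∈-upTo⁺ (NP.<-trans i<j j<n)) (∈-upTo⁺ j<n) i<j))
    (·-cong (K.reflexive (≡.cong (λ z → tz (+ z)) exponent)) (≋-reflexive (≡.cong (G N₀) (≡.trans (relabel-L₀ p) (≡.cong (_++ R₀) (≡.sym (identity-relabel (zip π lam))))))))
    where
    p : π ↭ upTo m
    p = rep-perm r
    exponent : invW (π ++ ρ₀) ≡ crossing (zip π lam)
    exponent = ≡.trans (invW-below (All.map (λ q → All.map (NP.≤-trans (NP.<⇒≤ q)) ρ₀-≥) (All-resp-↭ (↭-sym p) (All.tabulate ∈-upTo⁻)))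
        (invW-sorted ρ₀ (AllPairs.map NP.<⇒≤ (shifted-increasing m (length gam)))))
      (≡.sym (crossing≡invW π (perm-length p) (rep-lex r)))

  label-in : ∀ {π} → π ↭ upTo m → ∀ {k} → k N.< m → ∃ λ g → (k , g) ∈ zip π lam
  label-in {π} p {k} k<m with ∈-map⁻ proj₁ (≡.subst (k ∈_) (≡.sym (map-proj₁-zip π lam (perm-length p))) (∈-resp-↭ (↭-sym p) (∈-upTo⁺ k<m)))
  ... | (_ , g) , q , ≡.refl = g , q

  labels-unique : ∀ {π} → π ↭ upTo m → Unique (map proj₁ (zip π lam))
  labels-unique {π} p = ≡.subst Unique (≡.sym (map-proj₁-zip π lam (perm-length p))) (unique-↭ (↭-sym p) (UniqueP.upTo⁺ m))

  module _ (k : ℕ) (k<m : suc k N.< m) where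
    s : ℕ → ℕ
    s = transpose k

    k<n : suc k N.< n
    k<n = NP.<-≤-trans k<m m≤n

    θ : List ℕ → M
    θ = summand (λ x → x) R₀

    R₀-fixed : relabel s R₀ ≡ R₀
    R₀-fixed = relabel-absent k R₀ (mem-absent k R₀ (all-zip gam (All.map (λ q e → NP.<-irrefl e (NP.≤-trans (NP.<-trans (NP.n<1+n k) k<m) q)) ρ₀-≥)))
      (mem-absent (suc k) R₀ (all-zip gam (All.map (λ q e → NP.<-irrefl e (NP.≤-trans k<m q)) ρ₀-≥)))

    T-θ : ∀ {π g g'} → π ∈ reps → (k , g) ∈ zip π lam → (suc k , g') ∈ zip π lam → g' N.≤ g →
      T k (θ π) ≋ (t * tz (+ crossing (zip π lam))) · G N₀ (relabel s (zip π lam) ++ R₀)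
    T-θ {π} r p q le = begin
      T k (tz c · G N₀ (relabel (λ x → x) (zip π lam) ++ R₀)) ≈⟨ T.scale k _ _ ⟩
      tz c · T k (G N₀ (relabel (λ x → x) (zip π lam) ++ R₀)) ≈⟨ ·-cong K.refl (T.cong k (≋-reflexive (≡.cong (λ z → G N₀ (z ++ R₀)) (identity-relabel (zip π lam))))) ⟩
      tz c · T k (G N₀ (state π)) ≈⟨ ·-cong K.refl (T-G k k<n N₀ (state π) (state-uniq (rep-perm r))
          (before⇒ordered k (state-uniq (rep-perm r)) (before-++ˡ (zip π lam) R₀ (lex-before (rep-lex r) p q (NP.n<1+n k) le)))) ⟩
      tz c · (t · G N₀ (relabel s (state π))) ≈⟨ ·-· _ _ _ ⟩
      (tz c * t) · G N₀ (relabel s (state π)) ≈⟨ ·-cong (*-comm _ _) (≋-reflexive (≡.cong (G N₀) (≡.trans (relabel-++ s (zip π lam) R₀) (≡.cong (relabel s (zip π lam) ++_) R₀-fixed)))) ⟩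
      (t * tz c) · G N₀ (relabel s (zip π lam) ++ R₀) ∎
      where
      open ≋-Reasoning
      c : ℤ
      c = + crossing (zip π lam)

    G-same : ∀ {Z Z'} → AllPairs Taller Z → AllPairs Taller Z' → Z ↭ Z' → map proj₂ Z ≡ lam →
      G N₀ (Z ++ R₀) ≋ G N₀ (relabel (λ x → x) Z' ++ R₀)
    G-same {Z} {Z'} a b p e = ≋-trans (G-decreasing N₀ [] Z Z' R₀ a b p (heights e R₀-heights))
      (≋-reflexive (≡.cong (λ z → G N₀ (z ++ R₀)) (≡.sym (identity-relabel Z'))))

    rep-taller : ∀ {π} → π ∈ reps → AllPairs Taller (zip π lam)
    rep-taller r = AllPairs.map lex⇒taller (rep-lex r)

    -- If the column labelled k is the taller one, exchanging the labels gives a representative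
    -- longer by one. The factor t of `T-G` is just the quotient of the two scalars in front of `G`.
    T-θ-exchange : ∀ {π π' g g'} → π ∈ reps → π' ∈ reps → zip π' lam ↭ relabel s (zip π lam) →
      (k , g) ∈ zip π lam → (suc k , g') ∈ zip π lam → g' N.< g → T k (θ π) ≋ θ π'
    T-θ-exchange {π} {π'} r r' e p q below = ≋-trans (T-θ r p q (NP.<⇒≤ below)) (·-cong
      (K.trans (K.sym (tz-suc (crossing (zip π lam)))) (K.reflexive (≡.cong (λ z → tz (+ z)) (≡.sym (≡.trans (pairCount-↭ crosses e) (crossing-transpose k (labels-unique (rep-perm r)) p q below))))))
      (G-same (taller-relabel s (rep-taller r)) (rep-taller r') (↭-sym e) (≡.trans (proj₂-relabel s (zip π lam)) (zip-heights (rep-perm r)))))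

    pair-symmetric : ∀ {f f'} → T k f ≋ f' → T k (f ⊞ f') ≋ t · (f ⊞ f')
    pair-symmetric {f} {f'} e = ≋-trans (T.add k f f') (≋-trans
      (⊞-cong e (≋-trans (T.cong k (≋-sym e)) (≋-trans (ext (T-quadratic k k<n f)) (⊞-cong (·-cong K.refl e) ≋-refl))))
      (combine (x₁ :⊞ ((t - 1#) :· x₁ :⊞ t :· x₀)) (t :· (x₀ :⊞ x₁)) (f ∷ⱽ f' ∷ⱽ []ⱽ)
        (λ v → solve 3 (λ t x y → y :+ ((t :- :1) :* y :+ t :* x) := t :* (x :+ y)) K.refl t _ _)))

    transpose-permutes : map s (upTo m) ↭ upTo m
    transpose-permutes = transpose-upTo k m k<m

    swapped-labels : ∀ {Z} → Unique (map proj₁ Z) → ∀ {g} → (k , g) ∈ Z → (suc k , g) ∈ Z → relabel s Z ↭ Z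
    swapped-labels {Z} U {g} p q with extract p
    ... | Z₁ , e₁ with ∈-resp-↭ e₁ q
    ...   | here e = ⊥-elim (NP.1+n≢n (≡.cong proj₁ e))
    ...   | there q' with extract q'
    ...     | Z₂ , e₂ with ↭-trans e₁ (↭-prep (k , g) e₂)
    ...       | e with unique-↭ (map⁺ proj₁ e) U
    ...         | (_ ∷ a) ∷ b ∷ _ = ↭-trans (map⁺ _ e) (↭-trans (↭-reflexive (≡.cong₂ (λ x y → x ∷ y)
                   (≡.cong (_, g) (transpose-lower k)) (≡.cong₂ _∷_ (≡.cong (_, g) (transpose-upper k))
                     (relabel-absent k Z₂ (mem-absent k Z₂ (AllP.map⁻ a)) (mem-absent (suc k) Z₂ (AllP.map⁻ b))))))
                   (↭-trans (P.swap _ _ ↭-refl) (↭-sym e)))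
      where import Data.List.Relation.Binary.Permutation.Propositional as P

    -- If the columns labelled k and k + 1 have different heights, T_k sends the shorter of the two
    -- representatives to the longer one, and the quadratic relation makes the sum an eigenvector.
    -- If the heights agree, both are the same representative, whose term is an eigenvector by
    -- itself.
    T-pair : ∀ {π} → π ∈ reps → T k (θ π ⊞ θ (act s π)) ≋ t · (θ π ⊞ θ (act s π))
    T-pair {π} r with label-in (rep-perm r) (NP.<-trans (NP.n<1+n k) k<m) | label-in (rep-perm r) k<m
    ... | g , p | g' , q with NP.<-cmp g' g
    ...   | tri< g<g _ _ = pair-symmetric (T-θ-exchange r (act-rep transpose-permutes r) (zip-act-↭ transpose-permutes (rep-perm r)) p q g<g)
    ...   | tri≈ _ ≡.refl _ = ≋-trans (T.add k _ _) (≋-trans (⊞-cong fixed (≋-trans (≋-reflexive (≡.cong (λ z → T k (θ z)) same)) (≋-trans fixed (≋-reflexive (≡.cong (λ z → t · θ z) (≡.sym same))))))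
              (≋-sym (Linear.add (·-linear t) _ _)))
      where
      swapped : relabel s (zip π lam) ↭ zip π lam
      swapped = swapped-labels (labels-unique (rep-perm r)) p q
      same : act s π ≡ π
      same = rep-unique-state transpose-permutes (act-rep transpose-permutes r) r (↭-trans (zip-act-↭ transpose-permutes (rep-perm r)) swapped)
      fixed : T k (θ π) ≋ t · θ π
      fixed = ≋-trans (T-θ r p q NP.≤-refl) (≋-trans (≋-sym (·-· _ _ _)) (·-cong K.refl (·-cong K.refl
        (G-same (taller-relabel s (rep-taller r)) (rep-taller r) swapped (≡.trans (proj₂-relabel s (zip π lam)) (zip-heights (rep-perm r)))))))
    ...   | tri> _ _ higher = ≋-trans (T.cong k (⊞-comm (θ π) (θ (act s π)))) (≋-trans (pair-symmetric
              (T-θ-exchange (act-rep transpose-permutes r) r back (image-of q (transpose-upper k)) (image-of p (transpose-lower k)) higher))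
              (·-cong K.refl (⊞-comm (θ (act s π)) (θ π))))
      where
      ⊞-comm : ∀ a b → a ⊞ b ≋ b ⊞ a
      ⊞-comm a b = combine (x₀ :⊞ x₁) (x₁ :⊞ x₀) (a ∷ⱽ b ∷ⱽ []ⱽ) (λ v → +-comm _ _)
      forth : zip (act s π) lam ↭ relabel s (zip π lam)
      forth = zip-act-↭ transpose-permutes (rep-perm r)
      back : zip π lam ↭ relabel s (zip (act s π) lam)
      back = ↭-sym (↭-trans (map⁺ _ forth) (↭-reflexive (relabel-involutive k (zip π lam))))
      image-of : ∀ {l h l'} → (l , h) ∈ zip π lam → s l ≡ l' → (l' , h) ∈ zip (act s π) lam
      image-of x ≡.refl = ∈-resp-↭ (↭-sym forth) (∈-map⁺ (λ x → (s (proj₁ x) , proj₂ x)) x)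

    -- Orbits of `act s` have one or two elements. Adding to the sum its own reindexing treats both
    -- kinds alike, at the cost of a factor 2.
    T-Y : T k (Y (λ x → x) R₀) ≋ t · Y (λ x → x) R₀
    T-Y = halve (begin
      T k (ΣM θ reps) ⊞ T k (ΣM θ reps) ≈⟨ ≋-sym (T.add k _ _) ⟩
      T k (ΣM θ reps ⊞ ΣM θ reps) ≈⟨ T.cong k doubled ⟩
      T k (ΣM (λ π → θ π ⊞ θ (act s π)) reps) ≈⟨ linear-Σ (T-linear k) _ reps ⟩
      ΣM (λ π → T k (θ π ⊞ θ (act s π))) reps ≈⟨ ΣM-∈ reps T-pair ⟩
      ΣM (λ π → t · (θ π ⊞ θ (act s π))) reps ≈⟨ ≋-sym (linear-Σ (·-linear t) _ reps) ⟩
      t · ΣM (λ π → θ π ⊞ θ (act s π)) reps ≈⟨ ·-cong K.refl (≋-sym doubled) ⟩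
      t · (ΣM θ reps ⊞ ΣM θ reps) ≈⟨ Linear.add (·-linear t) _ _ ⟩
      t · ΣM θ reps ⊞ t · ΣM θ reps ∎)
      where
      open ≋-Reasoning
      ΣM-image : ∀ (f : List ℕ → List ℕ) xs → ΣM θ (map f xs) ≡ ΣM (λ x → θ (f x)) xs
      ΣM-image f [] = ≡.refl
      ΣM-image f (x ∷ xs) = ≡.cong (θ (f x) ⊞_) (ΣM-image f xs)
      doubled : ΣM θ reps ⊞ ΣM θ reps ≋ ΣM (λ π → θ π ⊞ θ (act s π)) reps
      doubled = ≋-trans (⊞-cong ≋-refl (≋-trans (≋-sym (ΣM-↭ θ (reindex transpose-permutes (λ _ → transpose-involutive k _)))) (≋-reflexive (ΣM-image (act s) reps))))
        (≋-sym (ΣM-⊞ θ (λ π → θ (act s π)) reps))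

  rev : ℕ → ℕ
  rev u = m ∸ suc u

  rev-permutes : map rev (upTo m) ↭ upTo m
  rev-permutes = involution-↭ rev (upTo m) (UniqueP.upTo⁺ m) (λ p → ∈-upTo⁺ (rev-< (∈-upTo⁻ p))) (λ p → ∸-reflect (∈-upTo⁻ p))
    where
    rev-< : ∀ {u} → u N.< m → rev u N.< m
    rev-< {u} p = NP.∸-monoʳ-< {m} {suc u} {0} (N.s≤s N.z≤n) p

  -- The lengths of a representative and of its reversal add up to inv λ, the number of pairs of
  -- columns of different heights. So the negative lengths left by the inversion of t become lengths
  -- again after reindexing.
  Y-reversed : ∀ g R → map proj₂ R ≡ gam →
    ΣM (λ π → tz (Z.- + crossing (zip π lam)) · G N₀ (relabel g (relabel rev (zip π lam)) ++ R)) reps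
      ≋ tz (Z.- + invW lam) · Y g R
  Y-reversed g R R-heights = ≋-sym (≋-trans (·-cong K.refl (≋-trans (≋-sym (ΣM-↭ (summand g R) (reindex rev-permutes (λ p → ∸-reflect p)))) (≋-reflexive (ΣM-image (act rev) reps))))
    (≋-trans (linear-Σ (·-linear _) _ reps) (ΣM-∈ reps term)))
    where
    ΣM-image : ∀ (f : List ℕ → List ℕ) xs → ΣM (summand g R) (map f xs) ≡ ΣM (λ x → summand g R (f x)) xs
    ΣM-image f [] = ≡.refl
    ΣM-image f (x ∷ xs) = ≡.cong (summand g R (f x) ⊞_) (ΣM-image f xs)
    term : ∀ {π} → π ∈ reps → tz (Z.- + invW lam) · summand g R (act rev π)
      ≋ tz (Z.- + crossing (zip π lam)) · G N₀ (relabel g (relabel rev (zip π lam)) ++ R)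
    term {π} r = ≋-trans (tz-· _ _ _) (·-cong (K.reflexive (≡.cong tz exponent))
        (G-decreasing N₀ [] (relabel g (zip (act rev π) lam)) (relabel g (relabel rev (zip π lam))) R
          (taller-relabel g (AllPairs.map lex⇒taller (rep-lex (act-rep rev-permutes r)))) (taller-relabel g (taller-relabel rev (AllPairs.map lex⇒taller (rep-lex r))))
          (map⁺ _ forth) (heights (≡.trans (proj₂-relabel g _) (zip-heights (rep-perm (act-rep rev-permutes r)))) R-heights)))
      where
      forth : zip (act rev π) lam ↭ relabel rev (zip π lam)
      forth = zip-act-↭ rev-permutes (rep-perm r)
      total : crossing (zip (act rev π) lam) N.+ crossing (zip π lam) ≡ invW lam
      total = ≡.trans (≡.cong (N._+ crossing (zip π lam)) (pairCount-↭ crosses forth))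
        (≡.trans (crossing-reverse {m} {rev} (reverses-∸ m) (labels-unique (rep-perm r)) (zip-bounded (rep-perm r))) (drops≡invW π (perm-length (rep-perm r)) decreasing))
      exponent : Z.- + invW lam Z.+ + crossing (zip (act rev π) lam) ≡ Z.- + crossing (zip π lam)
      exponent = ≡.trans (≡.cong (λ z → Z.- + z Z.+ + crossing (zip (act rev π) lam)) (≡.sym total)) (cancel (+ crossing (zip (act rev π) lam)) (+ crossing (zip π lam)))
        where
        cancel : ∀ a b → Z.- (a Z.+ b) Z.+ a ≡ Z.- b
        cancel = solve-∀ℤ

  -- The first m labels stand in the order prescribed by π, so w must not invert any two of them;
  -- hence the increasing prefix xs. All other pairs of labels stand in their original order.
  Tw-Y : ∀ fuel xs ys → length xs ≡ m → AllPairs N._≤_ xs → xs ++ ys ↭ upTo n → invW (xs ++ ys) N.≤ fuel →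
    Tw (redWord fuel (xs ++ ys)) (Y (λ x → x) R₀) ≋ tz (+ invW (xs ++ ys)) · Y (lookupL (xs ++ ys)) (relabel (lookupL (xs ++ ys)) R₀)
  Tw-Y fuel xs ys e sorted p le = ≋-trans (linear-Σ (Tw-linear W) _ reps) (≋-trans (ΣM-∈ reps term) (≋-sym (linear-Σ (·-linear _) _ reps)))
    where
    w W : List ℕ
    w = xs ++ ys
    W = redWord fuel w
    term : ∀ {π} → π ∈ reps → Tw W (summand (λ x → x) R₀ π) ≋ tz (+ invW w) · summand (lookupL w) (relabel (lookupL w) R₀) π
    term {π} r = ≋-trans (Linear.scale (Tw-linear W) _ _) (≋-trans (·-cong K.refl (≋-trans
        (Linear.cong (Tw-linear W) (≋-reflexive (≡.cong (λ z → G N₀ (z ++ R₀)) (identity-relabel (zip π lam)))))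
        (≋-trans (Tw-G fuel N₀ w (state π) p le (state-uniq q) (state-bounded q) additive)
          (·-cong K.refl (≋-reflexive (≡.cong (G N₀) (relabel-++ (lookupL w) (zip π lam) R₀)))))))
      (Linear.scale (·-linear (tz (+ crossing (zip π lam)))) (tz (+ invW w)) _))
      where
      q : π ↭ upTo m
      q = rep-perm r
      ρ₀-∈ : ∀ {j} → m N.≤ j → j N.< n → j ∈ ρ₀
      ρ₀-∈ {j} a b = ≡.subst (_∈ ρ₀) (NP.m+[n∸m]≡n a) (∈-map⁺ (m N.+_) (∈-upTo⁺ (NP.+-cancelˡ-< m _ _ (≡.subst₂ N._<_ (≡.sym (NP.m+[n∸m]≡n a)) sizes b))))
      additive : Additive w (state π)
      additive i j i<j j<n drop with NP.<-≤-connex j m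
      ... | inj₁ j<m = ⊥-elim (NP.<⇒≱ drop (≡.subst₂ N._≤_ (≡.sym (lookupL-++ˡ xs ys (≡.subst (i N.<_) (≡.sym e) (NP.<-trans i<j j<m)))) (≡.sym (lookupL-++ˡ xs ys (≡.subst (j N.<_) (≡.sym e) j<m)))
              (all-pairs-lookup sorted i<j (≡.subst (j N.<_) (≡.sym e) j<m))))
      ... | inj₂ m≤j with NP.<-≤-connex i m
      ...   | inj₁ i<m = before-++ (zip π lam) R₀ (mem-zip i π lam (perm-length q) (∈-resp-↭ (↭-sym q) (∈-upTo⁺ i<m))) (mem-zip j ρ₀ gam ρ₀-length (ρ₀-∈ m≤j j<n))
      ...   | inj₂ m≤i = before-++ʳ (zip π lam) R₀ (before-zip gam (shifted-increasing m (length gam)) ρ₀-length (ρ₀-∈ m≤i (NP.<-trans i<j j<n)) (ρ₀-∈ m≤j j<n) i<j)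

  Y-cong : ∀ {g g'} {R R'} → (∀ {u} → u N.< m → g u ≡ g' u) → R ≡ R' → Y g R ≋ Y g' R'
  Y-cong {g} {g'} {R} e ≡.refl = ΣM-∈ reps λ {π} r → ·-cong K.refl (≋-reflexive (≡.cong (λ z → G N₀ (z ++ R)) (relabel-cong (All.map e (zip-bounded (rep-perm r))))))

-- The two duality identities

module Discrepancies {n : ℕ} (V : Reversal n) where
  open Reversal V
  open Discrepancy V

  lowerTo-constant : ∀ l h c {L} → All (λ x → b (proj₁ x) Z.- b l ≡ c) L → lowerTo l h L ≡ (+ 1 Z.+ c) Z.* + countB (λ x → proj₂ x <ᵇ h) L
  lowerTo-constant l h c [] = ≡.sym (ZP.*-zeroʳ (+ 1 Z.+ c))
  lowerTo-constant l h c {(k , g) ∷ L} (e ∷ es) rewrite e with g <ᵇ h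
  ... | true rewrite lowerTo-constant l h c es = shuffle (+ 1 Z.+ c) (+ countB (λ x → proj₂ x <ᵇ h) L)
    where
    shuffle : ∀ c x → c Z.+ c Z.* x ≡ c Z.* (+ 1 Z.+ x)
    shuffle = solve-∀ℤ
  ... | false = ≡.trans (ZP.+-identityˡ _) (lowerTo-constant l h c es)

  lowerTo-++ : ∀ l h L L' → lowerTo l h (L ++ L') ≡ lowerTo l h L Z.+ lowerTo l h L'
  lowerTo-++ l h [] L' = ≡.sym (ZP.+-identityˡ _)
  lowerTo-++ l h ((k , g) ∷ L) L' = ≡.trans (≡.cong (λ z → (if g <ᵇ h then + 1 Z.+ (b k Z.- b l) else + 0) Z.+ z) (lowerTo-++ l h L L'))
    (≡.sym (ZP.+-assoc (if g <ᵇ h then + 1 Z.+ (b k Z.- b l) else + 0) (lowerTo l h L) (lowerTo l h L')))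

  discrepancy-constant : ∀ c {L} → All (λ x → b (proj₁ x) ≡ c) L → discrepancy L ≡ + invW (map proj₂ L)
  discrepancy-constant c [] = ≡.refl
  discrepancy-constant c {(l , h) ∷ L} (e ∷ es) = ≡.trans (≡.cong₂ Z._+_
      (lowerTo-constant l h (+ 0) (All.map (λ e' → ≡.trans (≡.cong₂ Z._-_ e' e) (ZP.+-inverseʳ c)) es)) (discrepancy-constant c es))
    (≡.trans (≡.cong (λ z → z Z.+ + invW (map proj₂ L)) (ZP.*-identityˡ (+ countB (λ x → proj₂ x <ᵇ h) L)))
      (≡.cong (λ z → + (z N.+ invW (map proj₂ L))) (≡.sym (countB-map (_<ᵇ h) proj₂ L))))

  -- A shorter column after a taller one counts once inside a block and 1 + β times across the
  -- blocks. For β = 0 the total is the number of inversions of (λ , γ).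
  discrepancy-blocks : ∀ β {Z} R → All (λ x → b (proj₁ x) ≡ + 0) Z → All (λ x → b (proj₁ x) ≡ β) R →
    discrepancy (Z ++ R) ≡ (+ invW (map proj₂ Z) Z.+ + invW (map proj₂ R)) Z.+ (+ 1 Z.+ β) Z.* + sum (map (λ l → countB (λ g → g <ᵇ l) (map proj₂ R)) (map proj₂ Z))
  discrepancy-blocks β R [] f = ≡.trans (discrepancy-constant β f) (shuffle (+ 1 Z.+ β) (+ invW (map proj₂ R)))
    where
    shuffle : ∀ c x → x ≡ (+ 0 Z.+ x) Z.+ c Z.* + 0
    shuffle = solve-∀ℤ
  discrepancy-blocks β {(l , h) ∷ Z} R (e ∷ es) f = ≡.trans (≡.cong₂ Z._+_
      (≡.trans (lowerTo-++ l h Z R) (≡.cong₂ Z._+_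
        (≡.trans (lowerTo-constant l h (+ 0) (All.map (λ e' → ≡.cong₂ Z._-_ e' e) es)) (≡.cong (λ z → (+ 1 Z.+ + 0) Z.* + z) (≡.sym (countB-map (_<ᵇ h) proj₂ Z))))
        (≡.trans (lowerTo-constant l h β (All.map (λ e' → ≡.trans (≡.cong₂ Z._-_ e' e) (ZP.+-identityʳ β)) f)) (≡.cong (λ z → (+ 1 Z.+ β) Z.* + z) (≡.sym (countB-map (_<ᵇ h) proj₂ R))))))
      (discrepancy-blocks β R es f))
    (shuffle (+ countB (_<ᵇ h) (map proj₂ Z)) (+ countB (_<ᵇ h) (map proj₂ R)) (+ 1 Z.+ β) (+ invW (map proj₂ Z)) (+ invW (map proj₂ R)) (+ sum (map (λ l → countB (λ g → g <ᵇ l) (map proj₂ R)) (map proj₂ Z))))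
    where
    shuffle : ∀ a d c i j x → ((+ 1 Z.+ + 0) Z.* a Z.+ c Z.* d) Z.+ ((i Z.+ j) Z.+ c Z.* x) ≡ ((a Z.+ i) Z.+ j) Z.+ c Z.* (d Z.+ x)
    shuffle = solve-∀ℤ

  wrapped-blocks : ∀ β {Z} R → All (λ x → b (proj₁ x) ≡ + 0) Z → All (λ x → b (proj₁ x) ≡ β) R →
    wrapped (Z ++ R) ≡ β Z.* + sum (map proj₂ R)
  wrapped-blocks β [] [] [] = ≡.sym (ZP.*-zeroʳ β)
  wrapped-blocks β ((l , h) ∷ R) [] (e ∷ es) rewrite e | wrapped-blocks β R [] es = ≡.sym (ZP.*-distribˡ-+ β (+ h) (+ sum (map proj₂ R)))
  wrapped-blocks β {(l , h) ∷ Z} R (e ∷ es) f rewrite e = ≡.trans (ZP.+-identityˡ _) (wrapped-blocks β R es f)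

module Duality (S : Setting) (lam gam : List ℕ) (decreasing : AllPairs N._≥_ lam)
  (sizes : Setting.n S ≡ length lam N.+ length gam) (E : Setting.M S) where
  open Setting S hiding (refl; sym; trans; zero)
  private module K = Setting S
  open IntegerSolver scalars
  open Core S
  open Exchange S
  open Columns S
  open Words S
  open Cosets lam decreasing
  open Symmetrized S lam gam decreasing sizes

  crossed : ℕ
  crossed = sum (map (λ l → countB (λ g → g <ᵇ l) gam) lam)

  invW-mu : invW mu ≡ invW lam N.+ invW gam N.+ crossed
  invW-mu = invW-++ lam gam

  P : M
  P = ΣM (λ π → Tw (permWord (π ++ ρ₀)) E) reps

  module _ (E-G : E ≋ tz (Z.- + invW mu) · G N₀ L₀) where
    P-Y : P ≋ tz (Z.- + invW mu) · Y (λ x → x) R₀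
    P-Y = ≋-trans (ΣM-∈ reps λ {π} r → ≋-trans (Linear.cong (Tw-linear (permWord (π ++ ρ₀))) E-G)
        (≋-trans (Linear.scale (Tw-linear (permWord (π ++ ρ₀))) _ _) (·-cong K.refl (Tw-rep r))))
      (≋-sym (linear-Σ (·-linear _) _ reps))

    T-P : ∀ k → suc k N.< m → T k P ≋ t · P
    T-P k k<m = ≋-trans (T.cong k P-Y) (≋-trans (T.scale k _ _) (≋-trans (·-cong K.refl (T-Y k k<m))
      (≋-trans (Linear.scale (·-linear _) t _) (·-cong K.refl (≋-sym P-Y)))))

    Tw-P : ∀ fuel xs ys → length xs ≡ m → AllPairs N._≤_ xs → xs ++ ys ↭ upTo n → invW (xs ++ ys) N.≤ fuel →
      Tw (redWord fuel (xs ++ ys)) P ≋ tz (Z.- + invW mu Z.+ + invW (xs ++ ys)) · Y (lookupL (xs ++ ys)) (relabel (lookupL (xs ++ ys)) R₀)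
    Tw-P fuel xs ys e s p le = ≋-trans (Linear.cong (Tw-linear W) P-Y) (≋-trans (Linear.scale (Tw-linear W) _ _)
      (≋-trans (·-cong K.refl (Tw-Y fuel xs ys e s p le)) (tz-· _ _ _)))
      where
      W : List ℕ
      W = redWord fuel (xs ++ ys)

    module _ (V : Reversal n) (C : Conjugation S V) (β : ℤ) (g : ℕ → ℕ) where
      open Reversal V
      open Conjugation C
      open Discrepancy V
      open Discrepancies V
      open Flip S V C

      -- Three powers of t meet: the inverted normalisation t^(inv μ), the factor t^(-d) of `ψ-G`,
      -- and t^(-inv λ) from `Y-reversed`. On the first block φ is split as g after `rev`; the
      -- reversal is absorbed by the coset representatives and only g survives.
      ψ-P : (∀ {u} → u N.< m → b u ≡ + 0) → (∀ {u} → m N.≤ u → u N.< n → b u ≡ β) → (∀ {u} → u N.< m → φ u ≡ g (rev u)) →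
        ψ P ≋ (qz (β Z.* + sum gam) * tz (Z.- (β Z.* + crossed) Z.- + invW lam)) · Y g (relabel φ R₀)
      ψ-P b₀ b₁ φ-rev = begin
        ψ P ≈⟨ ψ-cong′ P-Y ⟩
        ψ (tz (Z.- + invW mu) · Y (λ x → x) R₀) ≈⟨ ext (ψ-· _ _) ⟩
        bar (tz (Z.- + invW mu)) · ψ (Y (λ x → x) R₀) ≈⟨ ·-cong (bar-tz _) (≋-trans (ψ-Σ _ reps) (ΣM-∈ reps term)) ⟩
        tz (Z.- (Z.- + invW mu)) · ΣM (λ π → F · rest π) reps ≈⟨ ·-cong K.refl (≋-sym (linear-Σ (·-linear F) rest reps)) ⟩
        tz (Z.- (Z.- + invW mu)) · (F · ΣM rest reps)
          ≈⟨ ·-cong K.refl (·-cong K.refl (Y-reversed g (relabel φ R₀) (≡.trans (proj₂-relabel φ R₀) R₀-heights))) ⟩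
        tz (Z.- (Z.- + invW mu)) · (F · (tz (Z.- + invW lam) · Y g (relabel φ R₀)))
          ≈⟨ combine (tz (Z.- (Z.- + invW mu)) :· (F :· (tz (Z.- + invW lam) :· x₀))) ((qz w * ((tz (Z.- (Z.- + invW mu)) * tz (Z.- d)) * tz (Z.- + invW lam))) :· x₀) (Y g (relabel φ R₀) ∷ⱽ []ⱽ)
               (λ v → solve 5 (λ a q d l y → a :* ((q :* d) :* (l :* y)) := (q :* ((a :* d) :* l)) :* y) K.refl _ _ _ _ _) ⟩
        (qz w * ((tz (Z.- (Z.- + invW mu)) * tz (Z.- d)) * tz (Z.- + invW lam))) · Y g (relabel φ R₀)
          ≈⟨ ·-cong (*-cong K.refl (K.trans (*-cong (K.sym (tz-+ _ _)) K.refl) (K.trans (K.sym (tz-+ _ _)) (K.reflexive (≡.cong tz exponent))))) ≋-refl ⟩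
        (qz w * tz (Z.- (β Z.* + crossed) Z.- + invW lam)) · Y g (relabel φ R₀) ∎
        where
        open ≋-Reasoning
        w d : ℤ
        w = β Z.* + sum gam
        d = (+ invW lam Z.+ + invW gam) Z.+ (+ 1 Z.+ β) Z.* + crossed
        F : Carrier
        F = qz w * tz (Z.- d)
        rest : List ℕ → M
        rest π = tz (Z.- + crossing (zip π lam)) · G N₀ (relabel g (relabel rev (zip π lam)) ++ relabel φ R₀)
        R-b : All (λ x → b (proj₁ x) ≡ β) R₀
        R-b = all-zip gam (All.zipWith (λ (p , q) → b₁ p q) (ρ₀-≥ , ρ₀-<))
        term : ∀ {π} → π ∈ reps → ψ (summand (λ x → x) R₀ π) ≋ F · rest π
        term {π} r = ≋-trans (ext (ψ-· _ _)) (≋-trans (·-cong (bar-tz _) (≋-trans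
            (ψ-cong′ (≋-reflexive (≡.cong (λ z → G N₀ (z ++ R₀)) (identity-relabel (zip π lam)))))
            (≋-trans (ψ-G N₀ (state π) (heights (zip-heights (rep-perm r)) R₀-heights) (state-bounded (rep-perm r)))
            (·-cong (K.reflexive (≡.cong₂ (λ x y → qz x * tz (Z.- y)) wrapped-state discrepancy-state)) (≋-reflexive (≡.cong (G N₀) relabelled))))))
          (Linear.scale (·-linear _) F _))
          where
          Z-b : All (λ x → b (proj₁ x) ≡ + 0) (zip π lam)
          Z-b = All.map b₀ (zip-bounded (rep-perm r))
          wrapped-state : wrapped (state π) ≡ w
          wrapped-state = ≡.trans (wrapped-blocks β R₀ Z-b R-b) (≡.cong (λ z → β Z.* + sum z) R₀-heights)
          discrepancy-state : discrepancy (state π) ≡ d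
          discrepancy-state = ≡.trans (discrepancy-blocks β R₀ Z-b R-b) (≡.cong₂ (λ y z → (+ invW y Z.+ + invW z) Z.+ (+ 1 Z.+ β) Z.* + sum (map (λ l → countB (λ g → g <ᵇ l) z) y))
            (zip-heights (rep-perm r)) R₀-heights)
          relabelled : relabel φ (state π) ≡ relabel g (relabel rev (zip π lam)) ++ relabel φ R₀
          relabelled = ≡.trans (relabel-++ φ (zip π lam) R₀) (≡.cong (_++ relabel φ R₀)
            (≡.trans (relabel-cong (All.map φ-rev (zip-bounded (rep-perm r)))) (≡.sym (relabel-∘ g rev (λ _ → ≡.refl) (zip π lam)))))
        exponent : (Z.- (Z.- + invW mu) Z.+ Z.- d) Z.+ Z.- + invW lam ≡ Z.- (β Z.* + crossed) Z.- + invW lam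
        exponent = ≡.trans (≡.cong (λ z → (Z.- (Z.- + z) Z.+ Z.- d) Z.+ Z.- + invW lam) invW-mu) (shuffle (+ invW lam) (+ invW gam) (+ crossed) β)
          where
          shuffle : ∀ i j x β → (Z.- (Z.- ((i Z.+ j) Z.+ x)) Z.+ Z.- ((i Z.+ j) Z.+ (+ 1 Z.+ β) Z.* x)) Z.+ Z.- i ≡ Z.- (β Z.* x) Z.- i
          shuffle = solve-∀ℤ

    tz-transfer : ∀ {f y} i → f ≋ tz i · y → y ≋ tz (Z.- i) · f
    tz-transfer {f} {y} i e = ≋-sym (≋-trans (·-cong K.refl e) (≋-trans (tz-· (Z.- i) i y) (≋-trans
      (·-cong (K.reflexive (≡.cong tz (ZP.+-inverseˡ i))) ≋-refl) (tz0· y))))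

    R-relabel : ∀ {f h : ℕ → ℕ} → (∀ {j} → j N.< length gam → f (m N.+ j) ≡ h (m N.+ j)) → relabel f R₀ ≡ relabel h R₀
    R-relabel e = relabel-cong (all-zip gam (AllP.map⁺ (All.tabulate (λ p → e (∈-upTo⁻ p)))))

    module PartialFlip (C : Conjugation S (BlockReversal.reversal n m m≤n)) where
      open BlockReversal n m m≤n
      open Conjugation C

      w : List ℕ
      w = w0mn m (m N.+ length gam)

      w-shape : w ≡ upTo m ++ reverse ρ₀
      w-shape = ≡.cong (λ z → upTo m ++ reverse (map (m N.+_) (upTo z))) (NP.m+n∸m≡n m (length gam))

      w-tail : ∀ {j} → j N.< length gam → lookupL (upTo m ++ reverse ρ₀) (m N.+ j) ≡ flip (m N.+ j)
      w-tail {j} p = ≡.trans (≡.trans (≡.cong (λ z → lookupL (upTo m ++ reverse ρ₀) (z N.+ j)) (≡.sym (LP.length-upTo m))) (lookupL-++ʳ (upTo m) (reverse ρ₀) j))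
        (≡.trans (≡.cong (λ z → lookupL z j) (≡.trans (≡.sym (LP.reverse-map (m N.+_) (upTo (length gam)))) (≡.cong (map (m N.+_)) (reverse-upTo (length gam)))))
        (≡.trans (lookupL-map (m N.+_) (map (λ u → length gam ∸ suc u) (upTo (length gam))) (≡.subst (j N.<_) (≡.sym (≡.trans (LP.length-map _ (upTo (length gam))) (LP.length-upTo (length gam)))) p))
        (≡.trans (≡.cong (m N.+_) (≡.trans (lookupL-map (λ u → length gam ∸ suc u) (upTo (length gam)) (≡.subst (j N.<_) (≡.sym (LP.length-upTo (length gam))) p)) (≡.cong (λ u → length gam ∸ suc u) (lookupL-upTo (length gam) p))))
        (≡.sym (≡.trans (flip-right (NP.m≤m+n m j)) (≡.trans (≡.cong₂ _∸_ (≡.trans (≡.cong (N._+ m) sizes) (NP.+-comm (m N.+ length gam) m)) (≡.sym (NP.+-suc m j)))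
          (≡.trans (NP.[m+n]∸[m+o]≡n∸o m (m N.+ length gam) (suc j)) (NP.+-∸-assoc m p))))))))

      -- The case β = 1. On the first block `flip` is `rev`, so g is the identity there, and on the
      -- last block `flip` is the permutation w. Hence `ψ-P` and `Tw-P` produce the same sum `Y`.
      duality-B : ψ P ≋ (qz (+ sum gam) * tz (+ invW gam Z.- + invW w)) · Tw (permWord w) P
      duality-B = ≋-trans (ψ-P (reversal) C (+ 1) (lookupL (upTo m ++ reverse ρ₀)) (λ p → wrap-left p) (λ p _ → wrap-right p) first)
        (≋-trans (·-cong K.refl (≋-trans (Y-cong {R = relabel flip R₀} (λ _ → ≡.refl) (≡.sym (R-relabel w-tail)))
            (tz-transfer (Z.- + invW mu Z.+ + invW (upTo m ++ reverse ρ₀)) (Tw-P _ (upTo m) (reverse ρ₀) (LP.length-upTo m) (upTo-sorted m)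
              (↭-trans (++⁺ˡ (upTo m) (↭-reverse ρ₀)) (↭-reflexive (≡.sym upTo-n))) (invW-bound (upTo m ++ reverse ρ₀))))))
        (≋-trans (·-· _ _ _) (·-cong (K.trans (*-assoc _ _ _) (*-cong (K.reflexive (≡.cong qz (ZP.*-identityˡ (+ sum gam))))
            (K.trans (K.sym (tz-+ _ _)) (K.reflexive (≡.cong tz exponent)))))
          (≋-reflexive (≡.cong (λ z → Tw (permWord z) P) (≡.sym w-shape))))))
        where
        wrap-left : ∀ {u} → u N.< m → wrap u ≡ + 0
        wrap-left p rewrite <ᵇ-true p = ≡.refl
        wrap-right : ∀ {u} → m N.≤ u → wrap u ≡ + 1
        wrap-right p rewrite <ᵇ-false p = ≡.refl
        first : ∀ {u} → u N.< m → flip u ≡ lookupL (upTo m ++ reverse ρ₀) (rev u)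
        first {u} p = ≡.trans (flip-left p) (≡.sym (≡.trans (lookupL-++ˡ (upTo m) (reverse ρ₀) (≡.subst (rev u N.<_) (≡.sym (LP.length-upTo m)) r<m)) (lookupL-upTo m r<m)))
          where
          r<m : rev u N.< m
          r<m = NP.∸-monoʳ-< {m} {suc u} {0} (N.s≤s N.z≤n) p
        exponent : (Z.- (+ 1 Z.* + crossed) Z.- + invW lam) Z.+ Z.- (Z.- + invW mu Z.+ + invW (upTo m ++ reverse ρ₀)) ≡ + invW gam Z.- + invW w
        exponent = ≡.trans (≡.cong₂ (λ x y → (Z.- (+ 1 Z.* + crossed) Z.- + invW lam) Z.+ Z.- (Z.- + x Z.+ + invW y)) invW-mu (≡.sym w-shape)) (shuffle (+ invW lam) (+ invW gam) (+ crossed) (+ invW w))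
          where
          shuffle : ∀ i j x w → (Z.- (+ 1 Z.* x) Z.- i) Z.+ Z.- (Z.- ((i Z.+ j) Z.+ x) Z.+ w) ≡ j Z.- w
          shuffle = solve-∀ℤ

    module FullFlip (C : Conjugation S (BlockReversal.reversal n n NP.≤-refl)) where
      open BlockReversal n n NP.≤-refl
      open Conjugation C

      xs ys : List ℕ
      xs = map (λ u → n ∸ suc u) (upTo m)
      ys = map (λ u → n ∸ suc u) ρ₀

      w0-shape : w0 n ≡ xs ++ ys
      w0-shape = ≡.trans (reverse-upTo n) (≡.trans (≡.cong (map (λ u → n ∸ suc u)) upTo-n) (LP.map-++ _ (upTo m) ρ₀))

      w0-perm : w0 n ↭ upTo n
      w0-perm = ↭-reverse (upTo n)

      xs-length : length xs ≡ m
      xs-length = ≡.trans (LP.length-map _ (upTo m)) (LP.length-upTo m)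

      fuel : ℕ
      fuel = length (w0 n) N.* length (w0 n)

      open PrefixSorted (sort-prefix fuel xs ys P (≡.subst (λ z → invW z N.≤ fuel) w0-shape (invW-bound (w0 n)))
        (λ k p → T-P k (≡.subst (suc k N.<_) xs-length p)))

      top : List ℕ
      top = map ((n ∸ m) N.+_) (upTo m)

      reflected : ∀ {u} → u N.< m → n ∸ suc u ≡ (n ∸ m) N.+ rev u
      reflected {u} p = ≡.trans (≡.cong (λ z → z ∸ suc u) (≡.trans (≡.sym (NP.m+[n∸m]≡n m≤n)) (NP.+-comm m (n ∸ m)))) (NP.+-∸-assoc (n ∸ m) p)

      xs'-top : xs' ≡ top
      xs'-top = sorted-unique NP.≤-antisym (≤-pairs sorted) (AllPairs.map NP.<⇒≤ (shifted-increasing (n ∸ m) m))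
        (↭-trans permuted (↭-trans (↭-reflexive (≡.trans (mapped (upTo m) (All.tabulate ∈-upTo⁻)) (LP.map-∘ (upTo m)))) (map⁺ _ rev-permutes)))
        where
        mapped : ∀ us → All (N._< m) us → map (λ u → n ∸ suc u) us ≡ map (λ u → (n ∸ m) N.+ rev u) us
        mapped [] [] = ≡.refl
        mapped (u ∷ us) (p ∷ ps) = ≡.cong₂ _∷_ (reflected p) (mapped us ps)

      xs'-length : length xs' ≡ m
      xs'-length = ≡.trans (↭-length permuted) xs-length

      g : ℕ → ℕ
      g = lookupL (xs' ++ ys)

      g-rev : ∀ {u} → u N.< m → flip u ≡ g (rev u)
      g-rev {u} p = ≡.trans (≡.trans (flip-left (NP.<-≤-trans p m≤n)) (reflected p)) (≡.sym (≡.trans (lookupL-++ˡ xs' ys (≡.subst (rev u N.<_) (≡.sym xs'-length) r<m))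
        (≡.trans (≡.cong (λ z → lookupL z (rev u)) xs'-top) (≡.trans (lookupL-map ((n ∸ m) N.+_) (upTo m) (≡.subst (rev u N.<_) (≡.sym (LP.length-upTo m)) r<m)) (≡.cong ((n ∸ m) N.+_) (lookupL-upTo m r<m))))))
        where
        r<m : rev u N.< m
        r<m = NP.∸-monoʳ-< {m} {suc u} {0} (N.s≤s N.z≤n) p

      m+j<n : ∀ {j} → j N.< length gam → m N.+ j N.< n
      m+j<n p = ≡.subst (_ N.<_) (≡.sym sizes) (NP.+-monoʳ-< m p)

      g-tail : ∀ {j} → j N.< length gam → g (m N.+ j) ≡ flip (m N.+ j)
      g-tail {j} p = ≡.trans (≡.trans (≡.cong (λ z → g (z N.+ j)) (≡.sym xs'-length)) (lookupL-++ʳ xs' ys j))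
        (≡.trans (lookupL-map (λ u → n ∸ suc u) ρ₀ (≡.subst (j N.<_) (≡.sym ρ₀-length) p))
        (≡.trans (≡.cong (λ u → n ∸ suc u) (≡.trans (lookupL-map (m N.+_) (upTo (length gam)) (≡.subst (j N.<_) (≡.sym (LP.length-upTo (length gam))) p)) (≡.cong (m N.+_) (lookupL-upTo (length gam) p))))
        (≡.sym (flip-left (m+j<n p)))))

      word : List ℕ
      word = permWord (w0 n)

      -- w₀ inverts the labels of the first block, so `Tw-Y` does not apply at once. The letters
      -- applied first sort the prefix xs into `top`, and each acts as t on `P` by `T-P`. For the
      -- remaining permutation the prefix is increasing, and its map g takes `rev u` to the full
      -- reversal of u.
      Tw-w0 : Tw word P ≋ tz (Z.- + invW mu Z.+ + invW (w0 n)) · Y g (relabel flip R₀)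
      Tw-w0 = ≋-trans (≋-reflexive (≡.cong (λ z → Tw (redWord fuel z) P) w0-shape)) (≋-trans value (≋-trans (·-cong K.refl
          (Tw-P fuel' xs' ys xs'-length (≤-pairs sorted) (↭-trans (++⁺ʳ ys permuted) (≡.subst (_↭ upTo n) w0-shape w0-perm)) enough))
        (≋-trans (tz-· _ _ _) (·-cong (K.reflexive (≡.cong tz exponent)) (Y-cong {R = relabel g R₀} (λ _ → ≡.refl) (R-relabel g-tail))))))
        where
        exponent : + steps Z.+ (Z.- + invW mu Z.+ + invW (xs' ++ ys)) ≡ Z.- + invW mu Z.+ + invW (w0 n)
        exponent = ≡.trans (shuffle (+ steps) (+ invW mu) (+ invW (xs' ++ ys))) (≡.cong (λ z → Z.- + invW mu Z.+ + z) (≡.sym (≡.trans (≡.cong invW w0-shape) inversions)))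
          where
          shuffle : ∀ s i x → s Z.+ (Z.- i Z.+ x) ≡ Z.- i Z.+ (s Z.+ x)
          shuffle = solve-∀ℤ

      -- The same sum `Y` occurs in ψ P and in the image of `P` under the word of w₀, so the inverse
      -- operator carries ψ P to a power of t times `P`.
      duality-A : tz (+ invW (w0 n)) · TwInv word (ψ P) ≋ tz (+ invLG lam gam) · P
      duality-A = begin
        tz (+ invW (w0 n)) · TwInv word (ψ P) ≈⟨ ·-cong K.refl (Linear.cong (TwInv-linear word) conjugate) ⟩
        tz (+ invW (w0 n)) · TwInv word (tz c · Tw word P) ≈⟨ ·-cong K.refl (≋-trans (Linear.scale (TwInv-linear word) _ _)
            (·-cong K.refl (TwInv-Tw word (redWord-letters fuel (w0 n) (word-length w0-perm)) P))) ⟩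
        tz (+ invW (w0 n)) · (tz c · P) ≈⟨ tz-· _ _ _ ⟩
        tz (+ invW (w0 n) Z.+ c) · P ≈⟨ ·-cong (K.reflexive (≡.cong tz total-exponent)) ≋-refl ⟩
        tz (+ invLG lam gam) · P ∎
        where
        open ≋-Reasoning
        c : ℤ
        c = (Z.- (+ 0 Z.* + crossed) Z.- + invW lam) Z.+ Z.- (Z.- + invW mu Z.+ + invW (w0 n))
        wrap-zero : ∀ {u} → u N.< n → wrap u ≡ + 0
        wrap-zero p rewrite <ᵇ-true p = ≡.refl
        conjugate : ψ P ≋ tz c · Tw word P
        conjugate = ≋-trans (ψ-P reversal C (+ 0) g (λ p → wrap-zero (NP.<-≤-trans p m≤n)) (λ _ p → wrap-zero p) g-rev)
          (≋-trans (·-cong (K.trans (*-cong (K.trans (K.reflexive (≡.cong qz (ZP.*-zeroˡ (+ sum gam)))) qz-0) K.refl) (*-identityˡ _)) (tz-transfer _ Tw-w0)) (tz-· _ _ _))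
        total-exponent : + invW (w0 n) Z.+ c ≡ + invLG lam gam
        total-exponent = ≡.trans (≡.cong (λ z → + invW (w0 n) Z.+ ((Z.- (+ 0 Z.* + crossed) Z.- + invW lam) Z.+ Z.- (Z.- + z Z.+ + invW (w0 n)))) invW-mu)
          (shuffle (+ invW (w0 n)) (+ crossed) (+ invW lam) (+ invW gam))
          where
          shuffle : ∀ w x i j → w Z.+ ((Z.- (+ 0 Z.* x) Z.- i) Z.+ Z.- (Z.- ((i Z.+ j) Z.+ x) Z.+ w)) ≡ j Z.+ x
          shuffle = solve-∀ℤ

-- Boxes in the order of growth

eqBox-sound : ∀ b c → eqBox b c ≡ true → b ≡ c
eqBox-sound (i , j) (i' , j') e with ∧-split {i ≡ᵇ i'} e
... | p , q = ≡.cong₂ _,_ (≡ᵇ-sound i i' p) (≡ᵇ-sound j j' q)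

eqBox-refl : ∀ b → eqBox b b ≡ true
eqBox-refl (i , j) rewrite ≡ᵇ-refl i | ≡ᵇ-refl j = ≡.refl

eqBox-false : ∀ {b c} → ¬ b ≡ c → eqBox b c ≡ false
eqBox-false {b} {c} p with eqBox b c in e
... | false = ≡.refl
... | true = ⊥-elim (p (eqBox-sound b c e))

val-here : ∀ i j v fl → val (((i , suc j) , v) ∷ fl) (i , suc j) ≡ v
val-here i j v fl rewrite eqBox-refl (i , suc j) = ≡.refl

val-there : ∀ {b v} fl c → eqBox b c ≡ false → val ((b , v) ∷ fl) c ≡ val fl c
val-there fl (i , zero) e = ≡.refl
val-there fl (i , suc j) e rewrite e = ≡.refl

val-cons : ∀ b v {fl fl'} → (∀ c → val fl c ≡ val fl' c) → ∀ c → val ((b , v) ∷ fl) c ≡ val ((b , v) ∷ fl') c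
val-cons b v e (i , zero) = ≡.refl
val-cons b v e (i , suc j) with eqBox b (i , suc j)
... | true = ≡.refl
... | false = e (i , suc j)

val-swap : ∀ {b b'} → ¬ b ≡ b' → ∀ v v' fl c → val ((b , v) ∷ (b' , v') ∷ fl) c ≡ val ((b' , v') ∷ (b , v) ∷ fl) c
val-swap ne v v' fl (i , zero) = ≡.refl
val-swap {b} {b'} ne v v' fl (i , suc j) with eqBox b (i , suc j) in e | eqBox b' (i , suc j) in e'
... | true | true = ⊥-elim (ne (≡.trans (eqBox-sound b _ e) (≡.sym (eqBox-sound b' _ e'))))
... | true | false = ≡.refl
... | false | true = ≡.refl
... | false | false = ≡.refl

val-insert : ∀ {b} bs → All (λ c → ¬ b ≡ c) bs → ∀ v vs fl c →
  val (zip bs vs ++ (b , v) ∷ fl) c ≡ val ((b , v) ∷ zip bs vs ++ fl) c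
val-insert [] [] v vs fl c = ≡.refl
val-insert (b' ∷ bs) (p ∷ ps) v [] fl c = ≡.refl
val-insert {b} (b' ∷ bs) (p ∷ ps) v (v' ∷ vs) fl c = ≡.trans (val-cons b' v' (val-insert bs ps v vs fl) c)
  (val-swap (λ e → p (≡.sym e)) v' v (zip bs vs ++ fl) c)

mem-count : ∀ u L → mem u L ≡ not (countB (λ x → proj₁ x ≡ᵇ u) L ≡ᵇ 0)
mem-count u [] = ≡.refl
mem-count u ((l , h) ∷ L) with l ≡ᵇ u
... | true = ≡.refl
... | false = mem-count u L

countB-below : ∀ {i} P Q → All (N._< i) P → All (i N.<_) Q → ∀ q → countB (λ i' → (i' <ᵇ i) ∧ q i') (P ++ i ∷ Q) ≡ countB q P
countB-below {i} P Q P<i i<Q q = ≡.trans (countB-++ (λ i' → (i' <ᵇ i) ∧ q i') P (i ∷ Q)) (≡.trans (≡.cong₂ N._+_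
  (countB-cong (λ i' → (i' <ᵇ i) ∧ q i') q (All.map (λ {i'} p → ≡.cong (_∧ q i') (<ᵇ-true p)) P<i))
  (countB-none (λ i' → (i' <ᵇ i) ∧ q i') (i ∷ Q) (≡.cong (_∧ q i) (<ᵇ-false (NP.≤-refl {i})) ∷ All.map (λ {i'} p → ≡.cong (_∧ q i') (<ᵇ-false (NP.<⇒≤ p))) i<Q)))
  (NP.+-identityʳ _))

countB-above : ∀ {i} P Q → All (N._< i) P → All (i N.<_) Q → ∀ q → countB (λ i' → (i <ᵇ i') ∧ q i') (P ++ i ∷ Q) ≡ countB q Q
countB-above {i} P Q P<i i<Q q = ≡.trans (countB-++ (λ i' → (i <ᵇ i') ∧ q i') P (i ∷ Q)) (≡.cong₂ N._+_
  (countB-none (λ i' → (i <ᵇ i') ∧ q i') P (All.map (λ {i'} p → ≡.cong (_∧ q i') (<ᵇ-false (NP.<⇒≤ p))) P<i))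
  (≡.trans (≡.cong (λ b → if b ∧ q i then suc (countB (λ i' → (i <ᵇ i') ∧ q i') Q) else countB (λ i' → (i <ᵇ i') ∧ q i') Q) (<ᵇ-false (NP.≤-refl {i})))
    (countB-cong (λ i' → (i <ᵇ i') ∧ q i') q (All.map (λ {i'} p → ≡.cong (_∧ q i') (<ᵇ-true p)) i<Q))))

countB-filter : ∀ {A B : Set} (p : A → Bool) (f : A → B) (q : B → Bool) xs → countB q (map f (filterB p xs)) ≡ countB (λ x → p x ∧ q (f x)) xs
countB-filter p f q [] = ≡.refl
countB-filter p f q (x ∷ xs) with p x
... | false = countB-filter p f q xs
... | true rewrite countB-filter p f q xs = ≡.refl

sorted-split : ∀ P {i : ℕ} {Q} → AllPairs N._<_ (P ++ i ∷ Q) → All (N._< i) P × All (i N.<_) Q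
sorted-split [] (a ∷ s) = [] , a
sorted-split (x ∷ P) (a ∷ s) with sorted-split P s | AllP.++⁻ʳ P a
... | p , q | x<i ∷ _ = x<i ∷ p , q

filterB-++ : ∀ {A : Set} (p : A → Bool) xs ys → filterB p (xs ++ ys) ≡ filterB p xs ++ filterB p ys
filterB-++ p [] ys = ≡.refl
filterB-++ p (x ∷ xs) ys with p x
... | true = ≡.cong (x ∷_) (filterB-++ p xs ys)
... | false = filterB-++ p xs ys

≤ᵇ-true⇒≤ : ∀ a b → (a ≤ᵇ b) ≡ true → a N.≤ b
≤ᵇ-true⇒≤ a b e = NP.≤ᵇ⇒≤ a b (≡.subst Data.Bool.T (≡.sym e) _)

tower : ℕ → ℕ → ℕ → List Box
tower i j zero = []
tower i j (suc h) = (i , suc j) ∷ tower i (suc j) h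

module Cells (μ : List ℕ) where
  open Mac μ using (cols; μAt; boxes; basement; leg; arm)

  height : Box → ℕ
  height (i , j) = μAt i ∸ j

  -- The boxes that attack a given one and follow it in reading order.
  near : Box → (Box → Bool) → ℕ
  near (i , j) p = countB (λ i' → (i' <ᵇ i) ∧ (j ≤ᵇ μAt i') ∧ p (i' , j)) cols
    N.+ countB (λ i' → (i <ᵇ i') ∧ ((j ∸ 1) ≤ᵇ μAt i') ∧ p (i' , j ∸ 1)) cols

  near-cong : ∀ b {p p'} → (∀ c → p c ≡ p' c) → near b p ≡ near b p'
  near-cong (i , j) {p} {p'} e = ≡.cong₂ N._+_
    (countB-cong _ _ (All.tabulate {xs = cols} (λ {i'} _ → ≡.cong (λ z → (i' <ᵇ i) ∧ (j ≤ᵇ μAt i') ∧ z) (e (i' , j)))))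
    (countB-cong _ _ (All.tabulate {xs = cols} (λ {i'} _ → ≡.cong (λ z → (i <ᵇ i') ∧ ((j ∸ 1) ≤ᵇ μAt i') ∧ z) (e (i' , j ∸ 1)))))

  free : Filling → Box → Bool
  free fl b = near b (λ c → val fl c ≡ᵇ val fl b) ≡ᵇ 0

  row : ℕ → List ℕ → List Box
  row j is = map (λ i → (i , j)) (filterB (λ i → j ≤ᵇ μAt i) is)

  row-++ : ∀ j is is' → row j (is ++ is') ≡ row j is ++ row j is'
  row-++ j is is' = ≡.trans (≡.cong (map _) (filterB-++ _ is is')) (LP.map-++ _ (filterB (λ i → j ≤ᵇ μAt i) is) _)

  cols-sorted : AllPairs N._<_ cols
  cols-sorted = AllPairsP.map⁺ (AllPairs.map N.s≤s (upTo-increasing (length μ)))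

  -- The frontier of a filling that is complete up to row j, and in row j + 1 complete on the columns P.
  frontier : ℕ → List ℕ → List ℕ → List Box
  frontier j P Q = row j Q ++ row (suc j) P

  record Reached (C : List Box) : Set where
    constructor reached
    field
      {level} : ℕ
      {done todo} : List ℕ
      split : cols ≡ done ++ todo
      shape : C ≡ frontier level done todo

  data Head : Box → List Box → Set where
    head : ∀ {i j} P Q → cols ≡ P ++ i ∷ Q → j N.≤ μAt i → Head (i , j) (frontier j P Q)

  -- Columns of Q without a box in row j are passed over. They have no box in row j + 1 either, so
  -- moving them from Q to P does not alter the frontier.
  search : ∀ j P Q → cols ≡ P ++ Q → (filterB (λ i → j ≤ᵇ μAt i) Q ≡ []) ⊎ (∃ λ b → ∃ λ C → (frontier j P Q ≡ b ∷ C) × Head b C)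
  search j P [] s = inj₁ ≡.refl
  search j P (i ∷ Q) s with bool-cases (j ≤ᵇ μAt i)
  ... | inj₁ e rewrite e = inj₂ ((i , j) , frontier j P Q , ≡.refl , head P Q s (≤ᵇ-true⇒≤ j (μAt i) e))
  ... | inj₂ e rewrite e with search j (P ++ i ∷ []) Q (≡.trans s (≡.sym (LP.++-assoc P (i ∷ []) Q)))
  ...   | inj₁ z = inj₁ z
  ...   | inj₂ (b , C , sh , h) = inj₂ (b , C , ≡.trans (≡.cong (row j Q ++_) (≡.sym (skip e))) sh , h)
    where
    skip : (j ≤ᵇ μAt i) ≡ false → row (suc j) (P ++ i ∷ []) ≡ row (suc j) P
    skip e = ≡.trans (row-++ (suc j) P (i ∷ [])) (≡.trans (≡.cong (λ z → row (suc j) P ++ map (λ i → (i , suc j)) (if z then i ∷ [] else []))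
      (≤ᵇ-false {suc j} {μAt i} (N.s≤s (NP.≮⇒≥ λ p → true≢false (≤ᵇ-true (NP.<⇒≤ p)) e)))) (LP.++-identityʳ _))

  filterB-mono : ∀ (p q : ℕ → Bool) is → (∀ i → q i ≡ true → p i ≡ true) → filterB p is ≡ [] → filterB q is ≡ []
  filterB-mono p q [] imp e = ≡.refl
  filterB-mono p q (i ∷ is) imp e with p i in ep | q i in eq
  ... | false | false = filterB-mono p q is imp e
  ... | false | true = ⊥-elim (true≢false (imp i eq) ep)

  filter-prefix : ∀ (p : ℕ → Bool) P Q → filterB p (P ++ Q) ≡ [] → filterB p P ≡ []
  filter-prefix p P Q e = LP.++-conicalˡ _ _ (≡.trans (≡.sym (filterB-++ p P Q)) e)

  next-row : ∀ {j P Q} → cols ≡ P ++ Q → filterB (λ i → j ≤ᵇ μAt i) Q ≡ [] → frontier j P Q ≡ frontier (suc j) [] cols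
  next-row {j} {P} {Q} s z = ≡.trans (≡.cong (λ z → map _ z ++ row (suc j) P) z) (≡.sym (≡.trans (LP.++-identityʳ (row (suc j) cols)) (≡.trans (≡.cong (row (suc j)) s) (≡.trans (row-++ (suc j) P Q)
      (≡.trans (≡.cong (λ z → row (suc j) P ++ map (λ i → (i , suc j)) z) (filterB-mono _ _ Q (λ i e → ≤ᵇ-true (NP.<⇒≤ (≤ᵇ-true⇒≤ (suc j) (μAt i) e))) z)) (LP.++-identityʳ _))))))

  -- If row j has no column left, the search starts again in row j + 1. A second failure would mean
  -- that row j + 1 has no boxes at all, and then the frontier would be empty.
  reached-head : ∀ {b C} → Reached (b ∷ C) → Head b C
  reached-head {b} {C} (reached {j} {P} {Q} s sh) with search j P Q s
  ... | inj₂ (b' , C' , sh' , h) with ≡.refl ← ≡.trans sh sh' = h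
  ... | inj₁ z with search (suc j) [] cols ≡.refl
  ...   | inj₂ (b' , C' , sh' , h) with ≡.refl ← ≡.trans (≡.trans sh (next-row {j} {P} {Q} s z)) sh' = h
  ...   | inj₁ z' with () ← ≡.trans sh (≡.trans (≡.cong (λ z → map _ z ++ row (suc j) P) z)
    (≡.cong (map _) (filter-prefix _ P Q (≡.trans (≡.cong (filterB _) (≡.sym s)) z'))))

  reached-drop : ∀ {i j} P Q → cols ≡ P ++ i ∷ Q → height (i , j) ≡ 0 → Reached (frontier j P Q)
  reached-drop {i} {j} P Q s e = reached {_} {j} {P ++ i ∷ []} {Q} (≡.trans s (≡.sym (LP.++-assoc P (i ∷ []) Q))) (≡.cong (row j Q ++_)
    (≡.sym (≡.trans (row-++ (suc j) P (i ∷ [])) (≡.trans (≡.cong (λ z → row (suc j) P ++ map (λ i → (i , suc j)) (if z then i ∷ [] else []))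
      (≤ᵇ-false {suc j} {μAt i} (N.s≤s (NP.m∸n≡0⇒m≤n e)))) (LP.++-identityʳ _)))))

  reached-grow : ∀ {i j h} P Q → cols ≡ P ++ i ∷ Q → height (i , j) ≡ suc h → Reached (frontier j P Q ++ (i , suc j) ∷ [])
  reached-grow {i} {j} {h} P Q s e = reached {_} {j} {P ++ i ∷ []} {Q} (≡.trans s (≡.sym (LP.++-assoc P (i ∷ []) Q))) (≡.trans (LP.++-assoc (row j Q) (row (suc j) P) ((i , suc j) ∷ [])) (≡.cong (row j Q ++_)
    (≡.sym (≡.trans (row-++ (suc j) P (i ∷ [])) (≡.cong (λ z → row (suc j) P ++ map (λ i → (i , suc j)) (if z then i ∷ [] else []))
      (≤ᵇ-true {suc j} {μAt i} (NP.m∸n≢0⇒n<m (λ z → NP.1+n≢0 (≡.trans (≡.sym e) z)))))))))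

  -- The two parts of the frontier are the two parts of `near`: the columns of P lie to the left and
  -- have reached row j + 1, those of Q lie to the right and are still in row j.
  countB-frontier : ∀ {i} j P Q → cols ≡ P ++ i ∷ Q → ∀ p → countB p (frontier j P Q) ≡ near (i , suc j) p
  countB-frontier {i} j P Q s p with sorted-split P {i} {Q} (≡.subst (AllPairs N._<_) s cols-sorted)
  ... | P<i , i<Q = ≡.trans (countB-++ p (row j Q) (row (suc j) P)) (≡.trans (NP.+-comm (countB p (row j Q)) _) (≡.cong₂ N._+_
    (≡.trans (countB-filter (λ i → suc j ≤ᵇ μAt i) (λ i → (i , suc j)) p P) (≡.sym (≡.trans (≡.cong (countB _) s) (countB-below P Q P<i i<Q _))))
    (≡.trans (countB-filter (λ i → j ≤ᵇ μAt i) (λ i → (i , j)) p Q) (≡.sym (≡.trans (≡.cong (countB _) s) (countB-above P Q P<i i<Q _))))))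

  ∧-congʳ : ∀ a {b c} → (a ≡ true → b ≡ c) → a ∧ b ≡ a ∧ c
  ∧-congʳ true e = e ≡.refl
  ∧-congʳ false e = ≡.refl

  ≤ᵇ-∸ : ∀ a b j → j N.≤ a → j N.≤ b → (a ∸ j ≤ᵇ b ∸ j) ≡ (a ≤ᵇ b)
  ≤ᵇ-∸ a b zero p q = ≡.refl
  ≤ᵇ-∸ (suc a) (suc b) (suc j) (N.s≤s p) (N.s≤s q) = ≡.trans (≤ᵇ-∸ a b j p q) (sucs a)
    where
    sucs : ∀ a → (a ≤ᵇ b) ≡ (suc a ≤ᵇ suc b)
    sucs zero = ≡.refl
    sucs (suc a) = ≡.refl

  arm-near : ∀ i j → suc j N.≤ μAt i → near (i , suc j) (λ c → height c ≤ᵇ leg (i , suc j)) ≡ arm (i , suc j)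
  arm-near i j p = ≡.cong₂ N._+_
    (countB-cong _ _ (All.tabulate {xs = cols} λ {i'} _ → ∧-congʳ (i' <ᵇ i) λ _ → ∧-congʳ (suc j ≤ᵇ μAt i') λ q → ≤ᵇ-∸ (μAt i') (μAt i) (suc j) (≤ᵇ-true⇒≤ (suc j) (μAt i') q) p))
    (countB-cong _ _ (All.tabulate {xs = cols} λ {i'} _ → ∧-congʳ (i <ᵇ i') λ _ → ∧-congʳ (j ≤ᵇ μAt i') λ q →
      -- Boxes to the right lie one row lower, so one more box is above them than above a box of row
      -- j + 1 in the same column. This turns the weak inequality of heights into the strict one in
      -- the definition of the arm.
      (≤ᵇ-∸ (suc (μAt i')) (μAt i) (suc j) (N.s≤s (≤ᵇ-true⇒≤ j (μAt i') q)) p)))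

  -- The boxes in the order in which `G` creates them; the recursion copies that of `G`, with boxes
  -- in place of labels.
  order visit : ℕ → List Box → List Box
  grown : ℕ → Box → List Box → ℕ → List Box
  order zero C = []
  order (suc N) C = visit N C
  visit N [] = []
  visit N (b ∷ C) = grown N b C (height b)
  grown N b C zero = order N C
  grown N (i , j) C (suc h) = (i , suc j) ∷ order N (C ++ (i , suc j) ∷ [])

-- Expansion of the recursion for `G` over fillings

module Expansion (S : Setting) (μ : List ℕ) (sizes : length μ ≡ Setting.n S) where
  open Setting S hiding (refl; sym; trans; zero)
  private module K = Setting S
  open Core S
  open Exchange S
  open Words S using (·-·)
  open Mac μ using (cols; μAt; boxes; basement; leg; arm; allLists)
  open Cells μ

  -- The nested form of the sum over all labellings of bs, which follows the recursion of `G`;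
  -- `sumF-lists` passes to the flat form used in the definition of E_μ.
  sumF : List Box → (Filling → M) → Filling → M
  sumF [] Ψ fl = Ψ fl
  sumF (b ∷ bs) Ψ fl = ΣM (λ v → sumF bs Ψ ((b , v) ∷ fl)) cols

  AgreeOff : List Box → Filling → Filling → Set
  AgreeOff bs fl fl' = ∀ c → All (λ b → eqBox b c ≡ false) bs → val fl' c ≡ val fl c

  sumF-local : ∀ bs {Ψ Ψ'} fl → (∀ fl' → AgreeOff bs fl fl' → Ψ fl' ≋ Ψ' fl') → sumF bs Ψ fl ≋ sumF bs Ψ' fl
  sumF-local [] fl e = e fl (λ c _ → ≡.refl)
  sumF-local (b ∷ bs) fl e = ΣM-cong cols λ v → sumF-local bs ((b , v) ∷ fl) λ fl' a → e fl' λ { c (p ∷ ps) → ≡.trans (a c ps) (val-there fl c p) }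

  sumF-linear : ∀ {F} → Linear F → ∀ bs Ψ fl → F (sumF bs Ψ fl) ≋ sumF bs (λ fl' → F (Ψ fl')) fl
  sumF-linear L [] Ψ fl = ≋-refl
  sumF-linear L (b ∷ bs) Ψ fl = ≋-trans (linear-Σ L _ cols) (ΣM-cong cols λ v → sumF-linear L bs Ψ ((b , v) ∷ fl))

  Respectful : (Filling → M) → Set
  Respectful Ψ = ∀ fl fl' → (∀ c → val fl c ≡ val fl' c) → Ψ fl ≋ Ψ fl'

  sumF-resp : ∀ bs {Ψ} → Respectful Ψ → Respectful (sumF bs Ψ)
  sumF-resp [] r fl fl' e = r fl fl' e
  sumF-resp (b ∷ bs) r fl fl' e = ΣM-cong cols λ v → sumF-resp bs r ((b , v) ∷ fl) ((b , v) ∷ fl') (val-cons b v e)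

  sumF-↭ : ∀ {bs bs'} {Ψ} → Respectful Ψ → bs ↭ bs' → Unique bs → ∀ fl → sumF bs Ψ fl ≋ sumF bs' Ψ fl
  sumF-↭ r ↭.refl U fl = ≋-refl
  sumF-↭ r (↭.prep b p) (_ ∷ U) fl = ΣM-cong cols λ v → sumF-↭ r p U ((b , v) ∷ fl)
  sumF-↭ {Ψ = Ψ} r (↭.swap {xs} {ys} b b' p) ((ne ∷ _) ∷ _ ∷ U) fl = ≋-trans (ΣM-swap (λ v v' → sumF xs Ψ ((b' , v') ∷ (b , v) ∷ fl)) cols cols)
    (ΣM-cong cols λ v' → ΣM-cong cols λ v → ≋-trans (sumF-resp xs r _ _ (val-swap (λ e → ne (≡.sym e)) v' v fl)) (sumF-↭ r p U _))
  sumF-↭ r (↭.trans p q) U fl = ≋-trans (sumF-↭ r p U fl) (sumF-↭ r q (unique-↭ p U) fl)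

  ΣM-++ : ∀ {A : Set} (φ : A → M) xs ys → ΣM φ (xs ++ ys) ≋ ΣM φ xs ⊞ ΣM φ ys
  ΣM-++ φ [] ys = combine x₀ (:𝟘 :⊞ x₀) (ΣM φ ys ∷ⱽ []ⱽ) (λ v → K.sym (+-identityˡ _))
  ΣM-++ φ (x ∷ xs) ys = ≋-trans (⊞-cong ≋-refl (ΣM-++ φ xs ys))
    (combine (x₀ :⊞ (x₁ :⊞ x₂)) ((x₀ :⊞ x₁) :⊞ x₂) (φ x ∷ⱽ ΣM φ xs ∷ⱽ ΣM φ ys ∷ⱽ []ⱽ) (λ v → K.sym (+-assoc _ _ _)))

  ΣM-map : ∀ {A B : Set} (φ : B → M) (f : A → B) xs → ΣM φ (map f xs) ≡ ΣM (λ x → φ (f x)) xs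
  ΣM-map φ f [] = ≡.refl
  ΣM-map φ f (x ∷ xs) = ≡.cong (φ (f x) ⊞_) (ΣM-map φ f xs)

  ΣM-concatMap : ∀ {A B : Set} (φ : B → M) (f : A → List B) xs → ΣM φ (concatMap f xs) ≋ ΣM (λ x → ΣM φ (f x)) xs
  ΣM-concatMap φ f [] = ≋-refl
  ΣM-concatMap φ f (x ∷ xs) = ≋-trans (ΣM-++ φ (f x) (concatMap f xs)) (⊞-cong ≋-refl (ΣM-concatMap φ f xs))

  sumF-lists : ∀ bs {Ψ} → Respectful Ψ → Unique bs → ∀ fl → sumF bs Ψ fl ≋ ΣM (λ vs → Ψ (zip bs vs ++ fl)) (allLists (length bs))
  sumF-lists [] {Ψ} r U fl = combine x₀ (x₀ :⊞ :𝟘) (Ψ fl ∷ⱽ []ⱽ) (λ v → K.sym (+-identityʳ _))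
  sumF-lists (b ∷ bs) {Ψ} r (a ∷ U) fl = ≋-trans (ΣM-cong cols λ v → ≋-trans (sumF-lists bs r U ((b , v) ∷ fl))
      (≋-trans (ΣM-cong (allLists (length bs)) λ vs → r _ _ (val-insert bs a v vs fl)) (≋-reflexive (≡.sym (ΣM-map _ (v ∷_) (allLists (length bs)))))))
    (≋-sym (ΣM-concatMap _ (λ v → map (v ∷_) (allLists (length bs))) cols))

  weightF : Filling → Box → Carrier
  weightF fl (i , j) = tz (+ arm (i , j) Z.- + near (i , j) (λ c → val fl c <ᵇ val fl (i , j))) * ratio (leg (i , j)) (arm (i , j)) (val fl (i , j)) (val fl (i , j ∸ 1))

  -- The factor of one box in a complete filling. Each factor is zero or a scalar times a variable,
  -- so factors commute and the boxes may be taken in any order.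
  step : Filling → Box → M → M
  step fl b m = if free fl b then weightF fl b · X (val fl b ∸ 1) m else 𝟘

  term : List Box → Filling → M
  term bs fl = foldr (step fl) 𝟙 bs

  step-linear : ∀ fl b → Linear (step fl b)
  step-linear fl b with free fl b
  ... | true = record
    { cong = λ e → ·-cong K.refl (X.cong _ e)
    ; add = λ f g → ≋-trans (·-cong K.refl (X.add _ f g)) (Linear.add (·-linear _) _ _)
    ; scale = λ c f → ≋-trans (·-cong K.refl (X.scale _ c f)) (Linear.scale (·-linear _) c _) }
  ... | false = record
    { cong = λ _ → ≋-refl
    ; add = λ f g → combine :𝟘 (:𝟘 :⊞ :𝟘) []ⱽ (λ v → K.sym (+-identityˡ _))
    ; scale = λ c f → combine :𝟘 (c :· :𝟘) []ⱽ (λ v → K.sym (zeroʳ _)) }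

  step-comm : ∀ fl b b' m → step fl b (step fl b' m) ≋ step fl b' (step fl b m)
  step-comm fl b b' m with free fl b | free fl b'
  ... | true | true = ≋-trans (swapped b b') (≋-trans (·-cong (*-comm _ _) (ext (X-comm _ _ m))) (≋-sym (swapped b' b)))
    where
    swapped : ∀ b b' → weightF fl b · X (val fl b ∸ 1) (weightF fl b' · X (val fl b' ∸ 1) m) ≋ (weightF fl b * weightF fl b') · X (val fl b ∸ 1) (X (val fl b' ∸ 1) m)
    swapped b b' = ≋-trans (·-cong K.refl (X.scale _ _ _)) (·-· _ _ _)
  ... | true | false = ≋-trans (·-cong K.refl (Linear.zero-map (X-linear _))) (Linear.zero-map (·-linear _))
  ... | false | true = ≋-sym (≋-trans (·-cong K.refl (Linear.zero-map (X-linear _))) (Linear.zero-map (·-linear _)))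
  ... | false | false = ≋-refl

  term-↭ : ∀ {bs bs'} → bs ↭ bs' → ∀ fl → term bs fl ≋ term bs' fl
  term-↭ ↭.refl fl = ≋-refl
  term-↭ (↭.prep b p) fl = Linear.cong (step-linear fl b) (term-↭ p fl)
  term-↭ (↭.swap b b' p) fl = ≋-trans (step-comm fl b b' _) (Linear.cong (step-linear fl b') (Linear.cong (step-linear fl b) (term-↭ p fl)))
  term-↭ (↭.trans p q) fl = ≋-trans (term-↭ p fl) (term-↭ q fl)

  step-resp : ∀ fl fl' → (∀ c → val fl c ≡ val fl' c) → ∀ b m → step fl b m ≡ step fl' b m
  step-resp fl fl' e (i , j) m rewrite e (i , j) | e (i , j ∸ 1)
    | near-cong (i , j) {λ c → val fl c ≡ᵇ val fl' (i , j)} {λ c → val fl' c ≡ᵇ val fl' (i , j)} (λ c → ≡.cong (_≡ᵇ val fl' (i , j)) (e c))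
    | near-cong (i , j) {λ c → val fl c <ᵇ val fl' (i , j)} {λ c → val fl' c <ᵇ val fl' (i , j)} (λ c → ≡.cong (_<ᵇ val fl' (i , j)) (e c)) = ≡.refl

  term-resp : ∀ bs → Respectful (term bs)
  term-resp [] fl fl' e = ≋-refl
  term-resp (b ∷ bs) fl fl' e = ≋-trans (≋-reflexive (step-resp fl fl' e b _)) (Linear.cong (step-linear fl' b) (term-resp bs fl fl' e))

  Above : Box → Box → Set
  Above c b = proj₁ b ≡ proj₁ c → proj₂ c N.< proj₂ b

  -- The invariant that makes the label of c final: boxes added later lie above the frontier in
  -- their column, hence strictly above c if they share its column.
  Low : Box → List Box → Set
  Low c = All (λ c' → proj₁ c' ≡ proj₁ c → proj₂ c N.≤ proj₂ c')

  order-above : ∀ N C c → Low c C → All (Above c) (order N C)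
  order-above zero C c l = []
  order-above (suc N) [] c l = []
  order-above (suc N) ((i , j) ∷ C) c (p ∷ l) with height (i , j)
  ... | zero = order-above N C c l
  ... | suc h = (λ e → N.s≤s (p e)) ∷ order-above N (C ++ (i , suc j) ∷ []) c (AllP.++⁺ l ((λ e → NP.m≤n⇒m≤1+n (p e)) ∷ []))

  untouched : ∀ N C c → Low c C → All (λ b → eqBox b c ≡ false) (order N C)
  untouched N C c l = All.map (λ {b} a → eqBox-false {b} {c} λ { ≡.refl → NP.<-irrefl ≡.refl (a ≡.refl) }) (order-above N C c l)

  -- Fillings use the labels 1, ..., n and states the labels 0, ..., n - 1; `Labelled` ensures that
  -- subtracting 1 loses nothing.
  state : Filling → List Box → State
  state fl = map (λ c → (val fl c ∸ 1 , height c))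

  Labelled : Filling → List Box → Set
  Labelled fl = All (λ c → ∃ λ l → val fl c ≡ suc l)

  All-row : ∀ {Q : Box → Set} j is → All (λ i → Q (i , j)) is → All Q (row j is)
  All-row j [] [] = []
  All-row j (i ∷ is) (q ∷ qs) with j ≤ᵇ μAt i
  ... | true = q ∷ All-row j is qs
  ... | false = All-row j is qs

  low : ∀ {i j} P Q → cols ≡ P ++ i ∷ Q → ∀ {x r} → (r N.≤ j) ⊎ (r N.≤ suc j × x N.≤ i) → Low (x , r) (frontier j P Q ++ (i , suc j) ∷ [])
  low {i} {j} P Q s {x} {r} a with sorted-split P {i} {Q} (≡.subst (AllPairs N._<_) s cols-sorted)
  ... | P<i , i<Q = AllP.++⁺ (AllP.++⁺ (All-row j Q (All.map (λ i<y e → rightward a i<y e) i<Q)) (All-row (suc j) P (All.map (λ _ _ → upward a) P<i))) ((λ _ → upward a) ∷ [])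
    where
    upward : (r N.≤ j) ⊎ (r N.≤ suc j × x N.≤ i) → r N.≤ suc j
    upward (inj₁ p) = NP.m≤n⇒m≤1+n p
    upward (inj₂ (p , _)) = p
    rightward : (r N.≤ j) ⊎ (r N.≤ suc j × x N.≤ i) → ∀ {y} → i N.< y → y ≡ x → r N.≤ j
    rightward (inj₁ p) i<y e = p
    rightward (inj₂ (_ , x≤i)) i<y ≡.refl = ⊥-elim (NP.<⇒≱ i<y x≤i)

  frontier-low : ∀ {i j} P Q → cols ≡ P ++ i ∷ Q → All (λ c → Low c (frontier j P Q ++ (i , suc j) ∷ [])) (frontier j P Q)
  frontier-low {i} {j} P Q s with sorted-split P {i} {Q} (≡.subst (AllPairs N._<_) s cols-sorted)
  ... | P<i , i<Q = AllP.++⁺ (All-row j Q (All.map (λ _ → low P Q s (inj₁ NP.≤-refl)) i<Q))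
    (All-row (suc j) P (All.map (λ x<i → low P Q s (inj₂ (NP.≤-refl , NP.<⇒≤ x<i))) P<i))

  countB-state : ∀ (p : ℕ × ℕ → Bool) fl C → countB p (state fl C) ≡ countB (λ c → p (val fl c ∸ 1 , height c)) C
  countB-state p fl C = countB-map p _ C

  -- The weight of a step involves only labels of the frontier and of the new box, and these are
  -- never overwritten. It can therefore be evaluated on the complete filling, which turns the
  -- recursion into a sum of products over boxes.
  expand : ∀ N C fl → Reached C → Labelled fl C → G N (state fl C) ≋ sumF (order N C) (term (order N C)) fl
  expand-grown : ∀ N {i j} P Q fl h → cols ≡ P ++ i ∷ Q → height (i , j) ≡ h → Labelled fl ((i , j) ∷ frontier j P Q) →
    G (suc N) ((val fl (i , j) ∸ 1 , h) ∷ state fl (frontier j P Q)) ≋ sumF (grown N (i , j) (frontier j P Q) h) (term (grown N (i , j) (frontier j P Q) h)) fl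
  expand zero C fl r l = ≋-refl
  expand (suc N) [] fl r l = ≋-refl
  expand (suc N) (b ∷ C) fl r l with reached-head r
  ... | head {i} {j} P Q s _ = expand-grown N P Q fl (height (i , j)) s ≡.refl l
  expand-grown N P Q fl zero s e (_ ∷ ls) = expand N (frontier _ P Q) fl (reached-drop P Q s e) ls
  expand-grown N {i} {j} P Q fl (suc h) s e ((l , el) ∷ ls) = ≋-trans (≋-reflexive (≡.cong (λ k → ΣM (grow N (val fl (i , j) ∸ 1) h L) (upTo k)) (≡.sym sizes)))
    (≋-trans (ΣM-cong (upTo (length μ)) branch) (≋-reflexive (≡.sym (ΣM-map _ suc (upTo (length μ))))))
    where
    C C' : List Box
    C = frontier j P Q
    C' = C ++ (i , suc j) ∷ []
    L : State
    L = state fl C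
    placed : ℕ → Filling
    placed u = ((i , suc j) , suc u) ∷ fl
    leg-h : leg (i , suc j) ≡ h
    leg-h = ≡.trans (≡.sym (NP.pred[m∸n]≡m∸[1+n] (μAt i) j)) (≡.cong N.pred e)
    j<μ : suc j N.≤ μAt i
    j<μ = NP.m∸n≢0⇒n<m (λ z → NP.1+n≢0 (≡.trans (≡.sym e) z))
    above-C : All (λ c → eqBox (i , suc j) c ≡ false) C
    above-C with sorted-split P {i} {Q} (≡.subst (AllPairs N._<_) s cols-sorted)
    ... | P<i , i<Q = AllP.++⁺ (All-row j Q (All.map (λ { {x} i<x → eqBox-false {i , suc j} {x , j} λ () }) i<Q))
      (All-row (suc j) P (All.map (λ { {x} x<i → eqBox-false {i , suc j} {x , suc j} λ { ≡.refl → NP.<-irrefl ≡.refl x<i } }) P<i))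
    state-placed : ∀ u → state (placed u) C' ≡ L ++ (u , h) ∷ []
    state-placed u = ≡.trans (LP.map-++ _ C _) (≡.cong₂ _++_ (LP.map-cong-local (All.map (λ {c} p → ≡.cong (λ v → (v ∸ 1 , height c)) (val-there fl c p)) above-C))
      (≡.cong (_∷ []) (≡.cong₂ _,_ (≡.cong (_∸ 1) (val-here i j (suc u) fl)) leg-h)))
    labelled : ∀ u → Labelled (placed u) C'
    labelled u = AllP.++⁺ (All.zipWith (λ {c} → λ { (p , (k , q)) → k , ≡.trans (val-there fl c p) q }) (above-C , ls)) ((u , val-here i j (suc u) fl) ∷ [])
    matched : ∀ u fl' → AgreeOff (order N C') (placed u) fl' → ∀ m →
      (if mem u L then 𝟘 else weight (val fl (i , j) ∸ 1) h L u · X u m) ≡ step fl' (i , suc j) m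
    matched u fl' a m = ≡.trans (≡.cong₂ (λ x y → if x then 𝟘 else y · X u m) mem-eq weight-eq) (≡.trans (negated (near (i , suc j) (λ c → val fl' c ≡ᵇ val fl' (i , suc j)) ≡ᵇ 0))
       (≡.cong (λ v → if free fl' (i , suc j) then weightF fl' (i , suc j) · X (v ∸ 1) m else 𝟘) (≡.sym val-b)))
      where
      negated : ∀ b {x y : M} → (if not b then x else y) ≡ (if b then y else x)
      negated true = ≡.refl
      negated false = ≡.refl
      val-C : All (λ c → val fl' c ≡ val fl c) C
      val-C = All.zipWith (λ {c} → λ { (p , q) → ≡.trans (a c (untouched N C' c q)) (val-there fl c p) }) (above-C , frontier-low P Q s)
      val-b : val fl' (i , suc j) ≡ suc u
      val-b = ≡.trans (a (i , suc j) (untouched N C' (i , suc j) (low P Q s (inj₂ (NP.≤-refl , NP.≤-refl))))) (val-here i j (suc u) fl)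
      val-down : val fl' (i , j) ≡ val fl (i , j)
      val-down = ≡.trans (a (i , j) (untouched N C' (i , j) (low P Q s (inj₁ NP.≤-refl)))) (val-there fl (i , j) (eqBox-false {i , suc j} {i , j} λ e → NP.1+n≢n (≡.cong proj₂ e)))
      counted : ∀ (r : ℕ → ℕ → Bool) → (∀ x y → r (suc x) (suc y) ≡ r x y) → countB (λ x → r (proj₁ x) u) L ≡ near (i , suc j) (λ c → r (val fl' c) (val fl' (i , suc j)))
      counted r shift = ≡.trans (countB-state (λ x → r (proj₁ x) u) fl C) (≡.trans (countB-cong _ _ (All.zipWith (λ {c} → λ { (p , (k , q)) →
        ≡.trans (≡.cong (λ v → r (v ∸ 1) u) q) (≡.trans (≡.sym (shift k u)) (≡.cong₂ r (≡.trans (≡.sym q) (≡.sym p)) (≡.sym val-b))) }) (val-C , ls))) (countB-frontier j P Q s _))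
      mem-eq : mem u L ≡ not (free fl' (i , suc j))
      mem-eq = ≡.trans (mem-count u L) (≡.cong (λ k → not (k ≡ᵇ 0)) (counted _≡ᵇ_ (λ _ _ → ≡.refl)))
      arm-eq : countB (λ x → proj₂ x ≤ᵇ h) L ≡ arm (i , suc j)
      arm-eq = ≡.trans (countB-state (λ x → proj₂ x ≤ᵇ h) fl C) (≡.trans (countB-frontier j P Q s _) (≡.trans (≡.cong (λ h → near (i , suc j) (λ c → height c ≤ᵇ h)) (≡.sym leg-h)) (arm-near i j j<μ)))
      ratio-shift : ∀ h a u l → ratio h a (suc u) (suc l) ≡ ratio h a u l
      ratio-shift h a u l = ≡.refl
      weight-eq : weight (val fl (i , j) ∸ 1) h L u ≡ weightF fl' (i , suc j)
      weight-eq = ≡.cong₂ _*_ (≡.cong₂ (λ x y → tz (+ x Z.- + y)) arm-eq (counted _<ᵇ_ (λ _ _ → ≡.refl)))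
        (≡.trans (≡.cong₂ (λ x y → ratio y x u (val fl (i , j) ∸ 1)) arm-eq (≡.sym leg-h))
          (≡.trans (≡.sym (ratio-shift (leg (i , suc j)) (arm (i , suc j)) u (val fl (i , j) ∸ 1)))
            (≡.cong₂ (ratio (leg (i , suc j)) (arm (i , suc j))) (≡.sym val-b) (≡.trans (≡.cong (λ v → suc (v ∸ 1)) el) (≡.trans (≡.sym el) (≡.sym val-down))))))
    branch : ∀ u → grow N (val fl (i , j) ∸ 1) h L u ≋ sumF (order N C') (term ((i , suc j) ∷ order N C')) (placed u)
    branch u = ≋-trans (≋-reflexive (matched u (placed u) (λ c _ → ≡.refl) _)) (≋-trans (Linear.cong (step-linear (placed u) (i , suc j))
        (≋-trans (≋-reflexive (≡.cong (G N) (≡.sym (state-placed u)))) (expand N C' (placed u) (reached-grow P Q s e) (labelled u))))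
      (≋-trans (sumF-linear (step-linear (placed u) (i , suc j)) (order N C') (term (order N C')) (placed u))
        (sumF-local (order N C') (placed u) λ fl' a → ≋-reflexive (≡.trans (≡.sym (matched u (placed u) (λ c _ → ≡.refl) _)) (matched u fl' a _)))))

-- Statistics of fillings

countB≡sum : ∀ {A : Set} (p : A → Bool) xs → countB p xs ≡ sum (map (λ x → bit (p x)) xs)
countB≡sum p [] = ≡.refl
countB≡sum p (x ∷ xs) with p x
... | true = ≡.cong suc (countB≡sum p xs)
... | false = countB≡sum p xs

sum-map-+ : ∀ {A : Set} (f g : A → ℕ) xs → sum (map (λ x → f x N.+ g x) xs) ≡ sum (map f xs) N.+ sum (map g xs)
sum-map-+ f g [] = ≡.refl
sum-map-+ f g (x ∷ xs) = ≡.trans (≡.cong (f x N.+ g x N.+_) (sum-map-+ f g xs)) (interchange (f x) (g x) _ _)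
  where
  interchange : ∀ a b c d → a N.+ b N.+ (c N.+ d) ≡ a N.+ c N.+ (b N.+ d)
  interchange = solve-∀ℕ

sum-map-cong : ∀ {A : Set} {f g : A → ℕ} {xs} → All (λ x → f x ≡ g x) xs → sum (map f xs) ≡ sum (map g xs)
sum-map-cong e = ≡.cong sum (LP.map-cong-local e)

sum-map-zero : ∀ {A : Set} (xs : List A) → sum (map (λ _ → 0) xs) ≡ 0
sum-map-zero [] = ≡.refl
sum-map-zero (x ∷ xs) = sum-map-zero xs

sum-map-swap : ∀ {A B : Set} (f : A → B → ℕ) xs ys → sum (map (λ x → sum (map (f x) ys)) xs) ≡ sum (map (λ y → sum (map (λ x → f x y) xs)) ys)
sum-map-swap f [] ys = ≡.sym (sum-map-zero ys)
sum-map-swap f (x ∷ xs) ys = ≡.trans (≡.cong (sum (map (f x) ys) N.+_) (sum-map-swap f xs ys))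
  (≡.sym (sum-map-+ (f x) (λ y → sum (map (λ x → f x y) xs)) ys))

countB-concatMap : ∀ {A B : Set} (p : B → Bool) (f : A → List B) xs → countB p (concatMap f xs) ≡ sum (map (λ x → countB p (f x)) xs)
countB-concatMap p f [] = ≡.refl
countB-concatMap p f (x ∷ xs) = ≡.trans (countB-++ p (f x) (concatMap f xs)) (≡.cong (countB p (f x) N.+_) (countB-concatMap p f xs))

countB-at : ∀ k m c → countB (λ j → (j ≡ᵇ k) ∧ c) (upTo (suc m)) ≡ bit ((k ≤ᵇ m) ∧ c)
countB-at k m c = ≡.trans (within (λ j → j) k (suc m) (λ _ → ≡.refl)) (≡.cong (λ b → bit (b ∧ c)) (<ᵇ-≤ᵇ k m))
  where
  <ᵇ-≤ᵇ : ∀ k m → (k <ᵇ suc m) ≡ (k ≤ᵇ m)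
  <ᵇ-≤ᵇ zero m = ≡.refl
  <ᵇ-≤ᵇ (suc k) m = ≡.refl
  missing : ∀ f m → (∀ j → (f j ≡ᵇ k) ≡ false) → countB (λ j → (j ≡ᵇ k) ∧ c) (applyUpTo f m) ≡ 0
  missing f zero e = ≡.refl
  missing f (suc m) e rewrite e 0 = missing (λ j → f (suc j)) m (λ j → e (suc j))
  within : ∀ f i m → (∀ j → (f j ≡ᵇ k) ≡ (j ≡ᵇ i)) → countB (λ j → (j ≡ᵇ k) ∧ c) (applyUpTo f m) ≡ bit ((i <ᵇ m) ∧ c)
  within f i zero e = ≡.refl
  within f zero (suc m) e rewrite e 0 = ≡.trans (≡.cong (λ z → if c then suc z else z) (missing (λ j → f (suc j)) m (λ j → e (suc j)))) ≡.refl
  within f (suc i) (suc m) e rewrite e 0 = within (λ j → f (suc j)) i m (λ j → e (suc j))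

bool-iff : ∀ {a b} → (a ≡ true → b ≡ true) → (b ≡ true → a ≡ true) → a ≡ b
bool-iff {true} f g = ≡.sym (f ≡.refl)
bool-iff {false} {true} f g = g ≡.refl
bool-iff {false} {false} f g = ≡.refl

∧-false : ∀ {a b c} → (a ≡ true → b ≡ true → c ≡ false) → a ∧ b ∧ c ≡ false
∧-false {true} {true} f = f ≡.refl ≡.refl
∧-false {true} {false} f = ≡.refl
∧-false {false} f = ≡.refl

∧-false⁻ : ∀ {a b c} → a ∧ b ∧ c ≡ false → a ≡ true → b ≡ true → c ≡ false
∧-false⁻ e ≡.refl ≡.refl = e

countB-zero : ∀ {A : Set} (p : A → Bool) {xs} → countB p xs ≡ 0 → ∀ {x} → x ∈ xs → p x ≡ false
countB-zero p {x ∷ xs} e q with p x in ep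
countB-zero p {x ∷ xs} e (here ≡.refl) | false = ep
countB-zero p {x ∷ xs} e (there q) | false = countB-zero p e q

-- An earlier column meets the box in its own row, a later one in the row below.
rows-earlier : ∀ j j' → ((suc j ≡ᵇ j') ∨ ((j' ≡ᵇ j) ∧ false) ∨ ((suc (suc j) ≡ᵇ j') ∧ true)) ∧ ((j' <ᵇ suc j) ∨ ((suc j ≡ᵇ j') ∧ true)) ≡ (j' ≡ᵇ suc j)
rows-earlier zero zero = ≡.refl
rows-earlier zero (suc zero) = ≡.refl
rows-earlier zero (suc (suc zero)) = ≡.refl
rows-earlier zero (suc (suc (suc j'))) = ≡.refl
rows-earlier (suc j) zero = ≡.refl
rows-earlier (suc j) (suc j') = rows-earlier j j'

rows-later : ∀ j j' → ((suc j ≡ᵇ j') ∨ ((j' ≡ᵇ j) ∧ true) ∨ ((suc (suc j) ≡ᵇ j') ∧ false)) ∧ ((j' <ᵇ suc j) ∨ ((suc j ≡ᵇ j') ∧ false)) ≡ (j' ≡ᵇ j)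
rows-later zero zero = ≡.refl
rows-later zero (suc zero) = ≡.refl
rows-later zero (suc (suc zero)) = ≡.refl
rows-later zero (suc (suc (suc j'))) = ≡.refl
rows-later (suc j) zero = ≡.refl
rows-later (suc j) (suc j') = rows-later j j'

rows-same : ∀ a b c → not a ∧ (a ∨ (b ∧ false) ∨ (c ∧ false)) ≡ false
rows-same true b c = ≡.refl
rows-same false true true = ≡.refl
rows-same false true false = ≡.refl
rows-same false false true = ≡.refl
rows-same false false false = ≡.refl

module Counts (μ : List ℕ) where
  open Mac μ hiding (E; n)
  open Cells μ

  size : List Box → ℕ
  size [] = 0
  size (c ∷ C) = suc (height c) N.+ size C

  size-snoc : ∀ C c → size (C ++ c ∷ []) ≡ size C N.+ suc (height c)
  size-snoc [] c = NP.+-identityʳ _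
  size-snoc (c' ∷ C) c = ≡.trans (≡.cong (suc (height c') N.+_) (size-snoc C c)) (≡.sym (NP.+-assoc (suc (height c')) (size C) _))

  towers : List Box → List Box
  towers = concatMap (λ c → tower (proj₁ c) (proj₂ c) (height c))

  -- `order` runs through the rows and `towers` through the columns; both list the boxes above C.
  -- Growing a box moves the rest of its tower to the end, which is harmless up to permutation.
  order-↭ : ∀ N C → size C N.≤ N → order N C ↭ towers C
  order-↭ zero [] le = ↭-refl
  order-↭ (suc N) [] le = ↭-refl
  order-↭ (suc N) ((i , j) ∷ C) (N.s≤s le) with height (i , j) in e
  ... | zero = order-↭ N C le
  ... | suc h = ↭-prep _ (↭-trans (order-↭ N (C ++ (i , suc j) ∷ []) (NP.≤-trans (NP.≤-reflexive (≡.trans (size-snoc C (i , suc j)) (≡.trans (≡.cong (λ z → size C N.+ suc z) shorter) (NP.+-comm (size C) (suc h))))) le))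
      (↭-trans (↭-reflexive (≡.trans (LP.concatMap-++ _ C ((i , suc j) ∷ [])) (≡.cong (towers C ++_) (≡.trans (LP.++-identityʳ _) (≡.cong (tower i (suc j)) shorter))))) (++-comm (towers C) (tower i (suc j) h))))
    where
    shorter : height (i , suc j) ≡ h
    shorter = ≡.trans (≡.sym (NP.pred[m∸n]≡m∸[1+n] (μAt i) j)) (≡.cong N.pred e)

  tower-column : ∀ i h → tower i 0 h ≡ map (λ j → (i , j)) (map suc (upTo h))
  tower-column i h = ≡.trans (applied (λ k → (i , suc k)) 0 h (λ k → ≡.refl)) (≡.sym (≡.trans (≡.sym (LP.map-∘ (upTo h))) (LP.map-upTo _ h)))
    where
    applied : ∀ f j h → (∀ k → f k ≡ (i , suc (j N.+ k))) → tower i j h ≡ applyUpTo f h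
    applied f j zero e = ≡.refl
    applied f j (suc h) e = ≡.cong₂ _∷_ (≡.sym (≡.trans (e 0) (≡.cong (λ z → (i , suc z)) (NP.+-identityʳ j))))
      (applied (λ k → f (suc k)) (suc j) h (λ k → ≡.trans (e (suc k)) (≡.cong (λ z → (i , suc z)) (NP.+-suc j k))))

  towers-basement : towers basement ≡ boxes
  towers-basement = ≡.trans (LP.concatMap-map _ _ cols) (LP.concatMap-cong (λ i → tower-column i (μAt i)) cols)

  boxes-unique : Unique boxes
  boxes-unique = UniqueP.concat⁺ (AllP.map⁺ (All.tabulate (λ {i} _ → UniqueP.map⁺ (λ { ≡.refl → ≡.refl }) (UniqueP.map⁺ NP.suc-injective (UniqueP.upTo⁺ (μAt i))))))
    (AllPairsP.map⁺ {f = λ i → map (i ,_) (map suc (upTo (μAt i)))} (AllPairs.map (λ {i} {i'} i<i' {v} pq → disjoint i<i' (∈-map⁻ (i ,_) (proj₁ pq)) (∈-map⁻ (i' ,_) (proj₂ pq))) cols-sorted))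
    where
    disjoint : ∀ {i i' u} {xs ys : List ℕ} → i N.< i' → (∃ λ j → j ∈ xs × u ≡ (i , j)) → (∃ λ j → j ∈ ys × u ≡ (i' , j)) → ⊥
    disjoint i<i' (_ , _ , ≡.refl) (_ , _ , ≡.refl) = NP.<-irrefl ≡.refl i<i'

  boxes⁺ : ∀ {i j} → i ∈ cols → suc j N.≤ μAt i → (i , suc j) ∈ boxes
  boxes⁺ {i} {j} p q = ∈-concatMap⁺ _ (Any.map (λ { ≡.refl → ∈-map⁺ (i ,_) (∈-map⁺ suc (∈-upTo⁺ q)) }) p)

  boxes⁻ : ∀ {b} → b ∈ boxes → ∃ λ i → ∃ λ j → (b ≡ (i , suc j)) × i ∈ cols × suc j N.≤ μAt i
  boxes⁻ p = column cols (∈-concatMap⁻ _ {xs = cols} p)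
    where
    column : ∀ is {b} → Any (λ i → b ∈ map (i ,_) (map suc (upTo (μAt i)))) is → ∃ λ i → ∃ λ j → (b ≡ (i , suc j)) × i ∈ is × suc j N.≤ μAt i
    column (i ∷ is) (here q) with ∈-map⁻ (i ,_) q
    ... | _ , r , ≡.refl with ∈-map⁻ suc r
    ...   | j , s , ≡.refl = i , j , ≡.refl , here ≡.refl , ∈-upTo⁻ s
    column (i ∷ is) (there q) with column is q
    ... | i' , j , e , r , s = i' , j , e , there r , s

  aug⁺ : ∀ {i j} → i ∈ cols → j N.≤ μAt i → (i , j) ∈ aug
  aug⁺ {j = zero} p q = ∈-++⁺ʳ boxes (∈-map⁺ _ p)
  aug⁺ {j = suc j} p q = ∈-++⁺ˡ (boxes⁺ p q)

  aug⁻ : ∀ {i j} → (i , j) ∈ aug → i ∈ cols × j N.≤ μAt i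
  aug⁻ p with ∈-++⁻ boxes p
  ... | inj₁ q with boxes⁻ q
  ...   | _ , _ , ≡.refl , r , s = r , s
  aug⁻ p | inj₂ q with ∈-map⁻ _ q
  ...   | _ , r , ≡.refl = r , N.z≤n

  near-zero : ∀ i j p → (near (i , suc j) p ≡ᵇ 0) ≡ true → ∀ {i'} → i' ∈ cols →
    (i' N.< i → suc j N.≤ μAt i' → p (i' , suc j) ≡ false) × (i N.< i' → j N.≤ μAt i' → p (i' , j) ≡ false)
  near-zero i j p e q = (λ a b → ∧-false⁻ (countB-zero _ (NP.m+n≡0⇒m≡0 _ sum≡0) q) (<ᵇ-true a) (≤ᵇ-true b)) ,
    (λ a b → ∧-false⁻ (countB-zero _ (NP.m+n≡0⇒n≡0 _ sum≡0) q) (<ᵇ-true a) (≤ᵇ-true b))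
    where
    sum≡0 : near (i , suc j) p ≡ 0
    sum≡0 = ≡ᵇ-sound (near (i , suc j) p) 0 e

  zero-near : ∀ i j p → (∀ {i'} → i' ∈ cols → (i' N.< i → suc j N.≤ μAt i' → p (i' , suc j) ≡ false) × (i N.< i' → j N.≤ μAt i' → p (i' , j) ≡ false)) →
    (near (i , suc j) p ≡ᵇ 0) ≡ true
  zero-near i j p f = ≡.cong (_≡ᵇ 0) (≡.cong₂ N._+_
    (countB-none _ cols (All.tabulate λ {i'} q → ∧-false {i' <ᵇ i} λ a b → proj₁ (f q) (<ᵇ-true⇒< i' i a) (≤ᵇ-true⇒≤ (suc j) (μAt i') b)))
    (countB-none _ cols (All.tabulate λ {i'} q → ∧-false {i <ᵇ i'} λ a b → proj₂ (f q) (<ᵇ-true⇒< i i' a) (≤ᵇ-true⇒≤ j (μAt i') b))))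
    where
    <ᵇ-true⇒< : ∀ a b → (a <ᵇ b) ≡ true → a N.< b
    <ᵇ-true⇒< a b = ≤ᵇ-true⇒≤ (suc a) b

  attacks-row : ∀ {i i'} j → ¬ i ≡ i' → attacks (i , j) (i' , j) ≡ true
  attacks-row j ne rewrite ≡ᵇ-false ne | ≡ᵇ-refl j = ≡.refl

  attacks-below : ∀ {i i'} j → i N.< i' → attacks (i , suc j) (i' , j) ≡ true
  attacks-below {i} {i'} j p rewrite ≡ᵇ-false {i} {i'} (NP.<⇒≢ p) | suc-≡ᵇ j | ≡ᵇ-refl j | <ᵇ-true p = ≡.refl

  data Attack : Box → Box → Set where
    in-row : ∀ {i i'} j → ¬ i ≡ i' → Attack (i , j) (i' , j)
    downwards : ∀ {i i'} j → i N.< i' → Attack (i , suc j) (i' , j)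
    upwards : ∀ {i i'} j → i' N.< i → Attack (i , j) (i' , suc j)

  attack : ∀ u v → attacks u v ≡ true → Attack u v
  attack (i , j) (i' , j') e with ∧-split {not (eqBox (i , j) (i' , j'))} e
  ... | ne , e' with j ≡ᵇ j' in ej
  ...   | true with ≡.refl ← ≡ᵇ-sound j j' ej = in-row j λ { ≡.refl → true≢false ne (≡.cong (λ b → not (b ∧ true)) (≡ᵇ-refl i)) }
  ...   | false with (suc j' ≡ᵇ j) ∧ (i <ᵇ i') in ed
  ...     | true with ∧-split {suc j' ≡ᵇ j} ed
  ...       | a , b with ≡.refl ← ≡ᵇ-sound (suc j') j a = downwards j' (≤ᵇ-true⇒≤ (suc i) i' b)
  attack (i , j) (i' , j') e | ne , e' | false | false with ∧-split {suc j ≡ᵇ j'} e'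
  ...       | a , b with ≡.refl ← ≡ᵇ-sound (suc j) j' a = upwards j (≤ᵇ-true⇒≤ (suc i') i b)

  allB-pairs : ∀ p → (∀ u v → u ∈ aug → v ∈ aug → p (u , v) ≡ true) → allB p pairs ≡ true
  allB-pairs p e = ∈-allB p pairs (λ q → member (∈-concatMap⁻ _ {xs = aug} q) (λ r → r))
    where
    member : ∀ {us w} → Any (λ u → w ∈ map (u ,_) aug) us → (∀ {u} → u ∈ us → u ∈ aug) → p w ≡ true
    member (here q) f with ∈-map⁻ _ q
    ... | v , r , ≡.refl = e _ v (f (here ≡.refl)) r
    member (there q) f = member q (λ r → f (there r))

  -- Of two attacking boxes the one read first has the other among its `near` boxes, so it suffices
  -- to test each box against those. Two boxes of the basement attack each other too, but their
  -- labels are different.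
  nonAttacking-free : ∀ fl → nonAttacking fl ≡ allB (free fl) boxes
  nonAttacking-free fl = bool-iff forth back
    where
    compatible : Box × Box → Bool
    compatible (u , v) = not (attacks u v) ∨ not (val fl u ≡ᵇ val fl v)
    resolved : ∀ {a b} → not a ∨ not b ≡ true → a ≡ true → b ≡ false
    resolved {b = false} _ _ = ≡.refl
    resolved {b = true} () ≡.refl
    forth : nonAttacking fl ≡ true → allB (free fl) boxes ≡ true
    forth e = ∈-allB (free fl) boxes member
      where
      distinct : ∀ {u v} → u ∈ aug → v ∈ aug → attacks u v ≡ true → (val fl v ≡ᵇ val fl u) ≡ false
      distinct {u} {v} p q a = ≡.trans (≡ᵇ-comm (val fl v) (val fl u))
        (resolved {attacks u v} (allB-∈ _ e (∈-concatMap⁺ _ (Any.map (λ { ≡.refl → ∈-map⁺ (u ,_) q }) p))) a)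
      member : ∀ {b} → b ∈ boxes → free fl b ≡ true
      member p with boxes⁻ p
      ... | i , j , ≡.refl , q , r = zero-near i j (λ c → val fl c ≡ᵇ val fl (i , suc j)) λ s →
        (λ a b → distinct (aug⁺ q r) (aug⁺ s b) (attacks-row (suc j) (λ e → NP.<⇒≢ a (≡.sym e)))) ,
        (λ a b → distinct (aug⁺ q r) (aug⁺ s b) (attacks-below j a))
    back : allB (free fl) boxes ≡ true → nonAttacking fl ≡ true
    back e = allB-pairs _ compatible-attack
      where
      earlier : ∀ {i i'} j → i' N.< i → (i , j) ∈ aug → (i' , j) ∈ aug → (val fl (i' , j) ≡ᵇ val fl (i , j)) ≡ false
      earlier zero p u v = ≡ᵇ-false (NP.<⇒≢ p)
      earlier {i} (suc j) p u v with aug⁻ u | aug⁻ v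
      ... | a , b | a' , b' = proj₁ (near-zero i j (λ c → val fl c ≡ᵇ val fl (i , suc j)) (allB-∈ (free fl) e (boxes⁺ a b)) a') p b'
      later : ∀ {i i'} j → i N.< i' → (i , suc j) ∈ aug → (i' , j) ∈ aug → (val fl (i' , j) ≡ᵇ val fl (i , suc j)) ≡ false
      later {i} j p u v with aug⁻ u | aug⁻ v
      ... | a , b | a' , b' = proj₂ (near-zero i j (λ c → val fl c ≡ᵇ val fl (i , suc j)) (allB-∈ (free fl) e (boxes⁺ a b)) a') p b'
      distinct : ∀ {u v} → Attack u v → u ∈ aug → v ∈ aug → (val fl u ≡ᵇ val fl v) ≡ false
      distinct (in-row {i} {i'} j ne) p q with NP.<-cmp i i'
      ... | tri< a _ _ = earlier j a q p
      ... | tri≈ _ a _ = ⊥-elim (ne a)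
      ... | tri> _ _ a = ≡.trans (≡ᵇ-comm (val fl (i , j)) _) (earlier j a p q)
      distinct (downwards {i} j a) p q = ≡.trans (≡ᵇ-comm (val fl (i , suc j)) _) (later j a p q)
      distinct (upwards j a) p q = later j a q p
      compatible-attack : ∀ u v → u ∈ aug → v ∈ aug → compatible (u , v) ≡ true
      compatible-attack u v p q with attacks u v in a
      ... | false = ≡.refl
      ... | true = ≡.cong not (distinct (attack u v a) p q)

  inversion : Filling → Box → Box → Bool
  inversion fl u v = attacks u v ∧ readBefore u v ∧ (val fl v <ᵇ val fl u)

  count-aug : ∀ p → countB p aug ≡ sum (map (λ i → countB (λ j → p (i , j)) (upTo (suc (μAt i)))) cols)
  count-aug p = ≡.trans (countB-++ p boxes basement) (≡.trans (≡.cong₂ N._+_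
      (countB-concatMap p _ cols) (≡.trans (countB-map p _ cols) (countB≡sum _ cols)))
    (≡.trans (≡.sym (sum-map-+ _ _ cols)) (sum-map-cong {xs = cols} (All.tabulate λ {i} _ → column i))))
    where
    column : ∀ i → countB p (map (i ,_) (map suc (upTo (μAt i)))) N.+ bit (p (i , 0)) ≡ countB (λ j → p (i , j)) (upTo (suc (μAt i)))
    column i = ≡.trans (≡.cong (N._+ bit (p (i , 0))) (≡.trans (countB-map p (i ,_) (map suc (upTo (μAt i)))) (≡.cong (countB (λ j → p (i , j))) (LP.map-upTo suc (μAt i))))) (prepend (p (i , 0)) _)
      where
      prepend : ∀ b k → k N.+ bit b ≡ (if b then suc k else k)
      prepend true k = NP.+-comm k 1
      prepend false k = NP.+-identityʳ k

  inversions-box : ∀ fl i j → countB (inversion fl (i , suc j)) aug ≡ near (i , suc j) (λ c → val fl c <ᵇ val fl (i , suc j))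
  inversions-box fl i j = ≡.trans (count-aug _) (≡.trans (sum-map-cong {xs = cols} (All.tabulate λ {i'} _ → column i'))
    (≡.trans (sum-map-+ _ _ cols) (≡.sym (≡.cong₂ N._+_ (countB≡sum _ cols) (countB≡sum _ cols)))))
    where
    r : Box → Bool
    r c = val fl c <ᵇ val fl (i , suc j)
    regroup : ∀ a b c d → a ≡ (b ∧ c) → d ∧ a ≡ (d ∧ b) ∧ c
    regroup a b c true ≡.refl = ≡.refl
    regroup a b c false _ = ≡.refl
    ∧-assoc : ∀ a b c → a ∧ b ∧ c ≡ (a ∧ b) ∧ c
    ∧-assoc true b c = ≡.refl
    ∧-assoc false b c = ≡.refl
    at : ∀ i' j' k → (j' ≡ᵇ k) ∧ r (i' , j') ≡ (j' ≡ᵇ k) ∧ r (i' , k)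
    at i' j' k = ∧-congʳ (j' ≡ᵇ k) λ e → ≡.cong (λ z → r (i' , z)) (≡ᵇ-sound j' k e)
    column : ∀ i' → countB (λ j' → inversion fl (i , suc j) (i' , j')) (upTo (suc (μAt i'))) ≡
      bit ((i' <ᵇ i) ∧ (suc j ≤ᵇ μAt i') ∧ r (i' , suc j)) N.+ bit ((i <ᵇ i') ∧ (j ≤ᵇ μAt i') ∧ r (i' , j))
    column i' with NP.<-cmp i i'
    ... | tri< p ne _ rewrite ≡ᵇ-false ne | <ᵇ-true p | <ᵇ-false (NP.<⇒≤ p) = ≡.trans
      (countB-cong _ (λ j' → (j' ≡ᵇ j) ∧ r (i' , j)) (All.tabulate {xs = upTo (suc (μAt i'))} λ {j'} _ → ≡.trans (∧-assoc ((suc j ≡ᵇ j') ∨ ((j' ≡ᵇ j) ∧ true) ∨ ((suc (suc j) ≡ᵇ j') ∧ false)) _ _) (≡.trans (≡.cong (_∧ r (i' , j')) (rows-later j j')) (at i' j' j))))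
      (countB-at j (μAt i') (r (i' , j)))
    ... | tri> _ ne p rewrite ≡ᵇ-false ne | <ᵇ-true p | <ᵇ-false (NP.<⇒≤ p) = ≡.trans
      (countB-cong _ (λ j' → (j' ≡ᵇ suc j) ∧ r (i' , suc j)) (All.tabulate {xs = upTo (suc (μAt i'))} λ {j'} _ → ≡.trans (∧-assoc ((suc j ≡ᵇ j') ∨ ((j' ≡ᵇ j) ∧ false) ∨ ((suc (suc j) ≡ᵇ j') ∧ true)) _ _) (≡.trans (≡.cong (_∧ r (i' , j')) (rows-earlier j j')) (at i' j' (suc j)))))
      (≡.trans (countB-at (suc j) (μAt i') (r (i' , suc j))) (≡.sym (NP.+-identityʳ _)))
    ... | tri≈ _ ≡.refl _ rewrite ≡ᵇ-refl i | <ᵇ-false (NP.≤-refl {i}) =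
      countB-none _ (upTo (suc (μAt i))) (All.tabulate λ {j'} _ → ≡.cong (_∧ (((j' <ᵇ suc j) ∨ ((suc j ≡ᵇ j') ∧ false)) ∧ (val fl (i , j') <ᵇ val fl (i , suc j)))) (rows-same (suc j ≡ᵇ j') (j' ≡ᵇ j) (suc (suc j) ≡ᵇ j')))

  inversions-basement : ∀ fl i → countB (inversion fl (i , 0)) aug ≡ countB (λ i' → i' <ᵇ i) cols
  inversions-basement fl i = ≡.trans (count-aug _) (≡.trans (sum-map-cong {xs = cols} (All.tabulate λ {i'} _ → column i')) (≡.sym (countB≡sum _ cols)))
    where
    column : ∀ i' → countB (λ j' → inversion fl (i , 0) (i' , j')) (upTo (suc (μAt i'))) ≡ bit (i' <ᵇ i)
    column i' = ≡.trans (countB-cong _ (λ j' → (j' ≡ᵇ 0) ∧ (i' <ᵇ i)) (All.tabulate {xs = upTo (suc (μAt i'))} λ {j'} _ → entry j')) (countB-at 0 (μAt i') (i' <ᵇ i))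
      where
      entry : ∀ j' → inversion fl (i , 0) (i' , j') ≡ (j' ≡ᵇ 0) ∧ (i' <ᵇ i)
      entry (suc j') with attacks (i , 0) (i' , suc j')
      ... | true = ≡.refl
      ... | false = ≡.refl
      entry zero with NP.<-cmp i' i
      ... | tri< p ne _ rewrite ≡ᵇ-false (λ e → ne (≡.sym e)) | <ᵇ-true p = ≡.refl
      ... | tri≈ _ ≡.refl _ rewrite ≡ᵇ-refl i | <ᵇ-false (NP.≤-refl {i}) = ≡.refl
      ... | tri> _ ne p rewrite ≡ᵇ-false (λ e → ne (≡.sym e)) | <ᵇ-false (NP.<⇒≤ p) = ≡.refl

  -- The number of inversions inside the basement: it is labelled by the identity and read from
  -- right to left, so every pair is inverted.
  ascents : ℕ
  ascents = sum (map (λ i → countB (λ i' → i <ᵇ i') cols) cols)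

  inversionsAt : Filling → Box → ℕ
  inversionsAt fl b = near b (λ c → val fl c <ᵇ val fl b)

  invCount-split : ∀ fl → invCount fl ≡ sum (map (inversionsAt fl) boxes) N.+ ascents
  invCount-split fl = ≡.trans (countB-concatMap _ _ aug) (≡.trans (≡.cong sum (LP.map-cong (λ u → countB-map _ (u ,_) aug) aug))
    (≡.trans (≡.cong sum (LP.map-++ _ boxes basement)) (≡.trans (sum-++ (map _ boxes) (map _ basement)) (≡.cong₂ N._+_
      (sum-map-cong (All.tabulate λ p → on-box (boxes⁻ p)))
      (≡.trans (≡.cong sum (≡.sym (LP.map-∘ cols))) (≡.trans (≡.cong sum (LP.map-cong (λ i → ≡.trans (inversions-basement fl i) (countB≡sum _ cols)) cols))
        (≡.trans (sum-map-swap (λ i i' → bit (i' <ᵇ i)) cols cols) (≡.cong sum (LP.map-cong (λ i → ≡.sym (countB≡sum _ cols)) cols)))))))))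
    where
    on-box : ∀ {b} → (∃ λ i → ∃ λ j → (b ≡ (i , suc j)) × i ∈ cols × suc j N.≤ μAt i) → countB (inversion fl b) aug ≡ inversionsAt fl b
    on-box (i , j , ≡.refl , _) = inversions-box fl i j

  invW-sum : ∀ (g : ℕ → ℕ) is → AllPairs N._<_ is → invW (map g is) ≡ sum (map (λ i → countB (λ i' → (i <ᵇ i') ∧ (g i' <ᵇ g i)) is) is)
  invW-sum g [] [] = ≡.refl
  invW-sum g (i ∷ is) (a ∷ s) = ≡.cong₂ N._+_ (≡.trans (countB-map _ g is) (≡.sym (countB-above [] is [] a (λ i' → g i' <ᵇ g i))))
    (≡.trans (invW-sum g is s) (sum-map-cong (All.map (λ {k} i<k → ≡.sym (≡.cong (λ b → if b ∧ (g i <ᵇ g k) then suc (countB (λ i' → (k <ᵇ i') ∧ (g i' <ᵇ g k)) is) else countB (λ i' → (k <ᵇ i') ∧ (g i' <ᵇ g k)) is) (<ᵇ-false (NP.<⇒≤ i<k)))) a)))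

  μ-columns : map μAt cols ≡ μ
  μ-columns = ≡.trans (≡.sym (LP.map-∘ (upTo (length μ)))) (map-lookupL-upTo μ)

  -- A pair of columns i < i' has μ i ≤ μ i' and is counted in `basementCount`, or else it is an
  -- inversion of μ.
  basementCount-invW : basementCount N.+ invW μ ≡ ascents
  basementCount-invW = ≡.trans (≡.cong₂ N._+_
      (≡.trans (countB-concatMap _ _ cols) (≡.cong sum (LP.map-cong (λ i → ≡.trans (countB-map _ (i ,_) cols) (countB≡sum _ cols)) cols)))
      (≡.trans (≡.cong invW (≡.sym μ-columns)) (≡.trans (invW-sum μAt cols cols-sorted) (≡.cong sum (LP.map-cong (λ i → countB≡sum _ cols) cols)))))
    (≡.trans (≡.sym (sum-map-+ _ _ cols)) (≡.cong sum (LP.map-cong (λ i → ≡.trans (≡.sym (sum-map-+ _ _ cols))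
      (≡.trans (≡.cong sum (LP.map-cong (λ i' → complementary i i') cols)) (≡.sym (countB≡sum _ cols)))) cols)))
    where
    complementary : ∀ i i' → bit ((i <ᵇ i') ∧ (μAt i ≤ᵇ μAt i') ∧ (i <ᵇ i')) N.+ bit ((i <ᵇ i') ∧ (μAt i' <ᵇ μAt i)) ≡ bit (i <ᵇ i')
    complementary i i' with i <ᵇ i'
    ... | false = ≡.refl
    ... | true with NP.≤-<-connex (μAt i) (μAt i')
    ...   | inj₁ p rewrite ≤ᵇ-true p | <ᵇ-false p = ≡.refl
    ...   | inj₂ p rewrite ≤ᵇ-false p | <ᵇ-true p = ≡.refl

  descentArms : Filling → List Box → ℕ
  descentArms fl bs = sum (map (λ u → if descent fl u then arm u else 0) bs)

  -- The inversions inside the basement exceed `basementCount` by inv μ. This is the origin of the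
  -- factor t^(inv μ) between E_μ and `G`; the other terms are sums over boxes.
  coinv-formula : ∀ fl → coinvF fl ≡ (+ sum (map arm boxes) Z.- + sum (map (inversionsAt fl) boxes) Z.+ + descentArms fl boxes) Z.- + invW μ
  coinv-formula fl = ≡.trans (≡.cong₂ (λ x y → + sum (map arm boxes) Z.- (x Z.- + basementCount Z.- y))
      (≡.trans (≡.cong +_ (≡.trans (invCount-split fl) (≡.cong (sum (map (inversionsAt fl) boxes) N.+_) (≡.sym basementCount-invW))))
        (≡.trans (ZP.pos-+ (sum (map (inversionsAt fl) boxes)) _) (≡.cong (λ z → + sum (map (inversionsAt fl) boxes) Z.+ z) (ZP.pos-+ basementCount (invW μ))))) ≡.refl)
    (cancel (+ sum (map arm boxes)) (+ sum (map (inversionsAt fl) boxes)) (+ basementCount) (+ invW μ) (+ descentArms fl boxes))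
    where
    cancel : ∀ a b c w d → a Z.- ((b Z.+ (c Z.+ w)) Z.- c Z.- d) ≡ (a Z.- b Z.+ d) Z.- w
    cancel = solve-∀ℤ

-- `G` as a sum over non-attacking fillings

module Fillings (S : Setting) (μ : List ℕ) (sizes : length μ ≡ Setting.n S) where
  open Setting S hiding (refl; sym; trans; zero)
  private module K = Setting S
  open IntegerSolver scalars
  open Core S
  open Exchange S
  open Words S using (·-·)
  open Mac μ hiding (E; n; pairs)
  open Cells μ
  open Counts μ
  open Expansion S μ sizes

  factors : Filling → List Box → Carrier
  factors fl bs = foldr _*_ 1# (map (λ u → ζ (leg u) (arm u)) (filterB (λ u → not (val fl u ≡ᵇ val fl (down u))) bs))

  exponent : Filling → List Box → ℤ
  exponent fl bs = + sum (map arm bs) Z.- + sum (map (inversionsAt fl) bs) Z.+ + descentArms fl bs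

  descents : Filling → List Box → ℕ
  descents fl bs = sum (map (λ u → if descent fl u then suc (leg u) else 0) bs)

  coefficient : Filling → List Box → Carrier
  coefficient fl bs = tz (exponent fl bs) * (qz (+ descents fl bs) * factors fl bs)

  monomial : Filling → List Box → M
  monomial fl = foldr (λ b → X (val fl b ∸ 1)) 𝟙

  regroup : ∀ a x s y d → (a Z.- x) Z.+ (s Z.- y Z.+ d) ≡ (a Z.+ s) Z.- (x Z.+ y) Z.+ d
  regroup = solve-∀ℤ

  coefficient-∷ : ∀ fl b bs → weightF fl b * coefficient fl bs ≈ coefficient fl (b ∷ bs)
  coefficient-∷ fl b@(i , j) bs with NP.<-cmp (val fl b) (val fl (down b))
  ... | tri≈ _ e _ rewrite ≡.sym e | ratio-equal (leg b) (arm b) (val fl b) | ≡ᵇ-refl (val fl b) | <ᵇ-false (NP.≤-refl {val fl b}) =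
    K.trans (solve 3 (λ a s r → (a :* :1) :* (s :* r) := (a :* s) :* r) K.refl _ _ _)
      (*-cong (K.trans (K.sym (tz-+ _ _)) (K.reflexive (≡.cong tz (regroup (+ arm b) (+ inversionsAt fl b) (+ sum (map arm bs)) (+ sum (map (inversionsAt fl) bs)) (+ descentArms fl bs))))) K.refl)
  ... | tri< p _ _ rewrite ratio-less (leg b) (arm b) p | ≡ᵇ-false (NP.<⇒≢ p) | <ᵇ-false (NP.<⇒≤ p) =
    K.trans (solve 5 (λ a z s q r → (a :* z) :* (s :* (q :* r)) := (a :* s) :* (q :* (z :* r))) K.refl _ _ _ _ _)
      (*-cong (K.trans (K.sym (tz-+ _ _)) (K.reflexive (≡.cong tz (regroup (+ arm b) (+ inversionsAt fl b) (+ sum (map arm bs)) (+ sum (map (inversionsAt fl) bs)) (+ descentArms fl bs))))) K.refl)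
  ... | tri> _ ne p rewrite ratio-greater (leg b) (arm b) p | ≡ᵇ-false ne | <ᵇ-true p =
    K.trans (solve 7 (λ a z q' t' s q r → (a :* (z :* (q' :* t'))) :* (s :* (q :* r)) := ((a :* t') :* s) :* ((q' :* q) :* (z :* r))) K.refl _ _ _ _ _ _ _)
      (*-cong (K.trans (*-cong (K.sym (tz-+ _ _)) K.refl) (K.trans (K.sym (tz-+ _ _))
          (K.reflexive (≡.cong tz (regroup-descent (+ arm b) (+ inversionsAt fl b) (+ sum (map arm bs)) (+ sum (map (inversionsAt fl) bs)) (+ descentArms fl bs))))))
        (*-cong (K.sym (qz-+ _ _)) K.refl))
    where
    regroup-descent : ∀ a x s y d → (a Z.- x) Z.+ a Z.+ (s Z.- y Z.+ d) ≡ (a Z.+ s) Z.- (x Z.+ y) Z.+ (a Z.+ d)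
    regroup-descent = solve-∀ℤ

  coefficient-[] : ∀ fl → coefficient fl [] ≈ 1#
  coefficient-[] fl = K.trans (*-cong tz-0 (*-cong qz-0 K.refl)) (solve 0 (:1 :* (:1 :* :1) := :1) K.refl)

  1·-identity : ∀ f → 1# · f ≋ f
  1·-identity f = ext λ α → K.trans (coef-· 1# f α) (*-identityˡ _)

  term-collect : ∀ bs fl → term bs fl ≋ (if allB (free fl) bs then coefficient fl bs · monomial fl bs else 𝟘)
  term-collect [] fl = ≋-sym (≋-trans (·-cong (coefficient-[] fl) ≋-refl) (1·-identity 𝟙))
  term-collect (b ∷ bs) fl with free fl b
  ... | false = ≋-refl
  ... | true = ≋-trans (·-cong K.refl (X.cong _ (term-collect bs fl))) collected
    where
    collected : weightF fl b · X (val fl b ∸ 1) (if allB (free fl) bs then coefficient fl bs · monomial fl bs else 𝟘) ≋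
      (if allB (free fl) bs then coefficient fl (b ∷ bs) · X (val fl b ∸ 1) (monomial fl bs) else 𝟘)
    collected with allB (free fl) bs
    ... | true = ≋-trans (·-cong K.refl (X.scale _ _ _)) (≋-trans (·-· _ _ _) (·-cong (coefficient-∷ fl b bs) ≋-refl))
    ... | false = ≋-trans (·-cong K.refl (Linear.zero-map (X-linear _))) (Linear.zero-map (·-linear _))

  L₀ : State
  L₀ = zip (upTo n) μ

  basement-state : state [] basement ≡ L₀
  basement-state = ≡.trans (≡.trans (≡.sym (LP.map-∘ cols)) (≡.sym (LP.map-∘ (upTo (length μ)))))
    (≡.trans (graph (upTo (length μ))) (≡.cong₂ zip (≡.cong upTo sizes) (map-lookupL-upTo μ)))
    where
    graph : ∀ is → map (λ i → (i , lookupL μ i)) is ≡ zip is (map (lookupL μ) is)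
    graph [] = ≡.refl
    graph (i ∷ is) = ≡.cong (_ ∷_) (graph is)

  basement-reached : Reached basement
  basement-reached = reached {_} {0} {[]} {cols} ≡.refl (≡.trans (≡.cong (map (λ i → (i , 0))) (≡.sym (all-columns cols))) (≡.sym (LP.++-identityʳ _)))
    where
    all-columns : ∀ (is : List ℕ) → filterB (λ _ → true) is ≡ is
    all-columns [] = ≡.refl
    all-columns (i ∷ is) = ≡.cong (i ∷_) (all-columns is)

  basement-labelled : Labelled [] basement
  basement-labelled = AllP.map⁺ (AllP.map⁺ (All.tabulate {xs = upTo (length μ)} λ {i} _ → i , ≡.refl))

  meas-state : ∀ C → meas (state [] C) ≡ size C
  meas-state [] = ≡.refl
  meas-state (c ∷ C) = ≡.cong (suc (height c) N.+_) (meas-state C)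

  weighted : Filling → M
  weighted fl = if nonAttacking fl then coefficient fl boxes · monomial fl boxes else 𝟘

  -- The order of growth is exchanged for that of `boxes` twice: in the product over boxes for a
  -- fixed filling, and in the iterated sum over labels.
  G-fillings : G (meas L₀) L₀ ≋ ΣM (λ vs → weighted (zip boxes vs)) (allLists (length boxes))
  G-fillings = ≋-trans (≋-reflexive (≡.cong₂ G fuel (≡.sym basement-state)))
    (≋-trans (expand (size basement) basement [] basement-reached basement-labelled)
    (≋-trans (sumF-local (order (size basement) basement) [] λ fl _ → term-↭ ordered fl)
    (≋-trans (sumF-↭ (term-resp boxes) ordered (unique-↭ (↭-sym ordered) boxes-unique) [])
    (≋-trans (sumF-lists boxes (term-resp boxes) boxes-unique [])
      (ΣM-cong (allLists (length boxes)) λ vs → ≋-trans (≋-reflexive (≡.cong (term boxes) (LP.++-identityʳ (zip boxes vs)))) (≋-trans (term-collect boxes (zip boxes vs))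
        (≋-reflexive (≡.cong (λ b → if b then coefficient (zip boxes vs) boxes · monomial (zip boxes vs) boxes else 𝟘) (≡.sym (nonAttacking-free (zip boxes vs)))))))))))
    where
    fuel : meas L₀ ≡ size basement
    fuel = ≡.trans (≡.cong meas (≡.sym basement-state)) (meas-state basement)
    ordered : order (size basement) basement ↭ boxes
    ordered = ↭-trans (order-↭ (size basement) basement NP.≤-refl) (↭-reflexive towers-basement)

  -- The normalisation is that of E_μ: only the exponent of t is shifted, by inv μ.
  coefficient-coinv : ∀ fl → tz (Z.- + invW μ) * coefficient fl boxes ≈ qz (+ maj fl) * (tz (coinvF fl) * factors fl boxes)
  coefficient-coinv fl = K.trans (solve 4 (λ w e q z → w :* (e :* (q :* z)) := q :* ((e :* w) :* z)) K.refl _ _ _ _)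
    (*-cong K.refl (*-cong (K.trans (K.sym (tz-+ _ _)) (K.reflexive (≡.cong tz (≡.sym (coinv-formula fl))))) K.refl))

  val-positive : ∀ bs vs → All (λ b → ∃ λ j → proj₂ b ≡ suc j) bs → All (λ v → ∃ λ l → v ≡ suc l) vs → length vs ≡ length bs →
    ∀ fl → All (λ b → ∃ λ l → val (zip bs vs ++ fl) b ≡ suc l) bs
  val-positive bs vs r p e fl = All.map (λ { {b} (inj , (j , ej)) → found b j ej bs vs p e inj }) (All.zip (self bs , r))
    where
    open import Data.List.Membership.Propositional using (_∈_)
    open import Data.List.Relation.Unary.Any using (here; there)
    self : ∀ (bs : List Box) → All (_∈ bs) bs
    self bs = All.tabulate (λ p → p)
    found : ∀ b j → proj₂ b ≡ suc j → ∀ bs vs → All (λ v → ∃ λ l → v ≡ suc l) vs → length vs ≡ length bs → b ∈ bs → ∃ λ l → val (zip bs vs ++ fl) b ≡ suc l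
    found (i , _) j ≡.refl (b' ∷ bs) (v ∷ vs) (p ∷ ps) e q with eqBox b' (i , suc j) in eb
    ... | true = p
    found (i , _) j ≡.refl (b' ∷ bs) (v ∷ vs) (p ∷ ps) e (here ≡.refl) | false with () ← ≡.trans (≡.sym eb) (eqBox-refl b')
    found (i , _) j ≡.refl (b' ∷ bs) (v ∷ vs) (p ∷ ps) e (there q) | false = found (i , suc j) j ≡.refl bs vs ps (NP.suc-injective e) q

  allLists-positive : ∀ k → All (λ vs → length vs ≡ k × All (λ v → ∃ λ l → v ≡ suc l) vs) (allLists k)
  allLists-positive zero = (≡.refl , []) ∷ []
  allLists-positive (suc k) = AllP.concat⁺ (AllP.map⁺ (AllP.map⁺ (All.tabulate {xs = upTo (length μ)} λ {i} _ →
    AllP.map⁺ (All.map (λ { (e , p) → ≡.cong suc e , (i , ≡.refl) ∷ p }) (allLists-positive k)))))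

  boxes-positive : All (λ b → ∃ λ j → proj₂ b ≡ suc j) boxes
  boxes-positive = All.tabulate λ p → from (boxes⁻ p)
    where
    from : ∀ {b} {A : ℕ → Set} {B : ℕ → ℕ → Set} → (∃ λ i → ∃ λ j → (b ≡ (i , suc j)) × A i × B i j) → ∃ λ j → proj₂ b ≡ suc j
    from (i , j , ≡.refl , _) = j , ≡.refl

  guarded : ∀ b c {f g} → f ≋ c · g → (if b then f else 𝟘) ≋ c · (if b then g else 𝟘)
  guarded true c e = e
  guarded false c e = ≋-sym (Linear.zero-map (·-linear c))

-- The Demazure–Lusztig operator in the two exponents it acts on, dually:
-- H x y is the value of a linear functional on the monomial x^x y^y.
module TwoVariables (R : CommutativeRing 0ℓ 0ℓ) (t : CommutativeRing.Carrier R) where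
  open CommutativeRing R
  open IntegerSolver R
  open import Algebra.Properties.Ring ring using (-0#≈0#)
  open import Relation.Binary.Reasoning.Setoid setoid

  Fn : Set
  Fn = ℕ → ℕ → Carrier

  -- The sum of H over the d points of the antidiagonal from (a , e + d - 1) to (a + d - 1 , e). For
  -- a = e these are the exponents that occur in a divided difference.
  up : Fn → ℕ → ℕ → ℕ → Carrier
  up H a e zero = 0#
  up H a e (suc d) = H a (e N.+ d) + up H (suc a) e d

  up-snoc : ∀ H a e d → up H a e (suc d) ≈ up H a (suc e) d + H (a N.+ d) e
  up-snoc H a e zero = trans (+-cong (reflexive (≡.cong₂ H (≡.sym (NP.+-identityʳ a)) (NP.+-identityʳ e))) refl) (+-comm _ _)
  up-snoc H a e (suc d) = trans (+-cong (reflexive (≡.cong (H a) (NP.+-suc e d))) (up-snoc H (suc a) e d))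
    (trans (sym (+-assoc _ _ _)) (+-cong refl (reflexive (≡.cong (λ z → H z e) (≡.sym (NP.+-suc a d))))))

  _₁ _₂ : Fn → Fn
  (H ₁) x y = H (suc x) y
  (H ₂) x y = H x (suc y)

  up-₁ : ∀ H a e d → up (H ₁) a e d ≡ up H (suc a) e d
  up-₁ H a e zero = ≡.refl
  up-₁ H a e (suc d) = ≡.cong (λ z → _ + z) (up-₁ H (suc a) e d)

  up-₂ : ∀ H a e d → up (H ₂) a e d ≡ up H a (suc e) d
  up-₂ H a e zero = ≡.refl
  up-₂ H a e (suc d) = ≡.cong (λ z → _ + z) (up-₂ H (suc a) e d)

  up-cong : ∀ {H H'} → (∀ x y → H x y ≈ H' x y) → ∀ a e d → up H a e d ≈ up H' a e d
  up-cong E a e zero = refl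
  up-cong E a e (suc d) = +-cong (E _ _) (up-cong E (suc a) e d)

  up-+ : ∀ H H' a e d → up (λ x y → H x y + H' x y) a e d ≈ up H a e d + up H' a e d
  up-+ H H' a e zero = sym (+-identityˡ _)
  up-+ H H' a e (suc d) = trans (+-cong refl (up-+ H H' (suc a) e d))
    (solve 4 (λ a b c d → (a :+ b) :+ (c :+ d) := (a :+ c) :+ (b :+ d)) refl _ _ _ _)

  up-* : ∀ c H a e d → up (λ x y → c * H x y) a e d ≈ c * up H a e d
  up-* c H a e zero = sym (zeroʳ c)
  up-* c H a e (suc d) = trans (+-cong refl (up-* c H (suc a) e d)) (sym (distribˡ c _ _))

  ∂ : Fn → Fn
  ∂ H a b = if a <ᵇ b then up H a a (b ∸ a) else - up H b b (a ∸ b)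

  data Order : ℕ → ℕ → Set where
    le : ∀ a d → Order a (a N.+ d)
    gt : ∀ b d → Order (suc b N.+ d) b

  order : ∀ a b → Order a b
  order a b with NP.≤-<-connex a b
  ... | inj₁ p = ≡.subst (Order a) (NP.m+[n∸m]≡n p) (le a (b ∸ a))
  ... | inj₂ p = ≡.subst (λ z → Order z b) (NP.m+[n∸m]≡n p) (gt b (a ∸ suc b))

  ∂-le : ∀ H a d → ∂ H a (a N.+ d) ≈ up H a a d
  ∂-le H a zero rewrite NP.+-identityʳ a | <ᵇ-false (NP.≤-refl {a}) | NP.n∸n≡0 a = -0#≈0#
  ∂-le H a (suc d) rewrite <ᵇ-true {a} {a N.+ suc d} (NP.m<m+n a (N.s≤s N.z≤n)) | NP.m+n∸m≡n a (suc d) = refl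

  ∂-ge : ∀ H b d → ∂ H (b N.+ d) b ≈ - up H b b d
  ∂-ge H b d rewrite <ᵇ-false (NP.m≤m+n b d) | NP.m+n∸m≡n b d = refl

  ∂-cong : ∀ {H H'} → (∀ x y → H x y ≈ H' x y) → ∀ a b → ∂ H a b ≈ ∂ H' a b
  ∂-cong E a b with a <ᵇ b
  ... | true = up-cong E a a (b ∸ a)
  ... | false = -‿cong (up-cong E b b (a ∸ b))

  ∂-+ : ∀ H H' a b → ∂ (λ x y → H x y + H' x y) a b ≈ ∂ H a b + ∂ H' a b
  ∂-+ H H' a b with a <ᵇ b
  ... | true = up-+ H H' a a (b ∸ a)
  ... | false = trans (-‿cong (up-+ H H' b b (a ∸ b))) (solve 2 (λ x y → :- (x :+ y) := :- x :+ :- y) refl _ _)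

  ∂-* : ∀ c H a b → ∂ (λ x y → c * H x y) a b ≈ c * ∂ H a b
  ∂-* c H a b with a <ᵇ b
  ... | true = up-* c H a a (b ∸ a)
  ... | false = trans (-‿cong (up-* c H b b (a ∸ b))) (solve 2 (λ c x → :- (c :* x) := c :* :- x) refl c _)

  -- The twisted Leibniz rule ∂ (x f) = y ∂ f - f in dual form; `∂-suc-right` is ∂ (y f) = x ∂ f +
  -- f. The two rules drive the induction on exponents.
  ∂-suc-left : ∀ H a b → ∂ H (suc a) b ≈ ∂ (H ₂) a b - H a b
  ∂-suc-left H a b with order a b
  ... | le .a zero = begin
    ∂ H (suc a) (a N.+ 0) ≈⟨ reflexive (≡.cong₂ (∂ H) (≡.sym (NP.+-comm a 1)) (NP.+-identityʳ a)) ⟩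
    ∂ H (a N.+ 1) a ≈⟨ ∂-ge H a 1 ⟩
    - (H a (a N.+ 0) + 0#) ≈⟨ solve 1 (λ x → :- (x :+ :0) := :0 :- x) refl _ ⟩
    0# - H a (a N.+ 0) ≈⟨ +-cong (sym (∂-le (H ₂) a 0)) refl ⟩
    ∂ (H ₂) a (a N.+ 0) - H a (a N.+ 0) ∎
  ... | le .a (suc d) = begin
    ∂ H (suc a) (a N.+ suc d) ≈⟨ reflexive (≡.cong (∂ H (suc a)) (NP.+-suc a d)) ⟩
    ∂ H (suc a) (suc a N.+ d) ≈⟨ ∂-le H (suc a) d ⟩
    up H (suc a) (suc a) d ≈⟨ solve 2 (λ x h → x := (h :+ x) :- h) refl _ (H a (suc a N.+ d)) ⟩
    up H a (suc a) (suc d) - H a (suc a N.+ d) ≈⟨ +-cong (reflexive (≡.sym (up-₂ H a a (suc d)))) (-‿cong (reflexive (≡.cong (H a) (≡.sym (NP.+-suc a d))))) ⟩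
    up (H ₂) a a (suc d) - H a (a N.+ suc d) ≈⟨ +-cong (sym (∂-le (H ₂) a (suc d))) refl ⟩
    ∂ (H ₂) a (a N.+ suc d) - H a (a N.+ suc d) ∎
  ... | gt .b d = begin
    ∂ H (suc (suc b N.+ d)) b ≈⟨ reflexive (≡.cong (λ z → ∂ H z b) (≡.sym (≡.trans (NP.+-suc b (suc d)) (≡.cong suc (NP.+-suc b d))))) ⟩
    ∂ H (b N.+ suc (suc d)) b ≈⟨ ∂-ge H b (suc (suc d)) ⟩
    - up H b b (suc (suc d)) ≈⟨ -‿cong (up-snoc H b b (suc d)) ⟩
    - (up H b (suc b) (suc d) + H (b N.+ suc d) b) ≈⟨ solve 2 (λ x y → :- (x :+ y) := :- x :- y) refl _ _ ⟩
    - up H b (suc b) (suc d) - H (b N.+ suc d) b ≈⟨ +-cong (-‿cong (reflexive (≡.sym (up-₂ H b b (suc d))))) refl ⟩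
    - up (H ₂) b b (suc d) - H (b N.+ suc d) b ≈⟨ +-cong (sym (∂-ge (H ₂) b (suc d))) refl ⟩
    ∂ (H ₂) (b N.+ suc d) b - H (b N.+ suc d) b ≈⟨ reflexive (≡.cong (λ z → ∂ (H ₂) z b - H z b) (NP.+-suc b d)) ⟩
    ∂ (H ₂) (suc b N.+ d) b - H (suc b N.+ d) b ∎

  ∂-suc-right : ∀ H a b → ∂ H a (suc b) ≈ ∂ (H ₁) a b + H a b
  ∂-suc-right H a b with order a b
  ... | le .a d = begin
    ∂ H a (suc (a N.+ d)) ≈⟨ reflexive (≡.cong (∂ H a) (≡.sym (NP.+-suc a d))) ⟩
    ∂ H a (a N.+ suc d) ≈⟨ ∂-le H a (suc d) ⟩
    H a (a N.+ d) + up H (suc a) a d ≈⟨ +-comm _ _ ⟩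
    up H (suc a) a d + H a (a N.+ d) ≈⟨ +-cong (reflexive (≡.sym (up-₁ H a a d))) refl ⟩
    up (H ₁) a a d + H a (a N.+ d) ≈⟨ +-cong (sym (∂-le (H ₁) a d)) refl ⟩
    ∂ (H ₁) a (a N.+ d) + H a (a N.+ d) ∎
  ... | gt .b d = begin
    ∂ H (suc b N.+ d) (suc b) ≈⟨ ∂-ge H (suc b) d ⟩
    - up H (suc b) (suc b) d ≈⟨ solve 2 (λ x h → :- x := :- (x :+ h) :+ h) refl _ (H (suc b N.+ d) b) ⟩
    - (up H (suc b) (suc b) d + H (suc b N.+ d) b) + H (suc b N.+ d) b ≈⟨ +-cong (-‿cong (sym (up-snoc H (suc b) b d))) refl ⟩
    - up H (suc b) b (suc d) + H (suc b N.+ d) b ≈⟨ +-cong (-‿cong (reflexive (≡.sym (up-₁ H b b (suc d))))) refl ⟩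
    - up (H ₁) b b (suc d) + H (suc b N.+ d) b ≈⟨ +-cong (sym (∂-ge (H ₁) b (suc d))) refl ⟩
    ∂ (H ₁) (b N.+ suc d) b + H (suc b N.+ d) b ≈⟨ +-cong (reflexive (≡.cong (λ z → ∂ (H ₁) z b) (NP.+-suc b d))) refl ⟩
    ∂ (H ₁) (suc b N.+ d) b + H (suc b N.+ d) b ∎

  -- σ = 1 + (x_k − x_{k+1}) ∂
  ∂-swap : ∀ H a b → H b a ≈ H a b + (∂ (H ₁) a b - ∂ (H ₂) a b)
  ∂-swap H a b with order a b
  ... | le .a d = begin
    H (a N.+ d) a ≈⟨ solve 2 (λ x y → x := (y :+ x) :- y) refl _ (up H a (suc a) d) ⟩
    (up H a (suc a) d + H (a N.+ d) a) - up H a (suc a) d ≈⟨ +-cong (sym (up-snoc H a a d)) refl ⟩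
    (H a (a N.+ d) + up H (suc a) a d) - up H a (suc a) d ≈⟨ +-assoc _ _ _ ⟩
    H a (a N.+ d) + (up H (suc a) a d - up H a (suc a) d)
      ≈⟨ +-cong refl (+-cong (trans (reflexive (≡.sym (up-₁ H a a d))) (sym (∂-le (H ₁) a d))) (-‿cong (trans (reflexive (≡.sym (up-₂ H a a d))) (sym (∂-le (H ₂) a d))))) ⟩
    H a (a N.+ d) + (∂ (H ₁) a (a N.+ d) - ∂ (H ₂) a (a N.+ d)) ∎
  ... | gt .b d = begin
    H b (suc b N.+ d) ≈⟨ reflexive (≡.cong (H b) (≡.sym (NP.+-suc b d))) ⟩
    H b (b N.+ suc d) ≈⟨ solve 3 (λ x y z → x := z :+ ((:- y) :- (:- ((x :+ y) :- z)))) refl _ (up H (suc b) b (suc d)) (H (b N.+ suc d) b) ⟩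
    H (b N.+ suc d) b + (- up H (suc b) b (suc d) - (- (up H b b (suc (suc d)) - H (b N.+ suc d) b)))
      ≈⟨ +-cong refl (+-cong refl (-‿cong (-‿cong (trans (+-cong (up-snoc H b b (suc d)) refl) (solve 2 (λ x y → (x :+ y) :- y := x) refl _ _))))) ⟩
    H (b N.+ suc d) b + (- up H (suc b) b (suc d) - (- up H b (suc b) (suc d)))
      ≈⟨ +-cong refl (+-cong (trans (-‿cong (reflexive (≡.sym (up-₁ H b b (suc d))))) (sym (∂-ge (H ₁) b (suc d)))) (-‿cong (trans (-‿cong (reflexive (≡.sym (up-₂ H b b (suc d))))) (sym (∂-ge (H ₂) b (suc d)))))) ⟩
    H (b N.+ suc d) b + (∂ (H ₁) (b N.+ suc d) b - ∂ (H ₂) (b N.+ suc d) b)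
      ≈⟨ reflexive (≡.cong (λ z → H z b + (∂ (H ₁) z b - ∂ (H ₂) z b)) (NP.+-suc b d)) ⟩
    H (suc b N.+ d) b + (∂ (H ₁) (suc b N.+ d) b - ∂ (H ₂) (suc b N.+ d) b) ∎

  τ : Fn → Fn
  τ H a b = t * H b a + (t - 1#) * ∂ (H ₂) a b

  τ-cong : ∀ H H' → (∀ x y → H x y ≈ H' x y) → ∀ a b → τ H a b ≈ τ H' a b
  τ-cong H H' E a b = +-cong (*-cong refl (E b a)) (*-cong refl (∂-cong {H ₂} {H' ₂} (λ x y → E x (suc y)) a b))

  τ-+ : ∀ H H' a b → τ (λ x y → H x y + H' x y) a b ≈ τ H a b + τ H' a b
  τ-+ H H' a b = trans (+-cong refl (*-cong refl (∂-+ (H ₂) (H' ₂) a b)))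
    (solve 6 (λ t x y s u v → t :* (x :+ y) :+ s :* (u :+ v) := (t :* x :+ s :* u) :+ (t :* y :+ s :* v)) refl t _ _ (t - 1#) _ _)

  τ-* : ∀ c H a b → τ (λ x y → c * H x y) a b ≈ c * τ H a b
  τ-* c H a b = trans (+-cong refl (*-cong refl (∂-* c (H ₂) a b)))
    (solve 5 (λ t c x s u → t :* (c :* x) :+ s :* (c :* u) := c :* (t :* x :+ s :* u)) refl t c _ (t - 1#) _)

  -- Dual form of T x f = y (T f + (1 - t) f).
  τ-suc-left : ∀ H a b → τ H (suc a) b ≈ τ (H ₂) a b + (1# - t) * H a (suc b)
  τ-suc-left H a b = trans (+-cong refl (*-cong refl (∂-suc-left (H ₂) a b)))
    (solve 4 (λ t x d h → t :* x :+ (t :- :1) :* (d :- h) := (t :* x :+ (t :- :1) :* d) :+ (:1 :- t) :* h) refl t _ _ _)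

  τ-suc-right : ∀ H a b → τ H a (suc b) ≈ τ (H ₁) a b + (t - 1#) * H a (suc b)
  τ-suc-right H a b = trans (+-cong refl (*-cong refl (∂-suc-right (H ₂) a b)))
    (solve 4 (λ t x d h → t :* x :+ (t :- :1) :* (d :+ h) := (t :* x :+ (t :- :1) :* d) :+ (t :- :1) :* h) refl t _ _ _)

  τ-zero : ∀ H → τ H 0 0 ≈ t * H 0 0
  τ-zero H = trans (+-cong refl (trans (*-cong refl -0#≈0#) (zeroʳ _))) (+-identityʳ _)

  -- Induction on the exponents: the two cross relations move a factor x or y through τ twice. It
  -- ends at the constant monomial, where τ is multiplication by t.
  τ-quadratic : ∀ H a b → τ (τ H) a b ≈ (t - 1#) * τ H a b + t * H a b
  τ-quadratic H zero zero = trans (τ-zero (τ H)) (trans (*-cong refl (τ-zero H))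
    (trans (solve 2 (λ t h → t :* (t :* h) := (t :- :1) :* (t :* h) :+ t :* h) refl t (H 0 0)) (+-cong (*-cong refl (sym (τ-zero H))) refl)))
  τ-quadratic H zero (suc b) = begin
    τ (τ H) 0 (suc b) ≈⟨ τ-suc-right (τ H) 0 b ⟩
    τ ((τ H) ₁) 0 b + (t - 1#) * τ H 0 (suc b) ≈⟨ +-cong (trans (τ-cong ((τ H) ₁) (λ x y → τ (H ₂) x y + (1# - t) * (H ₂) x y) (λ x y → τ-suc-left H x y) 0 b) (trans (τ-+ (τ (H ₂)) (λ x y → (1# - t) * (H ₂) x y) 0 b) (+-cong (τ-quadratic (H ₂) 0 b) (τ-* (1# - t) (H ₂) 0 b)))) refl ⟩
    (((t - 1#) * τ (H ₂) 0 b + t * H 0 (suc b)) + (1# - t) * τ (H ₂) 0 b) + (t - 1#) * τ H 0 (suc b)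
      ≈⟨ solve 4 (λ t x h y → (((t :- :1) :* x :+ t :* h) :+ (:1 :- t) :* x) :+ (t :- :1) :* y := (t :- :1) :* y :+ t :* h) refl t _ _ _ ⟩
    (t - 1#) * τ H 0 (suc b) + t * H 0 (suc b) ∎
  τ-quadratic H (suc a) b = begin
    τ (τ H) (suc a) b ≈⟨ τ-suc-left (τ H) a b ⟩
    τ ((τ H) ₂) a b + (1# - t) * τ H a (suc b)
      ≈⟨ +-cong (trans (τ-cong ((τ H) ₂) (λ x y → τ (H ₁) x y + (t - 1#) * (H ₂) x y) (λ x y → τ-suc-right H x y) a b) (trans (τ-+ (τ (H ₁)) (λ x y → (t - 1#) * (H ₂) x y) a b) (+-cong (τ-quadratic (H ₁) a b) (τ-* (t - 1#) (H ₂) a b)))) (*-cong refl (τ-suc-right H a b)) ⟩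
    (((t - 1#) * τ (H ₁) a b + t * H (suc a) b) + (t - 1#) * τ (H ₂) a b) + (1# - t) * (τ (H ₁) a b + (t - 1#) * H a (suc b))
      ≈⟨ solve 5 (λ t x h y k → (((t :- :1) :* x :+ t :* h) :+ (t :- :1) :* y) :+ (:1 :- t) :* (x :+ (t :- :1) :* k)
           := (t :- :1) :* (y :+ (:1 :- t) :* k) :+ t :* h) refl t _ _ _ _ ⟩
    (t - 1#) * (τ (H ₂) a b + (1# - t) * H a (suc b)) + t * H (suc a) b ≈⟨ +-cong (*-cong refl (sym (τ-suc-left H a b))) refl ⟩
    (t - 1#) * τ H (suc a) b + t * H (suc a) b ∎

-- Exponent lists

length-setL : ∀ α k v → length (setL α k v) ≡ length α
length-setL [] k v = ≡.refl
length-setL (x ∷ α) zero v = ≡.refl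
length-setL (x ∷ α) (suc k) v = ≡.cong suc (length-setL α k v)

lookup-set : ∀ α {k} v → k N.< length α → lookupL (setL α k v) k ≡ v
lookup-set (x ∷ α) {zero} v _ = ≡.refl
lookup-set (x ∷ α) {suc k} v (N.s≤s p) = lookup-set α v p

lookup-set-other : ∀ α {j k} v → ¬ j ≡ k → lookupL (setL α k v) j ≡ lookupL α j
lookup-set-other [] v p = ≡.refl
lookup-set-other (x ∷ α) {zero} {zero} v p = ⊥-elim (p ≡.refl)
lookup-set-other (x ∷ α) {suc j} {zero} v p = ≡.refl
lookup-set-other (x ∷ α) {zero} {suc k} v p = ≡.refl
lookup-set-other (x ∷ α) {suc j} {suc k} v p = lookup-set-other α v (λ e → p (≡.cong suc e))

set-set : ∀ α k v w → setL (setL α k v) k w ≡ setL α k w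
set-set [] k v w = ≡.refl
set-set (x ∷ α) zero v w = ≡.refl
set-set (x ∷ α) (suc k) v w = ≡.cong (x ∷_) (set-set α k v w)

set-comm : ∀ α {j k} v w → ¬ j ≡ k → setL (setL α k v) j w ≡ setL (setL α j w) k v
set-comm [] v w p = ≡.refl
set-comm (x ∷ α) {zero} {zero} v w p = ⊥-elim (p ≡.refl)
set-comm (x ∷ α) {suc j} {zero} v w p = ≡.refl
set-comm (x ∷ α) {zero} {suc k} v w p = ≡.refl
set-comm (x ∷ α) {suc j} {suc k} v w p = ≡.cong (x ∷_) (set-comm α v w (λ e → p (≡.cong suc e)))

set-lookup : ∀ α k → setL α k (lookupL α k) ≡ α
set-lookup [] k = ≡.refl
set-lookup (x ∷ α) zero = ≡.refl
set-lookup (x ∷ α) (suc k) = ≡.cong (x ∷_) (set-lookup α k)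

put : List ℕ → ℕ → ℕ → ℕ → List ℕ
put α k x y = setL (setL α k x) (suc k) y

≢1+ : ∀ {k} → ¬ k ≡ suc k
≢1+ e = NP.1+n≢n (≡.sym e)

length-put : ∀ α k x y → length (put α k x y) ≡ length α
length-put α k x y = ≡.trans (length-setL (setL α k x) (suc k) y) (length-setL α k x)

set-put-lower : ∀ α k x y z → setL (put α k x y) k z ≡ put α k z y
set-put-lower α k x y z = ≡.trans (set-comm (setL α k x) y z ≢1+) (≡.cong (λ β → setL β (suc k) y) (set-set α k x z))

put-put : ∀ α k x y x' y' → put (put α k x y) k x' y' ≡ put α k x' y'
put-put α k x y x' y' = ≡.trans (≡.cong (λ β → setL β (suc k) y') (set-put-lower α k x y x')) (set-set (setL α k x') (suc k) y y')

put-lookup : ∀ α k → put α k (lookupL α k) (lookupL α (suc k)) ≡ α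
put-lookup α k = ≡.trans (≡.cong (λ β → setL β (suc k) (lookupL α (suc k))) (set-lookup α k)) (set-lookup α (suc k))

lookup-put-lower : ∀ α {k} x y → k N.< length α → lookupL (put α k x y) k ≡ x
lookup-put-lower α {k} x y p = ≡.trans (lookup-set-other (setL α k x) y ≢1+) (lookup-set α x p)

lookup-put-upper : ∀ α {k} x y → suc k N.< length α → lookupL (put α k x y) (suc k) ≡ y
lookup-put-upper α {k} x y p = lookup-set (setL α k x) y (≡.subst (suc k N.<_) (≡.sym (length-setL α k x)) p)

inc-put-lower : ∀ α {k} x y → k N.< length α → incL (put α k x y) k ≡ put α k (suc x) y
inc-put-lower α {k} x y p = ≡.trans (≡.cong (λ z → setL (put α k x y) k (suc z)) (lookup-put-lower α x y p)) (set-put-lower α k x y (suc x))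

inc-put-upper : ∀ α {k} x y → suc k N.< length α → incL (put α k x y) (suc k) ≡ put α k x (suc y)
inc-put-upper α {k} x y p = ≡.trans (≡.cong (λ z → setL (put α k x y) (suc k) (suc z)) (lookup-put-upper α x y p)) (set-set (setL α k x) (suc k) y (suc y))

inc-put-other : ∀ α {j k} x y → ¬ j ≡ k → ¬ j ≡ suc k → incL (put α k x y) j ≡ put (incL α j) k x y
inc-put-other α {j} {k} x y p q = ≡.trans (≡.cong (λ z → setL (put α k x y) j (suc z)) (≡.trans (lookup-set-other (setL α k x) y q) (lookup-set-other α x p)))
  (≡.trans (set-comm (setL α k x) y (suc (lookupL α j)) q) (≡.cong (λ β → setL β (suc k) y) (set-comm α x (suc (lookupL α j)) p)))

inc-comm : ∀ α j k → incL (incL α j) k ≡ incL (incL α k) j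
inc-comm α j k with k N.≟ j
... | yes ≡.refl = ≡.refl
... | no k≢j = ≡.trans (≡.cong (λ z → setL (incL α j) k (suc z)) (lookup-set-other α (suc (lookupL α j)) k≢j))
  (≡.trans (set-comm α (suc (lookupL α j)) (suc (lookupL α k)) k≢j)
  (≡.cong (λ z → setL (incL α k) j (suc z)) (≡.sym (lookup-set-other α (suc (lookupL α k)) (λ e → k≢j (≡.sym e))))))

inc-injective : ∀ α β k → length α ≡ length β → incL α k ≡ incL β k → α ≡ β
inc-injective [] [] k e e' = ≡.refl
inc-injective (x ∷ α) (y ∷ β) zero e e' = ≡.cong₂ _∷_ (NP.suc-injective (LP.∷-injectiveˡ e')) (LP.∷-injectiveʳ e')
inc-injective (x ∷ α) (y ∷ β) (suc k) e e' = ≡.cong₂ _∷_ (LP.∷-injectiveˡ e') (inc-injective α β k (NP.suc-injective e) (LP.∷-injectiveʳ e'))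

lookup-inc : ∀ α {k} → k N.< length α → lookupL (incL α k) k ≡ suc (lookupL α k)
lookup-inc α p = lookup-set α _ p

lookup-replicate : ∀ n k → lookupL (replicate n 0) k ≡ 0
lookup-replicate zero k = ≡.refl
lookup-replicate (suc n) zero = ≡.refl
lookup-replicate (suc n) (suc k) = lookup-replicate n k

inc-++ˡ : ∀ A B {u} → u N.< length A → incL (A ++ B) u ≡ incL A u ++ B
inc-++ˡ (a ∷ A) B {zero} p = ≡.refl
inc-++ˡ (a ∷ A) B {suc u} (N.s≤s p) = ≡.cong (a ∷_) (inc-++ˡ A B p)

inc-++ʳ : ∀ A B j → incL (A ++ B) (length A N.+ j) ≡ A ++ incL B j
inc-++ʳ [] B j = ≡.refl
inc-++ʳ (a ∷ A) B j = ≡.cong (a ∷_) (inc-++ʳ A B j)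

reverse-inc : ∀ A {u} → u N.< length A → reverse (incL A u) ≡ incL (reverse A) (length A ∸ suc u)
reverse-inc (a ∷ A) {zero} p = ≡.trans (LP.unfold-reverse (suc a) A) (≡.sym (≡.trans (≡.cong₂ incL (LP.unfold-reverse a A) (≡.trans (≡.sym (LP.length-reverse A)) (≡.sym (NP.+-identityʳ (length (reverse A))))))
  (inc-++ʳ (reverse A) (a ∷ []) 0)))
reverse-inc (a ∷ A) {suc u} (N.s≤s p) = ≡.trans (LP.unfold-reverse a (incL A u)) (≡.trans (≡.cong (_++ a ∷ []) (reverse-inc A p))
  (≡.sym (≡.trans (≡.cong (λ z → incL z (length A ∸ suc u)) (LP.unfold-reverse a A)) (inc-++ˡ (reverse A) (a ∷ []) (≡.subst (length A ∸ suc u N.<_) (≡.sym (LP.length-reverse A)) (NP.∸-monoʳ-< {length A} {suc u} {0} (N.s≤s N.z≤n) p))))))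

reverseBlocks : ℕ → List ℕ → List ℕ
reverseBlocks k α = reverse (take k α) ++ reverse (drop k α)

take-length-++ : ∀ (A B : List ℕ) → take (length A) (A ++ B) ≡ A
take-length-++ [] B = ≡.refl
take-length-++ (a ∷ A) B = ≡.cong (a ∷_) (take-length-++ A B)

drop-length-++ : ∀ (A B : List ℕ) → drop (length A) (A ++ B) ≡ B
drop-length-++ [] B = ≡.refl
drop-length-++ (a ∷ A) B = drop-length-++ A B

take-at : ∀ (A B : List ℕ) {k} → length A ≡ k → take k (A ++ B) ≡ A
take-at A B ≡.refl = take-length-++ A B

drop-at : ∀ (A B : List ℕ) {k} → length A ≡ k → drop k (A ++ B) ≡ B
drop-at A B ≡.refl = drop-length-++ A B

length-inc : ∀ A u → length (incL A u) ≡ length A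
length-inc A u = length-setL A u _

sum-inc : ∀ A {u} → u N.< length A → sum (incL A u) ≡ suc (sum A)
sum-inc (a ∷ A) {zero} p = ≡.refl
sum-inc (a ∷ A) {suc u} (N.s≤s p) = ≡.trans (≡.cong (a N.+_) (sum-inc A p)) (NP.+-suc a (sum A))

length-reverseBlocks : ∀ k α → length (reverseBlocks k α) ≡ length α
length-reverseBlocks k α = ≡.trans (LP.length-++ (reverse (take k α))) (≡.trans (≡.cong₂ N._+_ (LP.length-reverse (take k α)) (LP.length-reverse (drop k α)))
  (≡.trans (≡.sym (LP.length-++ (take k α))) (≡.cong length (LP.take++drop≡id k α))))

module _ (n k : ℕ) (k≤n : k N.≤ n) where
  open BlockReversal n k k≤n

  data Split (u : ℕ) (α : List ℕ) : Set where
    low : ∀ A B → α ≡ A ++ B → length A ≡ k → u N.< k → Split u α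
    high : ∀ A B j → α ≡ A ++ B → length A ≡ k → u ≡ k N.+ j → j N.< length B → Split u α

  split : ∀ {u} α → length α ≡ n → u N.< n → Split u α
  split {u} α e u<n with NP.<-≤-connex u k
  ... | inj₁ p = low (take k α) (drop k α) (≡.sym (LP.take++drop≡id k α)) (≡.trans (LP.length-take k α) (NP.m≤n⇒m⊓n≡m (≡.subst (k N.≤_) (≡.sym e) k≤n))) p
  ... | inj₂ p = high (take k α) (drop k α) (u ∸ k) (≡.sym (LP.take++drop≡id k α)) (≡.trans (LP.length-take k α) (NP.m≤n⇒m⊓n≡m (≡.subst (k N.≤_) (≡.sym e) k≤n)))
    (≡.sym (NP.m+[n∸m]≡n p)) (≡.subst (u ∸ k N.<_) (≡.sym (≡.trans (LP.length-drop k α) (≡.cong (_∸ k) e))) (NP.∸-monoˡ-< u<n p))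

  reverseBlocks-inc : ∀ {u} α → length α ≡ n → u N.< n → reverseBlocks k (incL α u) ≡ incL (reverseBlocks k α) (flip u)
  reverseBlocks-inc {u} α e u<n with split α e u<n
  ... | low A B ≡.refl ≡.refl p =
    ≡.trans (≡.cong (reverseBlocks k) (inc-++ˡ A B p)) (≡.trans (≡.cong₂ (λ x y → reverse x ++ reverse y) (take-at (incL A u) B (length-inc A u)) (drop-at (incL A u) B (length-inc A u)))
    (≡.trans (≡.cong (_++ reverse B) (≡.trans (reverse-inc A p) (≡.cong (incL (reverse A)) (≡.sym (flip-left p)))))
    (≡.trans (≡.sym (inc-++ˡ (reverse A) (reverse B) (≡.subst (flip u N.<_) (≡.sym (LP.length-reverse A)) (flip-left-< p))))
      (≡.cong (λ z → incL z (flip u)) (≡.sym (≡.cong₂ (λ x y → reverse x ++ reverse y) (take-length-++ A B) (drop-length-++ A B)))))))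
  ... | high A B j ≡.refl ≡.refl ≡.refl p rewrite inc-++ʳ A B j | take-length-++ A B | drop-length-++ A B
      | take-length-++ A (incL B j) | drop-length-++ A (incL B j) | reverse-inc B p =
    ≡.sym (≡.trans (≡.cong (incL (reverse A ++ reverse B)) position) (inc-++ʳ (reverse A) (reverse B) (length B ∸ suc j)))
    where
    position : flip (length A N.+ j) ≡ length (reverse A) N.+ (length B ∸ suc j)
    position = ≡.trans (flip-right (NP.m≤m+n (length A) j)) (≡.trans (≡.cong₂ _∸_ (≡.trans (≡.cong (N._+ length A) (≡.trans (≡.sym e) (LP.length-++ A))) (NP.+-comm (length A N.+ length B) (length A))) (≡.sym (NP.+-suc (length A) j)))
      (≡.trans (NP.[m+n]∸[m+o]≡n∸o (length A) (length A N.+ length B) (suc j)) (≡.trans (NP.+-∸-assoc (length A) p) (≡.cong (N._+ (length B ∸ suc j)) (≡.sym (LP.length-reverse A))))))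

  wrapᴺ : ℕ → ℕ
  wrapᴺ u = if u <ᵇ k then 0 else 1

  sum-drop-inc : ∀ {u} α → length α ≡ n → u N.< n → sum (drop k (incL α u)) ≡ wrapᴺ u N.+ sum (drop k α)
  sum-drop-inc {u} α e u<n with split α e u<n
  ... | low A B ≡.refl ≡.refl p rewrite <ᵇ-true p = ≡.cong sum (≡.trans (≡.cong (drop k) (inc-++ˡ A B p)) (≡.trans (drop-at (incL A u) B (length-inc A u)) (≡.sym (drop-length-++ A B))))
  ... | high A B j ≡.refl ≡.refl ≡.refl p rewrite <ᵇ-false (NP.m≤m+n (length A) j) | inc-++ʳ A B j | drop-length-++ A B | drop-length-++ A (incL B j) = sum-inc B p

-- Exponent vectors of a fixed length: `setL` does nothing beyond the end of a list, so relations
-- between the operators depend on the length. As its proof is irrelevant, equality reduces to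
-- equality of lists.
record Exps (n : ℕ) : Set where
  constructor exps
  field
    list : List ℕ
    .len : length list ≡ n
open Exps public

exps-≡ : ∀ {n} {β γ : Exps n} → list β ≡ list γ → β ≡ γ
exps-≡ ≡.refl = ≡.refl

length-list : ∀ {n} (β : Exps n) → length (list β) ≡ n
length-list {n} (exps α e) = recompute (length α N.≟ n) e

exps-basis : ℕ → DecidableBasis
exps-basis n = record
  { Basis = Exps n
  ; _==_ = λ β γ → eqListB (list β) (list γ)
  ; sound = λ β γ e → exps-≡ (eqListB-sound (list β) (list γ) e)
  ; complete = λ β → eqListB-refl (list β)
  }

-- Demazure-Lusztig operators on formal sums

module Operators (R : CommutativeRing 0ℓ 0ℓ) (n : ℕ) (t t-1 : CommutativeRing.Carrier R)
  (t-1≈ : CommutativeRing._≈_ R t-1 (CommutativeRing._-_ R t (CommutativeRing.1# R))) where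
  open CommutativeRing R
  open FormalSum R (exps-basis n)
  open TwoVariables R t
  open IntegerSolver R using (solve; _:=_; _:+_; _:*_; _:-_; :-_; :1; :0)
  open import Algebra.Properties.Ring ring using (-0#≈0#; -‿distribˡ-*)
  open import Relation.Binary.Reasoning.Setoid setoid

  putᴱ : Exps n → ℕ → ℕ → ℕ → Exps n
  putᴱ (exps α e) k x y = exps (put α k x y) (≡.trans (length-put α k x y) e)

  incᴱ : ℕ → Exps n → Exps n
  incᴱ k (exps α e) = exps (incL α k) (≡.trans (length-inc α k) e)

  swapᴱ : ℕ → Exps n → Exps n
  swapᴱ k β = putᴱ β k (lookupL (list β) (suc k)) (lookupL (list β) k)

  mapᴱ : (Exps n → Exps n) → Sum → Sum
  mapᴱ g = map (λ { (c , β) → (c , g β) })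

  X : ℕ → Sum → Sum
  X k = mapᴱ (incᴱ k)

  σ : ℕ → Sum → Sum
  σ k = mapᴱ (swapᴱ k)

  ∂-monomial : ℕ → Exps n → List (Bool × Exps n)
  ∂-monomial k β =
    if a <ᵇ b
    then map (λ j → (true , putᴱ β k (a N.+ j) (b ∸ 1 ∸ j))) (upTo (b ∸ a))
    else map (λ j → (false , putᴱ β k (b N.+ j) (a ∸ 1 ∸ j))) (upTo (a ∸ b))
    where
    a = lookupL (list β) k
    b = lookupL (list β) (suc k)

  ∂-op : ℕ → Sum → Sum
  ∂-op k = concatMap (λ { (c , β) → map (λ { (s , γ) → ((if s then c else - c) , γ) }) (∂-monomial k β) })

  T : ℕ → Sum → Sum
  T k f = scale t (σ k f) ++ scale t-1 (X (suc k) (∂-op k f))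

  𝟙 : Sum
  𝟙 = (1# , exps (replicate n 0) (LP.length-replicate n)) ∷ []

  Functional : Set
  Functional = Exps n → Carrier

  around : Functional → ℕ → Exps n → Fn
  around h k β x y = h (putᴱ β k x y)

  lin-map : ∀ h g f → lin h (mapᴱ g f) ≈ lin (h ∘ g) f
  lin-map h g [] = refl
  lin-map h g ((c , β) ∷ f) = +-cong refl (lin-map h g f)

  total : (ℕ → Carrier) → ℕ → Carrier
  total f zero = 0#
  total f (suc d) = f 0 + total (f ∘ suc) d

  total-cong : ∀ {f g} d → (∀ j → f j ≈ g j) → total f d ≈ total g d
  total-cong zero e = refl
  total-cong (suc d) e = +-cong (e 0) (total-cong d (λ j → e (suc j)))

  total-up : ∀ H a e d → total (λ j → H (a N.+ j) (e N.+ d ∸ 1 ∸ j)) d ≈ up H a e d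
  total-up H a e zero = refl
  total-up H a e (suc d) = +-cong (reflexive (≡.cong₂ H (NP.+-identityʳ a) (≡.cong (_∸ 1) (NP.+-suc e d))))
    (trans (total-cong d (λ j → reflexive (≡.cong₂ H (NP.+-suc a j) (≡.trans (≡.cong (λ z → z ∸ 1 ∸ suc j) (NP.+-suc e d)) (≡.sym (NP.∸-+-assoc (e N.+ d) 1 j)))))) (total-up H (suc a) e d))

  lin-signed : ∀ h c s (g : ℕ → Exps n) (i : ℕ → ℕ) d →
    lin h (map (λ { (s , γ) → ((if s then c else - c) , γ) }) (map (λ j → (s , g j)) (applyUpTo i d))) ≈ (if s then c else - c) * total (λ j → h (g (i j))) d
  lin-signed h c s g i zero = sym (zeroʳ _)
  lin-signed h c s g i (suc d) = trans (+-cong refl (lin-signed h c s g (i ∘ suc) d)) (sym (distribˡ _ _ _))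

  lin-∂ : ∀ h k f → lin h (∂-op k f) ≈ lin (λ β → ∂ (around h k β) (lookupL (list β) k) (lookupL (list β) (suc k))) f
  lin-∂ h k [] = refl
  lin-∂ h k ((c , β) ∷ f) = trans (lin-++ h (map _ (∂-monomial k β)) (∂-op k f)) (+-cong monomial (lin-∂ h k f))
    where
    a b : ℕ
    a = lookupL (list β) k
    b = lookupL (list β) (suc k)
    monomial : lin h (map _ (∂-monomial k β)) ≈ c * ∂ (around h k β) a b
    monomial with NP.<-≤-connex a b
    ... | inj₁ p rewrite <ᵇ-true p = trans (lin-signed h c true (λ j → putᴱ β k (a N.+ j) (b ∸ 1 ∸ j)) (λ j → j) (b ∸ a))
      (*-cong refl (trans (total-cong (b ∸ a) (λ j → reflexive (≡.cong (λ z → around h k β (a N.+ j) (z ∸ 1 ∸ j)) (≡.sym (NP.m+[n∸m]≡n (NP.<⇒≤ p)))))) (total-up (around h k β) a a (b ∸ a))))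
    ... | inj₂ p rewrite <ᵇ-false p = trans (lin-signed h c false (λ j → putᴱ β k (b N.+ j) (a ∸ 1 ∸ j)) (λ j → j) (a ∸ b))
      (trans (*-cong refl (trans (total-cong (a ∸ b) (λ j → reflexive (≡.cong (λ z → around h k β (b N.+ j) (z ∸ 1 ∸ j)) (≡.sym (NP.m+[n∸m]≡n p))))) (total-up (around h k β) b b (a ∸ b))))
        (solve 2 (λ c x → (:- c) :* x := c :* (:- x)) refl c _))

  -- The transpose of T_k. With all exponents but those at k and k + 1 fixed, it is the operator τ
  -- in two variables, and relations for τ carry over to T_k.
  T* : ℕ → Functional → Functional
  T* k h β = t * h (swapᴱ k β) + t-1 * ∂ (around (h ∘ incᴱ (suc k)) k β) (lookupL (list β) k) (lookupL (list β) (suc k))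

  lin-T : ∀ h k f → lin h (T k f) ≈ lin (T* k h) f
  lin-T h k f = trans (lin-++ h (scale t (σ k f)) (scale t-1 (X (suc k) (∂-op k f)))) (trans (+-cong
      (trans (lin-scale h t (σ k f)) (*-cong refl (lin-map h (swapᴱ k) f)))
      (trans (lin-scale h t-1 (X (suc k) (∂-op k f))) (*-cong refl (trans (lin-map h (incᴱ (suc k)) (∂-op k f)) (lin-∂ (h ∘ incᴱ (suc k)) k f)))))
    (trans (+-cong (sym (lin-* t (h ∘ swapᴱ k) f)) (sym (lin-* t-1 D f))) (sym (lin-+ (λ β → t * h (swapᴱ k β)) (λ β → t-1 * D β) f))))
    where
    D : Functional
    D β = ∂ (around (h ∘ incᴱ (suc k)) k β) (lookupL (list β) k) (lookupL (list β) (suc k))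

  module Adjacent (k : ℕ) (k<n : suc k N.< n) where
    lower< : ∀ (β : Exps n) → k N.< length (list β)
    lower< β = ≡.subst (k N.<_) (≡.sym (length-list β)) (NP.<-trans (NP.n<1+n k) k<n)

    upper< : ∀ (β : Exps n) → suc k N.< length (list β)
    upper< β = ≡.subst (suc k N.<_) (≡.sym (length-list β)) k<n

    inc-lower : ∀ β x y → incᴱ k (putᴱ β k x y) ≡ putᴱ β k (suc x) y
    inc-lower β x y = exps-≡ (inc-put-lower (list β) x y (lower< β))

    inc-upper : ∀ β x y → incᴱ (suc k) (putᴱ β k x y) ≡ putᴱ β k x (suc y)
    inc-upper β x y = exps-≡ (inc-put-upper (list β) x y (upper< β))

    put-self : ∀ β → putᴱ β k (lookupL (list β) k) (lookupL (list β) (suc k)) ≡ β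
    put-self β = exps-≡ (put-lookup (list β) k)

    T*-put : ∀ h β x y → T* k h (putᴱ β k x y) ≈ τ (around h k β) x y
    T*-put h β x y = +-cong (*-cong refl (reflexive (≡.cong h {swapᴱ k (putᴱ β k x y)} {putᴱ β k y x} (exps-≡ {β = swapᴱ k (putᴱ β k x y)} {γ = putᴱ β k y x} swapped))))
      (*-cong t-1≈ (trans (∂-cong (λ x' y' → reflexive (≡.cong h (≡.trans (≡.cong (incᴱ (suc k)) (exps-≡ {β = putᴱ (putᴱ β k x y) k x' y'} {γ = putᴱ β k x' y'} (put-put (list β) k x y x' y'))) (inc-upper β x' y'))))
          (lookupL (put (list β) k x y) k) (lookupL (put (list β) k x y) (suc k)))
        (reflexive (≡.cong₂ (∂ (around h k β ₂)) (lookup-put-lower (list β) x y (lower< β)) (lookup-put-upper (list β) x y (upper< β))))))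
      where
      swapped : list (swapᴱ k (putᴱ β k x y)) ≡ put (list β) k y x
      swapped = ≡.trans (put-put (list β) k x y _ _) (≡.cong₂ (put (list β) k) (lookup-put-upper (list β) x y (upper< β)) (lookup-put-lower (list β) x y (lower< β)))

    T*-τ : ∀ h β → T* k h β ≈ τ (around h k β) (lookupL (list β) k) (lookupL (list β) (suc k))
    T*-τ h β = trans (reflexive (≡.cong (T* k h) (≡.sym (put-self β)))) (T*-put h β _ _)

    T-quadratic : ∀ f → T k (T k f) ≋ scale (t - 1#) (T k f) ++ scale t f
    T-quadratic f = lin-ext (T k (T k f)) (scale (t - 1#) (T k f) ++ scale t f) λ h → begin
      lin h (T k (T k f)) ≈⟨ trans (lin-T h k (T k f)) (lin-T (T* k h) k f) ⟩
      lin (T* k (T* k h)) f ≈⟨ lin-cong f (λ β → begin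
        T* k (T* k h) β ≈⟨ T*-τ (T* k h) β ⟩
        τ (around (T* k h) k β) (lookupL (list β) k) (lookupL (list β) (suc k)) ≈⟨ τ-cong (around (T* k h) k β) (τ (around h k β)) (λ x y → T*-put h β x y) _ _ ⟩
        τ (τ (around h k β)) (lookupL (list β) k) (lookupL (list β) (suc k)) ≈⟨ τ-quadratic (around h k β) _ _ ⟩
        (t - 1#) * τ (around h k β) (lookupL (list β) k) (lookupL (list β) (suc k)) + t * around h k β (lookupL (list β) k) (lookupL (list β) (suc k))
          ≈⟨ +-cong (*-cong refl (sym (T*-τ h β))) (*-cong refl (reflexive (≡.cong h (put-self β)))) ⟩
        (t - 1#) * T* k h β + t * h β ∎) ⟩
      lin (λ β → (t - 1#) * T* k h β + t * h β) f ≈⟨ trans (lin-+ (λ β → (t - 1#) * T* k h β) (λ β → t * h β) f) (+-cong (lin-* (t - 1#) (T* k h) f) (lin-* t h f)) ⟩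
      (t - 1#) * lin (T* k h) f + t * lin h f ≈⟨ +-cong (trans (*-cong refl (sym (lin-T h k f))) (sym (lin-scale h (t - 1#) (T k f)))) (sym (lin-scale h t f)) ⟩
      lin h (scale (t - 1#) (T k f)) + lin h (scale t f) ≈⟨ sym (lin-++ h (scale (t - 1#) (T k f)) (scale t f)) ⟩
      lin h (scale (t - 1#) (T k f) ++ scale t f) ∎

    T-X : ∀ f → T k (X k f) ≋ X (suc k) (T k f ++ scale (1# - t) f)
    T-X f = lin-ext (T k (X k f)) (X (suc k) (T k f ++ scale (1# - t) f)) λ h → begin
      lin h (T k (X k f)) ≈⟨ trans (lin-T h k (X k f)) (lin-map (T* k h) (incᴱ k) f) ⟩
      lin (λ β → T* k h (incᴱ k β)) f ≈⟨ lin-cong f (λ β → begin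
        T* k h (incᴱ k β) ≈⟨ reflexive (≡.cong (T* k h) (≡.trans (≡.cong (incᴱ k) (≡.sym (put-self β))) (inc-lower β _ _))) ⟩
        T* k h (putᴱ β k (suc (lookupL (list β) k)) (lookupL (list β) (suc k))) ≈⟨ T*-put h β _ _ ⟩
        τ (around h k β) (suc (lookupL (list β) k)) (lookupL (list β) (suc k)) ≈⟨ τ-suc-left (around h k β) _ _ ⟩
        τ (around h k β ₂) (lookupL (list β) k) (lookupL (list β) (suc k)) + (1# - t) * around h k β (lookupL (list β) k) (suc (lookupL (list β) (suc k)))
          ≈⟨ +-cong (trans (τ-cong (around h k β ₂) (around (h ∘ incᴱ (suc k)) k β) (λ x y → reflexive (≡.cong h (≡.sym (inc-upper β x y)))) _ _) (sym (T*-τ (h ∘ incᴱ (suc k)) β)))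
               (*-cong refl (reflexive (≡.cong h (≡.trans (≡.sym (inc-upper β _ _)) (≡.cong (incᴱ (suc k)) (put-self β)))))) ⟩
        T* k (h ∘ incᴱ (suc k)) β + (1# - t) * h (incᴱ (suc k) β) ∎) ⟩
      lin (λ β → T* k (h ∘ incᴱ (suc k)) β + (1# - t) * h (incᴱ (suc k) β)) f ≈⟨ trans (lin-+ (T* k (h ∘ incᴱ (suc k))) (λ β → (1# - t) * h (incᴱ (suc k) β)) f) (+-cong refl (lin-* (1# - t) (h ∘ incᴱ (suc k)) f)) ⟩
      lin (T* k (h ∘ incᴱ (suc k))) f + (1# - t) * lin (h ∘ incᴱ (suc k)) f ≈⟨ +-cong (sym (lin-T _ k f)) (sym (lin-scale (h ∘ incᴱ (suc k)) (1# - t) f)) ⟩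
      lin (h ∘ incᴱ (suc k)) (T k f) + lin (h ∘ incᴱ (suc k)) (scale (1# - t) f) ≈⟨ sym (lin-++ (h ∘ incᴱ (suc k)) (T k f) (scale (1# - t) f)) ⟩
      lin (h ∘ incᴱ (suc k)) (T k f ++ scale (1# - t) f) ≈⟨ sym (lin-map h (incᴱ (suc k)) (T k f ++ scale (1# - t) f)) ⟩
      lin h (X (suc k) (T k f ++ scale (1# - t) f)) ∎

    T-X-other : ∀ j → ¬ j ≡ k → ¬ j ≡ suc k → ∀ f → T k (X j f) ≋ X j (T k f)
    T-X-other j p q f = lin-ext (T k (X j f)) (X j (T k f)) λ h → begin
      lin h (T k (X j f)) ≈⟨ trans (lin-T h k (X j f)) (lin-map (T* k h) (incᴱ j) f) ⟩
      lin (λ β → T* k h (incᴱ j β)) f ≈⟨ lin-cong f (λ β → begin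
        T* k h (incᴱ j β) ≈⟨ T*-τ h (incᴱ j β) ⟩
        τ (around h k (incᴱ j β)) (lookupL (incL (list β) j) k) (lookupL (incL (list β) j) (suc k))
          ≈⟨ reflexive (≡.cong₂ (τ (around h k (incᴱ j β))) (lookup-set-other (list β) _ (λ e → p (≡.sym e))) (lookup-set-other (list β) _ (λ e → q (≡.sym e)))) ⟩
        τ (around h k (incᴱ j β)) (lookupL (list β) k) (lookupL (list β) (suc k))
          ≈⟨ τ-cong (around h k (incᴱ j β)) (around (h ∘ incᴱ j) k β) (λ x y → reflexive (≡.cong h (exps-≡ (≡.sym (inc-put-other (list β) x y p q))))) _ _ ⟩
        τ (around (h ∘ incᴱ j) k β) (lookupL (list β) k) (lookupL (list β) (suc k)) ≈⟨ sym (T*-τ (h ∘ incᴱ j) β) ⟩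
        T* k (h ∘ incᴱ j) β ∎) ⟩
      lin (T* k (h ∘ incᴱ j)) f ≈⟨ sym (lin-T _ k f) ⟩
      lin (h ∘ incᴱ j) (T k f) ≈⟨ sym (lin-map h (incᴱ j) (T k f)) ⟩
      lin h (X j (T k f)) ∎

    T-𝟙 : T k 𝟙 ≋ scale t 𝟙
    T-𝟙 = lin-ext (T k 𝟙) (scale t 𝟙) λ h → trans (lin-T h k 𝟙) (+-cong (trans (*-identityˡ _) (trans (T*-τ h β₀)
      (trans (trans (reflexive (≡.cong₂ (τ (around h k β₀)) (lookup-replicate n k) (lookup-replicate n (suc k)))) (τ-zero (around h k β₀)))
        (trans (*-cong refl (reflexive (≡.cong h (≡.trans (≡.cong₂ (putᴱ β₀ k) (≡.sym (lookup-replicate n k)) (≡.sym (lookup-replicate n (suc k)))) (put-self β₀)))))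
          (*-cong (sym (*-identityʳ t)) refl))))) refl)
      where
      β₀ : Exps n
      β₀ = exps (replicate n 0) (LP.length-replicate n)

    coef-X : ∀ j g β → coef (X j g) (incᴱ j β) ≈ coef g β
    coef-X j [] β = refl
    coef-X j ((c , γ) ∷ g) β = trans (if-cong≈ same (coef-X j g β)) refl
      where
      if-cong≈ : ∀ {b b' x y} → b ≡ b' → x ≈ y → (if b then c + x else x) ≈ (if b' then c + y else y)
      if-cong≈ {true} ≡.refl e = +-cong refl e
      if-cong≈ {false} ≡.refl e = e
      same : eqListB (incL (list γ) j) (incL (list β) j) ≡ eqListB (list γ) (list β)
      same with eqListB (list γ) (list β) in e
      ... | true rewrite eqListB-sound (list γ) (list β) e = eqListB-refl (incL (list β) j)
      ... | false with eqListB (incL (list γ) j) (incL (list β) j) in e'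
      ...   | false = ≡.refl
      ...   | true rewrite inc-injective (list γ) (list β) j (≡.trans (length-list γ) (≡.sym (length-list β))) (eqListB-sound _ _ e')
              with () ← ≡.trans (≡.sym e) (eqListB-refl (list β))

    coef-X-zero : ∀ g β → lookupL (list β) k ≡ 0 → coef (X k g) β ≈ 0#
    coef-X-zero [] β z = refl
    coef-X-zero ((c , γ) ∷ g) β z with eqListB (incL (list γ) k) (list β) in e
    ... | false = coef-X-zero g β z
    ... | true with () ← ≡.trans (≡.sym (lookup-inc (list γ) (lower< γ))) (≡.trans (≡.cong (λ α → lookupL α k) (eqListB-sound _ _ e)) z)

    -- t x_k − x_{k+1} is not a zero divisor
    annihilated : ∀ g → scale t (X k g) ≋ X (suc k) g → g ≋ []
    annihilated g e β = trans (reflexive (≡.cong (coef g) (≡.sym (put-self β)))) (descend (lookupL (list β) k) (lookupL (list β) (suc k)))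
      where
      -- By the assumed relation the coefficient of g at (a , b) is t times that at (a - 1 , b + 1),
      -- and it is zero when a = 0; hence induction on a.
      descend : ∀ a b → coef g (putᴱ β k a b) ≈ 0#
      descend a b = begin
        coef g (putᴱ β k a b) ≈⟨ sym (coef-X (suc k) g (putᴱ β k a b)) ⟩
        coef (X (suc k) g) (incᴱ (suc k) (putᴱ β k a b)) ≈⟨ sym (e _) ⟩
        coef (scale t (X k g)) (incᴱ (suc k) (putᴱ β k a b)) ≈⟨ coef-scale t (X k g) _ ⟩
        t * coef (X k g) (incᴱ (suc k) (putᴱ β k a b)) ≈⟨ *-cong refl (trans (reflexive (≡.cong (coef (X k g)) (inc-upper β a b))) (previous a)) ⟩
        t * 0# ≈⟨ zeroʳ t ⟩
        0# ∎
        where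
        previous : ∀ a → coef (X k g) (putᴱ β k a (suc b)) ≈ 0#
        previous zero = coef-X-zero g (putᴱ β k 0 (suc b)) (lookup-put-lower (list β) 0 (suc b) (lower< β))
        previous (suc a) = trans (reflexive (≡.cong (coef (X k g)) (≡.sym (inc-lower β a (suc b))))) (trans (coef-X k g _) (descend a (suc b)))

    swap-expansion : ∀ h f → lin h (σ k f) ≈ lin h f + (lin h (X k (∂-op k f)) - lin h (X (suc k) (∂-op k f)))
    swap-expansion h f = begin
      lin h (σ k f) ≈⟨ lin-map h (swapᴱ k) f ⟩
      lin (h ∘ swapᴱ k) f ≈⟨ lin-cong f (λ β → trans (∂-swap (around h k β) (lookupL (list β) k) (lookupL (list β) (suc k)))
          (+-cong (reflexive (≡.cong h (put-self β))) (trans (+-cong (∂-cong {around h k β ₁} {around (h ∘ incᴱ k) k β} (λ x y → reflexive (≡.cong h (≡.sym (inc-lower β x y)))) (lookupL (list β) k) (lookupL (list β) (suc k)))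
            (-‿cong (∂-cong {around h k β ₂} {around (h ∘ incᴱ (suc k)) k β} (λ x y → reflexive (≡.cong h (≡.sym (inc-upper β x y)))) (lookupL (list β) k) (lookupL (list β) (suc k))))) (+-cong refl (solve 1 (λ x → :- x := (:- :1) :* x) refl _))))) ⟩
      lin (λ β → h β + (D k β + (- 1#) * D (suc k) β)) f ≈⟨ trans (lin-+ h (λ β → D k β + (- 1#) * D (suc k) β) f) (+-cong refl (trans (lin-+ (D k) (λ β → (- 1#) * D (suc k) β) f) (+-cong refl (lin-* (- 1#) (D (suc k)) f)))) ⟩
      lin h f + (lin (D k) f + (- 1#) * lin (D (suc k)) f)
        ≈⟨ +-cong refl (+-cong (lin-D k) (trans (*-cong refl (lin-D (suc k))) (solve 1 (λ x → (:- :1) :* x := :- x) refl _))) ⟩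
      lin h f + (lin h (X k (∂-op k f)) - lin h (X (suc k) (∂-op k f))) ∎
      where
      D : ℕ → Functional
      D j β = ∂ (around (h ∘ incᴱ j) k β) (lookupL (list β) k) (lookupL (list β) (suc k))
      lin-D : ∀ j → lin (D j) f ≈ lin h (X j (∂-op k f))
      lin-D j = trans (sym (lin-∂ (h ∘ incᴱ j) k f)) (sym (lin-map h (incᴱ j) (∂-op k f)))

    -- (T − t) f = (t x_k − x_{k+1}) ∂ f and σ f − f = (x_k − x_{k+1}) ∂ f
    T-eigen⇒symmetric : ∀ f → T k f ≋ scale t f → σ k f ≋ f
    T-eigen⇒symmetric f e = lin-ext (σ k f) f λ h → trans (swap-expansion h f) (trans (+-cong refl (trans (+-cong (vanish h k) (-‿cong (vanish h (suc k)))) (-‿inverseʳ 0#))) (+-identityʳ _))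
      where
      g : Sum
      g = ∂-op k f
      relation : scale t (X k g) ≋ X (suc k) g
      relation = lin-ext (scale t (X k g)) (X (suc k) g) λ h → begin
        lin h (scale t (X k g)) ≈⟨ lin-scale h t (X k g) ⟩
        -- The bracket is h applied to T f - t f, with σ f expanded by `swap-expansion`; the
        -- hypothesis T f = t f removes it.
        t * x h ≈⟨ solve 4 (λ t f x y → t :* x := (((t :* (f :+ (x :- y)) :+ (t :- :1) :* y) :- t :* f)) :+ y) refl t (lin h f) (x h) (y h) ⟩
        ((t * (lin h f + (x h - y h)) + (t - 1#) * y h) - t * lin h f) + y h
          ≈⟨ +-cong (+-cong (+-cong (*-cong refl (sym (swap-expansion h f))) (*-cong (sym t-1≈) refl)) refl) refl ⟩
        ((t * lin h (σ k f) + t-1 * y h) - t * lin h f) + y h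
          ≈⟨ +-cong (+-cong (trans (+-cong (sym (lin-scale h t (σ k f))) (sym (lin-scale h t-1 (X (suc k) g)))) (sym (lin-++ h (scale t (σ k f)) (scale t-1 (X (suc k) g))))) refl) refl ⟩
        (lin h (T k f) - t * lin h f) + y h ≈⟨ +-cong (+-cong (trans (lin-resp h (T k f) (scale t f) e) (lin-scale h t f)) refl) refl ⟩
        (t * lin h f - t * lin h f) + y h ≈⟨ trans (+-cong (-‿inverseʳ _) refl) (+-identityˡ _) ⟩
        lin h (X (suc k) g) ∎
        where
        x y : Functional → Carrier
        x h = lin h (X k g)
        y h = lin h (X (suc k) g)
      vanish : ∀ h j → lin h (X j g) ≈ 0#
      vanish h j = trans (lin-map h (incᴱ j) g) (lin-resp (h ∘ incᴱ j) g [] (annihilated g relation))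

-- Laurent polynomials and their fractions

module FractionLemmas (A : CommutativeRing 0ℓ 0ℓ) where
  open CommutativeRing A
  open IntegerSolver A
  open import Relation.Binary.Reasoning.Setoid setoid

  -- Denominators are only required not to be zero divisors, so Laurent polynomials need not be
  -- shown to form a domain. Cancelling the middle denominator in `frac-trans` is where this
  -- condition enters.
  Regular : Carrier → Set
  Regular d = ∀ r → d * r ≈ 0# → r ≈ 0#

  abstract
    regular-* : ∀ {d e} → Regular d → Regular e → Regular (d * e)
    regular-* {d} {e} D E r z = E r (D (e * r) (trans (sym (*-assoc d e r)) z))

  regular-unit : ∀ {d} e → e * d ≈ 1# → Regular d
  regular-unit {d} e u r z = begin
    r ≈⟨ sym (*-identityˡ r) ⟩
    1# * r ≈⟨ *-cong (sym u) refl ⟩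
    (e * d) * r ≈⟨ *-assoc e d r ⟩
    e * (d * r) ≈⟨ *-cong refl z ⟩
    e * 0# ≈⟨ zeroʳ e ⟩
    0# ∎

  cancel : ∀ {d} → Regular d → ∀ x y → d * x ≈ d * y → x ≈ y
  cancel {d} D x y e = begin
    x ≈⟨ solve 2 (λ x y → x := (x :- y) :+ y) refl x y ⟩
    (x - y) + y ≈⟨ +-cong (D (x - y) zero-diff) refl ⟩
    0# + y ≈⟨ +-identityˡ y ⟩
    y ∎
    where
    zero-diff : d * (x - y) ≈ 0#
    zero-diff = begin
      d * (x - y) ≈⟨ solve 3 (λ d x y → d :* (x :- y) := d :* x :- d :* y) refl d x y ⟩
      d * x - d * y ≈⟨ +-cong e refl ⟩
      d * y - d * y ≈⟨ -‿inverseʳ _ ⟩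
      0# ∎

  frac-trans : ∀ n₁ d₁ n₂ d₂ n₃ d₃ → Regular d₂ → n₁ * d₂ ≈ n₂ * d₁ → n₂ * d₃ ≈ n₃ * d₂ → n₁ * d₃ ≈ n₃ * d₁
  frac-trans n₁ d₁ n₂ d₂ n₃ d₃ D p r = cancel D _ _ (begin
    d₂ * (n₁ * d₃) ≈⟨ solve 3 (λ d n e → d :* (n :* e) := (n :* d) :* e) refl d₂ n₁ d₃ ⟩
    (n₁ * d₂) * d₃ ≈⟨ *-cong p refl ⟩
    (n₂ * d₁) * d₃ ≈⟨ solve 3 (λ n d e → (n :* d) :* e := (n :* e) :* d) refl n₂ d₁ d₃ ⟩
    (n₂ * d₃) * d₁ ≈⟨ *-cong r refl ⟩
    (n₃ * d₂) * d₁ ≈⟨ solve 3 (λ n d e → (n :* d) :* e := d :* (n :* e)) refl n₃ d₂ d₁ ⟩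
    d₂ * (n₃ * d₁) ∎)

  frac-+-cong : ∀ n₁ d₁ n₂ d₂ n₃ d₃ n₄ d₄ → n₁ * d₂ ≈ n₂ * d₁ → n₃ * d₄ ≈ n₄ * d₃ →
    (n₁ * d₃ + n₃ * d₁) * (d₂ * d₄) ≈ (n₂ * d₄ + n₄ * d₂) * (d₁ * d₃)
  frac-+-cong n₁ d₁ n₂ d₂ n₃ d₃ n₄ d₄ p r = begin
    (n₁ * d₃ + n₃ * d₁) * (d₂ * d₄)
      ≈⟨ solve 6 (λ n₁ d₃ n₃ d₁ d₂ d₄ → (n₁ :* d₃ :+ n₃ :* d₁) :* (d₂ :* d₄)
           := (n₁ :* d₂) :* (d₃ :* d₄) :+ (n₃ :* d₄) :* (d₁ :* d₂)) refl n₁ d₃ n₃ d₁ d₂ d₄ ⟩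
    (n₁ * d₂) * (d₃ * d₄) + (n₃ * d₄) * (d₁ * d₂)
      ≈⟨ +-cong (*-cong p refl) (*-cong r refl) ⟩
    (n₂ * d₁) * (d₃ * d₄) + (n₄ * d₃) * (d₁ * d₂)
      ≈⟨ solve 6 (λ n₂ d₁ d₃ d₄ n₄ d₂ → (n₂ :* d₁) :* (d₃ :* d₄) :+ (n₄ :* d₃) :* (d₁ :* d₂)
           := (n₂ :* d₄ :+ n₄ :* d₂) :* (d₁ :* d₃)) refl n₂ d₁ d₃ d₄ n₄ d₂ ⟩
    (n₂ * d₄ + n₄ * d₂) * (d₁ * d₃) ∎

  frac-*-cong : ∀ n₁ d₁ n₂ d₂ n₃ d₃ n₄ d₄ → n₁ * d₂ ≈ n₂ * d₁ → n₃ * d₄ ≈ n₄ * d₃ →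
    (n₁ * n₃) * (d₂ * d₄) ≈ (n₂ * n₄) * (d₁ * d₃)
  frac-*-cong n₁ d₁ n₂ d₂ n₃ d₃ n₄ d₄ p r = begin
    (n₁ * n₃) * (d₂ * d₄)
      ≈⟨ solve 4 (λ a b c d → (a :* b) :* (c :* d) := (a :* c) :* (b :* d)) refl n₁ n₃ d₂ d₄ ⟩
    (n₁ * d₂) * (n₃ * d₄) ≈⟨ *-cong p r ⟩
    (n₂ * d₁) * (n₄ * d₃)
      ≈⟨ solve 4 (λ a b c d → (a :* b) :* (c :* d) := (a :* c) :* (b :* d)) refl n₂ d₁ n₄ d₃ ⟩
    (n₂ * n₄) * (d₁ * d₃) ∎

  frac-neg-cong : ∀ n₁ d₁ n₂ d₂ → n₁ * d₂ ≈ n₂ * d₁ → (- n₁) * d₂ ≈ (- n₂) * d₁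
  frac-neg-cong n₁ d₁ n₂ d₂ p = begin
    (- n₁) * d₂ ≈⟨ solve 2 (λ n d → (:- n) :* d := :- (n :* d)) refl n₁ d₂ ⟩
    - (n₁ * d₂) ≈⟨ -‿cong p ⟩
    - (n₂ * d₁) ≈⟨ solve 2 (λ n d → :- (n :* d) := (:- n) :* d) refl n₂ d₁ ⟩
    (- n₂) * d₁ ∎

  frac-+-assoc : ∀ n₁ d₁ n₂ d₂ n₃ d₃ →
    ((n₁ * d₂ + n₂ * d₁) * d₃ + n₃ * (d₁ * d₂)) * (d₁ * (d₂ * d₃))
      ≈ (n₁ * (d₂ * d₃) + (n₂ * d₃ + n₃ * d₂) * d₁) * ((d₁ * d₂) * d₃)
  frac-+-assoc = solve 6 (λ n₁ d₁ n₂ d₂ n₃ d₃ →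
    ((n₁ :* d₂ :+ n₂ :* d₁) :* d₃ :+ n₃ :* (d₁ :* d₂)) :* (d₁ :* (d₂ :* d₃))
      := (n₁ :* (d₂ :* d₃) :+ (n₂ :* d₃ :+ n₃ :* d₂) :* d₁) :* ((d₁ :* d₂) :* d₃)) refl

  frac-*-assoc : ∀ n₁ d₁ n₂ d₂ n₃ d₃ →
    ((n₁ * n₂) * n₃) * (d₁ * (d₂ * d₃)) ≈ (n₁ * (n₂ * n₃)) * ((d₁ * d₂) * d₃)
  frac-*-assoc = solve 6 (λ n₁ d₁ n₂ d₂ n₃ d₃ →
    ((n₁ :* n₂) :* n₃) :* (d₁ :* (d₂ :* d₃)) := (n₁ :* (n₂ :* n₃)) :* ((d₁ :* d₂) :* d₃)) refl

  frac-+-comm : ∀ n₁ d₁ n₂ d₂ → (n₁ * d₂ + n₂ * d₁) * (d₂ * d₁) ≈ (n₂ * d₁ + n₁ * d₂) * (d₁ * d₂)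
  frac-+-comm = solve 4 (λ n₁ d₁ n₂ d₂ →
    (n₁ :* d₂ :+ n₂ :* d₁) :* (d₂ :* d₁) := (n₂ :* d₁ :+ n₁ :* d₂) :* (d₁ :* d₂)) refl

  frac-*-comm : ∀ n₁ d₁ n₂ d₂ → (n₁ * n₂) * (d₂ * d₁) ≈ (n₂ * n₁) * (d₁ * d₂)
  frac-*-comm = solve 4 (λ n₁ d₁ n₂ d₂ → (n₁ :* n₂) :* (d₂ :* d₁) := (n₂ :* n₁) :* (d₁ :* d₂)) refl

  frac-+-identity : ∀ n d → (0# * d + n * 1#) * d ≈ n * (1# * d)
  frac-+-identity = solve 2 (λ n d → (:0 :* d :+ n :* :1) :* d := n :* (:1 :* d)) refl

  frac-*-identity : ∀ n d → (1# * n) * d ≈ n * (1# * d)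
  frac-*-identity = solve 2 (λ n d → (:1 :* n) :* d := n :* (:1 :* d)) refl

  frac-inverse : ∀ n d → ((- n) * d + n * d) * 1# ≈ 0# * (d * d)
  frac-inverse = solve 2 (λ n d → ((:- n) :* d :+ n :* d) :* :1 := :0 :* (d :* d)) refl

  frac-distrib : ∀ n₁ d₁ n₂ d₂ n₃ d₃ →
    (n₁ * (n₂ * d₃ + n₃ * d₂)) * ((d₁ * d₂) * (d₁ * d₃))
      ≈ ((n₁ * n₂) * (d₁ * d₃) + (n₁ * n₃) * (d₁ * d₂)) * (d₁ * (d₂ * d₃))
  frac-distrib = solve 6 (λ n₁ d₁ n₂ d₂ n₃ d₃ →
    (n₁ :* (n₂ :* d₃ :+ n₃ :* d₂)) :* ((d₁ :* d₂) :* (d₁ :* d₃))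
      := ((n₁ :* n₂) :* (d₁ :* d₃) :+ (n₁ :* n₃) :* (d₁ :* d₂)) :* (d₁ :* (d₂ :* d₃))) refl

  -- The pattern behind inverting q and t in ζ = n / d. Inversion multiplies 1 - m by -m⁻¹; the
  -- signs of numerator and denominator cancel, and the monomials combine to qt.
  flip-quotient : ∀ n d n' d' u M qt → n' ≈ u * (- n) → d ≈ M * (- d') → u * M ≈ qt →
    n' * ((1# * 1#) * d) ≈ (qt * n) * d'
  flip-quotient n d n' d' u M qt p r s = begin
    n' * ((1# * 1#) * d) ≈⟨ *-cong p (*-cong refl r) ⟩
    (u * (- n)) * ((1# * 1#) * (M * (- d')))
      ≈⟨ solve 4 (λ u n M d' → (u :* (:- n)) :* ((:1 :* :1) :* (M :* (:- d'))) := ((u :* M) :* n) :* d') refl u n M d' ⟩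
    ((u * M) * n) * d' ≈⟨ *-cong (*-cong s refl) refl ⟩
    (qt * n) * d' ∎

  unit-quotient : ∀ n d → (n * d) * 1# ≈ n * (d * 1#)
  unit-quotient = solve 2 (λ n d → (n :* d) :* :1 := n :* (d :* :1)) refl

  double-unit : ∀ n d → n * (1# * d) ≈ (n * 1#) * d
  double-unit = solve 2 (λ n d → n :* (:1 :* d) := (n :* :1) :* d) refl

  swap-signs : ∀ m → 1# - m ≈ (- m) + 1#
  swap-signs = solve 1 (λ m → :1 :- m := (:- m) :+ :1) refl

ℤ²-basis : DecidableBasis
ℤ²-basis = record
  { Basis = ℤ × ℤ
  ; _==_ = λ { (i , j) (a , b) → ⌊ i Z.≟ a ⌋ ∧ ⌊ j Z.≟ b ⌋ }
  ; sound = snd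
  ; complete = cmp
  }
  where
  snd : ∀ x y → (⌊ proj₁ x Z.≟ proj₁ y ⌋ ∧ ⌊ proj₂ x Z.≟ proj₂ y ⌋) ≡ true → x ≡ y
  snd (i , j) (a , b) e with i Z.≟ a | j Z.≟ b
  ... | yes ≡.refl | yes ≡.refl = ≡.refl
  snd (i , j) (a , b) () | yes _ | no _
  snd (i , j) (a , b) () | no _ | _
  cmp : ∀ x → (⌊ proj₁ x Z.≟ proj₁ x ⌋ ∧ ⌊ proj₂ x Z.≟ proj₂ x ⌋) ≡ true
  cmp (i , j) with i Z.≟ i | j Z.≟ j
  ... | yes _ | yes _ = ≡.refl
  ... | no n | _ = ⊥-elim (n ≡.refl)
  ... | yes _ | no n = ⊥-elim (n ≡.refl)

module FL = FormalSum QP.+-*-commutativeRing ℤ²-basis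
module ℚS = IntegerSolver QP.+-*-commutativeRing

coeffL≡coef : ∀ p a b → coeffL p a b ≡ FL.coef p (a , b)
coeffL≡coef [] a b = ≡.refl
coeffL≡coef ((c , i , j) ∷ p) a b rewrite coeffL≡coef p a b = ≡.refl

record _≈ᴸ_ (p r : Laurent) : Set where
  constructor by-coef
  field at : p FL.≋ r
open _≈ᴸ_

≈ᴸ⇒≈L : ∀ {p r} → p ≈ᴸ r → p ≈L r
≈ᴸ⇒≈L {p} {r} e a b = ≡.trans (coeffL≡coef p a b) (≡.trans (at e (a , b)) (≡.sym (coeffL≡coef r a b)))

by-lin : ∀ {p r} → (∀ h → FL.lin h p ≡ FL.lin h r) → p ≈ᴸ r
by-lin {p} {r} e = by-coef (FL.lin-ext p r e)

lin-respᴸ : ∀ h {p r} → p ≈ᴸ r → FL.lin h p ≡ FL.lin h r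
lin-respᴸ h {p} {r} e = FL.lin-resp h p r (at e)

_⊕_ : ℤ × ℤ → ℤ × ℤ → ℤ × ℤ
(i , j) ⊕ (k , l) = (i Z.+ k , j Z.+ l)

⊖_ : ℤ × ℤ → ℤ × ℤ
⊖ (i , j) = (Z.- i , Z.- j)

lin-term : ∀ h c β (g : ℚ × ℤ × ℤ → ℚ × ℤ × ℤ) → (∀ d γ → g (d , γ) ≡ (c Q.* d , β ⊕ γ)) →
  ∀ r → FL.lin h (map g r) ≡ c Q.* FL.lin (λ γ → h (β ⊕ γ)) r
lin-term h c β g e [] = ≡.sym (QP.*-zeroʳ c)
lin-term h c β g e ((d , γ) ∷ r) rewrite e d γ =
  ≡.trans (≡.cong (λ z → c Q.* d Q.* h (β ⊕ γ) Q.+ z) (lin-term h c β g e r))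
  (solve 4 (λ c d x y → c :* d :* x :+ c :* y := c :* (d :* x :+ y)) ≡.refl c d (h (β ⊕ γ)) (FL.lin (λ γ → h (β ⊕ γ)) r))
  where open ℚS

lin-mulL : ∀ h p r → FL.lin h (mulL p r) ≡ FL.lin (λ β → FL.lin (λ γ → h (β ⊕ γ)) r) p
lin-mulL h [] r = ≡.refl
lin-mulL h ((c , β) ∷ p) r = ≡.trans (FL.lin-++ h (map _ r) (mulL p r))
  (≡.cong₂ Q._+_ (lin-term h c β _ (λ d γ → ≡.refl) r) (lin-mulL h p r))

lin-negL : ∀ h p → FL.lin h (negL p) ≡ Q.- FL.lin h p
lin-negL h [] = ≡.refl
lin-negL h ((c , β) ∷ p) = ≡.trans (≡.cong (λ z → (Q.- c) Q.* h β Q.+ z) (lin-negL h p))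
  (solve 3 (λ c x y → (:- c) :* x :+ :- y := :- (c :* x :+ y)) ≡.refl c (h β) (FL.lin h p))
  where open ℚS

lin-barL : ∀ h p → FL.lin h (barL p) ≡ FL.lin (h ∘ ⊖_) p
lin-barL h [] = ≡.refl
lin-barL h ((c , β) ∷ p) = ≡.cong (λ z → c Q.* h (⊖ β) Q.+ z) (lin-barL h p)

lin-congᴸ : ∀ {h h'} p → (∀ β → h β ≡ h' β) → FL.lin h p ≡ FL.lin h' p
lin-congᴸ p e = FL.lin-cong p e

mulL-cong : ∀ {p p' r r'} → p ≈ᴸ p' → r ≈ᴸ r' → mulL p r ≈ᴸ mulL p' r'
mulL-cong {p} {p'} {r} {r'} e f = by-lin λ h →
  ≡.trans (lin-mulL h p r) (≡.trans (lin-respᴸ _ e)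
  (≡.trans (lin-congᴸ p' (λ β → lin-respᴸ _ f)) (≡.sym (lin-mulL h p' r'))))

mulL-comm : ∀ p r → mulL p r ≈ᴸ mulL r p
mulL-comm p r = by-lin λ h → ≡.trans (lin-mulL h p r) (≡.trans (FL.lin-swap (λ β γ → h (β ⊕ γ)) p r)
  (≡.trans (lin-congᴸ r (λ γ → lin-congᴸ p λ β → ≡.cong h (≡.cong₂ _,_ (ZP.+-comm _ (proj₁ γ)) (ZP.+-comm _ (proj₂ γ)))))
  (≡.sym (lin-mulL h r p))))

mulL-assoc : ∀ p r s → mulL (mulL p r) s ≈ᴸ mulL p (mulL r s)
mulL-assoc p r s = by-lin λ h → ≡.trans (lin-mulL h (mulL p r) s) (≡.trans (lin-mulL _ p r)
  (≡.trans (lin-congᴸ p λ β → ≡.trans (lin-congᴸ r λ γ → lin-congᴸ s λ ε → ≡.cong h (assoc β γ ε)) (≡.sym (lin-mulL _ r s)))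
  (≡.sym (lin-mulL h p (mulL r s)))))
  where
  assoc : ∀ β γ ε → (β ⊕ γ) ⊕ ε ≡ β ⊕ (γ ⊕ ε)
  assoc β γ ε = ≡.cong₂ _,_ (ZP.+-assoc (proj₁ β) _ _) (ZP.+-assoc (proj₂ β) _ _)

mulL-identity : ∀ p → mulL (monoL (+ 0) (+ 0)) p ≈ᴸ p
mulL-identity p = by-lin λ h → ≡.trans (lin-mulL h (monoL (+ 0) (+ 0)) p) (≡.trans
  (≡.trans (QP.+-identityʳ _) (QP.*-identityˡ _))
  (lin-congᴸ p λ β → ≡.cong h (≡.cong₂ _,_ (ZP.+-identityˡ (proj₁ β)) (ZP.+-identityˡ (proj₂ β)))))

mulL-distribʳ : ∀ s p r → mulL (p ++ r) s ≈ᴸ (mulL p s ++ mulL r s)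
mulL-distribʳ s p r = by-lin λ h → ≡.trans (lin-mulL h (p ++ r) s) (≡.trans (FL.lin-++ _ p r)
  (≡.trans (≡.cong₂ Q._+_ (≡.sym (lin-mulL h p s)) (≡.sym (lin-mulL h r s))) (≡.sym (FL.lin-++ h (mulL p s) (mulL r s)))))

≈ᴸ-refl : ∀ {p} → p ≈ᴸ p
≈ᴸ-refl = by-coef λ _ → ≡.refl

≈ᴸ-trans : ∀ {p r s} → p ≈ᴸ r → r ≈ᴸ s → p ≈ᴸ s
≈ᴸ-trans e f = by-coef λ α → ≡.trans (at e α) (at f α)

≈ᴸ-sym : ∀ {p r} → p ≈ᴸ r → r ≈ᴸ p
≈ᴸ-sym e = by-coef λ α → ≡.sym (at e α)

laurentRing : CommutativeRing 0ℓ 0ℓ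
laurentRing = record
  { Carrier = Laurent
  ; _≈_ = _≈ᴸ_
  ; _+_ = _++_
  ; _*_ = mulL
  ; -_ = negL
  ; 0# = []
  ; 1# = monoL (+ 0) (+ 0)
  ; isCommutativeRing = record
    { isRing = record
      { +-isAbelianGroup = record
        { isGroup = record
          { isMonoid = record
            { isSemigroup = record
              { isMagma = record
                { isEquivalence = record { refl = ≈ᴸ-refl ; sym = ≈ᴸ-sym ; trans = ≈ᴸ-trans }
                ; ∙-cong = λ {p} {p'} {r} {r'} e f → by-lin λ h → ≡.trans (FL.lin-++ h p r)
                    (≡.trans (≡.cong₂ Q._+_ (lin-respᴸ h e) (lin-respᴸ h f)) (≡.sym (FL.lin-++ h p' r'))) }
              ; assoc = λ p r s → by-lin λ h → ≡.cong (FL.lin h) (LPr.++-assoc p r s) }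
            ; identity = (λ p → ≈ᴸ-refl) , (λ p → by-lin λ h → ≡.cong (FL.lin h) (LPr.++-identityʳ p)) }
          ; inverse = (λ p → ≈ᴸ-trans (swap-++ (negL p) p) (inverseʳ p)) , inverseʳ
          ; ⁻¹-cong = λ {p} {r} e → by-lin λ h → ≡.trans (lin-negL h p) (≡.trans (≡.cong Q.-_ (lin-respᴸ h e)) (≡.sym (lin-negL h r))) }
        ; comm = swap-++ }
      ; *-cong = mulL-cong
      ; *-assoc = mulL-assoc
      ; *-identity = mulL-identity , (λ p → ≈ᴸ-trans (mulL-comm p _) (mulL-identity p))
      ; distrib = (λ s p r → ≈ᴸ-trans (mulL-comm s (p ++ r)) (≈ᴸ-trans (mulL-distribʳ s p r)
          (by-lin λ h → ≡.trans (FL.lin-++ h (mulL p s) (mulL r s)) (≡.trans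
            (≡.cong₂ Q._+_ (lin-respᴸ h (mulL-comm p s)) (lin-respᴸ h (mulL-comm r s)))
            (≡.sym (FL.lin-++ h (mulL s p) (mulL s r)))))))
        , mulL-distribʳ }
    ; *-comm = mulL-comm }
  }
  where
  import Data.List.Properties as LPr
  swap-++ : ∀ p r → (p ++ r) ≈ᴸ (r ++ p)
  swap-++ p r = by-lin λ h → ≡.trans (FL.lin-++ h p r) (≡.trans (QP.+-comm (FL.lin h p) (FL.lin h r)) (≡.sym (FL.lin-++ h r p)))
  inverseʳ : ∀ p → (p ++ negL p) ≈ᴸ []
  inverseʳ p = by-lin λ h → ≡.trans (FL.lin-++ h p (negL p))
    (≡.trans (≡.cong (λ z → FL.lin h p Q.+ z) (lin-negL h p)) (QP.+-inverseʳ (FL.lin h p)))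

open FractionLemmas laurentRing

barL-cong : ∀ {p r} → p ≈ᴸ r → barL p ≈ᴸ barL r
barL-cong {p} {r} e = by-lin λ h → ≡.trans (lin-barL h p) (≡.trans (lin-respᴸ _ e) (≡.sym (lin-barL h r)))

barL-mul : ∀ p r → barL (mulL p r) ≈ᴸ mulL (barL p) (barL r)
barL-mul p r = by-lin λ h → ≡.trans (lin-barL h (mulL p r)) (≡.trans (lin-mulL _ p r) (≡.trans
  (lin-congᴸ p λ β → ≡.trans (lin-congᴸ r λ γ → ≡.cong h (neg-⊕ β γ)) (≡.sym (lin-barL _ r)))
  (≡.sym (≡.trans (lin-mulL h (barL p) (barL r)) (lin-barL _ p)))))
  where
  neg-⊕ : ∀ β γ → ⊖ (β ⊕ γ) ≡ (⊖ β) ⊕ (⊖ γ)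
  neg-⊕ (i , j) (k , l) = ≡.cong₂ _,_ (ZP.neg-distrib-+ i k) (ZP.neg-distrib-+ j l)

barL-++ : ∀ p r → barL (p ++ r) ≈ᴸ (barL p ++ barL r)
barL-++ p r = by-lin λ h → ≡.trans (lin-barL h (p ++ r)) (≡.trans (FL.lin-++ _ p r)
  (≡.trans (≡.cong₂ Q._+_ (≡.sym (lin-barL h p)) (≡.sym (lin-barL h r))) (≡.sym (FL.lin-++ h (barL p) (barL r)))))

barL-involutive : ∀ p → barL (barL p) ≈ᴸ p
barL-involutive p = by-lin λ h → ≡.trans (lin-barL h (barL p)) (≡.trans (lin-barL _ p)
  (lin-congᴸ p λ β → ≡.cong h (≡.cong₂ _,_ (ZP.neg-involutive (proj₁ β)) (ZP.neg-involutive (proj₂ β)))))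

abstract
  regular-bar : ∀ {d} → Regular d → Regular (barL d)
  regular-bar {d} D r z = ≈ᴸ-trans (≈ᴸ-sym (barL-involutive r)) (barL-cong (D (barL r)
    (≈ᴸ-trans (mulL-cong (≈ᴸ-sym (barL-involutive d)) ≈ᴸ-refl) (≈ᴸ-trans (≈ᴸ-sym (barL-mul (barL d) r)) (barL-cong z)))))

abstract
  regular-mono : ∀ i j → Regular (monoL i j)
  regular-mono i j = regular-unit (monoL (Z.- i) (Z.- j)) (≈ᴸ-reflexive
    (≡.cong₂ monoL (ZP.+-inverseˡ i) (ZP.+-inverseˡ j)))
    where
    ≈ᴸ-reflexive : ∀ {p r} → p ≡ r → p ≈ᴸ r
    ≈ᴸ-reflexive ≡.refl = ≈ᴸ-refl

-- A binomial 1 − q^a s^b with a ≠ 0 is regular: if (1 − q^a s^b) r = 0, then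
-- every linear functional takes the same value on r and on its translate by
-- (a , b), and translating far enough moves the support of r off any point.

oneMinus : ℤ → ℤ → Laurent
oneMinus a b = (1ℚ , + 0 , + 0) ∷ (Q.- 1ℚ , a , b) ∷ []

translate : ℕ → ℤ × ℤ → ℤ × ℤ → ℤ × ℤ
translate zero β γ = γ
translate (suc N) β γ = translate N β (β ⊕ γ)

proj₁-translate : ∀ N β γ → proj₁ (translate N β γ) ≡ proj₁ γ Z.+ + N Z.* proj₁ β
proj₁-translate zero β γ = ≡.sym (≡.trans (≡.cong (λ z → proj₁ γ Z.+ z) (ZP.*-zeroˡ (proj₁ β))) (ZP.+-identityʳ _))
proj₁-translate (suc N) β γ = ≡.trans (proj₁-translate N β (β ⊕ γ)) (shuffle (proj₁ β) (proj₁ γ) (+ N))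
  where
  shuffle : ∀ a c n → (a Z.+ c) Z.+ n Z.* a ≡ c Z.+ (+ 1 Z.+ n) Z.* a
  shuffle = solve-∀ℤ

abstract
  regular-oneMinus : ∀ a b → ¬ a ≡ + 0 → Regular (oneMinus a b)
  regular-oneMinus a b a≢0 r z = by-coef λ α →
    ≡.trans (FL.coef≈lin r α) (≡.trans (lin-translate (far α r) (FL.δ α)) (vanish (far α r) r α (far-ok α r)))
    where
    lin-step : ∀ g → FL.lin g r ≡ FL.lin (λ β → g ((a , b) ⊕ β)) r
    lin-step g = begin
      FL.lin g r ≡⟨ lin-congᴸ r (λ β → ≡.cong g (≡.sym (≡.cong₂ _,_ (ZP.+-identityˡ (proj₁ β)) (ZP.+-identityˡ (proj₂ β))))) ⟩
      X ≡⟨ solve 2 (λ x y → x := (:1 :* x :+ ((:- :1) :* y :+ :0)) :+ y) ≡.refl X Y ⟩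
      (1ℚ Q.* X Q.+ ((Q.- 1ℚ) Q.* Y Q.+ 0ℚ)) Q.+ Y
        ≡⟨ ≡.cong (Q._+ Y) (≡.trans (≡.sym (lin-mulL g (oneMinus a b) r)) (lin-respᴸ g z)) ⟩
      0ℚ Q.+ Y ≡⟨ QP.+-identityˡ Y ⟩
      Y ∎
      where
      open ℚS
      open ≡.≡-Reasoning
      X Y : ℚ
      X = FL.lin (λ β → g ((+ 0 , + 0) ⊕ β)) r
      Y = FL.lin (λ β → g ((a , b) ⊕ β)) r
    lin-translate : ∀ N g → FL.lin g r ≡ FL.lin (λ β → g (translate N (a , b) β)) r
    lin-translate zero g = ≡.refl
    lin-translate (suc N) g = ≡.trans (lin-translate N g) (lin-step (λ β → g (translate N (a , b) β)))
    far : ℤ × ℤ → Laurent → ℕ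
    far α [] = 0
    far α ((c , β) ∷ r) = suc Z.∣ proj₁ α Z.- proj₁ β ∣ N.+ far α r
    Off : ℕ → ℤ × ℤ → ℚ × ℤ × ℤ → Set
    Off N α (c , β) = Z.∣ proj₁ α Z.- proj₁ β ∣ N.< N
    far-ok : ∀ α r → All (Off (far α r) α) r
    far-ok α [] = []
    far-ok α ((c , β) ∷ r) = NP.m≤m+n _ _ ∷ All.map (λ p → NP.≤-trans p (NP.m≤n+m _ _)) (far-ok α r)
    ∣a∣≥1 : 1 N.≤ Z.∣ a ∣
    ∣a∣≥1 = NP.n≢0⇒n>0 λ e → a≢0 (ZP.∣i∣≡0⇒i≡0 e)
    δ-zero : ∀ N α β → Z.∣ proj₁ α Z.- proj₁ β ∣ N.< N → FL.δ α (translate N (a , b) β) ≡ 0ℚ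
    δ-zero N α β off with proj₁ (translate N (a , b) β) Z.≟ proj₁ α
    ... | no _ = ≡.refl
    ... | yes e = ⊥-elim (NP.<-irrefl ≡.refl (NP.<-≤-trans off (NP.≤-trans
            (NP.≤-reflexive (≡.sym (NP.*-identityʳ N))) (NP.≤-trans (NP.*-monoʳ-≤ N ∣a∣≥1)
            (NP.≤-reflexive (≡.trans (≡.sym (ZP.∣i*j∣≡∣i∣*∣j∣ (+ N) a)) (≡.cong Z.∣_∣ exact)))))))
      where
      difference : ∀ x y z → x ≡ y Z.+ z → z ≡ x Z.- y
      difference x y z ≡.refl = shuffle y z
        where
        shuffle : ∀ y z → z ≡ (y Z.+ z) Z.- y
        shuffle = solve-∀ℤ
      exact : + N Z.* a ≡ proj₁ α Z.- proj₁ β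
      exact = difference (proj₁ α) (proj₁ β) (+ N Z.* a) (≡.trans (≡.sym e) (proj₁-translate N (a , b) β))
    vanish : ∀ N s α → All (Off N α) s → FL.lin (λ β → FL.δ α (translate N (a , b) β)) s ≡ 0ℚ
    vanish N [] α _ = ≡.refl
    vanish N ((c , β) ∷ s) α (o ∷ os) rewrite δ-zero N α β o | vanish N s α os = ≡.trans (QP.+-identityʳ _) (QP.*-zeroʳ c)

-- The ring of fractions with regular denominators

open CommutativeRing laurentRing using () renaming (refl to reflᴸ; sym to symᴸ; trans to transᴸ; +-cong to +-congᴸ; *-cong to *-congᴸ; reflexive to reflexiveᴸ)

-- `Frac` puts no condition on its denominator, while transitivity of equality by
-- cross-multiplication cancels a denominator. The ring structure therefore lives on fractions
-- paired with a proof of regularity.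
record RegFrac : Set where
  constructor _,ʳ_
  field
    frac : Frac
    regular : Regular (den frac)
open RegFrac

infix 4 _≈ᴷ_
record _≈ᴷ_ (x y : RegFrac) : Set where
  constructor cross
  field uncross : mulL (num (frac x)) (den (frac y)) ≈ᴸ mulL (num (frac y)) (den (frac x))
open _≈ᴷ_

addᴷ mulᴷ : RegFrac → RegFrac → RegFrac
addᴷ (x ,ʳ r) (y ,ʳ s) = addF x y ,ʳ regular-* {den x} {den y} r s
mulᴷ (x ,ʳ r) (y ,ʳ s) = mulF x y ,ʳ regular-* {den x} {den y} r s

negᴷ barᴷ : RegFrac → RegFrac
negᴷ (x ,ʳ r) = negF x ,ʳ r
barᴷ (x ,ʳ r) = barF x ,ʳ regular-bar {den x} r

fromᴷ : Laurent → RegFrac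
fromᴷ p = fromL p ,ʳ regular-mono (+ 0) (+ 0)

fractionRing : CommutativeRing 0ℓ 0ℓ
fractionRing = record
  { Carrier = RegFrac
  ; _≈_ = _≈ᴷ_
  ; _+_ = addᴷ
  ; _*_ = mulᴷ
  ; -_ = negᴷ
  ; 0# = fromᴷ []
  ; 1# = fromᴷ (monoL (+ 0) (+ 0))
  ; isCommutativeRing = record
    { isRing = record
      { +-isAbelianGroup = record
        { isGroup = record
          { isMonoid = record
            { isSemigroup = record
              { isMagma = record
                { isEquivalence = record
                  { refl = cross reflᴸ
                  ; sym = λ e → cross (symᴸ (uncross e))
                  ; trans = transᴷ }
                ; ∙-cong = λ {x} {y} {u} {v} e f → cross (frac-+-cong (num (frac x)) (den (frac x)) (num (frac y)) (den (frac y))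
                    (num (frac u)) (den (frac u)) (num (frac v)) (den (frac v)) (uncross e) (uncross f)) }
              ; assoc = λ x y z → cross (frac-+-assoc (num (frac x)) (den (frac x)) (num (frac y)) (den (frac y)) (num (frac z)) (den (frac z))) }
            ; identity = (λ x → +-identityˡᴷ x) , (λ x → transᴷ (+-commᴷ x (fromᴷ [])) (+-identityˡᴷ x)) }
          ; inverse = +-inverseˡᴷ , (λ x → transᴷ (+-commᴷ x (negᴷ x)) (+-inverseˡᴷ x))
          ; ⁻¹-cong = λ {x} {y} e → cross (frac-neg-cong (num (frac x)) (den (frac x)) (num (frac y)) (den (frac y)) (uncross e)) }
        ; comm = +-commᴷ }
      ; *-cong = λ {x} {y} {u} {v} e f → *-congᴷ x y u v e f
      ; *-assoc = λ x y z → cross (frac-*-assoc (num (frac x)) (den (frac x)) (num (frac y)) (den (frac y)) (num (frac z)) (den (frac z)))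
      ; *-identity = *-identityˡᴷ , (λ x → transᴷ {mulᴷ x (fromᴷ (monoL (+ 0) (+ 0)))} {mulᴷ (fromᴷ (monoL (+ 0) (+ 0))) x} {x} (*-commᴷ x (fromᴷ (monoL (+ 0) (+ 0)))) (*-identityˡᴷ x))
      ; distrib = distribˡᴷ , (λ x y z → transᴷ (*-commᴷ (addᴷ y z) x) (transᴷ (distribˡᴷ x y z)
          (cross (frac-+-cong (num (frac (mulᴷ x y))) (den (frac (mulᴷ x y))) (num (frac (mulᴷ y x))) (den (frac (mulᴷ y x)))
             (num (frac (mulᴷ x z))) (den (frac (mulᴷ x z))) (num (frac (mulᴷ z x))) (den (frac (mulᴷ z x)))
             (uncross (*-commᴷ x y)) (uncross (*-commᴷ x z)))))) }
    ; *-comm = *-commᴷ }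
  }
  where
  transᴷ : ∀ {x y z} → x ≈ᴷ y → y ≈ᴷ z → x ≈ᴷ z
  transᴷ {x} {y} {z} e f = cross (frac-trans (num (frac x)) (den (frac x)) (num (frac y)) (den (frac y))
    (num (frac z)) (den (frac z)) (regular y) (uncross e) (uncross f))
  +-commᴷ : ∀ x y → addᴷ x y ≈ᴷ addᴷ y x
  +-commᴷ x y = cross (frac-+-comm (num (frac x)) (den (frac x)) (num (frac y)) (den (frac y)))
  *-commᴷ : ∀ x y → mulᴷ x y ≈ᴷ mulᴷ y x
  *-commᴷ x y = cross (frac-*-comm (num (frac x)) (den (frac x)) (num (frac y)) (den (frac y)))
  +-identityˡᴷ : ∀ x → addᴷ (fromᴷ []) x ≈ᴷ x
  +-identityˡᴷ x = cross (frac-+-identity (num (frac x)) (den (frac x)))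
  *-identityˡᴷ : ∀ x → mulᴷ (fromᴷ (monoL (+ 0) (+ 0))) x ≈ᴷ x
  *-identityˡᴷ x = cross (frac-*-identity (num (frac x)) (den (frac x)))
  +-inverseˡᴷ : ∀ x → addᴷ (negᴷ x) x ≈ᴷ fromᴷ []
  +-inverseˡᴷ x = cross (frac-inverse (num (frac x)) (den (frac x)))
  *-congᴷ : ∀ x y u v → x ≈ᴷ y → u ≈ᴷ v → mulᴷ x u ≈ᴷ mulᴷ y v
  *-congᴷ x y u v e f = cross (frac-*-cong (num (frac x)) (den (frac x)) (num (frac y)) (den (frac y))
    (num (frac u)) (den (frac u)) (num (frac v)) (den (frac v)) (uncross e) (uncross f))
  distribˡᴷ : ∀ x y z → mulᴷ x (addᴷ y z) ≈ᴷ addᴷ (mulᴷ x y) (mulᴷ x z)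
  distribˡᴷ x y z = cross (frac-distrib (num (frac x)) (den (frac x)) (num (frac y)) (den (frac y)) (num (frac z)) (den (frac z)))

qᴷ tᴷ : ℤ → RegFrac
qᴷ i = fromᴷ (monoL i (+ 0))
tᴷ k = fromᴷ (monoL (+ 0) (k Z.+ k))

suc≢0 : ∀ h → ¬ + suc h ≡ + 0
suc≢0 h ()

-- Literally the fraction `factor` in the definition of E_μ, so that forgetting the proof gives back
-- its coefficients by computation. Exponents of t are doubled because s = t^(1/2) is the generator.
ζᴷ : ℕ → ℕ → RegFrac
ζᴷ h a = (oneMinus (+ 0) (+ 2) / oneMinus (+ suc h) (+ (2 N.* suc a)))
  ,ʳ regular-oneMinus (+ suc h) (+ (2 N.* suc a)) (suc≢0 h)

module K = CommutativeRing fractionRing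

≡⇒≈ᴷ : ∀ {p r} → p ≡ r → fromᴷ p ≈ᴷ fromᴷ r
≡⇒≈ᴷ ≡.refl = K.refl

fromᴷ-* : ∀ p r → fromᴷ (mulL p r) ≈ᴷ mulᴷ (fromᴷ p) (fromᴷ r)
fromᴷ-* p r = cross (reflᴸ {mulL (mulL p r) (monoL (+ 0) (+ 0))})

qᴷ-+ : ∀ i j → qᴷ (i Z.+ j) ≈ᴷ mulᴷ (qᴷ i) (qᴷ j)
qᴷ-+ i j = fromᴷ-* (monoL i (+ 0)) (monoL j (+ 0))

tᴷ-+ : ∀ i j → tᴷ (i Z.+ j) ≈ᴷ mulᴷ (tᴷ i) (tᴷ j)
tᴷ-+ i j = K.trans (≡⇒≈ᴷ (≡.cong (monoL (+ 0)) (shuffle i j)))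
  (fromᴷ-* (monoL (+ 0) (i Z.+ i)) (monoL (+ 0) (j Z.+ j)))
  where
  shuffle : ∀ i j → (i Z.+ j) Z.+ (i Z.+ j) ≡ (i Z.+ i) Z.+ (j Z.+ j)
  shuffle = solve-∀ℤ

fromᴷ-cong : ∀ {p r} → p ≈ᴸ r → fromᴷ p ≈ᴷ fromᴷ r
fromᴷ-cong {p} {r} e = cross (*-congᴸ {p} {r} {monoL (+ 0) (+ 0)} {monoL (+ 0) (+ 0)} e reflᴸ)

barᴷ-cong : ∀ {x y} → x ≈ᴷ y → barᴷ x ≈ᴷ barᴷ y
barᴷ-cong {x} {y} e = cross (transᴸ (symᴸ (barL-mul (num (frac x)) (den (frac y))))
  (transᴸ (barL-cong (uncross e)) (barL-mul (num (frac y)) (den (frac x)))))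

same-fraction : ∀ x y → num (frac x) ≈ᴸ num (frac y) → den (frac x) ≈ᴸ den (frac y) → x ≈ᴷ y
same-fraction x y e f = cross (*-congᴸ {num (frac x)} {num (frac y)} {den (frac y)} {den (frac x)} e (symᴸ f))

barᴷ-+ : ∀ x y → barᴷ (addᴷ x y) ≈ᴷ addᴷ (barᴷ x) (barᴷ y)
barᴷ-+ x y = same-fraction (barᴷ (addᴷ x y)) (addᴷ (barᴷ x) (barᴷ y))
  (transᴸ (barL-++ (mulL (num (frac x)) (den (frac y))) (mulL (num (frac y)) (den (frac x))))
    (+-congᴸ {barL (mulL (num (frac x)) (den (frac y)))} {mulL (barL (num (frac x))) (barL (den (frac y)))}
             {barL (mulL (num (frac y)) (den (frac x)))} {mulL (barL (num (frac y))) (barL (den (frac x)))}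
      (barL-mul (num (frac x)) (den (frac y))) (barL-mul (num (frac y)) (den (frac x)))))
  (barL-mul (den (frac x)) (den (frac y)))

barᴷ-* : ∀ x y → barᴷ (mulᴷ x y) ≈ᴷ mulᴷ (barᴷ x) (barᴷ y)
barᴷ-* x y = same-fraction (barᴷ (mulᴷ x y)) (mulᴷ (barᴷ x) (barᴷ y))
  (barL-mul (num (frac x)) (num (frac y))) (barL-mul (den (frac x)) (den (frac y)))

barᴷ-t : ∀ i → barᴷ (tᴷ i) ≈ᴷ tᴷ (Z.- i)
barᴷ-t i = same-fraction (barᴷ (tᴷ i)) (tᴷ (Z.- i)) (reflexiveᴸ (≡.cong (monoL (+ 0)) (ZP.neg-distrib-+ i i))) ≈ᴸ-refl

≈ᴸ-terms : ∀ {c d i i' j j' k k' l l'} → i ≡ i' → j ≡ j' → k ≡ k' → l ≡ l' →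
  _≈ᴸ_ ((c , i , j) ∷ (d , k , l) ∷ []) ((c , i' , j') ∷ (d , k' , l') ∷ [])
≈ᴸ-terms ≡.refl ≡.refl ≡.refl ≡.refl = ≈ᴸ-refl

module _ (h a : ℕ) where
  ζ-num ζ-den : Laurent
  ζ-num = oneMinus (+ 0) (+ 2)
  ζ-den = oneMinus (+ suc h) (+ (2 N.* suc a))

  ρᴷ : RegFrac
  ρᴷ = (monoL (+ 0) (+ 0) / ζ-den) ,ʳ regular-oneMinus (+ suc h) (+ (2 N.* suc a)) (suc≢0 h)

  ρᴷ-inverse : mulᴷ ρᴷ (addᴷ K.1# (negᴷ (mulᴷ (qᴷ (+ suc h)) (tᴷ (+ suc a))))) ≈ᴷ K.1#
  ρᴷ-inverse = K.trans (K.*-cong (K.refl {ρᴷ}) denominator) (cross (unit-quotient (monoL (+ 0) (+ 0)) ζ-den))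
    where
    shuffle : ∀ i → ((i Z.+ + 0) Z.+ + 0) ≡ i
    shuffle = solve-∀ℤ
    doubled : ∀ a → suc a N.+ suc a ≡ 2 N.* suc a
    doubled a = ≡.cong (λ z → suc a N.+ z) (≡.sym (NP.+-identityʳ (suc a)))
    denominator : addᴷ K.1# (negᴷ (mulᴷ (qᴷ (+ suc h)) (tᴷ (+ suc a)))) ≈ᴷ fromᴷ ζ-den
    denominator = same-fraction (addᴷ K.1# (negᴷ (mulᴷ (qᴷ (+ suc h)) (tᴷ (+ suc a))))) (fromᴷ ζ-den)
      (≈ᴸ-terms ≡.refl ≡.refl (shuffle (+ suc h)) (≡.trans (shuffle' (+ suc a)) (≡.cong (λ z → + z) (doubled a)))) ≈ᴸ-refl
      where
      shuffle' : ∀ i → (((+ 0 Z.+ (i Z.+ i)) Z.+ + 0)) ≡ i Z.+ i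
      shuffle' = solve-∀ℤ

  ζᴷ-numerator : ζᴷ h a ≈ᴷ mulᴷ (addᴷ K.1# (negᴷ (tᴷ (+ 1)))) ρᴷ
  ζᴷ-numerator = K.trans (cross (double-unit ζ-num ζ-den)) (K.*-cong (K.sym numerator) (K.refl {ρᴷ}))
    where
    numerator : addᴷ K.1# (negᴷ (tᴷ (+ 1))) ≈ᴷ fromᴷ ζ-num
    numerator = same-fraction (addᴷ K.1# (negᴷ (tᴷ (+ 1)))) (fromᴷ ζ-num) ≈ᴸ-refl ≈ᴸ-refl

  barᴷ-ζ : barᴷ (ζᴷ h a) ≈ᴷ mulᴷ (mulᴷ (qᴷ (+ suc h)) (tᴷ (+ a))) (ζᴷ h a)
  barᴷ-ζ = cross (flip-quotient ζ-num ζ-den (barL ζ-num) (barL ζ-den) (monoL (+ 0) (Z.- + 2))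
    (monoL (+ suc h) (+ (2 N.* suc a))) (mulL (monoL (+ suc h) (+ 0)) (monoL (+ 0) (+ a Z.+ + a)))
    flip-num unflip-den (reflexiveᴸ (≡.cong₂ monoL e₁ e₂)))
    where
    flip-num : barL ζ-num ≈ᴸ mulL (monoL (+ 0) (Z.- + 2)) (negL ζ-num)
    flip-num = transᴸ (swap-signs (monoL (+ 0) (Z.- + 2))) (≈ᴸ-terms ≡.refl ≡.refl ≡.refl ≡.refl)
    unflip-den : ζ-den ≈ᴸ mulL (monoL (+ suc h) (+ (2 N.* suc a))) (negL (barL ζ-den))
    unflip-den = transᴸ (swap-signs (monoL (+ suc h) (+ (2 N.* suc a))))
      (≈ᴸ-terms (≡.sym (ZP.+-identityʳ (+ suc h))) (≡.sym (ZP.+-identityʳ (+ (2 N.* suc a))))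
        (≡.sym (ZP.+-inverseʳ (+ suc h))) (≡.sym (ZP.+-inverseʳ (+ (2 N.* suc a)))))
    e₁ : + 0 Z.+ + suc h ≡ + suc h Z.+ + 0
    e₁ = ≡.trans (ZP.+-identityˡ (+ suc h)) (≡.sym (ZP.+-identityʳ (+ suc h)))
    e₂ : (Z.- + 2) Z.+ + (2 N.* suc a) ≡ + 0 Z.+ (+ a Z.+ + a)
    e₂ = ≡.trans (≡.cong (λ z → (Z.- + 2) Z.+ + z) (NP.*-suc 2 a))
      (≡.trans (≡.cong (λ z → (Z.- + 2) Z.+ (+ 2 Z.+ + z)) (≡.cong (λ z → a N.+ z) (NP.+-identityʳ a))) (shuffle (+ a)))
      where
      shuffle : ∀ a → (Z.- + 2) Z.+ (+ 2 Z.+ (a Z.+ a)) ≡ + 0 Z.+ (a Z.+ a)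
      shuffle = solve-∀ℤ

½ᴷ : RegFrac
½ᴷ = fromᴷ ((Q.½ , + 0 , + 0) ∷ [])

½+½ : addᴷ ½ᴷ ½ᴷ ≈ᴷ K.1#
½+½ = K.trans (same-fraction (addᴷ ½ᴷ ½ᴷ) (fromᴷ halves) ≈ᴸ-refl ≈ᴸ-refl)
  (fromᴷ-cong {halves} {monoL (+ 0) (+ 0)} (by-coef merge))
  where
  halves : Laurent
  halves = (Q.½ , + 0 , + 0) ∷ (Q.½ , + 0 , + 0) ∷ []
  merge : FL._≋_ halves (monoL (+ 0) (+ 0))
  merge (a , b) with DecidableBasis._==_ ℤ²-basis (+ 0 , + 0) (a , b)
  ... | true = ≡.refl
  ... | false = ≡.refl

-- The polynomial representation

tMinus1ᴷ tInvMinus1ᴷ : RegFrac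
tMinus1ᴷ = fromᴷ ((1ℚ , + 0 , + 2) ∷ (Q.- 1ℚ , + 0 , + 0) ∷ [])
tInvMinus1ᴷ = fromᴷ ((1ℚ , + 0 , Z.- (+ 2)) ∷ (Q.- 1ℚ , + 0 , + 0) ∷ [])

tMinus1≈ : tMinus1ᴷ ≈ᴷ K._-_ (tᴷ (+ 1)) K.1#
tMinus1≈ = same-fraction tMinus1ᴷ (K._-_ (tᴷ (+ 1)) K.1#) ≈ᴸ-refl ≈ᴸ-refl

tInvMinus1≈ : tInvMinus1ᴷ ≈ᴷ K._-_ (tᴷ (Z.- (+ 1))) K.1#
tInvMinus1≈ = same-fraction tInvMinus1ᴷ (K._-_ (tᴷ (Z.- (+ 1))) K.1#) ≈ᴸ-refl ≈ᴸ-refl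

module SemilinearStep (R : CommutativeRing 0ℓ 0ℓ) where
  open CommutativeRing R
  open IntegerSolver R

  factor-out : ∀ c q d x y → (c * (q * d)) * x + q * y ≈ q * ((c * d) * x + y)
  factor-out = solve 5 (λ c q d x y → (c :* (q :* d)) :* x :+ q :* y := q :* ((c :* d) :* x :+ y)) (CommutativeRing.refl R)

≈ᴷ⇒≈F : ∀ {x y} → x ≈ᴷ y → RegFrac.frac x ≈F RegFrac.frac y
≈ᴷ⇒≈F e = ≈ᴸ⇒≈L (_≈ᴷ_.uncross e)

module Polynomials (n : ℕ) where
  open Operators fractionRing n (tᴷ (+ 1)) tMinus1ᴷ tMinus1≈ public
  open FormalSum fractionRing (exps-basis n) public

  setting : Setting
  setting = record
    { scalars = fractionRing
    ; tz = tᴷ ; qz = qᴷ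
    ; tz-+ = tᴷ-+ ; tz-0 = K.refl
    ; qz-+ = qᴷ-+ ; qz-0 = K.refl
    ; ρ = ρᴷ ; ζ = ζᴷ ; ρ-inverse = ρᴷ-inverse ; ζ-numerator = ζᴷ-numerator
    ; half = ½ᴷ ; half+half = ½+½
    ; n = n
    ; M = Sum
    ; Index = Exps n
    ; coef = coef
    ; _⊞_ = _++_
    ; 𝟘 = []
    ; _·_ = scale
    ; coef-⊞ = coef-++
    ; coef-𝟘 = λ α → K.refl
    ; coef-· = coef-scale
    ; X = X ; T = T
    ; X-cong = λ k f g e → lin-ext (X k f) (X k g) λ h → K.trans (lin-map h (incᴱ k) f) (K.trans (lin-resp (h ∘ incᴱ k) f g e) (K.sym (lin-map h (incᴱ k) g)))
    ; X-⊞ = λ k f g → lin-ext (X k (f ++ g)) (X k f ++ X k g) λ h → K.trans (lin-map h (incᴱ k) (f ++ g)) (K.trans (lin-++ _ f g)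
        (K.trans (K.sym (K.+-cong (lin-map h (incᴱ k) f) (lin-map h (incᴱ k) g))) (K.sym (lin-++ h (X k f) (X k g)))))
    ; X-· = λ k c f → lin-ext (X k (scale c f)) (scale c (X k f)) λ h → K.trans (lin-map h (incᴱ k) (scale c f)) (K.trans (lin-scale _ c f)
        (K.trans (K.*-cong (K.refl {c}) (K.sym (lin-map h (incᴱ k) f))) (K.sym (lin-scale h c (X k f)))))
    ; X-comm = λ j k f → lin-ext (X j (X k f)) (X k (X j f)) λ h → K.trans (K.trans (lin-map h (incᴱ j) (X k f)) (lin-map _ (incᴱ k) f))
        (K.trans (lin-cong f (λ β → K.reflexive (≡.cong h (exps-≡ (inc-comm (list β) k j))))) (K.sym (K.trans (lin-map h (incᴱ k) (X j f)) (lin-map _ (incᴱ j) f))))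
    ; T-cong = λ k f g e → lin-ext (T k f) (T k g) λ h → K.trans (lin-T h k f) (K.trans (lin-resp (T* k h) f g e) (K.sym (lin-T h k g)))
    ; T-⊞ = λ k f g → lin-ext (T k (f ++ g)) (T k f ++ T k g) λ h → K.trans (lin-T h k (f ++ g)) (K.trans (lin-++ _ f g)
        (K.trans (K.sym (K.+-cong (lin-T h k f) (lin-T h k g))) (K.sym (lin-++ h (T k f) (T k g)))))
    ; T-· = λ k c f → lin-ext (T k (scale c f)) (scale c (T k f)) λ h → K.trans (lin-T h k (scale c f)) (K.trans (lin-scale _ c f)
        (K.trans (K.*-cong (K.refl {c}) (K.sym (lin-T h k f))) (K.sym (lin-scale h c (T k f)))))
    ; T-quadratic = λ k p f → Adjacent.T-quadratic k p f
    ; T-X = λ k p f → Adjacent.T-X k p f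
    ; T-X-other = λ k j p a b f → Adjacent.T-X-other k p j a b f
    ; 𝟙 = 𝟙
    ; T-𝟙 = λ k p → Adjacent.T-𝟙 k p
    }

  barS : Sum → Sum
  barS = map (λ { (c , β) → (barᴷ c , β) })

  -- Semilinear maps that send the monomial with exponent β to κ β times that with exponent g β.
  -- They cover the conjugation inside `star`, where κ is 1, the substitution of (B), and the map ψ
  -- that serves for both.
  twist : (Exps n → RegFrac) → (Exps n → Exps n) → Sum → Sum
  twist κ g = map (λ { (c , β) → (mulᴷ (barᴷ c) (κ β) , g β) })

  bar-0 : barᴷ K.0# ≈ᴷ K.0#
  bar-0 = same-fraction (barᴷ K.0#) K.0# ≈ᴸ-refl ≈ᴸ-refl

  bar-1 : barᴷ K.1# ≈ᴷ K.1#
  bar-1 = same-fraction (barᴷ K.1#) K.1# ≈ᴸ-refl ≈ᴸ-refl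

  bar-q : ∀ i → barᴷ (qᴷ i) ≈ᴷ qᴷ (Z.- i)
  bar-q i = same-fraction (barᴷ (qᴷ i)) (qᴷ (Z.- i)) ≈ᴸ-refl ≈ᴸ-refl

  coef-bar : ∀ f α → coef (barS f) α ≈ᴷ barᴷ (coef f α)
  coef-bar [] α = K.sym bar-0
  coef-bar ((c , β) ∷ f) α with eqListB (list β) (list α)
  ... | true = K.trans (K.+-cong (K.refl {barᴷ c}) (coef-bar f α)) (K.sym (barᴷ-+ c (coef f α)))
  ... | false = coef-bar f α

  bar-resp : ∀ f g → f ≋ g → barS f ≋ barS g
  bar-resp f g e α = K.trans (coef-bar f α) (K.trans (barᴷ-cong (e α)) (K.sym (coef-bar g α)))

  lin-twist : ∀ h κ g f → lin h (twist κ g f) ≈ᴷ lin (λ β → mulᴷ (κ β) (h (g β))) (barS f)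
  lin-twist h κ g [] = K.refl
  lin-twist h κ g ((c , β) ∷ f) = K.+-cong (K.*-assoc (barᴷ c) (κ β) (h (g β))) (lin-twist h κ g f)

  twist-resp : ∀ κ g f f' → f ≋ f' → twist κ g f ≋ twist κ g f'
  twist-resp κ g f f' e = lin-ext (twist κ g f) (twist κ g f') λ h → K.trans (lin-twist h κ g f)
    (K.trans (lin-resp _ (barS f) (barS f') (bar-resp f f' e)) (K.sym (lin-twist h κ g f')))

  twist-scale : ∀ κ g c f → twist κ g (scale c f) ≋ scale (barᴷ c) (twist κ g f)
  twist-scale κ g c f = lin-ext (twist κ g (scale c f)) (scale (barᴷ c) (twist κ g f)) λ h → K.trans (go h f) (K.sym (lin-scale h (barᴷ c) (twist κ g f)))
    where
    go : ∀ h f → lin h (twist κ g (scale c f)) ≈ᴷ mulᴷ (barᴷ c) (lin h (twist κ g f))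
    go h [] = K.sym (K.zeroʳ (barᴷ c))
    go h ((d , β) ∷ f) = K.trans (K.+-cong (K.trans (K.*-cong (K.trans (K.*-cong (barᴷ-* c d) (K.refl {κ β})) (K.*-assoc (barᴷ c) (barᴷ d) (κ β))) (K.refl {h (g β)}))
        (K.*-assoc (barᴷ c) (mulᴷ (barᴷ d) (κ β)) (h (g β)))) (go h f))
      (K.sym (K.distribˡ (barᴷ c) (mulᴷ (mulᴷ (barᴷ d) (κ β)) (h (g β))) (lin h (twist κ g f))))

  twist-trivial : ∀ κ g g' f → (∀ β → κ β ≈ᴷ K.1#) → (∀ β → g β ≡ g' β) → mapᴱ g' (barS f) ≋ twist κ g f
  twist-trivial κ g g' f e e' = lin-ext (mapᴱ g' (barS f)) (twist κ g f) λ h → K.trans (lin-map h g' (barS f)) (K.trans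
    (lin-cong (barS f) (λ β → K.trans (K.reflexive (≡.cong h (≡.sym (e' β)))) (K.sym (K.trans (K.*-cong (e β) (K.refl {h (g β)})) (K.*-identityˡ (h (g β)))))))
    (K.sym (lin-twist h κ g f)))

  module _ (k : ℕ) (k≤n : k N.≤ n) where
    open BlockReversal n k k≤n

    upper-degree : Exps n → RegFrac
    upper-degree β = qᴷ (+ sum (drop k (list β)))

    reverseᴱ : Exps n → Exps n
    reverseᴱ (exps α e) = exps (reverseBlocks k α) (≡.trans (length-reverseBlocks k α) e)

    flipped : Sum → Sum
    flipped = twist upper-degree reverseᴱ

    flipped-X : ∀ u → u N.< n → ∀ f → flipped (X u f) ≋ scale (qᴷ (wrap u)) (X (flip u) (flipped f))
    flipped-X u u<n f = lin-ext (flipped (X u f)) (scale (qᴷ (wrap u)) (X (flip u) (flipped f))) λ h →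
      K.trans (go h f) (K.trans (K.*-cong (K.refl {qᴷ (wrap u)}) (K.sym (lin-map h (incᴱ (flip u)) (flipped f)))) (K.sym (lin-scale h (qᴷ (wrap u)) (X (flip u) (flipped f)))))
      where
      degree : ∀ β → upper-degree (incᴱ u β) ≈ᴷ mulᴷ (qᴷ (wrap u)) (upper-degree β)
      degree β = K.trans (K.reflexive (≡.cong (λ z → qᴷ (+ z)) (sum-drop-inc n k k≤n (list β) (length-list β) u<n)))
        (K.trans (K.reflexive (≡.cong (λ z → qᴷ (z Z.+ + sum (drop k (list β)))) wrap-ℕ)) (qᴷ-+ (wrap u) (+ sum (drop k (list β)))))
        where
        wrap-ℕ : + wrapᴺ n k k≤n u ≡ wrap u
        wrap-ℕ with u <ᵇ k
        ... | true = ≡.refl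
        ... | false = ≡.refl
      go : ∀ h f → lin h (flipped (X u f)) ≈ᴷ mulᴷ (qᴷ (wrap u)) (lin (h ∘ incᴱ (flip u)) (flipped f))
      go h [] = K.sym (K.zeroʳ (qᴷ (wrap u)))
      go h ((c , β) ∷ f) = K.trans (K.+-cong (K.*-cong (K.*-cong (K.refl {barᴷ c}) (degree β))
            (K.reflexive (≡.cong h (exps-≡ (reverseBlocks-inc n k k≤n (list β) (length-list β) u<n))))) (go h f))
        (SemilinearStep.factor-out fractionRing (barᴷ c) (qᴷ (wrap u)) (upper-degree β) (h (incᴱ (flip u) (reverseᴱ β))) (lin (h ∘ incᴱ (flip u)) (flipped f)))

    replicate-++ : ∀ a b → replicate a 0 ++ replicate b 0 ≡ replicate (a N.+ b) 0
    replicate-++ zero b = ≡.refl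
    replicate-++ (suc a) b = ≡.cong (0 ∷_) (replicate-++ a b)

    reverse-replicate : ∀ a → reverse (replicate a 0) ≡ replicate a 0
    reverse-replicate zero = ≡.refl
    reverse-replicate (suc a) = ≡.trans (LP.unfold-reverse 0 (replicate a 0)) (≡.trans (≡.cong (_++ 0 ∷ []) (reverse-replicate a))
      (≡.trans (replicate-++ a 1) (≡.cong (λ z → replicate z 0) (NP.+-comm a 1))))

    sum-replicate : ∀ a → sum (replicate a 0) ≡ 0
    sum-replicate zero = ≡.refl
    sum-replicate (suc a) = sum-replicate a

    flipped-𝟙 : flipped 𝟙 ≋ 𝟙
    flipped-𝟙 = lin-ext (flipped 𝟙) 𝟙 λ h → K.+-cong {mulᴷ (mulᴷ (barᴷ K.1#) (qᴷ (+ sum (drop k (replicate n 0))))) (h (reverseᴱ ones))} {mulᴷ K.1# (h ones)} {K.0#} {K.0#} (K.*-cong (K.trans (K.*-cong bar-1 (K.reflexive (≡.cong (λ z → qᴷ (+ z)) degree-zero))) (K.*-identityˡ K.1#))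
        (K.reflexive (≡.cong h (exps-≡ reversed)))) K.refl
      where
      ones : Exps n
      ones = exps (replicate n 0) (LP.length-replicate n)
      drop-replicate : ∀ k n → drop k (replicate n 0) ≡ replicate (n ∸ k) 0
      drop-replicate zero n = ≡.refl
      drop-replicate (suc k) zero = ≡.refl
      drop-replicate (suc k) (suc n) = drop-replicate k n
      take-replicate : ∀ {k n} → k N.≤ n → take k (replicate n 0) ≡ replicate k 0
      take-replicate {zero} p = ≡.refl
      take-replicate {suc k} {suc n} (N.s≤s p) = ≡.cong (0 ∷_) (take-replicate p)
      degree-zero : sum (drop k (replicate n 0)) ≡ 0
      degree-zero = ≡.trans (≡.cong sum (drop-replicate k n)) (sum-replicate (n ∸ k))
      reversed : reverseBlocks k (replicate n 0) ≡ replicate n 0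
      reversed = ≡.trans (≡.cong₂ (λ x y → reverse x ++ reverse y) (take-replicate k≤n) (drop-replicate k n))
        (≡.trans (≡.cong₂ _++_ (reverse-replicate k) (reverse-replicate (n ∸ k))) (≡.trans (replicate-++ k (n ∸ k)) (≡.cong (λ z → replicate z 0) (NP.m+[n∸m]≡n k≤n))))

    conjugation : Conjugation setting reversal
    conjugation = record
      { bar = barᴷ
      ; bar-cong = λ x y e → barᴷ-cong e
      ; bar-* = barᴷ-*
      ; bar-1 = bar-1
      ; bar-tz = barᴷ-t
      ; bar-qz = bar-q
      ; bar-ζ = barᴷ-ζ
      ; ψ = flipped
      ; ψ-cong = twist-resp upper-degree reverseᴱ
      ; ψ-𝟘 = λ α → K.refl
      ; ψ-⊞ = λ f g α → K.reflexive (≡.cong (λ z → coef z α) (LP.map-++ _ f g))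
      ; ψ-· = twist-scale upper-degree reverseᴱ
      ; ψ-X = flipped-X
      ; ψ-𝟙 = flipped-𝟙
      }

    -- the substitution of identity (B), which reverses the last variables only
    reverseUpper reverseLower : Exps n → Exps n
    reverseUpper (exps α e) = exps (take k α ++ reverse (drop k α)) (≡.trans (≡.trans (LP.length-++ (take k α))
      (≡.trans (≡.cong (length (take k α) N.+_) (LP.length-reverse (drop k α))) (≡.trans (≡.sym (LP.length-++ (take k α))) (≡.cong length (LP.take++drop≡id k α))))) e)
    reverseLower (exps α e) = exps (reverse (take k α) ++ drop k α) (≡.trans (≡.trans (LP.length-++ (reverse (take k α)))
      (≡.trans (≡.cong (N._+ length (drop k α)) (LP.length-reverse (take k α))) (≡.trans (≡.sym (LP.length-++ (take k α))) (≡.cong length (LP.take++drop≡id k α))))) e)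

    half-flipped : Sum → Sum
    half-flipped = twist upper-degree reverseUpper

    take-length : ∀ (β : Exps n) → length (take k (list β)) ≡ k
    take-length β = ≡.trans (LP.length-take k (list β)) (NP.m≤n⇒m⊓n≡m (≡.subst (k N.≤_) (≡.sym (length-list β)) k≤n))

    take-lower : ∀ β → take k (list (reverseLower β)) ≡ reverse (take k (list β))
    take-lower β = take-at (reverse (take k (list β))) (drop k (list β)) (≡.trans (LP.length-reverse (take k (list β))) (take-length β))

    drop-lower : ∀ β → drop k (list (reverseLower β)) ≡ drop k (list β)
    drop-lower β = drop-at (reverse (take k (list β))) (drop k (list β)) (≡.trans (LP.length-reverse (take k (list β))) (take-length β))

    reverseLower-involutive : ∀ β → reverseLower (reverseLower β) ≡ β
    reverseLower-involutive β = exps-≡ (≡.trans (≡.cong₂ (λ x y → reverse x ++ y) (take-lower β) (drop-lower β))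
      (≡.trans (≡.cong (_++ drop k (list β)) (LP.reverse-involutive (take k (list β)))) (LP.take++drop≡id k (list β))))

    coef-mapᴱ : ∀ g → (∀ β → g (g β) ≡ β) → ∀ f β → coef (mapᴱ g f) β ≈ᴷ coef f (g β)
    coef-mapᴱ g inv [] β = K.refl
    coef-mapᴱ g inv ((c , γ) ∷ f) β = aux (eqListB (list (g γ)) (list β)) (eqListB (list γ) (list (g β))) same
      where
      same : eqListB (list (g γ)) (list β) ≡ eqListB (list γ) (list (g β))
      same with eqListB (list γ) (list (g β)) in e
      ... | true rewrite exps-≡ {β = γ} {γ = g β} (eqListB-sound (list γ) (list (g β)) e) | inv β = eqListB-refl (list β)
      ... | false with eqListB (list (g γ)) (list β) in e'
      ...   | false = ≡.refl
      ...   | true with () ← ≡.trans (≡.sym e) (≡.trans (≡.cong (λ z → eqListB (list γ) (list (g z))) (≡.sym (exps-≡ {β = g γ} {γ = β} (eqListB-sound (list (g γ)) (list β) e'))))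
                (≡.trans (≡.cong (λ z → eqListB (list γ) (list z)) (inv γ)) (eqListB-refl (list γ))))
      aux : ∀ b b' → b ≡ b' → (if b then addᴷ c (coef (mapᴱ g f) β) else coef (mapᴱ g f) β) ≈ᴷ (if b' then addᴷ c (coef f (g β)) else coef f (g β))
      aux true _ ≡.refl = K.+-cong (K.refl {c}) (coef-mapᴱ g inv f β)
      aux false _ ≡.refl = coef-mapᴱ g inv f β

    Symmetric : Sum → Set
    Symmetric f = ∀ j → suc j N.< k → σ j f ≋ f

    swapᴱ-involutive : ∀ j → suc j N.< n → ∀ β → swapᴱ j (swapᴱ j β) ≡ β
    swapᴱ-involutive j j<n β = exps-≡ (≡.trans (put-put (list β) j b a (lookupL (put (list β) j b a) (suc j)) (lookupL (put (list β) j b a) j))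
        (≡.trans (≡.cong₂ (put (list β) j) (lookup-put-upper (list β) b a upper<) (lookup-put-lower (list β) b a (NP.<-trans (NP.n<1+n j) upper<))) (put-lookup (list β) j)))
      where
      a b : ℕ
      a = lookupL (list β) j
      b = lookupL (list β) (suc j)
      upper< : suc j N.< length (list β)
      upper< = ≡.subst (suc j N.<_) (≡.sym (length-list β)) j<n

    -- The permutation is resolved into adjacent exchanges along the derivation of `↭`. Entries
    -- already settled move into `pre`, so an exchange happens at position `length pre`, which the
    -- bound keeps inside the first k variables.
    coef-permuted : ∀ f → Symmetric f → ∀ pre {xs ys} post → xs ↭ ys → length pre N.+ length xs N.≤ k →
      (e : length (pre ++ xs ++ post) ≡ n) (e' : length (pre ++ ys ++ post) ≡ n) →
      coef f (exps (pre ++ xs ++ post) e) ≈ᴷ coef f (exps (pre ++ ys ++ post) e')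
    coef-permuted f S pre post ↭.refl le e e' = K.refl
    coef-permuted f S pre {x ∷ xs} {.x ∷ ys} post (↭.prep x p) le e e' = K.trans
      (K.reflexive (≡.cong (coef f) (exps-≡ {γ = exps ((pre ++ x ∷ []) ++ xs ++ post) (≡.trans (≡.cong length (LP.++-assoc pre (x ∷ []) (xs ++ post))) e)} (≡.sym (LP.++-assoc pre (x ∷ []) (xs ++ post))))))
      (K.trans (coef-permuted f S (pre ++ x ∷ []) post p (≡.subst (N._≤ k) (≡.trans (NP.+-suc (length pre) (length xs)) (≡.cong (N._+ length xs) (≡.sym (≡.trans (LP.length-++ pre) (NP.+-comm (length pre) 1))))) le) (≡.trans (≡.cong length (LP.++-assoc pre (x ∷ []) (xs ++ post))) e)
          (≡.trans (≡.cong length (LP.++-assoc pre (x ∷ []) (ys ++ post))) e'))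
        (K.reflexive (≡.cong (coef f) (exps-≡ (LP.++-assoc pre (x ∷ []) (ys ++ post))))))
    coef-permuted f S pre {.x ∷ .y ∷ xs} {.y ∷ .x ∷ ys} post (↭.swap x y p) le e e' = K.trans
      (K.reflexive (≡.cong (coef f) (exps-≡ {γ = exps ((pre ++ x ∷ y ∷ []) ++ xs ++ post) (≡.trans (≡.cong length (LP.++-assoc pre (x ∷ y ∷ []) (xs ++ post))) e)} (≡.sym (LP.++-assoc pre (x ∷ y ∷ []) (xs ++ post))))))
      (K.trans (coef-permuted f S (pre ++ x ∷ y ∷ []) post p le' (≡.trans (≡.cong length (LP.++-assoc pre (x ∷ y ∷ []) (xs ++ post))) e) (≡.trans (≡.cong length (LP.++-assoc pre (x ∷ y ∷ []) (ys ++ post))) e''))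
      (K.trans (K.reflexive (≡.cong (coef f) (exps-≡ {γ = unswapped} (LP.++-assoc pre (x ∷ y ∷ []) (ys ++ post)))))
      (K.trans (K.sym (S (length pre) j<k unswapped)) (K.trans (coef-mapᴱ (swapᴱ (length pre)) (swapᴱ-involutive (length pre) (NP.<-≤-trans j<k k≤n)) f unswapped)
        (K.reflexive (≡.cong (coef f) (exps-≡ (swapL-++ pre x y (ys ++ post)))))))))
      where
      e'' : length (pre ++ x ∷ y ∷ ys ++ post) ≡ n
      e'' = ≡.trans (≡.trans (LP.length-++ pre) (≡.sym (LP.length-++ pre))) e'
      unswapped : Exps n
      unswapped = exps (pre ++ x ∷ y ∷ ys ++ post) e''
      le' : length (pre ++ x ∷ y ∷ []) N.+ length xs N.≤ k
      le' = ≡.subst (N._≤ k) (≡.trans (≡.sym (NP.+-assoc (length pre) 2 (length xs))) (≡.cong (N._+ length xs) (≡.sym (LP.length-++ pre)))) le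
      j<k : suc (length pre) N.< k
      j<k = NP.≤-trans (NP.≤-trans (NP.≤-reflexive (≡.trans (≡.cong suc (≡.sym (NP.+-comm (length pre) 1))) (≡.sym (NP.+-suc (length pre) 1)))) (NP.+-monoʳ-≤ (length pre) (N.s≤s (N.s≤s N.z≤n)))) le
    coef-permuted f S pre post (↭.trans p q) le e e' = K.trans (coef-permuted f S pre post p le e mid) (coef-permuted f S pre post q
        (≡.subst (λ z → length pre N.+ z N.≤ k) (↭-length p) le) mid e')
      where
      mid : length (pre ++ _ ++ post) ≡ n
      mid = ≡.trans (↭-length (++⁺ˡ pre (++⁺ʳ post (↭-sym p)))) e

    lower-symmetric : ∀ f → Symmetric f → mapᴱ reverseLower f ≋ f
    lower-symmetric f S β = K.trans (coef-mapᴱ reverseLower reverseLower-involutive f β) (K.trans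
      (coef-permuted f S [] (drop k (list β)) (↭-reverse (take k (list β))) (NP.≤-reflexive (≡.trans (LP.length-reverse (take k (list β))) (take-length β))) (length-list (reverseLower β)) (≡.trans (≡.cong length (LP.take++drop≡id k (list β))) (length-list β)))
      (K.reflexive (≡.cong (coef f) (exps-≡ (LP.take++drop≡id k (list β))))))

    half-flipped-lower : ∀ f → half-flipped (mapᴱ reverseLower f) ≡ flipped f
    half-flipped-lower [] = ≡.refl
    half-flipped-lower ((c , β) ∷ f) = ≡.cong₂ _∷_ (≡.cong₂ _,_ (≡.cong (λ z → mulᴷ (barᴷ c) (qᴷ (+ sum z))) (drop-lower β))
        (exps-≡ (≡.cong₂ (λ x y → x ++ reverse y) (take-lower β) (drop-lower β)))) (half-flipped-lower f)

    -- ψ also reverses the first k variables, which the substitution leaves in place. For a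
    -- polynomial symmetric in these variables the reversal can be performed beforehand without
    -- effect.
    half-flipped≋flipped : ∀ f → Symmetric f → half-flipped f ≋ flipped f
    half-flipped≋flipped f S α = K.trans (K.sym (twist-resp upper-degree reverseUpper (mapᴱ reverseLower f) f (lower-symmetric f S) α))
      (K.reflexive (≡.cong (λ z → coef z α) (half-flipped-lower f)))

-- Comparison with lists of terms

module Erasure (n : ℕ) where
  open Polynomials n
  private module C = Core setting
  open Words setting

  -- Forgets the proofs in coefficients and exponents. The operators on `Sum` repeat those on `Poly`
  -- term by term, so `erase` commutes with them up to propositional equality.
  erase : Sum → Poly
  erase = map (λ { (c , β) → (RegFrac.frac c , list β) })

  erase-++ : ∀ f g → erase (f ++ g) ≡ addP (erase f) (erase g)
  erase-++ f g = LP.map-++ _ f g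

  erase-scale : ∀ c f → erase (scale c f) ≡ scaleP (RegFrac.frac c) (erase f)
  erase-scale c [] = ≡.refl
  erase-scale c ((d , β) ∷ f) = ≡.cong (_ ∷_) (erase-scale c f)

  erase-map : ∀ g g' → (∀ β → list (g β) ≡ g' (list β)) → ∀ f → erase (mapᴱ g f) ≡ mapMono g' (erase f)
  erase-map g g' e [] = ≡.refl
  erase-map g g' e ((c , β) ∷ f) = ≡.cong₂ _∷_ (≡.cong (_ ,_) (e β)) (erase-map g g' e f)

  erase-bar : ∀ f → erase (barS f) ≡ barP (erase f)
  erase-bar [] = ≡.refl
  erase-bar ((c , β) ∷ f) = ≡.cong (_ ∷_) (erase-bar f)

  erase-∂ : ∀ k f → erase (∂-op k f) ≡ ddP k (erase f)
  erase-∂ k [] = ≡.refl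
  erase-∂ k ((c , β) ∷ f) = ≡.trans (erase-++ (map _ (∂-monomial k β)) (∂-op k f)) (≡.cong₂ _++_ monomial (erase-∂ k f))
    where
    a b : ℕ
    a = lookupL (list β) k
    b = lookupL (list β) (suc k)
    signed : ∀ (s : Bool) (g : ℕ → Exps n) js →
      erase (map (λ { (s , γ) → ((if s then c else negᴷ c) , γ) }) (map (λ j → (s , g j)) js))
        ≡ map (λ { (s , γ) → ((if s then RegFrac.frac c else negF (RegFrac.frac c)) , γ) }) (map (λ j → (s , list (g j))) js)
    signed s g [] = ≡.refl
    signed true g (j ∷ js) = ≡.cong (_ ∷_) (signed true g js)
    signed false g (j ∷ js) = ≡.cong (_ ∷_) (signed false g js)
    monomial : erase (map _ (∂-monomial k β)) ≡ map _ (ddMono k (list β))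
    monomial with a <ᵇ b
    ... | true = signed true (λ j → putᴱ β k (a N.+ j) (b ∸ 1 ∸ j)) (upTo (b ∸ a))
    ... | false = signed false (λ j → putᴱ β k (b N.+ j) (a ∸ 1 ∸ j)) (upTo (a ∸ b))

  erase-T : ∀ k f → erase (T k f) ≡ TP k (erase f)
  erase-T k f = ≡.trans (erase-++ (scale (tᴷ (+ 1)) (σ k f)) _) (≡.cong₂ _++_
    (≡.trans (erase-scale (tᴷ (+ 1)) (σ k f)) (≡.cong (scaleP (tF (+ 1))) (erase-map (swapᴱ k) (swapL k) (λ β → ≡.refl) f)))
    (≡.trans (erase-scale tMinus1ᴷ (X (suc k) (∂-op k f))) (≡.cong (scaleP tMinus1)
      (≡.trans (erase-map (incᴱ (suc k)) (λ β → incL β (suc k)) (λ β → ≡.refl) (∂-op k f)) (≡.cong (mulXP (suc k)) (erase-∂ k f))))))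

  erase-Tw : ∀ w f → erase (Tw w f) ≡ Tword w (erase f)
  erase-Tw [] f = ≡.refl
  erase-Tw (k ∷ w) f = ≡.trans (erase-T k (Tw w f)) (≡.cong (TP k) (erase-Tw w f))

  -- Has the literal fraction `tInvMinus1` as its coefficient, like `TinvP`. In `Tinv` the
  -- coefficient t⁻¹ - 1 is computed in the ring, and is only equivalent to it.
  inverse : ℕ → Sum → Sum
  inverse k f = scale (tᴷ (Z.- (+ 1))) (T k f) ++ scale tInvMinus1ᴷ f

  inverses : List ℕ → Sum → Sum
  inverses [] f = f
  inverses (k ∷ w) f = inverses w (inverse k f)

  erase-inverses : ∀ w f → erase (inverses w f) ≡ TwordInv w (erase f)
  erase-inverses [] f = ≡.refl
  erase-inverses (k ∷ w) f = ≡.trans (erase-inverses w (inverse k f)) (≡.cong (TwordInv w) (≡.trans (erase-++ (scale (tᴷ (Z.- (+ 1))) (T k f)) _)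
    (≡.cong₂ _++_ (≡.trans (erase-scale (tᴷ (Z.- (+ 1))) (T k f)) (≡.cong (scaleP (tF (Z.- (+ 1)))) (erase-T k f))) (erase-scale tInvMinus1ᴷ f))))

  inverses≋ : ∀ w f → inverses w f C.≋ TwInv w f
  inverses≋ [] f = C.≋-refl
  inverses≋ (k ∷ w) f = C.≋-trans (inverses≋ w (inverse k f)) (C.Linear.cong (TwInv-linear w)
    (C.⊞-cong {scale (tᴷ (Z.- (+ 1))) (T k f)} (C.≋-refl {scale (tᴷ (Z.- (+ 1))) (T k f)}) (C.·-cong {tInvMinus1ᴷ} {K._-_ (tᴷ (Z.- (+ 1))) K.1#} {f} tInvMinus1≈ C.≋-refl)))

  coeffP-erase : ∀ f (α : Exps n) → coeffP (erase f) (list α) ≡ RegFrac.frac (coef f α)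
  coeffP-erase [] α = ≡.refl
  coeffP-erase ((c , β) ∷ f) α with eqListB (list β) (list α)
  ... | true = ≡.cong (addF (RegFrac.frac c)) (coeffP-erase f α)
  ... | false = coeffP-erase f α

  -- `≈P` compares coefficients at exponent lists of every length, whereas equality of sums speaks
  -- only of those of length n.
  coeffP-wrong-length : ∀ f α → ¬ length α ≡ n → coeffP (erase f) α ≡ 0F
  coeffP-wrong-length [] α p = ≡.refl
  coeffP-wrong-length ((c , β) ∷ f) α p with eqListB (list β) α in e
  ... | true = ⊥-elim (p (≡.trans (≡.cong length (≡.sym (eqListB-sound (list β) α e))) (length-list β)))
  ... | false = coeffP-wrong-length f α p

  erase-≈ : ∀ {f g} → f C.≋ g → erase f ≈P erase g
  erase-≈ {f} {g} e α with length α N.≟ n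
  ... | yes p rewrite coeffP-erase f (exps α p) | coeffP-erase g (exps α p) = ≈ᴷ⇒≈F (C.at e (exps α p))
  ... | no p rewrite coeffP-wrong-length f α p | coeffP-wrong-length g α p = λ a b → ≡.refl

-- The two identities for lists of terms

module Identities (lam gam : List ℕ) (decreasing : AllPairs N._≥_ lam) where
  n : ℕ
  n = length lam N.+ length gam
  open Polynomials n
  open Erasure n
  private module C = Core setting
  open Words setting
  open Exchange setting
  open Symmetrized setting lam gam decreasing ≡.refl using (mu; L₀; N₀; m≤n)

  m : ℕ
  m = length lam

  reverseAll : Exps n → Exps n
  reverseAll (exps α e) = exps (reverse α) (≡.trans (LP.length-reverse α) e)

  module _ (E : Sum) (E-erased : erase E ≡ Emac (lam ++ gam)) (E-G : E C.≋ scale (tᴷ (Z.- + invW mu)) (G N₀ L₀)) where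
    open Duality setting lam gam decreasing ≡.refl E

    P-erased : Ppartial lam gam ≡ erase P
    P-erased = ≡.sym (≡.trans (erase-Σ (cosetReps lam)) (≡.cong (λ Q → foldr addP zeroP (map (λ π → Tword (permWord (π ++ map (length lam N.+_) (upTo (length gam)))) Q) (cosetReps lam))) E-erased))
      where
      erase-Σ : ∀ πs → erase (C.ΣM (λ π → Tw (permWord (π ++ map (m N.+_) (upTo (length gam)))) E) πs)
        ≡ foldr addP zeroP (map (λ π → Tword (permWord (π ++ map (length lam N.+_) (upTo (length gam)))) (erase E)) πs)
      erase-Σ [] = ≡.refl
      erase-Σ (π ∷ πs) = ≡.trans (erase-++ (Tw (permWord (π ++ map (m N.+_) (upTo (length gam)))) E) _)
        (≡.cong₂ _++_ (erase-Tw (permWord (π ++ map (m N.+_) (upTo (length gam)))) E) (erase-Σ πs))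

    identity-A : IdentityA lam gam
    identity-A = ≡.subst₂ _≈P_ (≡.sym left-erased) (≡.sym (≡.trans (≡.cong (scaleP (tF (+ invLG lam gam))) P-erased) (≡.sym (erase-scale (tᴷ (+ invLG lam gam)) P)))) (erase-≈ equality)
      where
      word : List ℕ
      word = permWord (w0 n)
      starred : Sum
      starred = mapᴱ reverseAll (barS P)
      left-erased : star n (Ppartial lam gam) ≡ erase (scale (tᴷ (+ invW (w0 n))) (inverses word starred))
      left-erased = ≡.trans (≡.cong (star n) P-erased) (≡.sym (≡.trans (erase-scale (tᴷ (+ invW (w0 n))) (inverses word starred)) (≡.cong (scaleP (tF (+ invW (w0 n))))
        (≡.trans (erase-inverses word starred) (≡.cong (TwordInv word) (≡.trans (erase-map reverseAll reverse (λ β → ≡.refl) (barS P)) (≡.cong (mapMono reverse) (erase-bar P))))))))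
      drop-all : ∀ (β : Exps n) → drop n (list β) ≡ []
      drop-all β = LP.drop-all n (list β) (NP.≤-reflexive (length-list β))
      starred≋ : starred C.≋ flipped n NP.≤-refl P
      starred≋ = C.ext (twist-trivial (upper-degree n NP.≤-refl) (reverseᴱ n NP.≤-refl) reverseAll P
        (λ β → K.reflexive (≡.cong (λ z → qᴷ (+ sum z)) (drop-all β)))
        (λ β → exps-≡ (≡.trans (≡.cong₂ (λ x y → reverse x ++ reverse y) (LP.take-all n (list β) (NP.≤-reflexive (length-list β))) (drop-all β)) (LP.++-identityʳ (reverse (list β))))))
      equality : scale (tᴷ (+ invW (w0 n))) (inverses word starred) C.≋ scale (tᴷ (+ invLG lam gam)) P
      equality = C.≋-trans (C.·-cong {tᴷ (+ invW (w0 n))} K.refl (C.≋-trans (inverses≋ word starred) (C.Linear.cong (TwInv-linear word) starred≋)))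
        (FullFlip.duality-A E-G (conjugation n NP.≤-refl))

    identity-B : IdentityB lam gam
    identity-B = ≡.subst₂ _≈P_ (≡.sym left-erased) (≡.sym right-erased) (erase-≈ equality)
      where
      w : List ℕ
      w = w0mn m n
      c : RegFrac
      c = mulᴷ (qᴷ (+ sum gam)) (tᴷ (+ invW gam Z.- + invW w))
      erase-half-flipped : ∀ f → erase (half-flipped m m≤n f) ≡ substB m (erase f)
      erase-half-flipped [] = ≡.refl
      erase-half-flipped ((d , β) ∷ f) = ≡.cong (_ ∷_) (erase-half-flipped f)
      left-erased : substB m (Ppartial lam gam) ≡ erase (half-flipped m m≤n P)
      left-erased = ≡.trans (≡.cong (substB m) P-erased) (≡.sym (erase-half-flipped P))
      right-erased : scaleP (RegFrac.frac c) (Tword (permWord w) (Ppartial lam gam)) ≡ erase (scale c (Tw (permWord w) P))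
      right-erased = ≡.trans (≡.cong (λ Q → scaleP (RegFrac.frac c) (Tword (permWord w) Q)) P-erased)
        (≡.sym (≡.trans (erase-scale c (Tw (permWord w) P)) (≡.cong (scaleP (RegFrac.frac c)) (erase-Tw (permWord w) P))))
      symmetric : Symmetric m m≤n P
      -- `T-P` gives T_j P = t P, and this eigenvalue equation forces invariance of `P` under σ_j.
      -- The symmetry allows the substitution of (B) to be replaced by ψ.
      symmetric j j<m = Adjacent.T-eigen⇒symmetric j (NP.<-≤-trans j<m m≤n) P (C.at (T-P E-G j j<m))
      equality : half-flipped m m≤n P C.≋ scale c (Tw (permWord w) P)
      equality = C.≋-trans (C.ext (half-flipped≋flipped m m≤n P symmetric)) (PartialFlip.duality-B E-G (conjugation m m≤n))

-- Nonsymmetric Macdonald polynomials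

inc-applyUpTo : ∀ f m l → incL (applyUpTo f m) l ≡ applyUpTo (λ k → if l ≡ᵇ k then suc (f k) else f k) m
inc-applyUpTo f zero l = ≡.refl
inc-applyUpTo f (suc m) zero = ≡.refl
inc-applyUpTo f (suc m) (suc l) = ≡.cong (f 0 ∷_) (inc-applyUpTo (λ k → f (suc k)) m l)

module Macdonald (n : ℕ) (μ : List ℕ) (sizes : length μ ≡ n) where
  open Polynomials n
  open Erasure n using (erase)
  private module C = Core setting
  open Exchange setting using (G)
  open Mac μ hiding (E; n; pairs)
  open Fillings setting μ sizes

  length-cols : length cols ≡ n
  length-cols = ≡.trans (LP.length-map suc (upTo (length μ))) (≡.trans (LP.length-upTo (length μ)) sizes)

  xExpᴱ : Filling → Exps n
  xExpᴱ fl = exps (xExp fl) (≡.trans (LP.length-map _ cols) length-cols)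

  weightᴷ : Filling → RegFrac
  weightᴷ fl = mulᴷ (qᴷ (+ maj fl)) (mulᴷ (tᴷ (coinvF fl)) (factors fl boxes))

  monomial-term : Filling → RegFrac × Exps n
  monomial-term fl = weightᴷ fl , xExpᴱ fl

  E : Sum
  E = map monomial-term NAF

  frac-weight : ∀ fl → RegFrac.frac (weightᴷ fl) ≡ weightCoeff fl
  frac-weight fl = product (+ maj fl) (coinvF fl) (factors fl boxes) _ (frac-factors (filterB (λ u → not (val fl u ≡ᵇ val fl (down u))) boxes))
    where
    frac-factors : ∀ bs → RegFrac.frac (foldr mulᴷ K.1# (map (λ u → ζᴷ (leg u) (arm u)) bs)) ≡ prodF (map factor bs)
    frac-factors [] = ≡.refl
    frac-factors (b ∷ bs) = ≡.cong (mulF (factor b)) (frac-factors bs)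
    product : ∀ i j z w → RegFrac.frac z ≡ w → RegFrac.frac (mulᴷ (qᴷ i) (mulᴷ (tᴷ j) z)) ≡ mulF (qF i) (mulF (tF j) w)
    product i j z .(RegFrac.frac z) ≡.refl = ≡.refl

  E-erased : erase E ≡ Emac μ
  E-erased = mapped NAF
    where
    mapped : ∀ fls → erase (map monomial-term fls) ≡ map (λ fl → (weightCoeff fl , xExp fl)) fls
    mapped [] = ≡.refl
    mapped (fl ∷ fls) = ≡.cong₂ _∷_ (≡.cong (_, xExp fl) (frac-weight fl)) (mapped fls)

  kept : List ℕ → Sum
  kept vs = if nonAttacking (zip boxes vs) then monomial-term (zip boxes vs) ∷ [] else []

  filtered-sum : ∀ (p : Filling → Bool) (f : Filling → RegFrac × Exps n) (g : List ℕ → Filling) vss →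
    map f (filterB p (map g vss)) ≡ C.ΣM (λ vs → if p (g vs) then f (g vs) ∷ [] else []) vss
  filtered-sum p f g [] = ≡.refl
  filtered-sum p f g (vs ∷ vss) = step (p (g vs))
    where
    step : ∀ b → map f (if b then g vs ∷ filterB p (map g vss) else filterB p (map g vss))
      ≡ (if b then f (g vs) ∷ [] else []) ++ C.ΣM (λ vs → if p (g vs) then f (g vs) ∷ [] else []) vss
    step true = ≡.cong (f (g vs) ∷_) (filtered-sum p f g vss)
    step false = filtered-sum p f g vss

  columns : (ℕ → ℕ) → List ℕ
  columns c = map c cols

  columns-applyUpTo : ∀ c → columns c ≡ applyUpTo (λ k → c (suc k)) (length μ)
  columns-applyUpTo c = ≡.trans (≡.sym (LP.map-∘ (upTo (length μ)))) (LP.map-upTo _ (length μ))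

  monomial-exps : ∀ fl bs → All (λ b → ∃ λ l → val fl b ≡ suc l) bs →
    ∃ λ β → (monomial fl bs ≡ (K.1# , β) ∷ []) × (list β ≡ columns (λ k → countB (λ u → val fl u ≡ᵇ k) bs))
  monomial-exps fl [] [] = exps (replicate n 0) (LP.length-replicate n) , ≡.refl ,
    ≡.sym (≡.trans (columns-applyUpTo (λ _ → 0)) (≡.trans (zeros (length μ)) (≡.cong (λ k → replicate k 0) sizes)))
    where
    zeros : ∀ m → applyUpTo (λ _ → 0) m ≡ replicate m 0
    zeros zero = ≡.refl
    zeros (suc m) = ≡.cong (0 ∷_) (zeros m)
  monomial-exps fl (b ∷ bs) ((l , e) ∷ p) = next (monomial-exps fl bs p)
    where
    next : (∃ λ β → (monomial fl bs ≡ (K.1# , β) ∷ []) × (list β ≡ columns (λ k → countB (λ u → val fl u ≡ᵇ k) bs))) →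
      ∃ λ β → (monomial fl (b ∷ bs) ≡ (K.1# , β) ∷ []) × (list β ≡ columns (λ k → countB (λ u → val fl u ≡ᵇ k) (b ∷ bs)))
    next (β , eβ , eq) = incᴱ (val fl b ∸ 1) β , ≡.cong (X (val fl b ∸ 1)) eβ ,
      ≡.trans (≡.cong₂ incL (≡.trans eq (columns-applyUpTo _)) (≡.cong (_∸ 1) e)) (≡.trans (inc-applyUpTo _ (length μ) l)
        (≡.trans (≡.sym (columns-applyUpTo (λ k → if suc l ≡ᵇ k then suc (countB (λ u → val fl u ≡ᵇ k) bs) else countB (λ u → val fl u ≡ᵇ k) bs)))
          (≡.cong (λ z → columns (λ k → if z ≡ᵇ k then suc (countB (λ u → val fl u ≡ᵇ k) bs) else countB (λ u → val fl u ≡ᵇ k) bs)) (≡.sym e))))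

  normal : RegFrac
  normal = tᴷ (Z.- + invW μ)

  singleton : ∀ c d (β : Exps n) → c ≈ᴷ d → ((c , β) ∷ []) C.≋ ((d , β) ∷ [])
  singleton c d β e = C.ext λ α → pointwise α
    where
    pointwise : ∀ α → coef ((c , β) ∷ []) α ≈ᴷ coef ((d , β) ∷ []) α
    pointwise α with eqListB (list β) (list α)
    ... | true = K.+-cong {c} {d} {K.0#} {K.0#} e (K.refl {K.0#})
    ... | false = K.refl {K.0#}

  kept≋ : ∀ vs → length vs ≡ length boxes × All (λ v → ∃ λ l → v ≡ suc l) vs → kept vs C.≋ scale normal (weighted (zip boxes vs))
  kept≋ vs (e , p) = guarded (nonAttacking fl) normal {monomial-term fl ∷ []} {scale c (monomial fl boxes)}
    (from (monomial-exps fl boxes (≡.subst (λ fl → All (λ b → ∃ λ l → val fl b ≡ suc l) boxes) (LP.++-identityʳ fl) (val-positive boxes vs boxes-positive p e []))))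
    where
    fl : Filling
    fl = zip boxes vs
    c : RegFrac
    c = coefficient fl boxes
    coefficient≈ : weightᴷ fl ≈ᴷ mulᴷ normal (mulᴷ c K.1#)
    coefficient≈ = K.sym {mulᴷ normal (mulᴷ c K.1#)} (K.trans {_} {mulᴷ normal c} (K.*-cong {normal} {normal} {mulᴷ c K.1#} {c} (K.refl {normal}) (K.*-identityʳ c)) (coefficient-coinv fl))
    from : (∃ λ β → (monomial fl boxes ≡ (K.1# , β) ∷ []) × (list β ≡ xExp fl)) → (monomial-term fl ∷ []) C.≋ scale normal (scale c (monomial fl boxes))
    from (β , eβ , eq) = C.≋-trans {monomial-term fl ∷ []} {(mulᴷ normal (mulᴷ c K.1#) , β) ∷ []}
      (C.≋-trans {monomial-term fl ∷ []} {(weightᴷ fl , β) ∷ []}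
        (C.≋-reflexive (≡.cong (λ γ → (weightᴷ fl , γ) ∷ []) (exps-≡ {β = xExpᴱ fl} {γ = β} (≡.sym eq))))
        (singleton (weightᴷ fl) (mulᴷ normal (mulᴷ c K.1#)) β coefficient≈))
      (C.≋-reflexive (≡.cong (λ f → scale normal (scale c f)) (≡.sym eβ)))

  -- `E` lists the non-attacking fillings only, while `G-fillings` sums over all lists of labels
  -- with zero for the others. `kept` mediates between the two, and the scalars agree by
  -- `coefficient-coinv`.
  E-G : E C.≋ scale normal (G (meas L₀) L₀)
  E-G = C.≋-trans {E} {C.ΣM kept (allLists (length boxes))} (C.≋-reflexive (filtered-sum nonAttacking monomial-term (zip boxes) (allLists (length boxes))))
    (C.≋-trans {_} {C.ΣM (λ vs → scale normal (weighted (zip boxes vs))) (allLists (length boxes))} (Exchange.ΣM-congᴬ setting (allLists-positive (length boxes)) kept≋)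
    (C.≋-sym {scale normal (G (meas L₀) L₀)} (C.≋-trans {_} {scale normal (C.ΣM (λ vs → weighted (zip boxes vs)) (allLists (length boxes)))} (C.·-cong {normal} {normal} (K.refl {normal}) G-fillings)
      (C.linear-Σ (C.·-linear normal) (λ vs → weighted (zip boxes vs)) (allLists (length boxes))))))

module _ (lam gam : List ℕ) (decreasing : AllPairs N._≥_ lam) where
  open Macdonald (Identities.n lam gam decreasing) (lam ++ gam) (LP.length-++ lam)

  identities : IdentityA lam gam × IdentityB lam gam
  identities = Identities.identity-A lam gam decreasing E E-erased E-G , Identities.identity-B lam gam decreasing E E-erased E-G

all-toList : ∀ {m} {P : ℕ → Set} (v : Vec ℕ m) → (∀ i → P (lookup v i)) → All P (toList v)
all-toList Vec.[] p = []
all-toList (x Vec.∷ v) p = p zero ∷ all-toList v (λ i → p (suc i))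

weaklyDecreasing⇒allPairs : ∀ {m} (v : Vec ℕ m) → WeaklyDecreasing v → AllPairs N._≥_ (toList v)
weaklyDecreasing⇒allPairs Vec.[] d = []
weaklyDecreasing⇒allPairs (x Vec.∷ v) d = all-toList v (λ j → d zero (suc j) N.z≤n) ∷ weaklyDecreasing⇒allPairs v (λ i j p → d (suc i) (suc j) (N.s≤s p))

theorem1p2 : (m n : ℕ) → m ≤ n → (lam : Vec ℕ m) → (gam : Vec ℕ (n ∸ m)) →
    WeaklyDecreasing lam →
    IdentityA (toList lam) (toList gam)
    × ((IdentityA (toList lam) (toList gam) → IdentityB (toList lam) (toList gam))
    × (IdentityB (toList lam) (toList gam) → IdentityA (toList lam) (toList gam)))
-- Both identities are established for the given λ and γ, and their equivalence follows from this.
theorem1p2 m n m≤n lam gam d = proj₁ both , (λ _ → proj₂ both) , (λ _ → proj₁ both)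
  where
  both : IdentityA (toList lam) (toList gam) × IdentityB (toList lam) (toList gam)
  both = identities (toList lam) (toList gam) (weaklyDecreasing⇒allPairs lam d)
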